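{- Let $H$ be a fixed graph with at least one edge. Then, as $n\to\infty$, $$ {\rm cl}(K_n,H)=\frac{\binom{n}{2}- {\rm ex}(n,H)}{\|H\|}+o( {\rm ex}(n,H)).$$ Moreover, if $H$ is complete or bipartite, then the error term $ {\rm cl}(K_n,H)-\frac{\binom{n}{2}- {\rm ex}(n,H)}{\|H\|}$ is $O(n)$ (at most linear in $n$), and if $H$ is a forest, this error term is $O(1)$ (bounded by a constant depending only on $H$).
   Context: All graphs are finite and simple; $\|G\|$ denotes the number of edges of $G$, and $K_n$ is the complete graph on $n$ vertices. A copy of $H$ in $G$ is a subgraph of $G$ isomorphic to $H$. An $H$-packing of $G$ is a set of pairwise edge-disjoint copies of $H$ in $G$. An $H$-packing $\mathcal{P}$ of $G$ is maximal if no other $H$-packing of $G$ properly contains $\mathcal{P}$ (equivalently, every copy of $H$ in $G$ shares an edge with some member of $\mathcal{P}$). $ {\rm cl}(G,H)$ denotes the minimum cardinality of a maximal $H$-packing of $G$. $ {\rm ex}(n,H)$ is the maximum number of edges in a subgraph of $K_n$ containing no copy of $H$. -}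

module Defs where

open import Data.Nat using (ℕ; zero; suc; _+_; _*_; _∸_; _≤_; _<ᵇ_)
open import Data.Nat.Combinatorics using (_C_)
open import Data.Integer as ℤ using (ℤ; +_; ∣_∣; _-_)
open import Data.Bool using (Bool; true; false; if_then_else_; _∧_; not)
open import Data.Fin using (Fin; toℕ; zero; suc; inject₁; fromℕ)
open import Data.Fin.Properties using (_≟_)
open import Data.List using (List; length; map; allFin)
open import Data.Nat.ListAction using (sum)
open import Data.List.Relation.Unary.Any using (Any)
open import Data.List.Relation.Unary.AllPairs using (AllPairs)
open import Data.Product using (Σ; ∃; _×_; _,_)
open import Data.Sum using (_⊎_)
open import Function.Definitions using (Injective)
open import Relation.Binary.PropositionalEquality using (_≡_; _≢_)
open import Relation.Nullary using (¬_; ⌊_⌋)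

record Graph (n : ℕ) : Set where
  field
    adj    : Fin n → Fin n → Bool
    adj-sym    : ∀ i j → adj i j ≡ adj j i
    adj-irrefl : ∀ i → adj i i ≡ false
open Graph public

‖_‖ : ∀ {n} → Graph n → ℕ
‖_‖ {n} G = sum (map (λ i → sum (map (λ j →
  if (toℕ i <ᵇ toℕ j) ∧ adj G i j then 1 else 0) (allFin n))) (allFin n))

K : (n : ℕ) → Graph n
K n = record
  { adj = λ i j → not ⌊ i ≟ j ⌋
  ; adj-sym = sym′
  ; adj-irrefl = irr }
  where
  open import Relation.Binary.PropositionalEquality using (refl; sym)
  open import Relation.Nullary using (yes; no)
  sym′ : ∀ (i j : Fin n) → not ⌊ i ≟ j ⌋ ≡ not ⌊ j ≟ i ⌋
  sym′ i j with i ≟ j | j ≟ i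
  ... | yes _ | yes _ = refl
  ... | no _  | no _  = refl
  ... | yes p | no q  with q (sym p)
  ... | ()
  sym′ i j | no q | yes p with q (sym p)
  ... | ()
  irr : ∀ (i : Fin n) → not ⌊ i ≟ i ⌋ ≡ false
  irr i with i ≟ i
  ... | yes _ = refl
  ... | no q with q refl
  ... | ()

-- A copy of H in G, given by an injective vertex map sending edges to edges.
-- (The copy itself is the image subgraph.)
record Copy {h n : ℕ} (H : Graph h) (G : Graph n) : Set where
  field
    φ     : Fin h → Fin n
    inj   : Injective _≡_ _≡_ φ
    edges : ∀ i j → adj H i j ≡ true → adj G (φ i) (φ j) ≡ true
open Copy public

ShareEdge : ∀ {h n} {H : Graph h} {G : Graph n} → Copy H G → Copy H G → Set
ShareEdge {H = H} c d =
  ∃ λ i → ∃ λ j → ∃ λ i′ → ∃ λ j′ →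
    adj H i j ≡ true × adj H i′ j′ ≡ true × φ c i ≡ φ d i′ × φ c j ≡ φ d j′

IsPacking : ∀ {h n} {H : Graph h} {G : Graph n} → List (Copy H G) → Set
IsPacking P = AllPairs (λ c d → ¬ ShareEdge c d) P

IsMaximalPacking : ∀ {h n} {H : Graph h} {G : Graph n} → List (Copy H G) → Set
IsMaximalPacking {H = H} {G = G} P =
  IsPacking P × (∀ (c : Copy H G) → Any (ShareEdge c) P)

IsCl : ∀ {h n} → Graph n → Graph h → ℕ → Set
IsCl G H c =
  (Σ (List (Copy H G)) λ P → IsMaximalPacking P × length P ≡ c) ×
  (∀ (P : List (Copy H G)) → IsMaximalPacking P → c ≤ length P)

HFree : ∀ {h n} → Graph h → Graph n → Set
HFree H G = ¬ Copy H G

IsEx : ∀ {h} → ℕ → Graph h → ℕ → Set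
IsEx n H e =
  (Σ (Graph n) λ G → HFree H G × ‖ G ‖ ≡ e) ×
  (∀ (G : Graph n) → HFree H G → ‖ G ‖ ≤ e)

-- Error term scaled by ‖H‖:  | ‖H‖·cl(K_n,H) − (C(n,2) − ex(n,H)) |.
err : ℕ → ℕ → ℕ → ℕ → ℕ
err hH n c e = ∣ (+ (hH * c)) - (+ (n C 2) - + e) ∣

IsComplete : ∀ {h} → Graph h → Set
IsComplete {h} H = ∀ (i j : Fin h) → i ≢ j → adj H i j ≡ true

IsBipartite : ∀ {h} → Graph h → Set
IsBipartite {h} H = Σ (Fin h → Bool) λ f → ∀ i j → adj H i j ≡ true → f i ≢ f j

HasCycle : ∀ {h} → Graph h → Set
HasCycle {h} H = ∃ λ m → Σ (Fin (suc (suc (suc m))) → Fin h) λ v →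
  Injective _≡_ _≡_ v ×
  (∀ (i : Fin (suc (suc m))) → adj H (v (inject₁ i)) (v (suc i)) ≡ true) ×
  adj H (v (fromℕ (suc (suc m)))) (v zero) ≡ true

IsForest : ∀ {h} → Graph h → Set
IsForest H = ¬ HasCycle H

-- The uncovered edges of a maximal packing form an H-free graph, which bounds cl(K_n, H) from below. For the upper bound take an
-- H-free graph L of nearly ex(n, H) edges and pack the complement of L almost completely: when this packing is extended greedily,
-- every new copy uses an uncovered edge outside L, so few copies are added and almost all of L stays uncovered.
--
-- If H has chromatic number r + 1 ≥ 3, L is the balanced complete r-partite graph. Its complement consists of r complete graphs,
-- packed up to O(n) edges by designs: the list of all injections of H covers all pairs equally often, a blow-up over ℤ_c turns this
-- into a decomposition of a blown-up complete graph, and truncated transversal designs extend it to every large size.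
-- By Erdős–Stone (Turán if H is complete) L has nearly ex(n, H) edges.
--
-- If H is bipartite, L is extremal, hence sparse by Kővári–Sós–Turán. Fix a vertex v0 of H of degree d + 1 and pass to smaller and
-- smaller vertex sets; the edges leaving the next set are grouped into stars with d + 1 leaves, and each star is extended to
-- a copy of H inside the complement of L. At most O(d) edges per vertex are left over, none if v0 is a leaf. Finally ex(n, H) is
-- superlinear if H contains a cycle (graphs of large girth), and otherwise unbounded or, for a single edge, zero.

module Submission where

open import Defs
open import Data.Nat using (ℕ; zero; suc; _+_; _*_; _∸_; _^_; _≤_; _≥_; _<_; _>_; z≤n; s≤s; _<ᵇ_; _≤?_; _<?_; NonZero; >-nonZero; _/_; _%_; _⊔_; _!)
open import Data.Nat.Properties hiding (_≟_; suc-injective)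
open import Data.Nat.Properties using () renaming (_≟_ to _≟ℕ_)
open import Data.Nat.DivMod using (m%n<n; m≡m%n+[m/n]*n; [m+n]%n≡m%n; [m+kn]%n≡m%n; m<n⇒m%n≡m; m/n*n≤m; m/n≤m; /-monoˡ-≤; m*n/n≡m)
open import Data.Nat.Divisibility using (m≤n⇒m!∣n!; _∣_; divides; ∣-trans; m∣m*n; n∣m*n)
open import Data.Nat.Combinatorics using (nCk+nC[k+1]≡[n+1]C[k+1]; nC1≡n) renaming (_C_ to _choose_)
open import Data.Nat.Induction using (<-rec)
open import Data.Nat.Tactic.RingSolver using (solve-∀)
open import Data.Bool using (Bool; true; false; if_then_else_; _∧_; _∨_; not)
open import Data.Bool.Properties using (∧-comm; ∨-comm)
open import Data.Empty using (⊥; ⊥-elim)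
open import Data.Fin using (Fin; _↑ˡ_; _↑ʳ_; toℕ; zero; suc; fromℕ<; inject₁; fromℕ; combine; remQuot; finToFun; funToFin; inject≤)
open import Data.Fin.Properties using (_≟_; any?; all?; toℕ-injective; toℕ<n; toℕ-fromℕ<; fromℕ<-toℕ; toℕ-inject₁; toℕ-fromℕ; suc-injective; injective⇒≤; combine-injective; combine-remQuot; remQuot-combine; funToFin-finToFin; finToFun-funToFin; toℕ-inject≤; ↑ˡ-injective; ↑ʳ-injective; toℕ-↑ˡ; toℕ-↑ʳ)
open import Data.List using (filter; List; []; _∷_; _++_; length; map; concat; allFin; tabulate; lookup)
open import Data.List.Properties using (length-++; ++-assoc; length-map; map-tabulate; length-tabulate)
open import Data.List.Relation.Unary.All as All using (All; []; _∷_)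
open import Data.List.Relation.Unary.All.Properties as AllP using ()
open import Data.List.Relation.Unary.Any as Any using (Any; here; there)
open import Data.List.Relation.Unary.AllPairs as AP using (AllPairs; []; _∷_)
open import Data.List.Relation.Unary.AllPairs.Properties as APP using ()
open import Data.Nat.ListAction using (sum)
open import Data.Product using (Σ; ∃; _×_; _,_; proj₁; proj₂)
open import Data.Sum using (_⊎_; inj₁; inj₂; [_,_]′)
open import Data.Integer as ℤ using (ℤ)
import Data.Integer.Properties as ℤP
open import Function using (_∘_; id)
open import Function.Definitions using (Injective)
open import Relation.Binary.PropositionalEquality using (_≡_; _≢_; refl; sym; trans; cong; cong₂; subst; subst₂; _≗_; module ≡-Reasoning)
open import Relation.Nullary using (¬_; Dec; yes; no; ⌊_⌋)
import Data.Integer.DivMod as ℤD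
import Data.Integer.Tactic.RingSolver as ℤS
open import Relation.Binary.Definitions using (Tri; tri<; tri≈; tri>)
open import Relation.Nullary.Decidable using (_×-dec_; _⊎-dec_; ¬?)

-- Finite sums and counting

opaque
  ∑ : ∀ {n} → (Fin n → ℕ) → ℕ
  ∑ {zero}  f = 0
  ∑ {suc n} f = f zero + ∑ (f ∘ suc)

opaque
  unfolding ∑

  ∑-suc : ∀ {n} (f : Fin (suc n) → ℕ) → ∑ f ≡ f zero + ∑ (f ∘ suc)
  ∑-suc f = refl

opaque
  ⟦_⟧ : Bool → ℕ
  ⟦ true ⟧ = 1
  ⟦ false ⟧ = 0

# : ∀ {n} → (Fin n → Bool) → ℕ
# p = ∑ (λ i → ⟦ p i ⟧)

∑∑ : ∀ {m n} → (Fin m → Fin n → ℕ) → ℕ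
∑∑ f = ∑ (λ i → ∑ (f i))

opaque
  unfolding ∑ ⟦_⟧

  ∑-cong : ∀ {n} {f g : Fin n → ℕ} → (∀ i → f i ≡ g i) → ∑ f ≡ ∑ g
  ∑-cong {zero} e = refl
  ∑-cong {suc n} e = cong₂ _+_ (e zero) (∑-cong (e ∘ suc))

opaque
  unfolding ∑ ⟦_⟧

  ∑-mono : ∀ {n} {f g : Fin n → ℕ} → (∀ i → f i ≤ g i) → ∑ f ≤ ∑ g
  ∑-mono {zero} e = z≤n
  ∑-mono {suc n} e = +-mono-≤ (e zero) (∑-mono (e ∘ suc))

opaque
  unfolding ∑ ⟦_⟧

  ∑-distrib : ∀ {n} (f g : Fin n → ℕ) → ∑ (λ i → f i + g i) ≡ ∑ f + ∑ g
  ∑-distrib {zero} f g = refl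
  ∑-distrib {suc n} f g = trans (cong (f zero + g zero +_) (∑-distrib (f ∘ suc) (g ∘ suc)))
    (interchange (f zero) (g zero) (∑ (f ∘ suc)) (∑ (g ∘ suc)))
    where
    interchange : ∀ a b c d → a + b + (c + d) ≡ a + c + (b + d)
    interchange = solve-∀

opaque
  unfolding ∑ ⟦_⟧

  ∑-const : ∀ {n} c → ∑ {n} (λ _ → c) ≡ n * c
  ∑-const {zero} c = refl
  ∑-const {suc n} c = cong (c +_) (∑-const {n} c)

∑-zero : ∀ {n} {f : Fin n → ℕ} → (∀ i → f i ≡ 0) → ∑ f ≡ 0
∑-zero {n} e = trans (∑-cong e) (trans (∑-const {n} 0) (*-zeroʳ n))

∑-bound : ∀ {n} {f : Fin n → ℕ} c → (∀ i → f i ≤ c) → ∑ f ≤ n * c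
∑-bound {n} c e = ≤-trans (∑-mono e) (≤-reflexive (∑-const {n} c))

opaque
  unfolding ∑ ⟦_⟧

  ∑-*ˡ : ∀ {n} c (f : Fin n → ℕ) → ∑ (λ i → c * f i) ≡ c * ∑ f
  ∑-*ˡ {zero} c f = sym (*-zeroʳ c)
  ∑-*ˡ {suc n} c f = trans (cong (c * f zero +_) (∑-*ˡ c (f ∘ suc))) (sym (*-distribˡ-+ c (f zero) (∑ (f ∘ suc))))

∑-*ʳ : ∀ {n} (f : Fin n → ℕ) c → ∑ (λ i → f i * c) ≡ ∑ f * c
∑-*ʳ f c = trans (∑-cong (λ i → *-comm (f i) c)) (trans (∑-*ˡ c f) (*-comm c (∑ f)))

opaque
  unfolding ∑ ⟦_⟧

  ∑-swap : ∀ {m n} (f : Fin m → Fin n → ℕ) → ∑ (λ i → ∑ (f i)) ≡ ∑ (λ j → ∑ (λ i → f i j))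
  ∑-swap {zero} {n} f = sym (∑-zero {n} (λ _ → refl))
  ∑-swap {suc m} f = trans (cong (∑ (f zero) +_) (∑-swap (f ∘ suc)))
    (sym (∑-distrib (f zero) (λ j → ∑ (λ i → f (suc i) j))))

opaque
  unfolding ∑ ⟦_⟧

  ∑-term : ∀ {n} (f : Fin n → ℕ) i → f i ≤ ∑ f
  ∑-term f zero = m≤m+n _ _
  ∑-term f (suc i) = ≤-trans (∑-term (f ∘ suc) i) (m≤n+m _ _)

opaque
  unfolding ∑ ⟦_⟧

  ∑-pos : ∀ {n} (f : Fin n → ℕ) → 1 ≤ ∑ f → ∃ λ i → 1 ≤ f i
  ∑-pos {suc n} f p with f zero in e
  ... | suc k = zero , ≤-trans (s≤s z≤n) (≤-reflexive (sym e))
  ... | zero with ∑-pos (f ∘ suc) p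
  ... | i , q = suc i , q

opaque
  unfolding ∑ ⟦_⟧

  ∑-< : ∀ {n} (f g : Fin n → ℕ) → ∑ f < ∑ g → ∃ λ i → f i < g i
  ∑-< {suc n} f g p with f zero <? g zero
  ... | yes q = zero , q
  ... | no ¬q with ∑-< (f ∘ suc) (g ∘ suc) (+-cancelˡ-< (f zero) _ _ (<-≤-trans p (+-monoˡ-≤ (∑ (g ∘ suc)) (≮⇒≥ ¬q))))
  ... | i , r = suc i , r

opaque
  unfolding ∑ ⟦_⟧

  ∑-single : ∀ {n} (f : Fin n → ℕ) i → (∀ j → j ≢ i → f j ≡ 0) → ∑ f ≡ f i
  ∑-single f zero e = trans (cong (f zero +_) (∑-zero (λ j → e (suc j) λ ()))) (+-identityʳ _)
  ∑-single f (suc i) e = trans (cong (_+ ∑ (f ∘ suc)) (e zero λ ()))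
    (∑-single (f ∘ suc) i (λ j j≢ → e (suc j) (j≢ ∘ suc-injective)))

∑-atMost1 : ∀ {n} (f : Fin n → ℕ) → (∀ i → f i ≤ 1) → (∀ i j → 1 ≤ f i → 1 ≤ f j → i ≡ j) → ∑ f ≤ 1
∑-atMost1 f b u with 1 ≤? ∑ f
... | no ¬p = ≤-trans (≮⇒≥ (¬p ∘ id)) z≤n
... | yes p with ∑-pos f p
... | i , q = ≤-trans (≤-reflexive (∑-single f i off)) (b i)
  where
  off : ∀ j → j ≢ i → f j ≡ 0
  off j j≢i with f j in e
  ... | zero = refl
  ... | suc k = ⊥-elim (j≢i (u j i (≤-trans (s≤s z≤n) (≤-reflexive (sym e))) q))

_==_ : ∀ {n} → Fin n → Fin n → Bool
i == j = ⌊ i ≟ j ⌋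

infix 4 _==_

opaque
  unfolding ∑ ⟦_⟧

  ⟦⟧≤1 : ∀ b → ⟦ b ⟧ ≤ 1
  ⟦⟧≤1 true = ≤-refl
  ⟦⟧≤1 false = z≤n

opaque
  unfolding ∑ ⟦_⟧

  ⟦⟧-false : ∀ {b} → b ≡ false → ⟦ b ⟧ ≡ 0
  ⟦⟧-false refl = refl

  ⟦⟧⇒ : ∀ {b} → 1 ≤ ⟦ b ⟧ → b ≡ true
  ⟦⟧⇒ {true} _ = refl

opaque
  unfolding ∑ ⟦_⟧

  ⟦⟧-true : ∀ {b} → b ≡ true → ⟦ b ⟧ ≡ 1
  ⟦⟧-true refl = refl

opaque
  unfolding ∑ ⟦_⟧

  ⟦⟧-mono : ∀ {a b} → (a ≡ true → b ≡ true) → ⟦ a ⟧ ≤ ⟦ b ⟧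
  ⟦⟧-mono {false} h = z≤n
  ⟦⟧-mono {true} h = ≤-reflexive (sym (⟦⟧-true (h refl)))

δ : ∀ {n} → Fin n → Fin n → ℕ
δ i j = ⟦ i == j ⟧

==-refl : ∀ {n} (i : Fin n) → (i == i) ≡ true
==-refl i with i ≟ i
... | yes _ = refl
... | no q = ⊥-elim (q refl)

==-≢ : ∀ {n} {i j : Fin n} → i ≢ j → (i == j) ≡ false
==-≢ {i = i} {j} p with i ≟ j
... | yes q = ⊥-elim (p q)
... | no _ = refl

==⇒≡ : ∀ {n} {i j : Fin n} → (i == j) ≡ true → i ≡ j
==⇒≡ {i = i} {j} p with i ≟ j
==⇒≡ p | yes q = q
==⇒≡ () | no _

δ-refl : ∀ {n} (i : Fin n) → δ i i ≡ 1
δ-refl i = ⟦⟧-true (==-refl i)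

δ-≢ : ∀ {n} {i j : Fin n} → i ≢ j → δ i j ≡ 0
δ-≢ p = ⟦⟧-false (==-≢ p)

∑-δ : ∀ {n} (f : Fin n → ℕ) i → ∑ (λ j → δ i j * f j) ≡ f i
∑-δ f i = trans (∑-single _ i (λ j j≢ → cong (_* f j) (δ-≢ (j≢ ∘ sym))))
  (trans (cong (_* f i) (δ-refl i)) (*-identityˡ _))

∑-δ1 : ∀ {n} (i : Fin n) → ∑ (λ j → δ i j) ≡ 1
∑-δ1 i = trans (∑-cong (λ j → sym (*-identityʳ (δ i j)))) (∑-δ (λ _ → 1) i)

∑-strict : ∀ {n} {f g : Fin n → ℕ} → (∀ i → f i ≤ g i) → ∀ i → f i < g i → ∑ f < ∑ g
∑-strict {f = f} {g} le i lt = begin-strict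
    ∑ f                      <⟨ n<1+n (∑ f) ⟩
    1 + ∑ f                  ≡⟨ +-comm 1 (∑ f) ⟩
    ∑ f + 1                  ≡⟨ cong (∑ f +_) (sym (∑-δ1 i)) ⟩
    ∑ f + ∑ (δ i)            ≡⟨ sym (∑-distrib f (δ i)) ⟩
    ∑ (λ j → f j + δ i j)    ≤⟨ ∑-mono cell ⟩
    ∑ g ∎
  where
  open ≤-Reasoning
  cell : ∀ j → f j + δ i j ≤ g j
  cell j with i ≟ j
  ... | yes refl = ≤-trans (≤-trans (+-monoʳ-≤ (f i) (⟦⟧≤1 true)) (≤-reflexive (+-comm (f i) 1))) lt
  ... | no ne = ≤-trans (≤-reflexive (trans (cong (f j +_) (⟦⟧-false refl)) (+-identityʳ (f j)))) (le j)

∧⁻ : ∀ {a b} → a ∧ b ≡ true → a ≡ true × b ≡ true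
∧⁻ {true} {true} _ = refl , refl

∧⁺ : ∀ {a b} → a ≡ true → b ≡ true → a ∧ b ≡ true
∧⁺ refl refl = refl

∨⁻ : ∀ {a b} → a ∨ b ≡ true → a ≡ true ⊎ b ≡ true
∨⁻ {true} _ = inj₁ refl
∨⁻ {false} p = inj₂ p

∨⁺ˡ : ∀ {a b} → a ≡ true → a ∨ b ≡ true
∨⁺ˡ refl = refl

∨⁺ʳ : ∀ {a b} → b ≡ true → a ∨ b ≡ true
∨⁺ʳ {true} _ = refl
∨⁺ʳ {false} p = p

not⁻ : ∀ {a} → not a ≡ true → a ≡ false
not⁻ {false} _ = refl

not⁺ : ∀ {a} → a ≡ false → not a ≡ true
not⁺ refl = refl

t≢f : ∀ {a} → a ≡ true → a ≡ false → ⊥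
t≢f refl ()

¬true⇒ : ∀ {a} → ¬ (a ≡ true) → a ≡ false
¬true⇒ {true} p = ⊥-elim (p refl)
¬true⇒ {false} p = refl

bool-split : ∀ a → a ≡ true ⊎ a ≡ false
bool-split true = inj₁ refl
bool-split false = inj₂ refl

bool-ext : ∀ {a b} → (a ≡ true → b ≡ true) → (b ≡ true → a ≡ true) → a ≡ b
bool-ext {true} {true} f g = refl
bool-ext {true} {false} f g = ⊥-elim (t≢f (f refl) refl)
bool-ext {false} {true} f g = ⊥-elim (t≢f (g refl) refl)
bool-ext {false} {false} f g = refl

opaque
  unfolding ∑ ⟦_⟧

  ⟦∧⟧ : ∀ a b → ⟦ a ∧ b ⟧ ≡ ⟦ a ⟧ * ⟦ b ⟧
  ⟦∧⟧ true b = sym (+-identityʳ _)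
  ⟦∧⟧ false b = refl

opaque
  unfolding ∑ ⟦_⟧

  ⟦∨⟧ : ∀ a b → ⟦ a ∨ b ⟧ ≤ ⟦ a ⟧ + ⟦ b ⟧
  ⟦∨⟧ true b = s≤s z≤n
  ⟦∨⟧ false b = ≤-refl

dec⌊⌋ : ∀ {A : Set} {d : Dec A} → ⌊ d ⌋ ≡ true → A
dec⌊⌋ {d = yes a} _ = a

⌊⌋dec : ∀ {A : Set} {d : Dec A} → A → ⌊ d ⌋ ≡ true
⌊⌋dec {d = yes a} _ = refl
⌊⌋dec {d = no q} a = ⊥-elim (q a)

⌊⌋false : ∀ {A : Set} {d : Dec A} → ¬ A → ⌊ d ⌋ ≡ false
⌊⌋false {d = yes a} q = ⊥-elim (q a)
⌊⌋false {d = no _} _ = refl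

⌊⌋false⁻ : ∀ {A : Set} {d : Dec A} → ⌊ d ⌋ ≡ false → ¬ A
⌊⌋false⁻ {d = no q} _ = q

opaque
  unfolding ∑ ⟦_⟧

  split⟦⟧ : ∀ a b → ⟦ a ⟧ ≡ ⟦ a ∧ b ⟧ + ⟦ a ∧ not b ⟧
  split⟦⟧ false b = refl
  split⟦⟧ true true = refl
  split⟦⟧ true false = refl

#-split : ∀ {n} (p q : Fin n → Bool) → # p ≡ # (λ i → p i ∧ q i) + # (λ i → p i ∧ not (q i))
#-split p q = trans (∑-cong (λ i → split⟦⟧ (p i) (q i))) (∑-distrib _ _)

#-mono : ∀ {n} {p q : Fin n → Bool} → (∀ i → p i ≡ true → q i ≡ true) → # p ≤ # q
#-mono h = ∑-mono (λ i → ⟦⟧-mono (h i))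

#-pos : ∀ {n} (p : Fin n → Bool) → 1 ≤ # p → ∃ λ i → p i ≡ true
#-pos p h with ∑-pos _ h
... | i , q = i , ⟦⟧⇒ q

#-≤n : ∀ {n} (p : Fin n → Bool) → # p ≤ n
#-≤n {n} p = ≤-trans (∑-bound 1 (λ i → ⟦⟧≤1 (p i))) (≤-reflexive (*-identityʳ n))

#-true : ∀ {n} {p : Fin n → Bool} → (∀ i → p i ≡ true) → # p ≡ n
#-true {n} e = trans (∑-cong (λ i → ⟦⟧-true (e i))) (trans (∑-const {n} 1) (*-identityʳ n))

#-none : ∀ {n} {p : Fin n → Bool} → (∀ i → ¬ (p i ≡ true)) → # p ≡ 0
#-none e = ∑-zero (λ i → ⟦⟧-false (¬true⇒ (e i)))

∑-inj : ∀ {m n} (f : Fin m → Fin n) → Injective _≡_ _≡_ f → (g : Fin n → ℕ) → ∑ (g ∘ f) ≤ ∑ g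
∑-inj f f-inj g = ≤-trans (≤-reflexive (trans (∑-cong (λ i → sym (∑-δ g (f i)))) (∑-swap _))) (∑-mono col)
  where
  at1 : ∀ {a b : Fin _} → 1 ≤ δ a b → a ≡ b
  at1 h = ==⇒≡ (⟦⟧⇒ h)
  col : ∀ j → ∑ (λ i → δ (f i) j * g j) ≤ g j
  col j = ≤-trans (≤-reflexive (∑-*ʳ (λ i → δ (f i) j) (g j)))
    (≤-trans (*-monoˡ-≤ (g j) (∑-atMost1 _ (λ i → ⟦⟧≤1 _) (λ i i′ p q → f-inj (trans (at1 p) (sym (at1 q))))))
      (≤-reflexive (*-identityˡ _)))

#-inj : ∀ {m n} (p : Fin n → Bool) (f : Fin m → Fin n) → Injective _≡_ _≡_ f → (∀ i → p (f i) ≡ true) → m ≤ # p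
#-inj {m} p f f-inj h = ≤-trans (≤-reflexive (sym (#-true h))) (∑-inj f f-inj (λ j → ⟦ p j ⟧))

opaque
  unfolding ∑ ⟦_⟧

  enum : ∀ {n} (p : Fin n → Bool) → Σ (Fin (# p) → Fin n) λ f → Injective _≡_ _≡_ f × (∀ i → p (f i) ≡ true) × (∀ x → p x ≡ true → ∃ λ i → f i ≡ x)
  enum {zero} p = (λ ()) , (λ {}) , (λ ()) , λ ()
  enum {suc n} p with enum (p ∘ suc) | p zero in e
  ... | f , f-inj , h , sur | false = suc ∘ f , (f-inj ∘ suc-injective) , h , sur′
    where
    sur′ : ∀ x → p x ≡ true → ∃ λ i → suc (f i) ≡ x
    sur′ zero q = ⊥-elim (t≢f q e)
    sur′ (suc x) q with sur x q
    ... | i , r = i , cong suc r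
  ... | f , f-inj , h , sur | true = g , g-inj , gp , sur′
    where
    g : Fin (suc (# (p ∘ suc))) → Fin (suc n)
    g zero = zero
    g (suc i) = suc (f i)
    g-inj : Injective _≡_ _≡_ g
    g-inj {zero} {zero} _ = refl
    g-inj {suc i} {suc j} q = cong suc (f-inj (suc-injective q))
    gp : ∀ i → p (g i) ≡ true
    gp zero = e
    gp (suc i) = h i
    sur′ : ∀ x → p x ≡ true → ∃ λ i → g i ≡ x
    sur′ zero _ = zero , refl
    sur′ (suc x) q with sur x q
    ... | i , r = suc i , cong suc r

inject≤-inj : ∀ {m n} (le : m ≤ n) {i j : Fin m} → inject≤ i le ≡ inject≤ j le → i ≡ j
inject≤-inj le {i} {j} q = toℕ-injective (trans (sym (toℕ-inject≤ i le)) (trans (cong toℕ q) (toℕ-inject≤ j le)))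

pick : ∀ {n t} (p : Fin n → Bool) → t ≤ # p → Σ (Fin t → Fin n) λ f → Injective _≡_ _≡_ f × (∀ i → p (f i) ≡ true)
pick p le with enum p
... | f , f-inj , h , _ = (λ i → f (inject≤ i le)) , (λ q → inject≤-inj le (f-inj q)) , λ i → h _

#-≤-inj : ∀ {m n} (p : Fin n → Bool) (f : Fin n → Fin m) → (∀ i j → p i ≡ true → p j ≡ true → f i ≡ f j → i ≡ j) → # p ≤ m
#-≤-inj p f f-inj with enum p
... | g , g-inj , h , _ = injective⇒≤ {f = f ∘ g} (λ {i} {j} q → g-inj (f-inj _ _ (h i) (h j) q))

opaque
  unfolding ∑ ⟦_⟧

  subset : ∀ {n} (p : Fin n → Bool) q → q ≤ # p → Σ (Fin n → Bool) λ r → (∀ i → r i ≡ true → p i ≡ true) × # r ≡ q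
  subset {zero} p zero _ = p , (λ ()) , refl
  subset {suc n} p q le with p zero in e
  ... | false with subset (p ∘ suc) q le
  ...   | r , sub , c = r′ , sub′ , c
    where
    r′ : Fin (suc n) → Bool
    r′ zero = false
    r′ (suc i) = r i
    sub′ : ∀ i → r′ i ≡ true → p i ≡ true
    sub′ (suc i) = sub i
  subset {suc n} p zero le | true = (λ _ → false) , (λ _ ()) , #-none {suc n} {λ _ → false} (λ i ())
  subset {suc n} p (suc q) (s≤s le) | true with subset (p ∘ suc) q le
  ...   | r , sub , c = r′ , sub′ , cong suc c
    where
    r′ : Fin (suc n) → Bool
    r′ zero = true
    r′ (suc i) = r i
    sub′ : ∀ i → r′ i ≡ true → p i ≡ true
    sub′ zero _ = e
    sub′ (suc i) = sub i

avoid : ∀ {n m} (T : Fin n → Bool) (bad : Fin m → Fin n → Bool) → ∑ (λ j → # (λ t → T t ∧ bad j t)) < # T →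
  ∃ λ t → T t ≡ true × (∀ j → bad j t ≡ false)
avoid T bad lt with ∑-< (λ t → ∑ (λ j → ⟦ T t ∧ bad j t ⟧)) (λ t → ⟦ T t ⟧) (≤-trans (s≤s (≤-reflexive (sym (∑-swap _)))) lt)
... | t , q = t , Tt , good
  where
  Tt : T t ≡ true
  Tt = ⟦⟧⇒ (≤-trans (s≤s z≤n) q)
  small : ∑ (λ j → ⟦ T t ∧ bad j t ⟧) ≡ 0
  small = n≤0⇒n≡0 (≤-pred (≤-trans q (⟦⟧≤1 _)))
  good : ∀ j → bad j t ≡ false
  good j with bad j t in e
  ... | false = refl
  ... | true = ⊥-elim (1+n≰n (≤-trans (≤-reflexive (sym (⟦⟧-true (∧⁺ Tt e)))) (≤-trans (∑-term (λ j → ⟦ T t ∧ bad j t ⟧) j) (≤-reflexive small))))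

listSum : ∀ {A : Set} → (A → ℕ) → List A → ℕ
listSum f xs = sum (map f xs)

listSum-++ : ∀ {A : Set} (f : A → ℕ) xs ys → listSum f (xs ++ ys) ≡ listSum f xs + listSum f ys
listSum-++ f [] ys = refl
listSum-++ f (x ∷ xs) ys = trans (cong (f x +_) (listSum-++ f xs ys)) (sym (+-assoc (f x) _ _))

opaque
  unfolding ∑ ⟦_⟧

  listSum-∑ : ∀ {A : Set} {n} (f : A → Fin n → ℕ) xs → ∑ (λ i → listSum (λ a → f a i) xs) ≡ listSum (λ a → ∑ (f a)) xs
  listSum-∑ {n = n} f [] = ∑-zero {n} (λ _ → refl)
  listSum-∑ f (x ∷ xs) = trans (∑-distrib (f x) _) (cong (∑ (f x) +_) (listSum-∑ f xs))

listSum-cong : ∀ {A : Set} {f g : A → ℕ} → (∀ a → f a ≡ g a) → ∀ xs → listSum f xs ≡ listSum g xs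
listSum-cong e [] = refl
listSum-cong e (x ∷ xs) = cong₂ _+_ (e x) (listSum-cong e xs)

listSum-bound : ∀ {A : Set} {f : A → ℕ} {c} {xs} → All (λ a → f a ≤ c) xs → listSum f xs ≤ length xs * c
listSum-bound [] = z≤n
listSum-bound (p ∷ ps) = +-mono-≤ p (listSum-bound ps)

listSum-const : ∀ {A : Set} c (xs : List A) → listSum (λ _ → c) xs ≡ length xs * c
listSum-const c [] = refl
listSum-const c (x ∷ xs) = cong (c +_) (listSum-const c xs)

opaque
  unfolding ∑ ⟦_⟧

  listSum-allFin : ∀ {n} (f : Fin n → ℕ) → listSum f (allFin n) ≡ ∑ f
  listSum-allFin {n} f = trans (cong sum (map-tabulate {n = n} id f)) (tab f)
    where
    tab : ∀ {n} (f : Fin n → ℕ) → sum (tabulate f) ≡ ∑ f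
    tab {zero} f = refl
    tab {suc n} f = cong (f zero +_) (tab (f ∘ suc))

opaque
  unfolding ∑ ⟦_⟧

  length-concat-tab : ∀ {A : Set} {n} (f : Fin n → List A) → length (concat (tabulate f)) ≡ ∑ (λ i → length (f i))
  length-concat-tab {n = zero} f = refl
  length-concat-tab {n = suc n} f = trans (length-++ (f zero)) (cong (length (f zero) +_) (length-concat-tab (f ∘ suc)))

opaque
  unfolding ∑ ⟦_⟧

  listSum-concat-tab : ∀ {A : Set} {n} (g : A → ℕ) (f : Fin n → List A) → listSum g (concat (tabulate f)) ≡ ∑ (λ i → listSum g (f i))
  listSum-concat-tab {n = zero} g f = refl
  listSum-concat-tab {n = suc n} g f = trans (listSum-++ g (f zero) _) (cong (listSum g (f zero) +_) (listSum-concat-tab g (f ∘ suc)))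
-- Packings as lists of vertex maps

Inj : ∀ {h} {V : Set} → (Fin h → V) → Set
Inj f = ∀ i j → f i ≡ f j → i ≡ j

e2 : ∀ {n} → (Fin n → Fin n → Bool) → ℕ
e2 R = ∑∑ (λ x y → ⟦ R x y ⟧)

isZero : ℕ → Bool
isZero zero = true
isZero (suc _) = false

isZero⇒ : ∀ {k} → isZero k ≡ true → k ≡ 0
isZero⇒ {zero} _ = refl

isZero-pos : ∀ {k} → 1 ≤ k → isZero k ≡ false
isZero-pos (s≤s _) = refl

isZero-false : ∀ {k} → isZero k ≡ false → 1 ≤ k
isZero-false {suc k} _ = s≤s z≤n

module _ {h : ℕ} (H : Graph h) where

  Disj : {V : Set} → (Fin h → V) → (Fin h → V) → Set
  Disj φ ψ = ∀ i j i′ j′ → adj H i j ≡ true → adj H i′ j′ ≡ true → φ i ≡ ψ i′ → φ j ≡ ψ j′ → ⊥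

  Packs : {V : Set} → List (Fin h → V) → Set
  Packs P = All Inj P × AllPairs Disj P

  EdgesIn : ∀ {n} → (Fin n → Fin n → Bool) → (Fin h → Fin n) → Set
  EdgesIn A φ = ∀ i j → adj H i j ≡ true → A (φ i) (φ j) ≡ true

  cv : ∀ {n} → (Fin h → Fin n) → Fin n → Fin n → ℕ
  cv φ x y = ∑∑ (λ i j → ⟦ adj H i j ⟧ * (δ (φ i) x * δ (φ j) y))

  cvP : ∀ {n} → List (Fin h → Fin n) → Fin n → Fin n → ℕ
  cvP P x y = listSum (λ φ → cv φ x y) P

  e2H : ℕ
  e2H = e2 (adj H)

  cv-edge : ∀ {n} (φ : Fin h → Fin n) i j → adj H i j ≡ true → 1 ≤ cv φ (φ i) (φ j)
  cv-edge φ i j a = ≤-trans (≤-reflexive (sym here1))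
    (≤-trans (∑-term (λ j′ → ⟦ adj H i j′ ⟧ * (δ (φ i) (φ i) * δ (φ j′) (φ j))) j) (∑-term (λ i′ → ∑ (λ j′ → ⟦ adj H i′ j′ ⟧ * (δ (φ i′) (φ i) * δ (φ j′) (φ j)))) i))
    where
    here1 : ⟦ adj H i j ⟧ * (δ (φ i) (φ i) * δ (φ j) (φ j)) ≡ 1
    here1 = cong₂ _*_ (⟦⟧-true a) (cong₂ _*_ (δ-refl (φ i)) (δ-refl (φ j)))

  term-wit : ∀ {n} {b : Bool} {x y z w : Fin n} → 1 ≤ ⟦ b ⟧ * (δ x y * δ z w) → b ≡ true × x ≡ y × z ≡ w
  term-wit {b = b} {x} {y} {z} {w} p with bool-split b | bool-split (x == y) | bool-split (z == w)
  ... | inj₁ r | inj₁ s | inj₁ t = r , ==⇒≡ s , ==⇒≡ t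
  ... | inj₂ r | _ | _ = ⊥-elim (1+n≰n (≤-trans p (≤-reflexive (cong (_* (δ x y * δ z w)) (⟦⟧-false r)))))
  ... | inj₁ _ | inj₂ s | _ = ⊥-elim (1+n≰n (≤-trans p (≤-reflexive (trans (cong (λ u → ⟦ b ⟧ * (u * δ z w)) (⟦⟧-false s)) (*-zeroʳ ⟦ b ⟧)))))
  ... | inj₁ _ | inj₁ _ | inj₂ t = ⊥-elim (1+n≰n (≤-trans p (≤-reflexive (trans (cong (λ u → ⟦ b ⟧ * (δ x y * u)) (⟦⟧-false t)) (trans (cong (⟦ b ⟧ *_) (*-zeroʳ (δ x y))) (*-zeroʳ ⟦ b ⟧))))))

  cv-wit : ∀ {n} (φ : Fin h → Fin n) x y → 1 ≤ cv φ x y → ∃ λ i → ∃ λ j → adj H i j ≡ true × φ i ≡ x × φ j ≡ y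
  cv-wit φ x y p with ∑-pos _ p
  ... | i , q with ∑-pos _ q
  ... | j , r = i , j , term-wit r

  term≤1 : ∀ {n} (b : Bool) (x y z w : Fin n) → ⟦ b ⟧ * (δ x y * δ z w) ≤ 1
  term≤1 b x y z w = *-mono-≤ (⟦⟧≤1 b) (*-mono-≤ (⟦⟧≤1 (x == y)) (⟦⟧≤1 (z == w)))

  cv≤1 : ∀ {n} (φ : Fin h → Fin n) → Inj φ → ∀ x y → cv φ x y ≤ 1
  cv≤1 φ φ-inj x y = ∑-atMost1 _
    (λ i → ∑-atMost1 _ (λ j → term≤1 (adj H i j) (φ i) x (φ j) y)
      (λ j j′ p q → φ-inj j j′ (trans (proj₂ (proj₂ (term-wit p))) (sym (proj₂ (proj₂ (term-wit q)))))))
    (λ i i′ p q → φ-inj i i′ (trans (fst p) (sym (fst q))))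
    where
    fst : ∀ {i} → 1 ≤ ∑ (λ j → ⟦ adj H i j ⟧ * (δ (φ i) x * δ (φ j) y)) → φ i ≡ x
    fst p with ∑-pos _ p
    ... | j , r = proj₁ (proj₂ (term-wit r))

  cv-sym : ∀ {n} (φ : Fin h → Fin n) x y → cv φ x y ≡ cv φ y x
  cv-sym φ x y = trans (∑-swap (λ i j → ⟦ adj H i j ⟧ * (δ (φ i) x * δ (φ j) y)))
    (∑-cong (λ j → ∑-cong (λ i → cong₂ _*_ (cong ⟦_⟧ (adj-sym H i j)) (*-comm (δ (φ i) x) _))))

  cvP-sym : ∀ {n} (P : List (Fin h → Fin n)) x y → cvP P x y ≡ cvP P y x
  cvP-sym P x y = listSum-cong (λ φ → cv-sym φ x y) P

  cv-row : ∀ {n} (φ : Fin h → Fin n) x → ∑ (cv φ x) ≡ ∑ (λ i → δ (φ i) x * ∑ (λ j → ⟦ adj H i j ⟧))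
  cv-row φ x = trans (∑-swap (λ y i → ∑ (λ j → ⟦ adj H i j ⟧ * (δ (φ i) x * δ (φ j) y)))) (∑-cong inner)
    where
    inner : ∀ i → ∑ (λ y → ∑ (λ j → ⟦ adj H i j ⟧ * (δ (φ i) x * δ (φ j) y))) ≡ δ (φ i) x * ∑ (λ j → ⟦ adj H i j ⟧)
    inner i = trans (∑-swap (λ y j → ⟦ adj H i j ⟧ * (δ (φ i) x * δ (φ j) y)))
      (trans (∑-cong (λ j → trans (∑-*ˡ ⟦ adj H i j ⟧ (λ y → δ (φ i) x * δ (φ j) y)) (trans (cong (⟦ adj H i j ⟧ *_)
        (trans (∑-*ˡ (δ (φ i) x) (δ (φ j))) (trans (cong (δ (φ i) x *_) (∑-δ1 (φ j))) (*-identityʳ _)))) (*-comm ⟦ adj H i j ⟧ (δ (φ i) x)))))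
        (∑-*ˡ (δ (φ i) x) (λ j → ⟦ adj H i j ⟧)))

  cv-total : ∀ {n} (φ : Fin h → Fin n) → ∑∑ (cv φ) ≡ e2H
  cv-total φ = trans (∑-cong (cv-row φ)) (trans (∑-swap (λ x i → δ (φ i) x * ∑ (λ j → ⟦ adj H i j ⟧)))
    (∑-cong (λ i → trans (∑-*ʳ (δ (φ i)) _) (trans (cong (_* ∑ (λ j → ⟦ adj H i j ⟧)) (∑-δ1 (φ i))) (*-identityˡ _)))))

  cvP-total : ∀ {n} (P : List (Fin h → Fin n)) → ∑∑ (cvP P) ≡ length P * e2H
  cvP-total P = trans (∑-cong (λ x → listSum-∑ (λ φ → cv φ x) P)) (trans (listSum-∑ (λ φ x → ∑ (cv φ x)) P)
    (trans (listSum-cong cv-total P) (listSum-const e2H P)))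

  cvP-++ : ∀ {n} (P Q : List (Fin h → Fin n)) x y → cvP (P ++ Q) x y ≡ cvP P x y + cvP Q x y
  cvP-++ P Q x y = listSum-++ (λ φ → cv φ x y) P Q

  cvP-wit : ∀ {n} (P : List (Fin h → Fin n)) x y → 1 ≤ cvP P x y → Any (λ φ → 1 ≤ cv φ x y) P
  cvP-wit (φ ∷ P) x y p with 1 ≤? cv φ x y
  ... | yes q = here q
  ... | no ¬q = there (cvP-wit P x y (≤-trans p (≤-reflexive (cong (_+ cvP P x y) (n≤0⇒n≡0 (≮⇒≥ ¬q))))))

  cvP-any : ∀ {n} {P : List (Fin h → Fin n)} {x y} → Any (λ φ → 1 ≤ cv φ x y) P → 1 ≤ cvP P x y
  cvP-any (here p) = ≤-trans p (m≤m+n _ _)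
  cvP-any (there p) = ≤-trans (cvP-any p) (m≤n+m _ _)

  cvP-all0 : ∀ {n} {P : List (Fin h → Fin n)} {x y} → All (λ φ → ¬ (1 ≤ cv φ x y)) P → cvP P x y ≡ 0
  cvP-all0 [] = refl
  cvP-all0 (p ∷ ps) = cong₂ _+_ (n≤0⇒n≡0 (≮⇒≥ p)) (cvP-all0 ps)

  cvP≤1 : ∀ {n} {P : List (Fin h → Fin n)} → Packs P → ∀ x y → cvP P x y ≤ 1
  cvP≤1 ([] , []) x y = z≤n
  cvP≤1 {P = φ ∷ P} (i ∷ is , d ∷ ds) x y with 1 ≤? cv φ x y
  ... | no ¬q = ≤-trans (≤-reflexive (cong (_+ cvP P x y) (n≤0⇒n≡0 (≮⇒≥ ¬q)))) (cvP≤1 (is , ds) x y)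
  ... | yes q with cv-wit φ x y q
  ... | a , b , ab , ax , by = ≤-trans (≤-reflexive (trans (cong (cv φ x y +_) (cvP-all0 (All.map none d))) (+-identityʳ _))) (cv≤1 φ i x y)
    where
    none : ∀ {ψ} → Disj φ ψ → ¬ (1 ≤ cv ψ x y)
    none {ψ} dj r with cv-wit ψ x y r
    ... | a′ , b′ , ab′ , ax′ , by′ = dj a b a′ b′ ab ab′ (trans ax (sym ax′)) (trans by (sym by′))

  adj-≢ : ∀ {i j} → adj H i j ≡ true → i ≢ j
  adj-≢ {i} a refl = t≢f a (adj-irrefl H i)

  cv-diag : ∀ {n} (φ : Fin h → Fin n) → Inj φ → ∀ x → cv φ x x ≡ 0
  cv-diag φ φ-inj x with 1 ≤? cv φ x x
  ... | no ¬p = n≤0⇒n≡0 (≮⇒≥ ¬p)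
  ... | yes p with cv-wit φ x x p
  ... | i , j , a , e , e′ = ⊥-elim (adj-≢ a (φ-inj i j (trans e (sym e′))))

  cvP-diag : ∀ {n} {P : List (Fin h → Fin n)} → All Inj P → ∀ x → cvP P x x ≡ 0
  cvP-diag [] x = refl
  cvP-diag (i ∷ is) x = cong₂ _+_ (cv-diag _ i x) (cvP-diag is x)

  free : ∀ {n} → List (Fin h → Fin n) → Fin n → Fin n → Bool
  free P x y = isZero (cvP P x y)

  free-disj : ∀ {n} (P : List (Fin h → Fin n)) φ → EdgesIn (free P) φ → All (Disj φ) P
  free-disj [] φ f = []
  free-disj (ψ ∷ P) φ f = dis ∷ free-disj P φ (λ i j a → zer (cv ψ (φ i) (φ j)) (f i j a))
    where
    zer : ∀ a {b} → isZero (a + b) ≡ true → isZero b ≡ true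
    zer zero p = p
    dis : Disj φ ψ
    dis i j i′ j′ a a′ e e′ = 1+n≰n (≤-trans (cv-edge ψ i′ j′ a′)
      (≤-trans (≤-reflexive (cong₂ (cv ψ) (sym e) (sym e′))) (≤-trans (m≤m+n _ (cvP P (φ i) (φ j))) (≤-reflexive (isZero⇒ (f i j a))))))

  packs-length : ∀ {n} {P : List (Fin h → Fin n)} → Packs P → length P * e2H ≤ n * n
  packs-length {n} {P} p = ≤-trans (≤-reflexive (sym (cvP-total P)))
    (≤-trans (∑-bound (n * 1) (λ x → ∑-bound 1 (cvP≤1 p x))) (≤-reflexive (cong (n *_) (*-identityʳ n))))

search : ∀ {h n} (P : (Fin h → Fin n) → Set) → (∀ φ → Dec (P φ)) → (∀ {φ ψ} → φ ≗ ψ → P φ → P ψ) → Dec (∃ P)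
search {zero} P P? ext with P? (λ ())
... | yes p = yes (_ , p)
... | no ¬p = no λ { (φ , q) → ¬p (ext (λ ()) q) }
search {suc h} {n} P P? ext with any? (λ x → search (λ φ → P (cons x φ)) (λ φ → P? _) (λ e → ext (λ { zero → refl ; (suc i) → e i })))
  where
  cons : ∀ {n} → Fin n → (Fin h → Fin n) → Fin (suc h) → Fin n
  cons x φ zero = x
  cons x φ (suc i) = φ i
... | yes (x , φ , p) = yes (_ , p)
... | no ¬p = no λ { (φ , q) → ¬p (φ zero , φ ∘ suc , ext (λ { zero → refl ; (suc i) → refl }) q) }

inj? : ∀ {h n} (φ : Fin h → Fin n) → Dec (Inj φ)
inj? φ = all? λ i → all? λ j → imp (φ i ≟ φ j) (i ≟ j)
  where
  imp : ∀ {A B : Set} → Dec A → Dec B → Dec (A → B)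
  imp _ (yes b) = yes λ _ → b
  imp (no ¬a) (no _) = yes λ a → ⊥-elim (¬a a)
  imp (yes a) (no ¬b) = no λ f → ¬b (f a)

bool? : ∀ (b : Bool) → Dec (b ≡ true)
bool? true = yes refl
bool? false = no λ ()

module _ {h : ℕ} (H : Graph h) where

  edgesIn? : ∀ {n} (A : Fin n → Fin n → Bool) φ → Dec (EdgesIn H A φ)
  edgesIn? A φ = all? λ i → all? λ j → imp (adj H i j) (A (φ i) (φ j))
    where
    imp : ∀ a b → Dec (a ≡ true → b ≡ true)
    imp a true = yes λ _ → refl
    imp false false = yes λ ()
    imp true false = no λ f → t≢f (f refl) refl

  Saturated : ∀ {n} → (Fin n → Fin n → Bool) → List (Fin h → Fin n) → Set
  Saturated A P = ∀ φ → Inj φ → ¬ EdgesIn H (λ x y → A x y ∧ free H P x y) φ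

  saturate : ∀ {n} (A : Fin n → Fin n → Bool) (P : List (Fin h → Fin n)) → 1 ≤ e2H H → Packs H P →
    ∃ λ Q → Packs H (Q ++ P) × All (EdgesIn H A) Q × Saturated A (Q ++ P)
  saturate {n} A P pos = go (suc (n * n)) P (m≤n+m (suc (n * n)) (length P))
    where
    go : ∀ k P → n * n < length P + k → Packs H P → ∃ λ Q → Packs H (Q ++ P) × All (EdgesIn H A) Q × Saturated A (Q ++ P)
    go zero P lt pk = ⊥-elim (<-irrefl refl (≤-trans lt (≤-trans (≤-reflexive (trans (+-identityʳ _) (sym (*-identityʳ _))))
      (≤-trans (*-monoʳ-≤ (length P) pos) (packs-length H pk)))))
    go (suc k) P lt pk with search {h} {n} (λ φ → Inj φ × EdgesIn H (λ x y → A x y ∧ free H P x y) φ)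
        (λ φ → inj? φ ×-dec edgesIn? (λ x y → A x y ∧ free H P x y) φ)
        (λ {φ} {ψ} e (i , f) → (λ a b q → i a b (trans (e a) (trans q (sym (e b))))) ,
          λ a b q → subst₂ (λ x y → A x y ∧ free H P x y ≡ true) (e a) (e b) (f a b q))
    ... | no none = [] , pk , [] , λ φ i f → none (φ , i , f)
    ... | yes (φ , i , f) with go k (φ ∷ P) (≤-trans lt (≤-reflexive (+-suc (length P) k)))
                            ((i ∷ proj₁ pk) , (free-disj H P φ (λ a b q → proj₂ (∧⁻ {A (φ a) (φ b)} (f a b q))) ∷ proj₂ pk))
    ...   | Q , pk′ , qs , sat = Q ++ (φ ∷ []) , subst (Packs H) re pk′ , AllP.++⁺ qs ((λ a b q → proj₁ (∧⁻ {A (φ a) (φ b)} (f a b q))) ∷ []) , subst (Saturated A) re sat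
      where
      re : Q ++ φ ∷ P ≡ (Q ++ φ ∷ []) ++ P
      re = sym (++-assoc Q (φ ∷ []) P)

-- Edge counts and the two general bounds on cl

opaque
  unfolding ∑ ⟦_⟧

  ‖‖-∑ : ∀ {n} (G : Graph n) → ‖ G ‖ ≡ ∑∑ (λ i j → ⟦ (toℕ i <ᵇ toℕ j) ∧ adj G i j ⟧)
  ‖‖-∑ {n} G = trans (listSum-allFin (λ i → sum (map (λ j → if (toℕ i <ᵇ toℕ j) ∧ adj G i j then 1 else 0) (allFin n))))
    (∑-cong (λ i → trans (listSum-allFin (λ j → if (toℕ i <ᵇ toℕ j) ∧ adj G i j then 1 else 0)) (∑-cong (λ j → ite ((toℕ i <ᵇ toℕ j) ∧ adj G i j)))))
    where
    ite : ∀ b → (if b then 1 else 0) ≡ ⟦ b ⟧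
    ite true = refl
    ite false = refl

private
  <ᵇ-cases : ∀ i j → ((i <ᵇ j) ≡ true × (j <ᵇ i) ≡ false) ⊎ ((i <ᵇ j) ≡ false × (j <ᵇ i) ≡ true) ⊎ i ≡ j
  <ᵇ-cases zero zero = inj₂ (inj₂ refl)
  <ᵇ-cases zero (suc j) = inj₁ (refl , refl)
  <ᵇ-cases (suc i) zero = inj₂ (inj₁ (refl , refl))
  <ᵇ-cases (suc i) (suc j) with <ᵇ-cases i j
  ... | inj₁ p = inj₁ p
  ... | inj₂ (inj₁ p) = inj₂ (inj₁ p)
  ... | inj₂ (inj₂ refl) = inj₂ (inj₂ refl)

e2-‖‖ : ∀ {n} (G : Graph n) → e2 (adj G) ≡ 2 * ‖ G ‖
e2-‖‖ G = trans (∑-cong (λ i → trans (∑-cong (cell i)) (∑-distrib _ _)))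
  (trans (∑-distrib (λ i → ∑ (λ j → up i j)) (λ i → ∑ (λ j → up j i)))
  (trans (cong (∑∑ up +_) (∑-swap (λ i j → up j i))) (trans (cong (∑∑ up +_) (sym (+-identityʳ (∑∑ up)))) (cong (2 *_) (sym (‖‖-∑ G))))))
  where
  up : Fin _ → Fin _ → ℕ
  up i j = ⟦ (toℕ i <ᵇ toℕ j) ∧ adj G i j ⟧
  up1 : ∀ {i j} → (toℕ i <ᵇ toℕ j) ≡ true → up i j ≡ ⟦ adj G i j ⟧
  up1 {i} {j} p = cong (λ b → ⟦ b ∧ adj G i j ⟧) p
  up0 : ∀ {i j} → (toℕ i <ᵇ toℕ j) ≡ false → up i j ≡ 0
  up0 {i} {j} p = trans (cong (λ b → ⟦ b ∧ adj G i j ⟧) p) (⟦⟧-false refl)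
  cell : ∀ i j → ⟦ adj G i j ⟧ ≡ up i j + up j i
  cell i j with <ᵇ-cases (toℕ i) (toℕ j)
  ... | inj₁ (p , q) = sym (trans (cong₂ _+_ (up1 p) (up0 q)) (+-identityʳ _))
  ... | inj₂ (inj₁ (p , q)) = sym (trans (cong₂ _+_ (up0 p) (up1 q)) (cong ⟦_⟧ (adj-sym G j i)))
  ... | inj₂ (inj₂ e) with toℕ-injective e
  ...   | refl = trans (⟦⟧-false (adj-irrefl G i)) (sym (cong₂ _+_ diag diag))
    where
    diag : up i i ≡ 0
    diag = ⟦⟧-false (¬true⇒ (λ q → t≢f (proj₂ (∧⁻ {toℕ i <ᵇ toℕ i} q)) (adj-irrefl G i)))

2*C2 : ∀ n → n + 2 * (n choose 2) ≡ n * n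
2*C2 zero = refl
2*C2 (suc n) = trans (cong (λ z → suc n + 2 * z) (trans (sym (nCk+nC[k+1]≡[n+1]C[k+1] n 1)) (cong (_+ (n choose 2)) (nC1≡n n))))
  (trans (lem n (n choose 2)) (trans (cong (λ z → suc (n + n + z)) (2*C2 n)) (lem′ n)))
  where
  lem : ∀ n c → suc n + 2 * (n + c) ≡ suc (n + n + (n + 2 * c))
  lem = solve-∀
  lem′ : ∀ n → suc (n + n + n * n) ≡ suc n * suc n
  lem′ = solve-∀

err-bound : ∀ m n c e E → n choose 2 ≤ m * c + e → m * c + e ≤ n choose 2 + E → err m n c e ≤ E
err-bound m n c e E lo hi = ≤-trans (≤-reflexive eq) (≤-trans (∸-monoˡ-≤ (n choose 2) hi) (≤-reflexive (m+n∸m≡n (n choose 2) E)))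
  where
  assoc : ∀ (a b c : ℤ) → a ℤ.- (b ℤ.- c) ≡ (a ℤ.+ c) ℤ.- b
  assoc a b c = trans (cong (λ z → a ℤ.+ z) (trans (ℤP.neg-distrib-+ b (ℤ.- c)) (trans (cong (ℤ._+_ (ℤ.- b)) (ℤP.neg-involutive c)) (ℤP.+-comm (ℤ.- b) c))))
    (sym (ℤP.+-assoc a c (ℤ.- b)))
  eq : err m n c e ≡ m * c + e ∸ n choose 2
  eq = cong ℤ.∣_∣ (trans (assoc (ℤ.+ (m * c)) (ℤ.+ (n choose 2)) (ℤ.+ e)) (trans (ℤP.m-n≡m⊖n (m * c + e) (n choose 2)) (ℤP.⊖-≥ lo)))

K-adj : ∀ {n} {i j : Fin n} → i ≢ j → adj (K n) i j ≡ true
K-adj p = cong not (==-≢ p)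

K-adj⁻ : ∀ {n} {i j : Fin n} → adj (K n) i j ≡ true → i ≢ j
K-adj⁻ {i = i} p refl = t≢f p (cong not (==-refl i))

e2K : ∀ n → n + e2 (adj (K n)) ≡ n * n
e2K n = trans (cong (_+ e2 (adj (K n))) (sym (trans (∑-cong {n} (λ i → ∑-δ1 i)) (trans (∑-const {n} 1) (*-identityʳ n)))))
  (trans (sym (∑-distrib (λ i → ∑ (δ i)) _)) (trans (∑-cong (λ i → trans (sym (∑-distrib (δ i) _)) (trans (∑-cong (cell i)) (trans (∑-const {n} 1) (*-identityʳ n))))) (∑-const {n} n)))
  where
  cell : ∀ (i j : Fin n) → δ i j + ⟦ adj (K n) i j ⟧ ≡ 1
  cell i j with bool-split (i == j)
  ... | inj₁ p = cong₂ _+_ (⟦⟧-true p) (⟦⟧-false (cong not p))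
  ... | inj₂ p = cong₂ _+_ (⟦⟧-false p) (⟦⟧-true (cong not p))

module _ {h : ℕ} (H : Graph h) where

  toCopies : ∀ {n} {P : List (Fin h → Fin n)} → All Inj P → Σ (List (Copy H (K n))) λ C → map φ C ≡ P
  toCopies [] = [] , refl
  toCopies {P = f ∷ P} (i ∷ is) with toCopies is
  ... | C , e = record { φ = f ; inj = λ {a} {b} → i a b ; edges = λ a b p → K-adj (λ q → adj-≢ H p (i a b q)) } ∷ C , cong (f ∷_) e

  copiesInj : ∀ {n} {G : Graph n} (C : List (Copy H G)) → All Inj (map φ C)
  copiesInj [] = []
  copiesInj (c ∷ C) = (λ i j → inj c) ∷ copiesInj C

  packing⇒ : ∀ {n} {G : Graph n} {C : List (Copy H G)} → IsPacking C → Packs H (map φ C)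
  packing⇒ {C = C} p = copiesInj C , APP.map⁺ (AP.map (λ {c} {d} ns i j i′ j′ a a′ e e′ → ns (i , j , i′ , j′ , a , a′ , e , e′)) p)

  packing⇐ : ∀ {n} {G : Graph n} {C : List (Copy H G)} → Packs H (map φ C) → IsPacking C
  packing⇐ p = AP.map (λ {c} {d} dj (i , j , i′ , j′ , a , a′ , e , e′) → dj i j i′ j′ a a′ e e′) (APP.map⁻ (proj₂ p))

  uncov : ∀ {n} → List (Fin h → Fin n) → Graph n
  uncov {n} P = record
    { adj = λ x y → adj (K n) x y ∧ free H P x y
    ; adj-sym = λ x y → cong₂ _∧_ (adj-sym (K n) x y) (cong isZero (cvP-sym H P x y))
    ; adj-irrefl = λ x → cong (_∧ free H P x x) (adj-irrefl (K n) x) }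

  uncov-count : ∀ {n} {P : List (Fin h → Fin n)} → Packs H P → n + (length P * e2H H + e2 (adj (uncov P))) ≡ n * n
  uncov-count {n} {P} pk = trans (cong (n +_) (trans (cong (_+ e2 (adj (uncov P))) (sym (cvP-total H P)))
      (trans (sym (∑-distrib (λ x → ∑ (cvP H P x)) _)) (∑-cong (λ x → trans (sym (∑-distrib (cvP H P x) _)) (∑-cong (cell x))))))) (e2K n)
    where
    zo : ∀ k b → k ≤ 1 → (b ≡ false → k ≡ 0) → k + ⟦ b ∧ isZero k ⟧ ≡ ⟦ b ⟧
    zo zero true _ _ = refl
    zo zero false _ _ = refl
    zo (suc zero) true _ _ = trans (cong suc (⟦⟧-false refl)) (sym (⟦⟧-true refl))
    zo (suc k) false _ q with q refl
    ... | ()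
    zo (suc (suc k)) b (s≤s ()) _
    cell : ∀ x y → cvP H P x y + ⟦ adj (uncov P) x y ⟧ ≡ ⟦ adj (K n) x y ⟧
    cell x y = zo _ (adj (K n) x y) (cvP≤1 H pk x y) (λ q → subst (λ z → cvP H P x z ≡ 0) (eq q) (cvP-diag H (proj₁ pk) x))
      where
      eq : adj (K n) x y ≡ false → x ≡ y
      eq q with x ≟ y
      ... | yes e = e

  share⇒cvP : ∀ {n} {c : Copy H (K n)} {C : List (Copy H (K n))} → Any (ShareEdge c) C →
    ∃ λ i → ∃ λ j → adj H i j ≡ true × 1 ≤ cvP H (map φ C) (φ c i) (φ c j)
  share⇒cvP {c = c} {d ∷ C} (here (i , j , i′ , j′ , a , a′ , e , e′)) = i , j , a , ≤-trans (cv-edge H (φ d) i′ j′ a′)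
    (≤-trans (≤-reflexive (cong₂ (cv H (φ d)) (sym e) (sym e′))) (m≤m+n _ _))
  share⇒cvP {c = c} {d ∷ C} (there p) with share⇒cvP {c = c} {C} p
  ... | i , j , a , q = i , j , a , ≤-trans q (m≤n+m _ _)

  cvP⇒share : ∀ {n} (c : Copy H (K n)) (C : List (Copy H (K n))) i j → adj H i j ≡ true → 1 ≤ cvP H (map φ C) (φ c i) (φ c j) → Any (ShareEdge c) C
  cvP⇒share c (d ∷ C) i j a p with 1 ≤? cv H (φ d) (φ c i) (φ c j)
  ... | yes q with cv-wit H (φ d) _ _ q
  ...   | i′ , j′ , a′ , e , e′ = here (i , j , i′ , j′ , a , a′ , sym e , sym e′)
  cvP⇒share c (d ∷ C) i j a p | no ¬q = there (cvP⇒share c C i j a (≤-trans p (≤-reflexive (cong (_+ cvP H (map φ C) (φ c i) (φ c j)) (n≤0⇒n≡0 (≮⇒≥ ¬q))))))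

  saturated⇒maximal : ∀ {n} {C : List (Copy H (K n))} → Packs H (map φ C) → Saturated H (adj (K n)) (map φ C) → IsMaximalPacking C
  saturated⇒maximal {n} {C} pk sat = packing⇐ {C = C} pk , λ c → share c
    where
    share : ∀ c → Any (ShareEdge c) C
    share c with any? (λ i → any? (λ j → bool? (adj H i j) ×-dec (1 ≤? cvP H (map φ C) (φ c i) (φ c j))))
    ... | yes (i , j , a , p) = cvP⇒share c C i j a p
    ... | no none = ⊥-elim (sat (φ c) (λ _ _ → inj c) (λ i j a → ∧⁺ (edges c i j a) (zer (λ p → none (i , j , a , p)))))
      where
      zer : ∀ {k} → ¬ (1 ≤ k) → isZero k ≡ true
      zer {zero} _ = refl
      zer {suc k} p = ⊥-elim (p (s≤s z≤n))

  cl-lower : ∀ {n c e} → IsCl (K n) H c → IsEx n H e → n * n ≤ n + c * e2H H + 2 * e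
  cl-lower {n} {c} {e} ((C , (pk , mx) , refl) , _) (_ , ex) = ≤-trans (≤-reflexive (sym (uncov-count (packing⇒ {C = C} pk))))
    (≤-trans (≤-reflexive (sym (+-assoc n _ _)))
      (+-mono-≤ (≤-reflexive (cong (λ l → n + l * e2H H) (length-map φ C)))
        (≤-trans (≤-reflexive (e2-‖‖ (uncov (map φ C)))) (*-monoʳ-≤ 2 (ex _ hfree)))))
    where
    cK : Copy H (uncov (map φ C)) → Copy H (K n)
    cK c′ = record { φ = φ c′ ; inj = inj c′ ; edges = λ i j a → proj₁ (∧⁻ {adj (K n) (φ c′ i) (φ c′ j)} (edges c′ i j a)) }
    hfree : HFree H (uncov (map φ C))
    hfree c′ with share⇒cvP {c = cK c′} {C} (mx (cK c′))
    ... | i , j , a , p = t≢f (proj₂ (∧⁻ {adj (K n) (φ c′ i) (φ c′ j)} (edges c′ i j a))) (isZero-pos p)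

  cl-trivial : ∀ {n c} → IsCl (K n) H c → n + c * e2H H ≤ n * n
  cl-trivial {n} {c} ((C , (pk , mx) , refl) , _) = ≤-trans (+-monoʳ-≤ n (≤-trans (≤-reflexive (cong (_* e2H H) (sym (length-map φ C)))) (m≤m+n _ _)))
    (≤-reflexive (uncov-count (packing⇒ {C = C} pk)))

  nonL : ∀ {n} → Graph n → Fin n → Fin n → Bool
  nonL {n} L x y = adj (K n) x y ∧ not (adj L x y)

  unc : ∀ {n} → Graph n → List (Fin h → Fin n) → ℕ
  unc L P = e2 (λ x y → nonL L x y ∧ free H P x y)

  -- Every copy added while saturating uses an edge outside L, since L is H-free.
  cl-upper : ∀ {n c} (L : Graph n) → HFree H L → (P : List (Fin h → Fin n)) → Packs H P → All (EdgesIn H (nonL L)) P → 1 ≤ e2H H →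
    IsCl (K n) H c → n + c * e2H H + e2 (adj L) ≤ n * n + e2H H * unc L P
  cl-upper {n} {c} L free-L P pk inL pos (_ , least) with saturate H (adj (K n)) P pos pk
  ... | Q , pk′ , _ , sat with toCopies (proj₁ pk′)
  ... | C , e = begin
      n + c * E + e2 (adj L)                              ≤⟨ +-monoˡ-≤ _ (+-monoʳ-≤ n (*-monoˡ-≤ E c≤)) ⟩
      n + (unc L P + length P) * E + e2 (adj L)           ≡⟨ re n (unc L P) (length P) E (e2 (adj L)) ⟩
      n + (length P * E + e2 (adj L)) + E * unc L P       ≤⟨ +-monoˡ-≤ _ (≤-trans (+-monoʳ-≤ n pl) (≤-reflexive (uncov-count pk))) ⟩
      n * n + E * unc L P ∎
    where
    open ≤-Reasoning
    E = e2H H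
    re : ∀ n u l E x → n + (u + l) * E + x ≡ n + (l * E + x) + E * u
    re = solve-∀
    pl : length P * E + e2 (adj L) ≤ length P * E + e2 (adj (uncov P))
    pl = +-monoʳ-≤ _ (∑-mono (λ x → ∑-mono (λ y → ⟦⟧-mono (λ a → ∧⁺ (K-adj (λ { refl → t≢f a (adj-irrefl L x) })) (fr x y a)))))
      where
      fr : ∀ x y → adj L x y ≡ true → free H P x y ≡ true
      fr x y a with bool-split (free H P x y)
      ... | inj₁ p = p
      ... | inj₂ p = ⊥-elim (bad (cvP-wit H P x y (isZero-false p)) inL)
        where
        bad : ∀ {P} → Any (λ φ → 1 ≤ cv H φ x y) P → All (EdgesIn H (nonL L)) P → ⊥
        bad {f ∷ _} (here q) (r ∷ _) with cv-wit H f x y q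
        ... | i , j , b , refl , refl = t≢f a (not⁻ (proj₂ (∧⁻ {adj (K n) (f i) (f j)} (r i j b))))
        bad (there q) (_ ∷ rs) = bad q rs
    W : Fin n → Fin n → ℕ
    W x y = ⟦ nonL L x y ⟧ * cvP H Q x y
    hit : ∀ f → Inj f → 1 ≤ ∑∑ (λ x y → ⟦ nonL L x y ⟧ * cv H f x y)
    hit f f-inj with any? (λ i → any? (λ j → bool? (adj H i j ∧ not (adj L (f i) (f j)))))
    ... | no none = ⊥-elim (free-L (record { φ = f ; inj = λ {a} {b} → f-inj a b ; edges = λ i j a → inl i j a }))
      where
      inl : ∀ i j → adj H i j ≡ true → adj L (f i) (f j) ≡ true
      inl i j a with bool-split (adj L (f i) (f j))
      ... | inj₁ p = p
      ... | inj₂ p = ⊥-elim (none (i , j , ∧⁺ a (not⁺ p)))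
    ... | yes (i , j , p) with ∧⁻ {adj H i j} p
    ...   | a , nl = ≤-trans (*-mono-≤ (≤-reflexive (sym (⟦⟧-true (∧⁺ (K-adj (λ q → adj-≢ H a (f-inj i j q))) nl)))) (cv-edge H f i j a))
            (≤-trans (∑-term (λ y → ⟦ nonL L (f i) y ⟧ * cv H f (f i) y) (f j)) (∑-term (λ x → ∑ (λ y → ⟦ nonL L x y ⟧ * cv H f x y)) (f i)))
    many : ∀ Q → All Inj Q → length Q ≤ ∑∑ (λ x y → ⟦ nonL L x y ⟧ * cvP H Q x y)
    many [] _ = z≤n
    many (f ∷ Q) (i ∷ is) = ≤-trans (+-mono-≤ (hit f i) (many Q is)) (≤-reflexive (trans (sym (∑-distrib (λ x → ∑ (λ y → ⟦ nonL L x y ⟧ * cv H f x y)) _))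
      (∑-cong (λ x → trans (sym (∑-distrib (λ y → ⟦ nonL L x y ⟧ * cv H f x y) _)) (∑-cong (λ y → sym (*-distribˡ-+ ⟦ nonL L x y ⟧ (cv H f x y) _)))))))
    Q≤ : length Q ≤ unc L P
    Q≤ = ≤-trans (many Q (AllP.++⁻ˡ Q (proj₁ pk′))) (∑-mono (λ x → ∑-mono (λ y → cell (nonL L x y) (cvP H Q x y) (cvP H P x y)
        (≤-trans (≤-reflexive (sym (cvP-++ H Q P x y))) (cvP≤1 H pk′ x y)))))
      where
      cell : ∀ b q p → q + p ≤ 1 → ⟦ b ⟧ * q ≤ ⟦ b ∧ isZero p ⟧
      cell b zero p _ = ≤-trans (≤-reflexive (*-zeroʳ ⟦ b ⟧)) z≤n
      cell true (suc zero) zero _ = ≤-reflexive (*-identityʳ ⟦ true ⟧)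
      cell false (suc zero) zero _ = ≤-reflexive (*-identityʳ ⟦ false ⟧)
      cell b (suc zero) (suc p) (s≤s ())
      cell b (suc (suc q)) p (s≤s ())
    c≤ : c ≤ unc L P + length P
    c≤ = ≤-trans (least C (saturated⇒maximal {C = C} (subst (Packs H) (sym e) pk′) (subst (Saturated H (adj (K n))) (sym e) sat)))
      (≤-trans (≤-reflexive (trans (sym (length-map φ C)) (trans (cong length e) (length-++ Q)))) (+-monoˡ-≤ (length P) Q≤))

-- Congruences and the difference matrix over ℤ_c

module Cong (c : ℕ) where

  infix 4 _≈_

  -- (opaque wrapper, so that the two sides can be inferred)
  record _≈_ (a b : ℤ) : Set where
    constructor mk≈
    field
      quot : ℤ
      eqn : a ≡ b ℤ.+ quot ℤ.* ℤ.+ c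
  open _≈_

  ≈-refl : ∀ {a} → a ≈ a
  ≈-refl {a} = mk≈ (ℤ.+ 0) (sym (ℤP.+-identityʳ a))

  ≡⇒≈ : ∀ {a b} → a ≡ b → a ≈ b
  ≡⇒≈ refl = ≈-refl

  ≈-sym : ∀ {a b} → a ≈ b → b ≈ a
  ≈-sym {a} {b} (mk≈ k refl) = mk≈ (ℤ.- k) (lem b k (ℤ.+ c))
    where
    lem : ∀ b k c → b ≡ (b ℤ.+ k ℤ.* c) ℤ.+ (ℤ.- k) ℤ.* c
    lem = ℤS.solve-∀

  ≈-trans : ∀ {a b d} → a ≈ b → b ≈ d → a ≈ d
  ≈-trans {d = d} (mk≈ k refl) (mk≈ l refl) = mk≈ (l ℤ.+ k) (lem d k l (ℤ.+ c))
    where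
    lem : ∀ d k l c → (d ℤ.+ l ℤ.* c) ℤ.+ k ℤ.* c ≡ d ℤ.+ (l ℤ.+ k) ℤ.* c
    lem = ℤS.solve-∀

  ≈-+ : ∀ {a b a′ b′} → a ≈ a′ → b ≈ b′ → a ℤ.+ b ≈ a′ ℤ.+ b′
  ≈-+ {a′ = a′} {b′} (mk≈ k refl) (mk≈ l refl) = mk≈ (k ℤ.+ l) (lem a′ b′ k l (ℤ.+ c))
    where
    lem : ∀ a b k l c → (a ℤ.+ k ℤ.* c) ℤ.+ (b ℤ.+ l ℤ.* c) ≡ (a ℤ.+ b) ℤ.+ (k ℤ.+ l) ℤ.* c
    lem = ℤS.solve-∀

  ≈-neg : ∀ {a b} → a ≈ b → ℤ.- a ≈ ℤ.- b
  ≈-neg {b = b} (mk≈ k refl) = mk≈ (ℤ.- k) (lem b k (ℤ.+ c))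
    where
    lem : ∀ b k c → ℤ.- (b ℤ.+ k ℤ.* c) ≡ (ℤ.- b) ℤ.+ (ℤ.- k) ℤ.* c
    lem = ℤS.solve-∀

  ≈-- : ∀ {a b a′ b′} → a ≈ a′ → b ≈ b′ → a ℤ.- b ≈ a′ ℤ.- b′
  ≈-- p q = ≈-+ p (≈-neg q)

  cancel-last : ∀ a b z → a ℤ.+ z ≈ b ℤ.+ z → a ≈ b
  cancel-last a b z p = ≈-trans (≡⇒≈ (lem a z)) (≈-trans (≈-- p (≈-refl {z})) (≡⇒≈ (sym (lem b z))))
    where
    lem : ∀ a z → a ≡ (a ℤ.+ z) ℤ.- z
    lem = ℤS.solve-∀

  fin-≈ : (i j : Fin c) → ℤ.+ toℕ i ≈ ℤ.+ toℕ j → i ≡ j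
  fin-≈ i j (mk≈ (ℤ.+ k) e) = toℕ-injective (small k (ℤP.+-injective (trans e (cong (λ z → ℤ.+ toℕ j ℤ.+ z) (sym (ℤP.pos-* k c))))))
    where
    small : ∀ k → toℕ i ≡ toℕ j + k * c → toℕ i ≡ toℕ j
    small zero e = trans e (+-identityʳ _)
    small (suc k) e = ⊥-elim (<⇒≱ (toℕ<n i) (≤-trans (≤-trans (m≤m+n c (k * c)) (m≤n+m _ (toℕ j))) (≤-reflexive (sym e))))
  fin-≈ i j (mk≈ (ℤ.-[1+ k ]) e) = ⊥-elim (<⇒≱ (toℕ<n j) (≤-trans (≤-trans (m≤m+n c (k * c)) (m≤n+m _ (toℕ i))) (≤-reflexive
      (sym (ℤP.+-injective (trans (move {k = ℤ.+ suc k} e) (cong (λ z → ℤ.+ toℕ i ℤ.+ z) (sym (ℤP.pos-* (suc k) c)))))))))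
    where
    move : ∀ {a b k} → a ≡ b ℤ.+ (ℤ.- k) ℤ.* ℤ.+ c → b ≡ a ℤ.+ k ℤ.* ℤ.+ c
    move {b = b} {k} refl = lem b k (ℤ.+ c)
      where
      lem : ∀ b k c → b ≡ (b ℤ.+ (ℤ.- k) ℤ.* c) ℤ.+ k ℤ.* c
      lem = ℤS.solve-∀

  module _ .{{_ : NonZero c}} where
    toMod : ℤ → Fin c
    toMod a = fromℕ< (ℤD.n%ℕd<d a c)

    toMod-≈ : ∀ a b → toMod a ≡ toMod b → a ≈ b
    toMod-≈ a b e = ≈-trans (rep a) (≈-trans (≡⇒≈ (cong ℤ.+_ (trans (sym (toℕ-fromℕ< (ℤD.n%ℕd<d a c))) (trans (cong toℕ e) (toℕ-fromℕ< (ℤD.n%ℕd<d b c)))))) (≈-sym (rep b)))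
      where
      rep : ∀ a → a ≈ ℤ.+ (a ℤD.%ℕ c)
      rep a = mk≈ (a ℤD./ℕ c) (ℤD.a≡a%ℕn+[a/ℕn]*n a c)

  ∑ℤ : ∀ {n} → (Fin n → ℤ) → ℤ
  ∑ℤ {zero} f = ℤ.+ 0
  ∑ℤ {suc n} f = f zero ℤ.+ ∑ℤ (f ∘ suc)

  ∑ℤ-≈ : ∀ {n} {f g : Fin n → ℤ} → (∀ i → f i ≈ g i) → ∑ℤ f ≈ ∑ℤ g
  ∑ℤ-≈ {zero} e = ≈-refl
  ∑ℤ-≈ {suc n} e = ≈-+ (e zero) (∑ℤ-≈ (e ∘ suc))

  ∑ℤ-solve : ∀ {n} {f g : Fin n → ℤ} q → (∀ i → i ≢ q → f i ≈ g i) → ∑ℤ f ≈ ∑ℤ g → f q ≈ g q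
  ∑ℤ-solve {suc n} {f} {g} zero e s = ≈-trans (≡⇒≈ (lem (f zero) (∑ℤ (f ∘ suc)))) (≈-trans (≈-- s (∑ℤ-≈ (λ i → e (suc i) λ ()))) (≡⇒≈ (sym (lem (g zero) (∑ℤ (g ∘ suc))))))
    where
    lem : ∀ a z → a ≡ (a ℤ.+ z) ℤ.- z
    lem = ℤS.solve-∀
  ∑ℤ-solve {suc n} {f} {g} (suc q) e s = ∑ℤ-solve q (λ i i≢ → e (suc i) (i≢ ∘ suc-injective))
    (≈-trans (≡⇒≈ (lem (f zero) (∑ℤ (f ∘ suc)))) (≈-trans (≈-- s (e zero λ ())) (≡⇒≈ (sym (lem (g zero) (∑ℤ (g ∘ suc)))))))
    where
    lem : ∀ a z → z ≡ (a ℤ.+ z) ℤ.- a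
    lem = ℤS.solve-∀

  -- If z(t+i) = z(t+j) cyclically mod N+1 for all but one t, where k = j - i divides N, then z is constant:
  -- the k-step chain of residue r runs from r to N-k+r, and one further step wraps around to r-1.
  module _ (y : ℕ → ℤ) (k e : ℕ) (stepA : ∀ t → t + suc k ≤ suc k * e → y t ≈ y (t + suc k))
           (stepB : ∀ t r → suc r < suc k → t + suc k ≡ suc k * e + suc r → y t ≈ y r) where
    private
      K′ = suc k
    chain : ∀ q r → q * K′ + r ≤ K′ * e → y r ≈ y (q * K′ + r)
    chain zero r _ = ≈-refl
    chain (suc q) r le = ≈-trans (chain q r (≤-trans (+-monoˡ-≤ r (m≤n+m (q * K′) K′)) le))
      (≈-trans (stepA (q * K′ + r) (≤-trans (≤-reflexive (re (q * K′) r K′)) le)) (≡⇒≈ (cong y (re (q * K′) r K′))))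
      where
      re : ∀ a r k → a + r + k ≡ k + a + r
      re = solve-∀
    low : ∀ r → r < K′ → 1 ≤ e → y r ≈ y 0
    low zero _ _ = ≈-refl
    low (suc r) lt (s≤s {n = e′} _) = ≈-trans (chain e′ (suc r) le) (≈-trans (stepB (e′ * K′ + suc r) r lt (re e′ (suc r) K′)) (low r (≤-trans (n≤1+n _) lt) (s≤s z≤n)))
      where
      re : ∀ e r k → e * k + r + k ≡ k * suc e + r
      re = solve-∀
      le : e′ * K′ + suc r ≤ K′ * suc e′
      le = ≤-trans (+-monoʳ-≤ (e′ * K′) (<⇒≤ lt)) (≤-reflexive (re′ e′ K′))
        where
        re′ : ∀ e k → e * k + k ≡ k * suc e
        re′ = solve-∀
    const-chain : ∀ t → t ≤ K′ * e → 1 ≤ e → y t ≈ y 0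
    const-chain t le 1≤e = ≈-trans (≡⇒≈ (cong y eq)) (≈-trans (≈-sym (chain (t / K′) (t % K′) (subst (_≤ K′ * e) eq le))) (low (t % K′) (m%n<n t K′) 1≤e))
      where
      eq : t ≡ t / K′ * K′ + t % K′
      eq = trans (m≡m%n+[m/n]*n t K′) (+-comm (t % K′) _)

  -- shifted windows: coordinates (t + i) mod (N + 1), t < N
  window : ∀ (z : ℕ → ℤ) N i j → i < j → j ≤ N → (j ∸ i) ∣ N → 1 ≤ N →
    (∀ t → t < N → z ((t + i) % suc N) ≈ z ((t + j) % suc N)) → ∀ x → x ≤ N → z x ≈ z 0
  window z N i j i<j j≤N (divides e eq) 1≤N rel x x≤N = ≈-trans (at x x≤N) (≈-sym (at 0 z≤n))
    where
    y : ℕ → ℤ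
    y t = z ((t + i) % suc N)
    k = j ∸ suc i
    k-eq : suc k ≡ j ∸ i
    k-eq = sym (+-∸-assoc 1 i<j)
    N-eq : N ≡ suc k * e
    N-eq = trans eq (trans (*-comm e _) (cong (_* e) (sym k-eq)))
    j-eq : j ≡ suc k + i
    j-eq = trans (sym (m∸n+n≡m (<⇒≤ i<j))) (cong (_+ i) (sym k-eq))
    1≤e : 1 ≤ e
    1≤e = pos e N-eq
      where
      pos : ∀ e → N ≡ suc k * e → 1 ≤ e
      pos zero q = ⊥-elim (1+n≰n (≤-trans 1≤N (≤-reflexive (trans q (*-zeroʳ (suc k))))))
      pos (suc e) _ = s≤s z≤n
    stepA : ∀ t → t + suc k ≤ suc k * e → y t ≈ y (t + suc k)
    stepA t le = ≈-trans (rel t (≤-trans (≤-trans (≤-reflexive (+-comm 1 t)) (+-monoʳ-≤ t (s≤s z≤n))) (≤-trans le (≤-reflexive (sym N-eq)))))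
      (≡⇒≈ (cong (λ w → z (w % suc N)) (trans (cong (t +_) j-eq) (sym (+-assoc t (suc k) i)))))
    stepB : ∀ t r → suc r < suc k → t + suc k ≡ suc k * e + suc r → y t ≈ y r
    stepB t r lt q = ≈-trans (rel t t<N) (≡⇒≈ (cong z (trans (cong (_% suc N) tj) ([m+n]%n≡m%n (r + i) (suc N)))))
      where
      q′ : t + suc k ≡ N + suc r
      q′ = trans q (cong (_+ suc r) (sym N-eq))
      t<N : t < N
      t<N = +-cancelʳ-< (suc k) t N (≤-trans (s≤s (≤-reflexive q′)) (≤-trans (≤-reflexive (sym (+-suc N (suc r)))) (+-monoʳ-≤ N lt)))
      tj : t + j ≡ (r + i) + suc N
      tj = trans (cong (t +_) j-eq) (trans (sym (+-assoc t (suc k) i)) (trans (cong (_+ i) q′) (re N r i)))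
        where
        re : ∀ N r i → N + suc r + i ≡ (r + i) + suc N
        re = solve-∀
    yc : ∀ t → t ≤ N → y t ≈ y 0
    yc t le = const-chain y k e stepA stepB t (≤-trans le (≤-reflexive N-eq)) 1≤e
    at : ∀ x → x ≤ N → z x ≈ y 0
    at x le with x <? i
    ... | no x≮i = ≈-trans (≡⇒≈ (cong z (sym (trans (cong (_% suc N) (m∸n+n≡m (≮⇒≥ x≮i))) (m<n⇒m%n≡m (s≤s le)))))) (yc (x ∸ i) (≤-trans (m∸n≤m x i) le))
    ... | yes x<i = ≈-trans (≡⇒≈ (cong z (sym (trans (cong (_% suc N) (m∸n+n≡m i≤)) (trans ([m+n]%n≡m%n x (suc N)) (m<n⇒m%n≡m (s≤s le))))))) (yc (x + suc N ∸ i) t≤)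
      where
      i≤ : i ≤ x + suc N
      i≤ = ≤-trans (≤-trans (<⇒≤ i<j) (≤-trans j≤N (n≤1+n N))) (m≤n+m (suc N) x)
      t≤ : x + suc N ∸ i ≤ N
      t≤ = ≤-trans (∸-monoʳ-≤ (x + suc N) x<i) (≤-reflexive (trans (cong (_∸ suc x) (trans (+-suc x N) (cong suc (+-comm x N)))) (m+n∸n≡m N x)))

-- Exact H-decompositions of blown-up complete graphs

funToFin-cong : ∀ {m n} {f g : Fin m → Fin n} → f ≗ g → funToFin f ≡ funToFin g
funToFin-cong {zero} e = refl
funToFin-cong {suc m} e = cong₂ combine (e zero) (funToFin-cong (e ∘ suc))

finToFun-inj : ∀ {m n} {i j : Fin (n ^ m)} → finToFun {n} {m} i ≗ finToFun j → i ≡ j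
finToFun-inj {m} {n} {i} {j} e = trans (sym (funToFin-finToFin {m} {n} i)) (trans (funToFin-cong e) (funToFin-finToFin {m} {n} j))

funToFin-inj : ∀ {m n} {f g : Fin m → Fin n} → funToFin f ≡ funToFin g → f ≗ g
funToFin-inj {f = f} {g} e i = trans (sym (finToFun-funToFin f i)) (trans (cong (λ z → finToFun z i) e) (finToFun-funToFin g i))

remQuot-inj : ∀ {m} n {i j : Fin (m * n)} → proj₁ (remQuot {m} n i) ≡ proj₁ (remQuot {m} n j) → proj₂ (remQuot {m} n i) ≡ proj₂ (remQuot {m} n j) → i ≡ j
remQuot-inj {m} n {i} {j} e e′ = trans (sym (combine-remQuot {m} n i)) (trans (cong₂ combine e e′) (combine-remQuot {m} n j))

-- Numbers the templates containing a given pair.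
pre : ∀ {M} → (Fin M → ℕ) → Fin M → ℕ
pre f zero = 0
pre f (suc k) = f zero + pre (f ∘ suc) k

opaque
  unfolding ∑

  pre-< : ∀ {M} (f : Fin M → ℕ) k → 1 ≤ f k → pre f k < ∑ f
  pre-< f zero p = ≤-trans p (m≤m+n _ _)
  pre-< f (suc k) p = ≤-trans (≤-reflexive (sym (+-suc (f zero) _))) (+-monoʳ-≤ (f zero) (pre-< (f ∘ suc) k p))

pre-inj : ∀ {M} (f : Fin M → ℕ) k k′ → 1 ≤ f k → 1 ≤ f k′ → pre f k ≡ pre f k′ → k ≡ k′
pre-inj f zero zero p q e = refl
pre-inj f zero (suc k′) p q e = ⊥-elim (1+n≰n (≤-trans p (≤-trans (m≤m+n _ _) (≤-reflexive (sym e)))))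
pre-inj f (suc k) zero p q e = ⊥-elim (1+n≰n (≤-trans q (≤-trans (m≤m+n _ _) (≤-reflexive e))))
pre-inj f (suc k) (suc k′) p q e = cong suc (pre-inj (f ∘ suc) k k′ p q (+-cancelˡ-≡ (f zero) _ _ e))

module _ {h : ℕ} (H : Graph h) where

  record GDD (g u : ℕ) : Set where
    field
      blocks : List (Fin h → Fin u × Fin g)
      transversal : All (λ f → Inj (proj₁ ∘ f)) blocks
      disjoint : AllPairs (Disj H) blocks
      exact : length blocks * e2H H + u * (g * g) ≡ u * u * (g * g)

  -- From a list of templates covering every pair of [u] exactly c^N times, N = B!.
  -- A vertex is (x , z) with z ∈ (ℤ_c^N)^D, one coordinate for each pair p of [B].
  -- The copies are z_p(t) = b_p(t) + w_p((t + ι_p x) mod (N+1)) + [x = first p] · rank_p, where w_p(0) = 0, ∑_p w_p = 0 and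
  -- ι_p identifies the two points of p: coordinate p of a pair p recovers the template, the other coordinates recover w.
  module Lift (B′ c : ℕ) .{{_ : NonZero c}} (u : ℕ) (u≤B : u ≤ suc B′) {M : ℕ} (tmpl : Fin M → Fin h → Fin u) (tmpl-inj : ∀ k → Inj (tmpl k))
              (cover : ∀ x y → x ≢ y → ∑ (λ k → cv H (tmpl k) x y) ≡ c ^ (suc B′ !)) where
    open Cong c

    B N D′ D S : ℕ
    B = suc B′
    N = B !
    D′ = B′ + B′ * B
    D = suc D′
    S = c ^ N

    Pt : Set
    Pt = Fin D → Fin N → Fin c

    px py : Fin D → Fin B
    px p = proj₁ (remQuot {B} B p)
    py p = proj₂ (remQuot {B} B p)

    up : Fin u → Fin B
    up x = inject≤ x u≤B

    up-inj : ∀ {x y} → up x ≡ up y → x ≡ y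
    up-inj = inject≤-inj u≤B

    merges : Fin D → Fin B → Bool
    merges p g = ⌊ toℕ (px p) <? toℕ (py p) ⌋ ∧ (g == py p)

    ι : Fin D → Fin B → Fin B
    ι p g = if merges p g then px p else g

    ι-yes : ∀ p g → merges p g ≡ true → ι p g ≡ px p
    ι-yes p g e = cong (λ b → if b then px p else g) e

    ι-no : ∀ p g → merges p g ≡ false → ι p g ≡ g
    ι-no p g e = cong (λ b → if b then px p else g) e

    ι-sep : ∀ p g g′ → toℕ g < toℕ g′ → ¬ (px p ≡ g × py p ≡ g′) → ι p g ≢ ι p g′
    ι-sep p g g′ lt np e with bool-split (merges p g) | bool-split (merges p g′)
    ... | inj₂ m | inj₂ m′ = <-irrefl (cong toℕ (trans (sym (ι-no p g m)) (trans e (ι-no p g′ m′)))) lt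
    ... | inj₂ m | inj₁ m′ = np (trans (sym (ι-yes p g′ m′)) (trans (sym e) (ι-no p g m)) , sym (==⇒≡ (proj₂ (∧⁻ {⌊ toℕ (px p) <? toℕ (py p) ⌋} m′))))
    ... | inj₁ m | inj₁ m′ = <-irrefl (cong toℕ (trans (==⇒≡ (proj₂ (∧⁻ {⌊ toℕ (px p) <? toℕ (py p) ⌋} m))) (sym (==⇒≡ (proj₂ (∧⁻ {⌊ toℕ (px p) <? toℕ (py p) ⌋} m′)))))) lt
    ... | inj₁ m | inj₂ m′ with ∧⁻ {⌊ toℕ (px p) <? toℕ (py p) ⌋} m
    ...   | p1 , p2 = <-irrefl refl (<-trans lt (subst₂ (λ a b → toℕ a < toℕ b) (trans (sym (ι-yes p g m)) (trans e (ι-no p g′ m′))) (sym (==⇒≡ p2)) (dec⌊⌋ p1)))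

    ι-same : ∀ p g g′ → toℕ g < toℕ g′ → px p ≡ g → py p ≡ g′ → ι p g ≡ g × ι p g′ ≡ g
    ι-same p g g′ lt refl refl = ι-no p g (¬true⇒ (λ q → <-irrefl (cong toℕ (==⇒≡ (proj₂ (∧⁻ {⌊ toℕ (px p) <? toℕ (py p) ⌋} q)))) lt))
      , ι-yes p g′ (∧⁺ (⌊⌋dec lt) (==-refl g′))

    covB : Fin D → Fin M → ℕ
    covB p k = ∑∑ (λ x y → δ (up x) (px p) * (δ (up y) (py p) * cv H (tmpl k) x y))

    covB-at : ∀ p k x y → up x ≡ px p → up y ≡ py p → covB p k ≡ cv H (tmpl k) x y
    covB-at p k x y ex ey = trans (∑-single _ x (λ x′ x′≢ → ∑-zero (λ y′ → cong (_* (δ (up y′) (py p) * cv H (tmpl k) x′ y′)) (δ-≢ (λ q → x′≢ (up-inj (trans q (sym ex))))))))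
      (trans (∑-single _ y (λ y′ y′≢ → trans (cong (λ z → δ (up x) (px p) * (z * cv H (tmpl k) x y′)) (δ-≢ (λ q → y′≢ (up-inj (trans q (sym ey)))))) (*-zeroʳ (δ (up x) (px p)))))
        (trans (cong₂ (λ a b → a * (b * cv H (tmpl k) x y)) (trans (cong (λ z → δ z (px p)) ex) (δ-refl (px p))) (trans (cong (λ z → δ z (py p)) ey) (δ-refl (py p))))
          (trans (*-identityˡ _) (*-identityˡ _))))

    zeroPt : Fin N → Fin c
    zeroPt t = toMod (ℤ.+ 0)

    enc : ℕ → Fin N → Fin c
    enc r with r <? S
    ... | yes lt = finToFun (fromℕ< lt)
    ... | no _ = zeroPt

    enc-inj : ∀ r r′ → r < S → r′ < S → enc r ≗ enc r′ → r ≡ r′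
    enc-inj r r′ lt lt′ e with r <? S | r′ <? S
    ... | yes q | yes q′ = trans (sym (toℕ-fromℕ< q)) (trans (cong toℕ (finToFun-inj e)) (toℕ-fromℕ< q′))
    ... | no q | _ = ⊥-elim (q lt)
    ... | yes _ | no q = ⊥-elim (q lt′)

    Free : Set
    Free = Fin D′ → Fin N → Fin c

    ext : (Fin N → Fin c) → ℕ → ℤ
    ext f zero = ℤ.+ 0
    ext f (suc t) with t <? N
    ... | yes lt = ℤ.+ toℕ (f (fromℕ< lt))
    ... | no _ = ℤ.+ 0

    ext-cong : ∀ {f g} → f ≗ g → ∀ t → ext f t ≡ ext g t
    ext-cong e zero = refl
    ext-cong e (suc t) with t <? N
    ... | yes lt = cong (λ z → ℤ.+ toℕ z) (e (fromℕ< lt))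
    ... | no _ = refl

    ext-at : ∀ f (t : Fin N) → ext f (suc (toℕ t)) ≡ ℤ.+ toℕ (f t)
    ext-at f t with toℕ t <? N
    ... | yes lt = cong (λ z → ℤ.+ toℕ (f z)) (fromℕ<-toℕ t lt)
    ... | no q = ⊥-elim (q (toℕ<n t))

    W : Free → Fin D → ℕ → ℤ
    W T zero t = ℤ.- ∑ℤ (λ q → ext (T q) t)
    W T (suc q) t = ext (T q) t

    W0 : ∀ T T′ p → W T p 0 ≈ W T′ p 0
    W0 T T′ zero = ≈-neg (∑ℤ-≈ {f = λ q → ext (T q) 0} (λ q → ≈-refl))
    W0 T T′ (suc q) = ≈-refl

    off : Fin M → Fin D → Fin B → Fin N → ℤ
    off k p g t = if g == px p then ℤ.+ toℕ (enc (pre (covB p) k) t) else ℤ.+ 0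

    F : Fin M → Free → Fin D → Fin N → Fin B → ℤ
    F k T p t g = W T p ((toℕ t + toℕ (ι p g)) % suc N) ℤ.+ off k p g t

    coord : Fin M → Free → Pt → Fin u → Pt
    coord k T b x p t = toMod (ℤ.+ toℕ (b p t) ℤ.+ F k T p t (up x))

    vert : Fin M → Free → Pt → Fin u → Fin (S ^ D)
    vert k T b x = funToFin {D} (λ p → funToFin {N} (coord k T b x p))

    vert-≈ : ∀ {k T b x k′ T′ b′} → vert k T b x ≡ vert k′ T′ b′ x → ∀ p t →
      ℤ.+ toℕ (b p t) ℤ.+ F k T p t (up x) ≈ ℤ.+ toℕ (b′ p t) ℤ.+ F k′ T′ p t (up x)
    vert-≈ {k} {T} {b} {x} {k′} {T′} {b′} e p t = toMod-≈ _ _ (funToFin-inj {N} {f = coord k T b x p} {coord k′ T′ b′ x p} (funToFin-inj {D} {f = λ p → funToFin {N} (coord k T b x p)} {λ p → funToFin {N} (coord k′ T′ b′ x p)} e p) t)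

    private
      diff : ∀ b b′ f f′ e e′ → b ℤ.+ f ≈ b′ ℤ.+ f′ → b ℤ.+ e ≈ b′ ℤ.+ e′ → f ℤ.- e ≈ f′ ℤ.- e′
      diff b b′ f f′ e e′ p q = ≈-trans (≡⇒≈ (lem b f e)) (≈-trans (≈-- p q) (≡⇒≈ (sym (lem b′ f′ e′))))
        where
        lem : ∀ b f e → f ℤ.- e ≡ (b ℤ.+ f) ℤ.- (b ℤ.+ e)
        lem = ℤS.solve-∀

    module Share (k k′ : Fin M) (T T′ : Free) (b b′ : Pt) (x y : Fin u) (x<y : toℕ x < toℕ y)
                 (ck : 1 ≤ cv H (tmpl k) x y) (ck′ : 1 ≤ cv H (tmpl k′) x y)
                 (ex : vert k T b x ≡ vert k′ T′ b′ x) (ey : vert k T b y ≡ vert k′ T′ b′ y) where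

      D≈ : ∀ p t → F k T p t (up x) ℤ.- F k T p t (up y) ≈ F k′ T′ p t (up x) ℤ.- F k′ T′ p t (up y)
      D≈ p t = diff (ℤ.+ toℕ (b p t)) (ℤ.+ toℕ (b′ p t)) (F k T p t (up x)) (F k′ T′ p t (up x)) (F k T p t (up y)) (F k′ T′ p t (up y)) (vert-≈ {k} {T} {b} {x} {k′} {T′} {b′} ex p t) (vert-≈ {k} {T} {b} {y} {k′} {T′} {b′} ey p t)

      ux<uy : toℕ (up x) < toℕ (up y)
      ux<uy = subst₂ _<_ (sym (toℕ-inject≤ x u≤B)) (sym (toℕ-inject≤ y u≤B)) x<y

      p0 : Fin D
      p0 = combine {B} {B} (up x) (up y)

      px0 : px p0 ≡ up x
      px0 = cong proj₁ (remQuot-combine {B} {B} (up x) (up y))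

      py0 : py p0 ≡ up y
      py0 = cong proj₂ (remQuot-combine {B} {B} (up x) (up y))

      rank≈ : ∀ t → enc (pre (covB p0) k) t ≡ enc (pre (covB p0) k′) t
      rank≈ t = fin-≈ _ _ (≈-trans (≡⇒≈ (sym (side k T))) (≈-trans (D≈ p0 t) (≡⇒≈ (side k′ T′))))
        where
        side : ∀ k T → F k T p0 t (up x) ℤ.- F k T p0 t (up y) ≡ ℤ.+ toℕ (enc (pre (covB p0) k) t)
        side k T = trans (cong₂ ℤ._-_
            (cong₂ ℤ._+_ (cong (λ z → W T p0 ((toℕ t + toℕ z) % suc N)) (proj₁ (ι-same p0 (up x) (up y) ux<uy px0 py0)))
              (cong (λ b → if b then ℤ.+ toℕ (enc (pre (covB p0) k) t) else ℤ.+ 0) (trans (cong (up x ==_) px0) (==-refl (up x)))))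
            (cong₂ ℤ._+_ (cong (λ z → W T p0 ((toℕ t + toℕ z) % suc N)) (proj₂ (ι-same p0 (up x) (up y) ux<uy px0 py0)))
              (cong (λ b → if b then ℤ.+ toℕ (enc (pre (covB p0) k) t) else ℤ.+ 0) (trans (cong (up y ==_) px0) (==-≢ (λ q → <-irrefl (cong toℕ (sym q)) ux<uy))))))
          (lem (W T p0 ((toℕ t + toℕ (up x)) % suc N)) (ℤ.+ toℕ (enc (pre (covB p0) k) t)))
          where
          lem : ∀ w r → (w ℤ.+ r) ℤ.- (w ℤ.+ ℤ.+ 0) ≡ r
          lem = ℤS.solve-∀

      k≡ : k ≡ k′
      k≡ = pre-inj (covB p0) k k′ (cov+ k ck) (cov+ k′ ck′) (enc-inj _ _ (rank< k ck) (rank< k′ ck′) rank≈)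
        where
        cov+ : ∀ k → 1 ≤ cv H (tmpl k) x y → 1 ≤ covB p0 k
        cov+ k p = ≤-trans p (≤-reflexive (sym (covB-at p0 k x y (sym px0) (sym py0))))
        rank< : ∀ k → 1 ≤ cv H (tmpl k) x y → pre (covB p0) k < S
        rank< k p = ≤-trans (pre-< (covB p0) k (cov+ k p)) (≤-reflexive (trans (∑-cong (λ k → covB-at p0 k x y (sym px0) (sym py0))) (cover x y (λ q → <-irrefl (cong toℕ q) x<y))))

      other : ∀ p → p ≢ p0 → ∀ t → t ≤ N → W T p t ≈ W T′ p t
      other p p≢ t t≤N = subst₂ _≈_ (lem₁ (W T p t) (W T′ p t)) (lem₂ (W T′ p t)) (≈-+ (≈-trans (wind (toℕ i) (toℕ j) (λ q → i≢j (toℕ-injective q)) rel (toℕ<n i) (toℕ<n j) t t≤N) z0) (≈-refl {W T′ p t}))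
        where
        i = ι p (up x)
        j = ι p (up y)
        i≢j : i ≢ j
        i≢j = ι-sep p (up x) (up y) ux<uy λ (q , q′) → p≢ (remQuot-inj {B} B (trans q (sym px0)) (trans q′ (sym py0)))
        z : ℕ → ℤ
        z t = W T p t ℤ.- W T′ p t
        z0 : z 0 ≈ ℤ.+ 0
        z0 = ≈-trans (≈-- (W0 T T′ p) ≈-refl) (≡⇒≈ (ℤP.+-inverseʳ (W T′ p 0)))
        lem₁ : ∀ a b → (a ℤ.- b) ℤ.+ b ≡ a
        lem₁ = ℤS.solve-∀
        lem₂ : ∀ b → ℤ.+ 0 ℤ.+ b ≡ b
        lem₂ = ℤS.solve-∀
        rel : ∀ t → t < N → z ((t + toℕ i) % suc N) ≈ z ((t + toℕ j) % suc N)
        rel t lt = subst (λ t → z ((t + toℕ i) % suc N) ≈ z ((t + toℕ j) % suc N)) (toℕ-fromℕ< lt) (core (fromℕ< lt))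
          where
          core : ∀ t → z ((toℕ t + toℕ i) % suc N) ≈ z ((toℕ t + toℕ j) % suc N)
          core t = move (W T p ((toℕ t + toℕ i) % suc N)) (W T p ((toℕ t + toℕ j) % suc N)) (W T′ p ((toℕ t + toℕ i) % suc N)) (W T′ p ((toℕ t + toℕ j) % suc N)) (off k p (up x) t) (off k p (up y) t) (subst (λ k″ → F k T p t (up x) ℤ.- F k T p t (up y) ≈ F k″ T′ p t (up x) ℤ.- F k″ T′ p t (up y)) (sym k≡) (D≈ p t))
            where
            move : ∀ a b a′ b′ o o′ → (a ℤ.+ o) ℤ.- (b ℤ.+ o′) ≈ (a′ ℤ.+ o) ℤ.- (b′ ℤ.+ o′) → a ℤ.- a′ ≈ b ℤ.- b′
            move a b a′ b′ o o′ p = ≈-trans (≡⇒≈ (m₁ a b a′ o o′)) (≈-trans (≈-+ p (≈-refl {(b ℤ.+ o′) ℤ.- (a′ ℤ.+ o)})) (≡⇒≈ (m₂ a′ b b′ o o′)))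
              where
              m₁ : ∀ a b a′ o o′ → a ℤ.- a′ ≡ ((a ℤ.+ o) ℤ.- (b ℤ.+ o′)) ℤ.+ ((b ℤ.+ o′) ℤ.- (a′ ℤ.+ o))
              m₁ = ℤS.solve-∀
              m₂ : ∀ a′ b b′ o o′ → ((a′ ℤ.+ o) ℤ.- (b′ ℤ.+ o′)) ℤ.+ ((b ℤ.+ o′) ℤ.- (a′ ℤ.+ o)) ≡ b ℤ.- b′
              m₂ = ℤS.solve-∀
        1≤N : 1 ≤ N
        1≤N = 1≤n! B
        B≤N : B ≤ N
        B≤N = ≤-trans (≤-reflexive (sym (*-identityʳ B))) (*-monoʳ-≤ B (1≤n! B′))
        dv : ∀ i j → i < j → j < B → (j ∸ i) ∣ N
        dv i j i<j j<B with j ∸ i | m<n⇒0<n∸m i<j | m∸n≤m j i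
        ... | suc d | _ | le = ∣-trans (m∣m*n (d !)) (m≤n⇒m!∣n! (≤-trans le (<⇒≤ j<B)))
        wind : ∀ i j → i ≢ j → (∀ t → t < N → z ((t + i) % suc N) ≈ z ((t + j) % suc N)) → i < B → j < B → ∀ x → x ≤ N → z x ≈ z 0
        wind i j ne rel i< j< with <-cmp i j
        ... | tri< lt _ _ = window z N i j lt (≤-trans (<⇒≤ j<) B≤N) (dv i j lt j<) 1≤N rel
        ... | tri≈ _ e _ = ⊥-elim (ne e)
        ... | tri> _ _ gt = window z N j i gt (≤-trans (<⇒≤ i<) B≤N) (dv j i gt i<) 1≤N (λ t lt → ≈-sym (rel t lt))

      T-ext : ∀ q → suc q ≢ p0 → T q ≗ T′ q
      T-ext q ne t = fin-≈ _ _ (subst₂ _≈_ (ext-at (T q) t) (ext-at (T′ q) t) (other (suc q) ne (suc (toℕ t)) (toℕ<n t)))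

      T≡ : ∀ q → T q ≗ T′ q
      T≡ q t with suc q ≟ p0
      ... | no ne = T-ext q ne t
      ... | yes e = fin-≈ _ _ (subst₂ _≈_ (ext-at (T q) t) (ext-at (T′ q) t) (∑ℤ-solve {f = λ q → ext (T q) (suc (toℕ t))} {λ q → ext (T′ q) (suc (toℕ t))} q
          (λ i i≢q → other (suc i) (λ w → i≢q (suc-injective (trans w (sym e)))) (suc (toℕ t)) (toℕ<n t))
          (subst₂ _≈_ (ℤP.neg-involutive _) (ℤP.neg-involutive _) (≈-neg (other zero (λ w → 0≢ (trans w (sym e))) (suc (toℕ t)) (toℕ<n t))))))
        where
        0≢ : ∀ {n} {q : Fin n} → Fin.zero ≢ suc q
        0≢ ()

      W≡ : ∀ p t → W T p t ≈ W T′ p t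
      W≡ zero t = ≈-neg (∑ℤ-≈ (λ q → ≡⇒≈ (ext-cong (T≡ q) t)))
      W≡ (suc q) t = ≡⇒≈ (ext-cong (T≡ q) t)

      b≡ : ∀ p t → b p t ≡ b′ p t
      b≡ p t = fin-≈ _ _ (cancel-last _ _ (F k T p t (up x)) (≈-trans (vert-≈ {k} {T} {b} {x} {k′} {T′} {b′} ex p t)
        (≈-+ (≈-refl {ℤ.+ toℕ (b′ p t)}) (≈-+ (≈-sym (W≡ p _)) (≡⇒≈ (cong (λ k → off k p (up x) t) (sym k≡)))))))

    Index : ℕ
    Index = M * (S ^ D′ * S ^ D)

    tmplOf : Fin Index → Fin M
    tmplOf i = proj₁ (remQuot {M} (S ^ D′ * S ^ D) i)

    rest : Fin Index → Fin (S ^ D′ * S ^ D)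
    rest i = proj₂ (remQuot {M} (S ^ D′ * S ^ D) i)

    freeOf : Fin Index → Free
    freeOf i q = finToFun (finToFun {S} {D′} (proj₁ (remQuot {S ^ D′} (S ^ D) (rest i))) q)

    baseOf : Fin Index → Pt
    baseOf i q = finToFun (finToFun {S} {D} (proj₂ (remQuot {S ^ D′} (S ^ D) (rest i))) q)

    copy : Fin Index → Fin h → Fin u × Fin (S ^ D)
    copy i v = tmpl (tmplOf i) v , vert (tmplOf i) (freeOf i) (baseOf i) (tmpl (tmplOf i) v)

    copy-disj : ∀ {i j} → i ≢ j → Disj H (copy i) (copy j)
    copy-disj {i} {j} i≢j v w v′ w′ a a′ e e′ = by-order (<-cmp (toℕ (tmpl (tmplOf i) v)) (toℕ (tmpl (tmplOf i) w)))
      where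
      conclude : ∀ v w v′ w′ → adj H v w ≡ true → adj H v′ w′ ≡ true → copy i v ≡ copy j v′ → copy i w ≡ copy j w′ →
        toℕ (tmpl (tmplOf i) v) < toℕ (tmpl (tmplOf i) w) → ⊥
      conclude v w v′ w′ a a′ e e′ lt = i≢j (remQuot-inj {M} _ k≡ (remQuot-inj {S ^ D′} _
          (finToFun-inj {D′} {S} (λ q → finToFun-inj {N} {c} (T≡ q))) (finToFun-inj {D} {S} (λ q → finToFun-inj {N} {c} (b≡ q)))))
        where
        ev = cong proj₁ e
        ew = cong proj₁ e′
        open Share (tmplOf i) (tmplOf j) (freeOf i) (freeOf j) (baseOf i) (baseOf j) (tmpl (tmplOf i) v) (tmpl (tmplOf i) w) lt
          (cv-edge H (tmpl (tmplOf i)) v w a)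
          (≤-trans (cv-edge H (tmpl (tmplOf j)) v′ w′ a′) (≤-reflexive (cong₂ (cv H (tmpl (tmplOf j))) (sym ev) (sym ew))))
          (trans (cong proj₂ e) (cong (vert (tmplOf j) (freeOf j) (baseOf j)) (sym ev)))
          (trans (cong proj₂ e′) (cong (vert (tmplOf j) (freeOf j) (baseOf j)) (sym ew)))
      by-order : Tri (toℕ (tmpl (tmplOf i) v) < toℕ (tmpl (tmplOf i) w)) (toℕ (tmpl (tmplOf i) v) ≡ toℕ (tmpl (tmplOf i) w)) (toℕ (tmpl (tmplOf i) v) > toℕ (tmpl (tmplOf i) w)) → ⊥
      by-order (tri< lt _ _) = conclude v w v′ w′ a a′ e e′ lt
      by-order (tri≈ _ q _) = adj-≢ H a (tmpl-inj (tmplOf i) v w (toℕ-injective q))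
      by-order (tri> _ _ gt) = conclude w v w′ v′ (trans (adj-sym H w v) a) (trans (adj-sym H w′ v′) a′) e′ e gt

    lifted : GDD (S ^ D) u
    lifted = record
      { blocks = tabulate copy
      ; transversal = AllP.tabulate⁺ (λ i → tmpl-inj (tmplOf i))
      ; disjoint = APP.tabulate⁺ copy-disj
      ; exact = trans (cong (λ l → l * e2H H + u * (G * G)) (length-tabulate copy)) (trans (re M (S ^ D′) S (e2H H) u)
          (trans (cong (_* (S * S ^ D′ * S ^ D′)) count) (re′ u S (S ^ D′)))) }
      where
      G = S ^ D
      re : ∀ m a s e u → m * (a * (s * a)) * e + u * ((s * a) * (s * a)) ≡ (m * e + u * s) * (s * a * a)
      re = solve-∀
      re′ : ∀ u s a → (u * u * s) * (s * a * a) ≡ u * u * ((s * a) * (s * a))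
      re′ = solve-∀
      cell : ∀ x y → ∑ (λ k → cv H (tmpl k) x y) + δ x y * S ≡ S
      cell x y = by (x ≟ y)
        where
        by : Dec (x ≡ y) → ∑ (λ k → cv H (tmpl k) x y) + δ x y * S ≡ S
        by (yes refl) = trans (cong (_+ δ x x * S) (∑-zero (λ k → cv-diag H (tmpl k) (tmpl-inj k) x))) (trans (cong (_* S) (δ-refl x)) (*-identityˡ S))
        by (no ne) = trans (cong₂ _+_ (cover x y ne) (cong (_* S) (δ-≢ ne))) (+-identityʳ S)
      count : M * e2H H + u * S ≡ u * u * S
      count = begin
        M * e2H H + u * S                                                       ≡⟨ cong₂ _+_ (sym (trans (∑-cong (λ k → cv-total H (tmpl k))) (∑-const {M} (e2H H)))) (sym (trans (∑-cong {u} (λ x → trans (∑-*ʳ (δ x) S) (trans (cong (_* S) (∑-δ1 x)) (*-identityˡ S)))) (∑-const {u} S))) ⟩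
        ∑ (λ k → ∑∑ (cv H (tmpl k))) + ∑∑ (λ x y → δ {u} x y * S)                ≡⟨ cong (_+ ∑∑ (λ x y → δ {u} x y * S)) (trans (∑-swap (λ k x → ∑ (cv H (tmpl k) x))) (∑-cong (λ x → ∑-swap (λ k y → cv H (tmpl k) x y)))) ⟩
        ∑∑ (λ x y → ∑ (λ k → cv H (tmpl k) x y)) + ∑∑ (λ x y → δ {u} x y * S)    ≡⟨ sym (trans (∑-cong (λ x → ∑-distrib (λ y → ∑ (λ k → cv H (tmpl k) x y)) _)) (∑-distrib _ _)) ⟩
        ∑∑ (λ x y → ∑ (λ k → cv H (tmpl k) x y) + δ {u} x y * S)                 ≡⟨ ∑-cong (λ x → trans (∑-cong (cell x)) (∑-const {u} S)) ⟩
        ∑ {u} (λ x → u * S)                                                     ≡⟨ trans (∑-const {u} (u * S)) (sym (*-assoc u u S)) ⟩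
        u * u * S ∎
        where open ≡-Reasoning

-- The list of all injections covers every pair of points equally often

swap : ∀ {u} → Fin u → Fin u → Fin u → Fin u
swap x y i = if i == x then y else (if i == y then x else i)

swap-x : ∀ {u} (x y : Fin u) → swap x y x ≡ y
swap-x x y = cong (λ b → if b then y else (if x == y then x else x)) (==-refl x)

swap-y : ∀ {u} (x y : Fin u) → swap x y y ≡ x
swap-y x y with bool-split (y == x)
... | inj₁ p = trans (cong (λ b → if b then y else (if y == y then x else y)) p) (==⇒≡ p)
... | inj₂ p = trans (cong (λ b → if b then y else (if y == y then x else y)) p) (cong (λ b → if b then x else y) (==-refl y))

swap-o : ∀ {u} (x y i : Fin u) → i ≢ x → i ≢ y → swap x y i ≡ i
swap-o x y i p q = trans (cong (λ b → if b then y else (if i == y then x else i)) (==-≢ p)) (cong (λ b → if b then x else i) (==-≢ q))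

swap-invol : ∀ {u} (x y i : Fin u) → swap x y (swap x y i) ≡ i
swap-invol x y i = by (i ≟ x) (i ≟ y)
  where
  by : Dec (i ≡ x) → Dec (i ≡ y) → swap x y (swap x y i) ≡ i
  by (yes refl) _ = trans (cong (swap x y) (swap-x x y)) (swap-y x y)
  by (no _) (yes refl) = trans (cong (swap x y) (swap-y x y)) (swap-x x y)
  by (no p) (no q) = trans (cong (swap x y) (swap-o x y i p q)) (swap-o x y i p q)

swap-inj : ∀ {u} (x y : Fin u) {i j} → swap x y i ≡ swap x y j → i ≡ j
swap-inj x y {i} {j} e = trans (sym (swap-invol x y i)) (trans (cong (swap x y) e) (swap-invol x y j))

∑-swapIndex : ∀ {u} (x y : Fin u) (g : Fin u → ℕ) → ∑ (g ∘ swap x y) ≡ ∑ g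
∑-swapIndex x y g = ≤-antisym (∑-inj (swap x y) (swap-inj x y) g)
  (≤-trans (≤-reflexive (∑-cong (λ i → cong g (sym (swap-invol x y i))))) (∑-inj (swap x y) (swap-inj x y) (g ∘ swap x y)))

infixr 5 _◂_
_◂_ : ∀ {h} {A : Set} → A → (Fin h → A) → Fin (suc h) → A
(x ◂ f) zero = x
(x ◂ f) (suc i) = f i

◂-eta : ∀ {h} {A : Set} (f : Fin (suc h) → A) → f ≗ (f zero ◂ (f ∘ suc))
◂-eta f zero = refl
◂-eta f (suc i) = refl

allFuns : ∀ h u → List (Fin h → Fin u)
allFuns zero u = (λ ()) ∷ []
allFuns (suc h) u = concat (tabulate (λ x → map (x ◂_) (allFuns h u)))

listSum-map : ∀ {A B : Set} (F : B → ℕ) (f : A → B) xs → listSum F (map f xs) ≡ listSum (F ∘ f) xs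
listSum-map F f [] = refl
listSum-map F f (x ∷ xs) = cong (F (f x) +_) (listSum-map F f xs)

Ext : ∀ {h u} → ((Fin h → Fin u) → ℕ) → Set
Ext F = ∀ {φ ψ} → φ ≗ ψ → F φ ≡ F ψ

allFuns-suc : ∀ h u (F : (Fin (suc h) → Fin u) → ℕ) → listSum F (allFuns (suc h) u) ≡ ∑ (λ x → listSum (λ f → F (x ◂ f)) (allFuns h u))
allFuns-suc h u F = trans (listSum-concat-tab F (λ x → map (x ◂_) (allFuns h u))) (∑-cong (λ x → listSum-map F (x ◂_) (allFuns h u)))

allFuns-post : ∀ h {u} (x y : Fin u) (F : (Fin h → Fin u) → ℕ) → Ext F → listSum (λ f → F (swap x y ∘ f)) (allFuns h u) ≡ listSum F (allFuns h u)
allFuns-post zero x y F ext = cong (_+ 0) (ext λ ())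
allFuns-post (suc h) {u} x y F ext = trans (allFuns-suc h u _) (trans
  (∑-cong (λ z → trans (listSum-cong (λ f → ext (λ { zero → refl ; (suc i) → refl })) (allFuns h u))
    (allFuns-post h x y (λ f → F (swap x y z ◂ f)) (λ e → ext (λ { zero → refl ; (suc i) → e i })))))
  (trans (∑-swapIndex x y (λ z → listSum (λ f → F (z ◂ f)) (allFuns h u))) (sym (allFuns-suc h u F))))

allFuns-term : ∀ h {u} (F : (Fin h → Fin u) → ℕ) → Ext F → ∀ φ → F φ ≤ listSum F (allFuns h u)
allFuns-term zero F ext φ = ≤-trans (≤-reflexive (ext λ ())) (m≤m+n _ _)
allFuns-term (suc h) {u} F ext φ = ≤-trans (≤-reflexive (ext (◂-eta φ)))
  (≤-trans (allFuns-term h (λ f → F (φ zero ◂ f)) (λ e → ext (λ { zero → refl ; (suc i) → e i })) (φ ∘ suc))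
    (≤-trans (∑-term (λ x → listSum (λ f → F (x ◂ f)) (allFuns h u)) (φ zero)) (≤-reflexive (sym (allFuns-suc h u F)))))

listSum-filter : ∀ {A : Set} {P : A → Set} (P? : ∀ a → Dec (P a)) (F : A → ℕ) xs → listSum F (filter P? xs) ≡ listSum (λ a → ⟦ ⌊ P? a ⌋ ⟧ * F a) xs
listSum-filter P? F [] = refl
listSum-filter P? F (x ∷ xs) with P? x
... | yes p = cong₂ _+_ (sym (trans (cong (_* F x) (⟦⟧-true refl)) (*-identityˡ (F x)))) (listSum-filter P? F xs)
... | no _ = trans (listSum-filter P? F xs) (cong (_+ listSum (λ a → ⟦ ⌊ P? a ⌋ ⟧ * F a) xs) (sym (cong (_* F x) (⟦⟧-false refl))))

δ-inj : ∀ {m n} (f : Fin m → Fin n) → (∀ {i j} → f i ≡ f j → i ≡ j) → ∀ i j → δ (f i) (f j) ≡ δ i j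
δ-inj f f-inj i j = cong ⟦_⟧ (bool-ext (λ p → ⌊⌋dec (f-inj (==⇒≡ p))) (λ p → ⌊⌋dec (cong f (==⇒≡ p))))

module _ {h : ℕ} (H : Graph h) where

  pairCount : ∀ {u} → Fin u → Fin u → (Fin h → Fin u) → ℕ
  pairCount x y φ = ⟦ ⌊ inj? φ ⌋ ⟧ * cv H φ x y

  pairCount-ext : ∀ {u} (x y : Fin u) → Ext (pairCount x y)
  pairCount-ext x y {φ} {ψ} e = cong₂ _*_ (cong ⟦_⟧ (bool-ext (λ p → ⌊⌋dec (tr e (dec⌊⌋ p))) (λ p → ⌊⌋dec (tr (sym ∘ e) (dec⌊⌋ p)))))
    (∑-cong (λ i → ∑-cong (λ j → cong₂ (λ a b → ⟦ adj H i j ⟧ * (δ a x * δ b y)) (e i) (e j))))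
    where
    tr : ∀ {φ ψ : Fin h → Fin _} → φ ≗ ψ → Inj φ → Inj ψ
    tr e i a b q = i a b (trans (e a) (trans q (sym (e b))))

  injections : ∀ u → List (Fin h → Fin u)
  injections u = filter inj? (allFuns h u)

  coverage : ∀ {u} → Fin u → Fin u → ℕ
  coverage {u} x y = cvP H (injections u) x y

  coverage-sum : ∀ {u} (x y : Fin u) → coverage x y ≡ listSum (pairCount x y) (allFuns h u)
  coverage-sum {u} x y = listSum-filter inj? (λ f → cv H f x y) (allFuns h u)

  coverage-swap : ∀ {u} (a b x y : Fin u) → coverage (swap a b x) (swap a b y) ≡ coverage x y
  coverage-swap {u} a b x y = trans (coverage-sum _ _) (trans (sym (allFuns-post h a b (pairCount (swap a b x) (swap a b y)) (pairCount-ext _ _)))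
    (trans (listSum-cong eq (allFuns h u)) (sym (coverage-sum x y))))
    where
    eq : ∀ φ → pairCount (swap a b x) (swap a b y) (swap a b ∘ φ) ≡ pairCount x y φ
    eq φ = cong₂ _*_ (cong ⟦_⟧ (bool-ext (λ p → ⌊⌋dec (λ i j e → dec⌊⌋ p i j (cong (swap a b) e))) (λ p → ⌊⌋dec (λ i j e → dec⌊⌋ {d = inj? φ} p i j (swap-inj a b e)))))
      (∑-cong (λ i → ∑-cong (λ j → cong₂ (λ p q → ⟦ adj H i j ⟧ * (p * q)) (δ-inj (swap a b) (swap-inj a b) (φ i) x) (δ-inj (swap a b) (swap-inj a b) (φ j) y))))

  coverage-move : ∀ {u} (x x′ y : Fin u) → x ≢ y → x′ ≢ y → coverage x y ≡ coverage x′ y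
  coverage-move x x′ y p q = trans (sym (coverage-swap x x′ x y)) (cong₂ coverage (swap-x x x′) (swap-o x x′ y (p ∘ sym) (q ∘ sym)))

  coverage-sym : ∀ {u} (x y : Fin u) → coverage x y ≡ coverage y x
  coverage-sym {u} x y = cvP-sym H (injections u) x y

  coverage-const : ∀ {u} (x y x′ y′ : Fin u) → x ≢ y → x′ ≢ y′ → coverage x y ≡ coverage x′ y′
  coverage-const x y x′ y′ p q with x′ ≟ y
  ... | no r = trans (coverage-move x x′ y p r) (trans (coverage-sym x′ y) (trans (coverage-move y y′ x′ (r ∘ sym) (q ∘ sym)) (coverage-sym y′ x′)))
  ... | yes refl = trans (coverage-sym x x′) (trans (coverage-move2) (refl))
    where
    coverage-move2 : coverage x′ x ≡ coverage x′ y′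
    coverage-move2 = trans (coverage-sym x′ x) (trans (coverage-move x y′ x′ p (q ∘ sym)) (coverage-sym y′ x′))

  edge-of : 1 ≤ e2H H → ∃ λ i → ∃ λ j → adj H i j ≡ true
  edge-of pos with ∑-pos _ pos
  ... | i , p with ∑-pos _ p
  ... | j , q = i , j , ⟦⟧⇒ q

  coverage-all : ∀ u → h ≤ u → 1 ≤ e2H H → ∃ λ c → 1 ≤ c × (∀ (x y : Fin u) → x ≢ y → coverage x y ≡ c)
  coverage-all u h≤u pos with edge-of pos
  ... | i , j , a = coverage (f i) (f j) , ≤-trans (*-mono-≤ (≤-reflexive (sym (⟦⟧-true (⌊⌋dec f-inj)))) (cv-edge H f i j a))
      (≤-trans (allFuns-term h (pairCount (f i) (f j)) (pairCount-ext _ _) f) (≤-reflexive (sym (coverage-sum (f i) (f j)))))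
      , λ x y x≢y → coverage-const x y (f i) (f j) x≢y (λ e → adj-≢ H a (f-inj i j e))
    where
    f : Fin h → Fin u
    f v = inject≤ v h≤u
    f-inj : Inj f
    f-inj a b e = inject≤-inj h≤u e

  private
    rep : ∀ {A : Set} → ℕ → List A → List A
    rep zero xs = []
    rep (suc q) xs = xs ++ rep q xs

    rep-sum : ∀ {A : Set} (f : A → ℕ) q xs → listSum f (rep q xs) ≡ q * listSum f xs
    rep-sum f zero xs = refl
    rep-sum f (suc q) xs = trans (listSum-++ f xs (rep q xs)) (cong (listSum f xs +_) (rep-sum f q xs))

    rep-all : ∀ {A : Set} {P : A → Set} q {xs : List A} → All P xs → All P (rep q xs)
    rep-all zero p = []
    rep-all (suc q) p = AllP.++⁺ p (rep-all q p)

  all-lookup : ∀ {A : Set} {P : A → Set} {xs : List A} → All P xs → ∀ k → P (lookup xs k)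
  all-lookup (p ∷ _) zero = p
  all-lookup (_ ∷ ps) (suc k) = all-lookup ps k

  listSum-lookup : ∀ {A : Set} (f : A → ℕ) xs → ∑ (λ k → f (lookup xs k)) ≡ listSum f xs
  listSum-lookup f [] = ∑-zero {0} (λ ())
  listSum-lookup f (x ∷ xs) = trans (∑-suc (λ k → f (lookup (x ∷ xs) k))) (cong (f x +_) (listSum-lookup f xs))

  base : ∀ B′ u c (u≤B : u ≤ suc B′) → h ≤ u → 1 ≤ e2H H → .{{_ : NonZero c}} → (∀ l → (∀ (x y : Fin u) → x ≢ y → coverage x y ≡ l) → 1 ≤ l → l ∣ c) → GDD H ((c ^ (suc B′ !)) ^ (suc B′ * suc B′)) u
  base B′ u c u≤B h≤u pos dv with coverage-all u h≤u pos
  ... | l , l≥1 , cov with dv l cov l≥1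
  ... | divides q c≡ql = Lift.lifted H B′ c u u≤B (lookup T) (λ k → all-lookup Tinj k)
      (λ x y x≢y → trans (listSum-lookup (λ φ → cv H φ x y) T) (trans (rep-sum (λ φ → cv H φ x y) r (injections u)) (trans (cong (r *_) (cov x y x≢y)) eq)))
    where
    N = suc B′ !
    r = q * c ^ (N ∸ 1)
    T = rep r (injections u)
    Tinj = rep-all r (AllP.all-filter inj? (allFuns h u))
    eq : r * l ≡ c ^ N
    eq = trans (re q l (c ^ (N ∸ 1))) (trans (cong (_* c ^ (N ∸ 1)) (sym c≡ql)) (cong (c ^_) (m+[n∸m]≡n (1≤n! (suc B′)))))
      where
      re : ∀ q l x → q * x * l ≡ q * l * x
      re = solve-∀

-- Pairwise balanced designs and the packing theorem for complete graphs

module _ {h : ℕ} (H : Graph h) where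

  record Block (g : ℕ) (X : Set) : Set where
    constructor block
    field
      size : ℕ
      at : Fin size → X
      at-inj : Inj at
      gdd : GDD H g size
  open Block

  Meet : ∀ {g X} → Block g X → Block g X → Set
  Meet b c = ∀ i i′ j j′ → i ≢ i′ → at b i ≡ at c j → at b i′ ≡ at c j′ → ⊥

  push : ∀ {g X} (u : ℕ) → (X → Fin u) → Block g X → List (Fin h → Fin u × Fin g)
  push u enc b = map (λ f v → enc (at b (proj₁ (f v))) , proj₂ (f v)) (GDD.blocks (gdd b))

  pbd : ∀ {g u X} (enc : X → Fin u) → (∀ x y → enc x ≡ enc y → x ≡ y) → (L : List (Block g X)) → AllPairs Meet L →
    listSum (λ b → size b * size b) L + u ≡ u * u + listSum size L → GDD H g u
  pbd {g} {u} {X} enc enc-inj L meet count = record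
    { blocks = concat (map (push u enc) L)
    ; transversal = AllP.concat⁺ {xss = map (push u enc) L} (AllP.map⁺ (All.tabulate (λ {b} _ → trans-b b)))
    ; disjoint = APP.concat⁺ (AllP.map⁺ (All.tabulate (λ {b} _ → APP.map⁺ (AP.map (λ {f} {f′} d → inner b f f′ d) (GDD.disjoint (gdd b))))))
        (APP.map⁺ (AP.map (λ {b} {c} m → cross b c m) meet))
    ; exact = fin (length (concat (map (push u enc) L)) * e2H H) (total L) }
    where
    trans-b : ∀ b → All (λ f → Inj (proj₁ ∘ f)) (push u enc b)
    trans-b b = AllP.map⁺ (All.map (λ t i j e → t i j (at-inj b _ _ (enc-inj _ _ e))) (GDD.transversal (gdd b)))
    inner : ∀ b f f′ → Disj H f f′ → Disj H (λ v → enc (at b (proj₁ (f v))) , proj₂ (f v)) (λ v → enc (at b (proj₁ (f′ v))) , proj₂ (f′ v))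
    inner b f f′ d i j i′ j′ a a′ e e′ = d i j i′ j′ a a′ (back e) (back e′)
      where
      back : ∀ {i i′} → (enc (at b (proj₁ (f i))) , proj₂ (f i)) ≡ (enc (at b (proj₁ (f′ i′))) , proj₂ (f′ i′)) → f i ≡ f′ i′
      back e = cong₂ _,_ (at-inj b _ _ (enc-inj _ _ (cong proj₁ e))) (cong proj₂ e)
    cross : ∀ b c → Meet b c → All (λ f → All (Disj H f) (push u enc c)) (push u enc b)
    cross b c m = AllP.map⁺ (All.map (λ {f} t → AllP.map⁺ (All.tabulate (λ {f′} _ i j i′ j′ a a′ e e′ →
      m _ _ _ _ (λ q → adj-≢ H a (t i j q)) (enc-inj _ _ (cong proj₁ e)) (enc-inj _ _ (cong proj₁ e′))))) (GDD.transversal (gdd b)))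
    total : ∀ L → length (concat (map (push u enc) L)) * e2H H + listSum size L * (g * g) ≡ listSum (λ b → size b * size b) L * (g * g)
    total [] = refl
    total (b ∷ L) = trans (cong (λ l → l * e2H H + (size b + listSum size L) * (g * g)) (trans (length-++ (push u enc b)) (cong (_+ length (concat (map (push u enc) L))) (length-map _ (GDD.blocks (gdd b))))))
      (trans (re (length (GDD.blocks (gdd b))) _ (e2H H) (size b) (listSum size L) (g * g)) (trans (cong₂ _+_ (GDD.exact (gdd b)) (total L)) (sym (*-distribʳ-+ (g * g) (size b * size b) _))))
      where
      re : ∀ a l e s t q → (a + l) * e + (s + t) * q ≡ (a * e + s * q) + (l * e + t * q)
      re = solve-∀
    fin : ∀ e → e + listSum size L * (g * g) ≡ listSum (λ b → size b * size b) L * (g * g) → e + u * (g * g) ≡ u * u * (g * g)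
    fin e p = +-cancelʳ-≡ (listSum size L * (g * g)) _ _ (trans (r1 e u (g * g) (listSum size L)) (trans (cong (_+ u * (g * g)) p)
      (trans (sym (*-distribʳ-+ (g * g) (listSum (λ b → size b * size b) L) u)) (trans (cong (_* (g * g)) count) (*-distribʳ-+ (g * g) (u * u) _)))))
      where
      r1 : ∀ e u q s → e + u * q + s * q ≡ e + s * q + u * q
      r1 = solve-∀

-- A truncated transversal design: lines of ℤ_t × [h], t ≡ 1 mod h!, with the slopes below s as additional points.
module Truncated (h q s : ℕ) where

  t : ℕ
  t = suc (h ! * q)

  Pt : Set
  Pt = (Fin h × Fin t) ⊎ Fin s

  On : Fin t → Fin t → Pt → Set
  On a b (inj₁ (i , x)) = toℕ x ≡ (toℕ a * toℕ i + toℕ b) % t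
  On a b (inj₂ w) = toℕ w ≡ toℕ a

  open Cong t

  %⇒≈ : ∀ {x y} → x % t ≡ y % t → ℤ.+ x ≈ ℤ.+ y
  %⇒≈ {x} {y} e = ≈-trans (rep x) (≈-trans (≡⇒≈ (cong ℤ.+_ e)) (≈-sym (rep y)))
    where
    rep : ∀ x → ℤ.+ x ≈ ℤ.+ (x % t)
    rep x = mk≈ (ℤ.+ (x / t)) (trans (cong ℤ.+_ (m≡m%n+[m/n]*n x t)) (cong (λ z → ℤ.+ (x % t) ℤ.+ z) (ℤP.pos-* (x / t) t)))

  ≈-*ʳ : ∀ {a b} k → a ≈ b → a ℤ.* k ≈ b ℤ.* k
  ≈-*ʳ {b = b} k (mk≈ l refl) = mk≈ (l ℤ.* k) (lem b l k (ℤ.+ t))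
    where
    lem : ∀ b l k t → (b ℤ.+ l ℤ.* t) ℤ.* k ≡ b ℤ.* k ℤ.+ (l ℤ.* k) ℤ.* t
    lem = ℤS.solve-∀

  -- h! q ≡ -1 mod t makes every nonzero difference of two elements of [h] a unit.
  unit : ∀ (i j : Fin h) → i ≢ j → ∃ λ e → (ℤ.+ toℕ i ℤ.- ℤ.+ toℕ j) ℤ.* e ≡ ℤ.+ (h !)
  unit i j i≢j with <-cmp (toℕ i) (toℕ j)
  ... | tri≈ _ e _ = ⊥-elim (i≢j (toℕ-injective e))
  ... | tri< lt _ _ with dv (toℕ i) (toℕ j) lt (toℕ<n j)
    where
    dv : ∀ i j → i < j → j < h → (j ∸ i) ∣ h !
    dv i j i<j j<h with j ∸ i | m<n⇒0<n∸m i<j | m∸n≤m j i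
    ... | suc d | _ | le = ∣-trans (m∣m*n (d !)) (m≤n⇒m!∣n! (≤-trans le (<⇒≤ j<h)))
  ...   | divides e eq = ℤ.- (ℤ.+ e) , trans (cong (λ z → (ℤ.+ toℕ i ℤ.- z) ℤ.* (ℤ.- (ℤ.+ e))) jz)
            (trans (lem (ℤ.+ toℕ i) (ℤ.+ (toℕ j ∸ toℕ i)) (ℤ.+ e)) (trans (sym (ℤP.pos-* e (toℕ j ∸ toℕ i))) (cong ℤ.+_ (sym eq))))
    where
    jz : ℤ.+ toℕ j ≡ ℤ.+ toℕ i ℤ.+ ℤ.+ (toℕ j ∸ toℕ i)
    jz = cong ℤ.+_ (sym (m+[n∸m]≡n (<⇒≤ lt)))
    lem : ∀ i d e → (i ℤ.- (i ℤ.+ d)) ℤ.* (ℤ.- e) ≡ e ℤ.* d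
    lem = ℤS.solve-∀
  unit i j i≢j | tri> _ _ gt with dv (toℕ j) (toℕ i) gt (toℕ<n i)
    where
    dv : ∀ i j → i < j → j < h → (j ∸ i) ∣ h !
    dv i j i<j j<h with j ∸ i | m<n⇒0<n∸m i<j | m∸n≤m j i
    ... | suc d | _ | le = ∣-trans (m∣m*n (d !)) (m≤n⇒m!∣n! (≤-trans le (<⇒≤ j<h)))
  ...   | divides e eq = ℤ.+ e , trans (cong (λ z → (z ℤ.- ℤ.+ toℕ j) ℤ.* (ℤ.+ e)) jz)
            (trans (lem (ℤ.+ toℕ j) (ℤ.+ (toℕ i ∸ toℕ j)) (ℤ.+ e)) (trans (sym (ℤP.pos-* e (toℕ i ∸ toℕ j))) (cong ℤ.+_ (sym eq))))
    where
    jz : ℤ.+ toℕ i ≡ ℤ.+ toℕ j ℤ.+ ℤ.+ (toℕ i ∸ toℕ j)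
    jz = cong ℤ.+_ (sym (m+[n∸m]≡n (<⇒≤ gt)))
    lem : ∀ i d e → ((i ℤ.+ d) ℤ.- i) ℤ.* e ≡ e ℤ.* d
    lem = ℤS.solve-∀

  pos-line : ∀ a i b → ℤ.+ (a * i + b) ≡ ℤ.+ a ℤ.* ℤ.+ i ℤ.+ ℤ.+ b
  pos-line a i b = cong (ℤ._+ ℤ.+ b) (ℤP.pos-* a i)

  slope : ∀ (a a′ b b′ : Fin t) (i j : Fin h) → i ≢ j →
    (toℕ a * toℕ i + toℕ b) % t ≡ (toℕ a′ * toℕ i + toℕ b′) % t → (toℕ a * toℕ j + toℕ b) % t ≡ (toℕ a′ * toℕ j + toℕ b′) % t → a ≡ a′
  slope a a′ b b′ i j i≢j ei ej with unit i j i≢j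
  ... | e , ue = fin-≈ a a′ (≈-trans (≡⇒≈ (sym (fin₁ A A′))) (≈-trans (≈-+ zero≈ (≈-refl {A′})) (≡⇒≈ (ℤP.+-identityˡ A′))))
    where
    A = ℤ.+ toℕ a
    A′ = ℤ.+ toℕ a′
    I = ℤ.+ toℕ i
    J = ℤ.+ toℕ j
    fin₁ : ∀ a b → (a ℤ.- b) ℤ.+ b ≡ a
    fin₁ = ℤS.solve-∀
    di : A ℤ.* I ℤ.+ ℤ.+ toℕ b ≈ A′ ℤ.* I ℤ.+ ℤ.+ toℕ b′
    di = subst₂ _≈_ (pos-line (toℕ a) (toℕ i) (toℕ b)) (pos-line (toℕ a′) (toℕ i) (toℕ b′)) (%⇒≈ ei)
    dj : A ℤ.* J ℤ.+ ℤ.+ toℕ b ≈ A′ ℤ.* J ℤ.+ ℤ.+ toℕ b′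
    dj = subst₂ _≈_ (pos-line (toℕ a) (toℕ j) (toℕ b)) (pos-line (toℕ a′) (toℕ j) (toℕ b′)) (%⇒≈ ej)
    step1 : (A ℤ.- A′) ℤ.* (I ℤ.- J) ≈ ℤ.+ 0
    step1 = ≈-trans (≡⇒≈ (l₁ A A′ I J (ℤ.+ toℕ b) (ℤ.+ toℕ b′)))
      (≈-trans (≈-- (≈-- di dj) (≈-refl {(A′ ℤ.* I ℤ.+ ℤ.+ toℕ b′) ℤ.- (A′ ℤ.* J ℤ.+ ℤ.+ toℕ b′)})) (≡⇒≈ (l₂ ((A′ ℤ.* I ℤ.+ ℤ.+ toℕ b′) ℤ.- (A′ ℤ.* J ℤ.+ ℤ.+ toℕ b′)))))
      where
      l₁ : ∀ A A′ I J b b′ → (A ℤ.- A′) ℤ.* (I ℤ.- J) ≡ ((A ℤ.* I ℤ.+ b) ℤ.- (A ℤ.* J ℤ.+ b)) ℤ.- ((A′ ℤ.* I ℤ.+ b′) ℤ.- (A′ ℤ.* J ℤ.+ b′))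
      l₁ = ℤS.solve-∀
      l₂ : ∀ x → x ℤ.- x ≡ ℤ.+ 0
      l₂ = ℤS.solve-∀
    step2 : (A ℤ.- A′) ℤ.* ℤ.+ (h ! * q) ≈ ℤ.+ 0
    step2 = ≈-trans (≡⇒≈ (trans (cong (λ z → (A ℤ.- A′) ℤ.* z) (trans (ℤP.pos-* (h !) q) (cong (ℤ._* ℤ.+ q) (sym ue)))) (l₁ (A ℤ.- A′) (I ℤ.- J) e (ℤ.+ q))))
      (≈-*ʳ (e ℤ.* ℤ.+ q) step1)
      where
      l₁ : ∀ a d e q → a ℤ.* (d ℤ.* e ℤ.* q) ≡ (a ℤ.* d) ℤ.* (e ℤ.* q)
      l₁ = ℤS.solve-∀
    zero≈ : A ℤ.- A′ ≈ ℤ.+ 0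
    zero≈ = ≈-trans (mk≈ (A ℤ.- A′) (trans (l₁ (A ℤ.- A′) (ℤ.+ (h ! * q))) refl)) (≈-neg step2)
      where
      l₁ : ∀ a x → a ≡ ℤ.- (a ℤ.* x) ℤ.+ a ℤ.* (ℤ.+ 1 ℤ.+ x)
      l₁ = ℤS.solve-∀

  intercept : ∀ (a b b′ : Fin t) (i : Fin h) → (toℕ a * toℕ i + toℕ b) % t ≡ (toℕ a * toℕ i + toℕ b′) % t → b ≡ b′
  intercept a b b′ i e = fin-≈ b b′ (cancel-last _ _ (ℤ.+ (toℕ a * toℕ i)) (subst₂ _≈_ (cong ℤ.+_ (+-comm (toℕ a * toℕ i) _)) (cong ℤ.+_ (+-comm (toℕ a * toℕ i) _)) (%⇒≈ e)))

  determined : ∀ a a′ b b′ (i : Fin h) → a ≡ a′ → (toℕ a * toℕ i + toℕ b) % t ≡ (toℕ a′ * toℕ i + toℕ b′) % t → a ≡ a′ × b ≡ b′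
  determined a .a b b′ i refl e = refl , intercept a b b′ i e

  on-unique : ∀ a b a′ b′ X Y → X ≢ Y → On a b X → On a b Y → On a′ b′ X → On a′ b′ Y → a ≡ a′ × b ≡ b′
  on-unique a b a′ b′ (inj₂ w) (inj₂ w′) ne p p′ _ _ = ⊥-elim (ne (cong inj₂ (toℕ-injective (trans p (sym p′)))))
  on-unique a b a′ b′ (inj₂ w) (inj₁ (i , x)) ne p p′ r r′ = determined a a′ b b′ i (toℕ-injective (trans (sym p) r)) (trans (sym p′) r′)
  on-unique a b a′ b′ (inj₁ (i , x)) (inj₂ w) ne p p′ r r′ = determined a a′ b b′ i (toℕ-injective (trans (sym p′) r′)) (trans (sym p) r)
  on-unique a b a′ b′ (inj₁ (i , x)) (inj₁ (j , y)) ne p p′ r r′ = by (i ≟ j)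
    where
    by : Dec (i ≡ j) → a ≡ a′ × b ≡ b′
    by (yes refl) = ⊥-elim (ne (cong (λ z → inj₁ (i , z)) (toℕ-injective (trans p (sym p′)))))
    by (no i≢j) = determined a a′ b b′ i (slope a a′ b b′ i j i≢j (trans (sym p) r) (trans (sym p′) r′)) (trans (sym p) r)

  line : Fin t → Fin t → Fin h → Pt
  line a b i = inj₁ (i , fromℕ< (m%n<n (toℕ a * toℕ i + toℕ b) t))

  line-on : ∀ a b i → On a b (line a b i)
  line-on a b i = toℕ-fromℕ< _

  long : (a : Fin t) → toℕ a < s → Fin t → Fin (suc h) → Pt
  long a lt b zero = inj₂ (fromℕ< lt)
  long a lt b (suc i) = line a b i

  long-on : ∀ a lt b i → On a b (long a lt b i)
  long-on a lt b zero = toℕ-fromℕ< lt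
  long-on a lt b (suc i) = line-on a b i

  line-inj : ∀ a b i j → line a b i ≡ line a b j → i ≡ j
  line-inj a b i .i refl = refl

  long-inj : ∀ a lt b i j → long a lt b i ≡ long a lt b j → i ≡ j
  long-inj a lt b zero zero _ = refl
  long-inj a lt b (suc i) (suc j) e = cong suc (line-inj a b i j e)

∑-below : ∀ {n} s A B → s ≤ n → ∑ {n} (λ a → if ⌊ toℕ a <? s ⌋ then A else B) ≡ s * A + (n ∸ s) * B
∑-below {n} zero A B _ = trans (∑-cong (λ a → cong (λ b → if b then A else B) (⌊⌋false {d = toℕ a <? 0} λ ()))) (∑-const {n} B)
∑-below {suc n} (suc s) A B (s≤s le) = trans (∑-suc (λ a → if ⌊ toℕ a <? suc s ⌋ then A else B))
  (trans (cong (A +_) (trans (∑-cong {n} (λ a → cong (λ b → if b then A else B) (bool-ext {⌊ suc (toℕ a) <? suc s ⌋} {⌊ toℕ a <? s ⌋}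
      (λ p → ⌊⌋dec (≤-pred (dec⌊⌋ p))) (λ p → ⌊⌋dec {d = suc (toℕ a) <? suc s} (s≤s (dec⌊⌋ p)))))) (∑-below s A B le))) (sym (+-assoc A (s * A) _)))

module _ {h : ℕ} (H : Graph h) where

  closure : ∀ {g} q s → s ≤ suc (h ! * q) → GDD H g h → GDD H g (suc h) → GDD H g (suc (h ! * q)) → GDD H g s → GDD H g (h * suc (h ! * q) + s)
  closure {g} q s s≤t gh gh1 gt gs = pbd H enc enc-inj L meet count
    where
    open Truncated h q s
    open Block
    enc : Pt → Fin (h * t + s)
    enc (inj₁ (i , x)) = combine i x ↑ˡ s
    enc (inj₂ w) = (h * t) ↑ʳ w
    enc-inj : ∀ x y → enc x ≡ enc y → x ≡ y
    enc-inj (inj₁ (i , x)) (inj₁ (j , y)) e with combine-injective i x j y (↑ˡ-injective s _ _ e)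
    ... | refl , refl = refl
    enc-inj (inj₂ w) (inj₂ w′) e = cong inj₂ (↑ʳ-injective (h * t) _ _ e)
    enc-inj (inj₁ (i , x)) (inj₂ w′) e = ⊥-elim (<⇒≱ (toℕ<n (combine i x)) (≤-trans (m≤m+n _ _) (≤-reflexive (trans (sym (toℕ-↑ʳ (h * t) w′)) (trans (cong toℕ (sym e)) (toℕ-↑ˡ (combine i x) s))))))
    enc-inj (inj₂ w′) (inj₁ (i , x)) e = ⊥-elim (<⇒≱ (toℕ<n (combine i x)) (≤-trans (m≤m+n _ _) (≤-reflexive (trans (sym (toℕ-↑ʳ (h * t) w′)) (trans (cong toℕ e) (toℕ-↑ˡ (combine i x) s))))))
    blk : (a b : Fin t) → Dec (toℕ a < s) → Block H g Pt
    blk a b (yes lt) = block (suc h) (long a lt b) (long-inj a lt b) gh1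
    blk a b (no _) = block h (line a b) (line-inj a b) gh
    blk-on : ∀ a b d i → On a b (at (blk a b d) i)
    blk-on a b (yes lt) i = long-on a lt b i
    blk-on a b (no _) i = line-on a b i
    grp : Fin h → Block H g Pt
    grp i = block t (λ x → inj₁ (i , x)) (λ { x .x refl → refl }) gt
    cell : Fin t → Fin t → Block H g Pt
    cell a b = blk a b (toℕ a <? s)
    row : Fin t → List (Block H g Pt)
    row a = tabulate (cell a)
    top : Block H g Pt
    top = block s inj₂ (λ { x .x refl → refl }) gs
    lines = concat (tabulate row)
    L : List (Block H g Pt)
    L = lines ++ tabulate grp ++ top ∷ []
    lines-meet : ∀ a b d a′ b′ d′ → (a ≡ a′ × b ≡ b′ → ⊥) → Meet H (blk a b d) (blk a′ b′ d′)
    lines-meet a b d a′ b′ d′ ne i i′ j j′ i≢i′ e e′ = ne (on-unique a b a′ b′ _ _ (λ q → i≢i′ (at-inj (blk a b d) _ _ q))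
      (blk-on a b d i) (blk-on a b d i′) (subst (On a′ b′) (sym e) (blk-on a′ b′ d′ j)) (subst (On a′ b′) (sym e′) (blk-on a′ b′ d′ j′)))
    grp-meet : ∀ a b d k → Meet H (blk a b d) (grp k)
    grp-meet a b d k i i′ j j′ i≢i′ e e′ = i≢i′ (at-inj (blk a b d) _ _ (trans e (trans (cong (λ z → inj₁ (k , z))
      (toℕ-injective (trans (subst (On a b) e (blk-on a b d i)) (sym (subst (On a b) e′ (blk-on a b d i′)))))) (sym e′))))
    top-meet : ∀ a b d → Meet H (blk a b d) top
    top-meet a b d i i′ j j′ i≢i′ e e′ = i≢i′ (at-inj (blk a b d) _ _ (trans e (trans (cong inj₂
      (toℕ-injective (trans (subst (On a b) e (blk-on a b d i)) (sym (subst (On a b) e′ (blk-on a b d i′)))))) (sym e′))))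
    allLines : ∀ {P : Block H g Pt → Set} → (∀ a b d → P (blk a b d)) → All P lines
    allLines p = AllP.concat⁺ (AllP.tabulate⁺ {f = row} (λ a → AllP.tabulate⁺ {f = cell a} (λ b → p a b (toℕ a <? s))))
    meet : AllPairs (Meet H) L
    meet = APP.++⁺ (APP.concat⁺ (AllP.tabulate⁺ {f = row} (λ a → APP.tabulate⁺ {f = cell a} (λ {b} {b′} ne → lines-meet a b (toℕ a <? s) a b′ (toℕ a <? s) (ne ∘ proj₂))))
        (APP.tabulate⁺ {f = row} (λ {a} {a′} ne → AllP.tabulate⁺ {f = cell a} (λ b → AllP.tabulate⁺ {f = cell a′} (λ b′ → lines-meet a b (toℕ a <? s) a′ b′ (toℕ a′ <? s) (ne ∘ proj₁))))))
      (APP.++⁺ (APP.tabulate⁺ {f = grp} (λ {k} {k′} ne i i′ j j′ _ e _ → ne (grp-of e))) ([] ∷ []) (AllP.tabulate⁺ {f = grp} (λ k → (λ { i i′ j j′ _ () _ }) ∷ [])))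
      (allLines (λ a b d → AllP.++⁺ (AllP.tabulate⁺ {f = grp} (grp-meet a b d)) (top-meet a b d ∷ [])))
      where
      grp-of : ∀ {k k′ : Fin h} {x y : Fin t} → _≡_ {A = Pt} (inj₁ (k , x)) (inj₁ (k′ , y)) → k ≡ k′
      grp-of refl = refl
    sumL : ∀ (f : ℕ → ℕ) → listSum (f ∘ size) L ≡ (s * (t * f (suc h)) + (t ∸ s) * (t * f h)) + (h * f t + f s)
    sumL f = trans (listSum-++ (f ∘ size) lines _) (cong₂ _+_
      (trans (listSum-concat-tab (f ∘ size) row) (trans (∑-cong rowsum) (∑-below s _ _ s≤t)))
      (trans (listSum-++ (f ∘ size) (tabulate grp) _) (cong₂ _+_ (trans (tab (f ∘ size) grp) (∑-const {h} (f t))) (+-identityʳ (f s)))))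
      where
      tab : ∀ {n} {A : Set} (F : A → ℕ) (k : Fin n → A) → listSum F (tabulate k) ≡ ∑ (F ∘ k)
      tab {zero} F k = sym (∑-zero {0} (λ ()))
      tab {suc n} F k = trans (cong (F (k zero) +_) (tab F (k ∘ suc))) (sym (∑-suc (F ∘ k)))
      rowsum : ∀ a → listSum (f ∘ size) (row a) ≡ (if ⌊ toℕ a <? s ⌋ then t * f (suc h) else t * f h)
      rowsum a = trans (tab (f ∘ size) (λ b → blk a b (toℕ a <? s))) (by (toℕ a <? s))
        where
        by : ∀ d → ∑ (λ b → f (size (blk a b d))) ≡ (if ⌊ d ⌋ then t * f (suc h) else t * f h)
        by (yes _) = ∑-const {t} (f (suc h))
        by (no _) = ∑-const {t} (f h)
    count : listSum (λ b → size b * size b) L + (h * t + s) ≡ (h * t + s) * (h * t + s) + listSum size L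
    count = trans (cong (_+ (h * t + s)) (sumL (λ n → n * n))) (trans (alg (t ∸ s) t (sym (m+[n∸m]≡n s≤t))) (cong ((h * t + s) * (h * t + s) +_) (sym (sumL id))))
      where
      alg : ∀ r t → t ≡ s + r → (s * (t * (suc h * suc h)) + r * (t * (h * h))) + (h * (t * t) + s * s) + (h * t + s)
        ≡ (h * t + s) * (h * t + s) + ((s * (t * suc h) + r * (t * h)) + (h * t + s))
      alg r t refl = lem h s r
        where
        lem : ∀ h s r → (s * ((s + r) * (suc h * suc h)) + r * ((s + r) * (h * h))) + (h * ((s + r) * (s + r)) + s * s) + (h * (s + r) + s)
          ≡ (h * (s + r) + s) * (h * (s + r) + s) + ((s * ((s + r) * suc h) + r * ((s + r) * h)) + (h * (s + r) + s))
        lem = solve-∀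

prodTo : (ℕ → ℕ) → ℕ → ℕ
prodTo f zero = 1
prodTo f (suc n) = f n * prodTo f n

prodTo-∣ : ∀ f n k → k < n → f k ∣ prodTo f n
prodTo-∣ f (suc n) k (s≤s k≤n) with m≤n⇒m<n∨m≡n k≤n
... | inj₁ lt = ∣-trans (prodTo-∣ f n k lt) (n∣m*n (f n))
... | inj₂ refl = m∣m*n (prodTo f n)

prodTo-pos : ∀ f n → (∀ k → 1 ≤ f k) → 1 ≤ prodTo f n
prodTo-pos f zero p = ≤-refl
prodTo-pos f (suc n) p = *-mono-≤ (p n) (prodTo-pos f n p)

module _ {h : ℕ} (H : Graph h) (pos : 1 ≤ e2H H) where

  private
    covNum : ℕ → ℕ
    covNum u with h ≤? u
    ... | yes h≤u = proj₁ (coverage-all H u h≤u pos)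
    ... | no _ = 1

    covNum-pos : ∀ u → 1 ≤ covNum u
    covNum-pos u with h ≤? u
    ... | yes h≤u = proj₁ (proj₂ (coverage-all H u h≤u pos))
    ... | no _ = ≤-refl

    covNum-eq : ∀ u → h ≤ u → ∀ l → (∀ (x y : Fin u) → x ≢ y → coverage H x y ≡ l) → l ≡ covNum u
    covNum-eq u h≤u l p with h ≤? u
    ... | no q = ⊥-elim (q h≤u)
    ... | yes h≤u′ with edge-of H pos
    ...   | i , j , a = trans (sym (p x y x≢y)) (proj₂ (proj₂ (coverage-all H u h≤u′ pos)) x y x≢y)
      where
      x = inject≤ i h≤u
      y = inject≤ j h≤u
      x≢y : x ≢ y
      x≢y e = adj-≢ H a (inject≤-inj h≤u e)

    base-all : ∀ B′ → ∃ λ g → 1 ≤ g × (∀ u → h ≤ u → u ≤ suc B′ → GDD H g u)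
    base-all B′ = _ , m^n>0 (c ^ (suc B′ !)) {{m^n≢0 c (suc B′ !) {{c≢0}}}} (suc B′ * suc B′) ,
        λ u h≤u u≤B → base H B′ u c u≤B h≤u pos {{c≢0}} (λ l p _ → subst (_∣ c) (sym (covNum-eq u h≤u l p)) (prodTo-∣ covNum (suc (suc B′)) u (s≤s u≤B)))
      where
      c = prodTo covNum (suc (suc B′))
      c≢0 : NonZero c
      c≢0 = >-nonZero (prodTo-pos covNum (suc (suc B′)) covNum-pos)

    1≤h : 1 ≤ h
    1≤h with edge-of H pos
    ... | i , _ = ≤-trans (s≤s z≤n) (toℕ<n i)

  -- The same blow-up g works for every u ≥ h: above the base range, u = h t + s with smaller s, t.
  gdd-all : ∃ λ g → 1 ≤ g × (∀ u → h ≤ u → GDD H g u)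
  gdd-all = from (base-all (h + h * (h * h ! + 2 * h + h !)))
   where
   from : (∃ λ g → 1 ≤ g × (∀ u → h ≤ u → u ≤ suc (h + h * (h * h ! + 2 * h + h !)) → GDD H g u)) → ∃ λ g → 1 ≤ g × (∀ u → h ≤ u → GDD H g u)
   from (g , g≥1 , bs) = g , g≥1 , <-rec (λ u → h ≤ u → GDD H g u) (λ u rec h≤u → step u rec h≤u (u ≤? suc (h + h * V)))
    where
    F = h !
    V = h * F + 2 * h + F
    1≤F : 1 ≤ F
    1≤F = 1≤n! h
    instance
      h≢0 : NonZero h
      h≢0 = >-nonZero 1≤h
      F≢0 : NonZero F
      F≢0 = >-nonZero 1≤F
    step : ∀ u → (∀ {w} → w < u → h ≤ w → GDD H g w) → h ≤ u → Dec (u ≤ suc (h + h * V)) → GDD H g u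
    step u rec h≤u (yes le) = bs u h≤u le
    step u rec h≤u (no big) = subst (GDD H g) u-eq (closure H q s s≤t (bs h ≤-refl h≤B) (bs (suc h) (n≤1+n h) (s≤s (m≤m+n h (h * V)))) (rec t<u h≤t) (rec s<u h≤s))
      where
      h≤B : h ≤ suc (h + h * V)
      h≤B = ≤-trans (m≤m+n h (h * V)) (n≤1+n _)
      v = (u ∸ h) / h
      q = (v ∸ 1) / F
      t = suc (F * q)
      s = u ∸ h * t
      big′ : suc (h + h * V) < u
      big′ = ≰⇒> big
      V≤v : V ≤ v
      V≤v = ≤-trans (≤-reflexive (sym (m*n/n≡m V h))) (/-monoˡ-≤ h (≤-trans (≤-reflexive (trans (*-comm V h) (sym (m+n∸m≡n h (h * V))))) (∸-monoˡ-≤ h (≤-trans (n≤1+n _) (<⇒≤ big′)))))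
      1≤V : 1 ≤ V
      1≤V = ≤-trans 1≤F (m≤n+m F (h * F + 2 * h))
      1≤v : 1 ≤ v
      1≤v = ≤-trans 1≤V V≤v
      t≤v : t ≤ v
      t≤v = ≤-trans (s≤s (≤-trans (≤-reflexive (*-comm F q)) (m/n*n≤m (v ∸ 1) F))) (≤-reflexive (m+[n∸m]≡n 1≤v))
      v<t+F : v < t + F
      v<t+F = ≤-trans (s≤s (≤-trans (≤-reflexive (trans (sym (m+[n∸m]≡n 1≤v)) (cong suc (m≡m%n+[m/n]*n (v ∸ 1) F)))) (+-monoˡ-≤ (q * F) (m%n<n (v ∸ 1) F))))
        (≤-reflexive (cong suc (trans (+-comm F (q * F)) (cong (_+ F) (*-comm q F)))))
      ht≤ : h * t ≤ u ∸ h
      ht≤ = ≤-trans (*-monoʳ-≤ h t≤v) (≤-trans (≤-reflexive (*-comm h v)) (m/n*n≤m (u ∸ h) h))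
      ht≤u : h * t ≤ u
      ht≤u = ≤-trans ht≤ (m∸n≤m u h)
      u-eq : h * t + s ≡ u
      u-eq = m+[n∸m]≡n ht≤u
      h≤s : h ≤ s
      h≤s = +-cancelˡ-≤ (h * t) h s (≤-trans (+-monoˡ-≤ h ht≤) (≤-trans (≤-reflexive (m∸n+n≡m h≤u)) (≤-reflexive (sym u-eq))))
      u< : u < h * v + (h + h)
      u< = ≤-trans (s≤s (≤-trans (≤-reflexive (trans (sym (m∸n+n≡m h≤u)) (cong (_+ h) (m≡m%n+[m/n]*n (u ∸ h) h)))) ≤-refl))
        (≤-trans (+-monoˡ-≤ h (+-monoˡ-≤ (v * h) (m%n<n (u ∸ h) h))) (≤-reflexive (re h v)))
        where
        re : ∀ h v → h + v * h + h ≡ h * v + (h + h)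
        re = solve-∀
      s≤t : s ≤ t
      s≤t = ≤-trans (+-cancelˡ-≤ (h * t) s (h * F + 2 * h) (≤-trans (≤-reflexive u-eq) (≤-trans (<⇒≤ u<) (≤-trans (+-monoˡ-≤ (h + h) (*-monoʳ-≤ h (<⇒≤ v<t+F))) (≤-reflexive (re h t F))))))
        (+-cancelʳ-≤ F _ _ (≤-trans V≤v (<⇒≤ v<t+F)))
        where
        re : ∀ h t F → h * (t + F) + (h + h) ≡ h * t + (h * F + 2 * h)
        re = solve-∀
      h≤t : h ≤ t
      h≤t = ≤-trans h≤s s≤t
      s<u : s < u
      s<u = ∸-monoʳ-< {u} {h * t} {0} (≤-trans (s≤s z≤n) (*-mono-≤ 1≤h (s≤s (z≤n {F * q})))) ht≤u
      t<u : t < u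
      t<u = ≤-trans (+-mono-≤ (≤-trans 1≤h h≤s) (≤-trans (≤-reflexive (sym (*-identityˡ t))) (*-monoˡ-≤ t 1≤h))) (≤-reflexive (trans (+-comm s (h * t)) u-eq))

  pack-complete : ∃ λ C → ∀ m → ∃ λ (P : List (Fin h → Fin m)) → Packs H P × m * m ≤ m + length P * e2H H + C * m
  pack-complete = from gdd-all
   where
   from : (∃ λ g → 1 ≤ g × (∀ u → h ≤ u → GDD H g u)) → ∃ λ C → ∀ m → ∃ λ (P : List (Fin h → Fin m)) → Packs H P × m * m ≤ m + length P * e2H H + C * m
   from (g , g≥1 , gd) = h * g + 4 * g , λ m → go m (h ≤? m / g)
    where
    instance
      g≢0 : NonZero g
      g≢0 = >-nonZero g≥1
    go : ∀ m → Dec (h ≤ m / g) → ∃ λ (P : List (Fin h → Fin m)) → Packs H P × m * m ≤ m + length P * e2H H + (h * g + 4 * g) * m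
    go m (no q) = [] , ([] , []) , ≤-trans (*-monoˡ-≤ m (≤-trans m≤ (m≤m+n (h * g) (4 * g)))) (m≤n+m ((h * g + 4 * g) * m) (m + 0 * e2H H))
      where
      m≤ : m ≤ h * g
      m≤ = ≤-trans (≤-reflexive (m≡m%n+[m/n]*n m g)) (≤-trans (+-monoˡ-≤ (m / g * g) (<⇒≤ (m%n<n m g))) (*-monoˡ-≤ g (≰⇒> q)))
    go m (yes h≤u) = P , (AllP.map⁺ (All.map (λ t i j e → t i j (cong proj₁ (emb-inj e))) (GDD.transversal D)) ,
        APP.map⁺ (AP.map (λ d i j i′ j′ a a′ e e′ → d i j i′ j′ a a′ (emb-inj e) (emb-inj e′)) (GDD.disjoint D))) , bound
      where
      u = m / g
      r = m % g
      D = gd u h≤u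
      m-eq : m ≡ r + u * g
      m-eq = m≡m%n+[m/n]*n m g
      le : u * g ≤ m
      le = m/n*n≤m m g
      emb : Fin u × Fin g → Fin m
      emb (x , z) = inject≤ (combine x z) le
      emb-inj : ∀ {x y} → emb x ≡ emb y → x ≡ y
      emb-inj {x , z} {y , w} e with combine-injective x z y w (inject≤-inj le e)
      ... | refl , refl = refl
      P = map (emb ∘_) (GDD.blocks D)
      E = length P * e2H H
      ex : E + u * (g * g) ≡ u * u * (g * g)
      ex = trans (cong (λ l → l * e2H H + u * (g * g)) (length-map (emb ∘_) (GDD.blocks D))) (GDD.exact D)
      bound : m * m ≤ m + E + (h * g + 4 * g) * m
      bound = begin
        m * m                                       ≡⟨ cong₂ _*_ m-eq m-eq ⟩
        (r + u * g) * (r + u * g)                   ≡⟨ re₁ r u g ⟩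
        u * u * (g * g) + (r * (r + u * g) + u * g * r) ≡⟨ cong₂ (λ a b → a + (r * b + u * g * r)) (sym ex) (sym m-eq) ⟩
        (E + u * (g * g)) + (r * m + u * g * r)     ≤⟨ +-mono-≤ (+-monoʳ-≤ E (≤-trans (≤-reflexive (sym (*-assoc u g g))) (*-monoˡ-≤ g le))) (+-mono-≤ (*-monoˡ-≤ m r≤) (*-mono-≤ le r≤)) ⟩
        (E + m * g) + (g * m + m * g)               ≤⟨ ≤-trans (m≤m+n _ (h * g * m + m + g * m)) (≤-reflexive (re₂ E m g (h * g))) ⟩
        m + E + (h * g + 4 * g) * m ∎
        where
        open ≤-Reasoning
        r≤ : r ≤ g
        r≤ = <⇒≤ (m%n<n m g)
        re₁ : ∀ r u g → (r + u * g) * (r + u * g) ≡ u * u * (g * g) + (r * (r + u * g) + u * g * r)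
        re₁ = solve-∀
        re₂ : ∀ E m g k → (E + m * g) + (g * m + m * g) + (k * m + m + g * m) ≡ m + E + (k + 4 * g) * m
        re₂ = solve-∀

-- Complete multipartite subgraphs of dense graphs

Rel : ℕ → Set
Rel n = Fin n → Fin n → Bool

homog : ∀ {n} q (R : Rel n) (ws : Fin q → Fin n) (p : Fin n → Bool) →
  Σ (Fin n → Bool) λ p′ → (∀ v → p′ v ≡ true → p v ≡ true) × # p ≤ 2 ^ q * # p′ × (∀ i u v → p′ u ≡ true → p′ v ≡ true → R u (ws i) ≡ R v (ws i))
homog zero R ws p = p , (λ _ q → q) , ≤-reflexive (sym (+-identityʳ _)) , λ ()
homog (suc q) R ws p with homog q R (ws ∘ suc) (λ v → p v ∧ R v (ws zero)) | homog q R (ws ∘ suc) (λ v → p v ∧ not (R v (ws zero))) | ≤-total (# (λ v → p v ∧ R v (ws zero))) (# (λ v → p v ∧ not (R v (ws zero))))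
... | _ | p′ , sub , c , hom | inj₁ le = p′ , (λ v q → proj₁ (∧⁻ (sub v q))) ,
      ≤-trans (≤-reflexive (#-split p (λ v → R v (ws zero)))) (≤-trans (+-mono-≤ (≤-trans le c) c) (≤-reflexive (re (2 ^ q) (# p′)))) ,
      λ { zero u v a b → trans (not⁻ (proj₂ (∧⁻ {p u} (sub u a)))) (sym (not⁻ (proj₂ (∧⁻ {p v} (sub v b))))) ; (suc i) → hom i }
  where
  re : ∀ x y → x * y + x * y ≡ 2 * x * y
  re = solve-∀
... | p′ , sub , c , hom | _ | inj₂ le = p′ , (λ v q → proj₁ (∧⁻ (sub v q))) ,
      ≤-trans (≤-reflexive (#-split p (λ v → R v (ws zero)))) (≤-trans (+-mono-≤ c (≤-trans le c)) (≤-reflexive (re (2 ^ q) (# p′)))) ,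
      λ { zero u v a b → trans (proj₂ (∧⁻ {p u} (sub u a))) (sym (proj₂ (∧⁻ {p v} (sub v b)))) ; (suc i) → hom i }
  where
  re : ∀ x y → x * y + x * y ≡ 2 * x * y
  re = solve-∀

record Multi {n : ℕ} (R : Rel n) (S : Fin n → Bool) (r t : ℕ) : Set where
  constructor multi
  field
    part : Fin r → Fin t → Fin n
    part-inj : ∀ i → Inj (part i)
    part-in : ∀ i j → S (part i j) ≡ true
    cross : ∀ i i′ j j′ → i ≢ i′ → R (part i j) (part i′ j′) ≡ true
open Multi public

-- Many vertices with t neighbours in each part of a K_r(q): those with equal neighbourhoods form a new part.
extend : ∀ {n r q t} {R : Rel n} {S : Fin n → Bool} → (∀ x y → R x y ≡ R y x) → (M : Multi R S r q) → (good : Fin n → Bool) → (∀ v → good v ≡ true → S v ≡ true) →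
  (∀ v → good v ≡ true → ∀ i → t ≤ # (λ j → R v (part M i j))) → 2 ^ (r * q) * t ≤ # good → Multi R S (suc r) t
extend {t = zero} _ M good _ _ _ = multi (λ _ ()) (λ _ ()) (λ _ ()) (λ _ _ ())
extend {n} {r} {q} {suc t} {R} {S} R-sym M good good-S nbrs big with homog (r * q) R (λ k → part M (proj₁ (remQuot {r} q k)) (proj₂ (remQuot {r} q k))) good
... | p′ , sub , c , hom = result
  where
  enough : suc t ≤ # p′
  enough = *-cancelˡ-≤ (2 ^ (r * q)) {{m^n≢0 2 (r * q)}} (≤-trans big c)
  us = proj₁ (pick p′ enough)
  us-inj = proj₁ (proj₂ (pick p′ enough))
  us-in = proj₂ (proj₂ (pick p′ enough))
  u0 = us zero
  nb : ∀ i → Σ (Fin (suc t) → Fin q) λ f → Injective _≡_ _≡_ f × (∀ j → R u0 (part M i (f j)) ≡ true)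
  nb i = pick (λ j → R u0 (part M i j)) (nbrs u0 (sub u0 (us-in zero)) i)
  all-adj : ∀ i j l → R (us l) (part M i (proj₁ (nb i) j)) ≡ true
  all-adj i j l = trans (subst (λ (a , b) → R (us l) (part M a b) ≡ R u0 (part M a b)) (remQuot-combine {r} {q} i (proj₁ (nb i) j))
      (hom (combine i (proj₁ (nb i) j)) (us l) u0 (us-in l) (us-in zero))) (proj₂ (proj₂ (nb i)) j)
  prt : Fin (suc r) → Fin (suc t) → Fin n
  prt zero = us
  prt (suc i) j = part M i (proj₁ (nb i) j)
  crs : ∀ i i′ j j′ → i ≢ i′ → R (prt i j) (prt i′ j′) ≡ true
  crs zero zero j j′ ne = ⊥-elim (ne refl)
  crs zero (suc i′) j j′ ne = all-adj i′ j′ j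
  crs (suc i) zero j j′ ne = trans (R-sym _ _) (all-adj i j j′)
  crs (suc i) (suc i′) j j′ ne = cross M i i′ _ _ (ne ∘ cong suc)
  result : Multi R S (suc r) (suc t)
  result = multi prt (λ { zero i j e → us-inj e ; (suc i) a b e → proj₁ (proj₂ (nb i)) (part-inj M i _ _ e) })
    (λ { zero j → good-S _ (sub _ (us-in j)) ; (suc i) j → part-in M i _ }) crs

multi-embed : ∀ {n h r} (H : Graph h) {R : Rel n} {S} → (∀ x → R x x ≡ false) → Multi R S r h → (f : Fin h → Fin r) → (∀ i j → adj H i j ≡ true → f i ≢ f j) →
  ∃ λ φ → Inj φ × EdgesIn H R φ
multi-embed H {R} irr M f proper = (λ v → part M (f v) v) , in′ , λ i j a → cross M _ _ _ _ (proper i j a)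
  where
  in′ : Inj (λ v → part M (f v) v)
  in′ i j e with f i ≟ f j
  ... | yes q = part-inj M (f j) i j (trans (cong (λ z → part M z i) (sym q)) e)
  ... | no ne = ⊥-elim (t≢f (cross M (f i) (f j) i j ne) (subst (λ z → R (part M (f i) i) z ≡ false) e (irr _)))

-- Kővári–Sós–Turán: q = 2Γt vertices of degree ≥ |U|/Γ have many common neighbours.
kst-multi : ∀ {n} (Γ t : ℕ) (R : Rel n) → (∀ x y → R x y ≡ R y x) → (U : Fin n → Bool) → 1 ≤ Γ → 1 ≤ t → 2 * Γ * (2 ^ (2 * Γ * t) * t) ≤ # U →
  2 * Γ * t ≤ # (λ v → ⌊ # U ≤? Γ * # (λ w → U w ∧ R v w) ⌋) → Multi R (λ _ → true) 2 t
kst-multi {n} Γ t R R-sym U 1≤Γ 1≤t big many = extend {r = 1} {q} {t} R-sym M good (λ _ _ → refl) (λ v p i → dec⌊⌋ (proj₂ (∧⁻ {U v} p)))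
    (*-cancelˡ-≤ (2 * Γ) {{2Γ≢0}} (≤-trans (≤-reflexive (cong (λ e → 2 * Γ * (2 ^ e * t)) (+-identityʳ q))) (≤-trans big (*-cancelʳ-≤ _ _ t {{t≢0}} count))))
  where
  q = 2 * Γ * t
  t≢0 : NonZero t
  t≢0 = >-nonZero 1≤t
  2Γ≢0 : NonZero (2 * Γ)
  2Γ≢0 = >-nonZero (*-mono-≤ (s≤s (z≤n {1})) 1≤Γ)
  Γ≢0 : NonZero Γ
  Γ≢0 = >-nonZero 1≤Γ
  ws = proj₁ (pick _ many)
  M : Multi R (λ _ → true) 1 q
  M = multi (λ _ → ws) (λ _ i j e → proj₁ (proj₂ (pick _ many)) e) (λ _ _ → refl) λ { zero zero _ _ ne → ⊥-elim (ne refl) }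
  good : Fin n → Bool
  good v = U v ∧ ⌊ t ≤? # (λ j → R v (ws j)) ⌋
  total : 2 * t * # U ≤ ∑ (λ v → ⟦ U v ⟧ * # (λ j → R v (ws j)))
  total = *-cancelˡ-≤ Γ {{Γ≢0}} (begin
      Γ * (2 * t * # U)                                        ≡⟨ re Γ t (# U) ⟩
      q * # U                                                  ≡⟨ sym (∑-const {q} (# U)) ⟩
      ∑ {q} (λ j → # U)                                        ≤⟨ ∑-mono {q} (λ j → dec⌊⌋ (proj₂ (proj₂ (pick _ many)) j)) ⟩
      ∑ (λ j → Γ * # (λ w → U w ∧ R (ws j) w))                 ≡⟨ ∑-*ˡ Γ (λ j → # (λ w → U w ∧ R (ws j) w)) ⟩
      Γ * ∑ (λ j → # (λ w → U w ∧ R (ws j) w))                 ≡⟨ cong (Γ *_) (∑-swap (λ j w → ⟦ U w ∧ R (ws j) w ⟧)) ⟩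
      Γ * ∑ (λ w → ∑ (λ j → ⟦ U w ∧ R (ws j) w ⟧))             ≡⟨ cong (Γ *_) (∑-cong col) ⟩
      Γ * ∑ (λ v → ⟦ U v ⟧ * # (λ j → R v (ws j))) ∎)
    where
    open ≤-Reasoning
    re : ∀ g t u → g * (2 * t * u) ≡ 2 * g * t * u
    re = solve-∀
    col : ∀ w → ∑ (λ j → ⟦ U w ∧ R (ws j) w ⟧) ≡ ⟦ U w ⟧ * # (λ j → R w (ws j))
    col w = trans (∑-cong (λ j → trans (⟦∧⟧ (U w) _) (cong (λ b → ⟦ U w ⟧ * ⟦ b ⟧) (R-sym (ws j) w)))) (∑-*ˡ ⟦ U w ⟧ (λ j → ⟦ R w (ws j) ⟧))
  upper : ∑ (λ v → ⟦ U v ⟧ * # (λ j → R v (ws j))) ≤ # good * q + # U * t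
  upper = ≤-trans (∑-mono cell) (≤-reflexive (trans (∑-distrib (λ v → ⟦ good v ⟧ * q) _) (cong₂ _+_ (∑-*ʳ (λ v → ⟦ good v ⟧) q) (∑-*ʳ (λ v → ⟦ U v ⟧) t))))
    where
    cell : ∀ v → ⟦ U v ⟧ * # (λ j → R v (ws j)) ≤ ⟦ good v ⟧ * q + ⟦ U v ⟧ * t
    cell v with U v | t ≤? # (λ j → R v (ws j))
    ... | false | _ = ≤-trans (≤-reflexive (cong (_* # (λ j → R v (ws j))) (⟦⟧-false refl))) z≤n
    ... | true | yes _ = ≤-trans (*-monoʳ-≤ ⟦ true ⟧ (#-≤n _)) (m≤m+n _ _)
    ... | true | no lt = ≤-trans (*-monoʳ-≤ ⟦ true ⟧ (<⇒≤ (≰⇒> lt))) (m≤n+m _ _)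
  count : # U * t ≤ 2 * Γ * # good * t
  count = +-cancelʳ-≤ (# U * t) _ _ (≤-trans (≤-reflexive (re₁ t (# U))) (≤-trans total (≤-trans upper (+-monoˡ-≤ (# U * t) (≤-reflexive (re₂ (# good) Γ t))))))
    where
    re₁ : ∀ t u → u * t + u * t ≡ 2 * t * u
    re₁ = solve-∀
    re₂ : ∀ x g t → x * (2 * g * t) ≡ 2 * g * x * t
    re₂ = solve-∀

e2in : ∀ {n} → Rel n → (Fin n → Bool) → ℕ
e2in R S = ∑∑ (λ x y → ⟦ (S x ∧ S y) ∧ R x y ⟧)

e2in-≤ : ∀ {n} (R : Rel n) S → e2in R S ≤ # S * # S
e2in-≤ R S = ≤-trans (∑-mono (λ x → ≤-trans (∑-mono (λ y → cell (S x) (S y) (R x y))) (≤-reflexive (∑-*ˡ ⟦ S x ⟧ (λ y → ⟦ S y ⟧))))) (≤-reflexive (∑-*ʳ (λ x → ⟦ S x ⟧) (# S)))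
  where
  cell : ∀ a b c → ⟦ (a ∧ b) ∧ c ⟧ ≤ ⟦ a ⟧ * ⟦ b ⟧
  cell a b c = ≤-trans (⟦⟧-mono (λ q → proj₁ (∧⁻ {a ∧ b} q))) (≤-reflexive (⟦∧⟧ a b))

remove : ∀ {n} → (Fin n → Bool) → Fin n → Fin n → Bool
remove S v x = S x ∧ not (x == v)

#-remove : ∀ {n} (S : Fin n → Bool) v → S v ≡ true → suc (# (remove S v)) ≡ # S
#-remove S v Sv = sym (trans (#-split S (λ x → x == v)) (cong (_+ # (remove S v)) (trans (∑-single _ v off) (⟦⟧-true (∧⁺ Sv (==-refl v))))))
  where
  off : ∀ j → j ≢ v → ⟦ S j ∧ (j == v) ⟧ ≡ 0
  off j ne = ⟦⟧-false (¬true⇒ (λ q → ne (==⇒≡ (proj₂ (∧⁻ {S j} q)))))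

e2in-remove : ∀ {n} (R : Rel n) → (∀ x y → R x y ≡ R y x) → ∀ S v → e2in R S ≤ e2in R (remove S v) + 2 * # (λ x → S x ∧ R v x)
e2in-remove R R-sym S v = ≤-trans (∑-mono (λ x → ≤-trans (∑-mono (cell x)) (≤-reflexive (trans (∑-distrib (λ y → ⟦ (remove S v x ∧ remove S v y) ∧ R x y ⟧) _)
      (cong (∑ (λ y → ⟦ (remove S v x ∧ remove S v y) ∧ R x y ⟧) +_) (trans (∑-distrib (λ y → δ x v * ⟦ S y ∧ R v y ⟧) _)
        (cong₂ _+_ (∑-*ˡ (δ x v) (λ y → ⟦ S y ∧ R v y ⟧)) (trans (∑-cong (λ y → cong (_* ⟦ S x ∧ R v x ⟧) (δ-comm y v))) (trans (∑-*ʳ (δ v) ⟦ S x ∧ R v x ⟧) (trans (cong (_* ⟦ S x ∧ R v x ⟧) (∑-δ1 v)) (*-identityˡ _))))))))))) 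
    (≤-reflexive (trans (∑-distrib (λ x → ∑ (λ y → ⟦ (remove S v x ∧ remove S v y) ∧ R x y ⟧)) _) (cong (e2in R (remove S v) +_)
      (trans (∑-distrib (λ x → δ x v * D) _) (cong₂ _+_ (trans (∑-cong (λ x → cong (_* D) (δ-comm x v))) (trans (∑-*ʳ (δ v) D) (trans (cong (_* D) (∑-δ1 v)) (*-identityˡ D)))) (sym (+-identityʳ D)))))))
  where
  D = # (λ x → S x ∧ R v x)
  δ-comm : ∀ (x y : Fin _) → δ x y ≡ δ y x
  δ-comm x y = cong ⟦_⟧ (bool-ext (λ p → ⌊⌋dec (sym (==⇒≡ p))) (λ p → ⌊⌋dec (sym (==⇒≡ p))))
  cell : ∀ x y → ⟦ (S x ∧ S y) ∧ R x y ⟧ ≤ ⟦ (remove S v x ∧ remove S v y) ∧ R x y ⟧ + (δ x v * ⟦ S y ∧ R v y ⟧ + δ y v * ⟦ S x ∧ R v x ⟧)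
  cell x y with bool-split ((S x ∧ S y) ∧ R x y)
  ... | inj₂ f = ≤-trans (≤-reflexive (⟦⟧-false f)) z≤n
  ... | inj₁ q with ∧⁻ {S x ∧ S y} q
  ...   | q1 , r with ∧⁻ {S x} q1
  ...     | sx , sy = ≤-trans (⟦⟧≤1 _) (by (x ≟ v) (y ≟ v))
    where
    by : Dec (x ≡ v) → Dec (y ≡ v) → 1 ≤ ⟦ (remove S v x ∧ remove S v y) ∧ R x y ⟧ + (δ x v * ⟦ S y ∧ R v y ⟧ + δ y v * ⟦ S x ∧ R v x ⟧)
    by (yes refl) _ = ≤-trans (≤-trans (≤-reflexive (sym (cong₂ _*_ (δ-refl x) (⟦⟧-true (∧⁺ sy r))))) (m≤m+n _ _)) (m≤n+m _ ⟦ (remove S v x ∧ remove S v y) ∧ R x y ⟧)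
    by _ (yes refl) = ≤-trans (≤-trans (≤-reflexive (sym (cong₂ _*_ (δ-refl y) (⟦⟧-true (∧⁺ sx (trans (R-sym y x) r)))))) (m≤n+m _ (δ x y * ⟦ S y ∧ R y y ⟧))) (m≤n+m _ ⟦ (remove S v x ∧ remove S v y) ∧ R x y ⟧)
    by (no p) (no p′) = ≤-trans (≤-reflexive (sym (⟦⟧-true (∧⁺ (∧⁺ (∧⁺ sx (cong not (==-≢ p))) (∧⁺ sy (cong not (==-≢ p′)))) r)))) (m≤m+n _ _)

-- If every large set has a vertex of relative degree at most a/b, deleting such vertices one by one bounds the edges.
deletion : ∀ {n} (a b N : ℕ) (R : Rel n) → (∀ x y → R x y ≡ R y x) →
  (∀ S → N ≤ # S → 1 ≤ # S → ∃ λ v → S v ≡ true × b * # (λ x → S x ∧ R v x) ≤ a * # S) →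
  ∀ s S → # S ≡ s → b * e2in R S ≤ a * (s * s + s) + b * (N * N)
deletion a b N R R-sym hyp zero S e = ≤-trans (*-monoʳ-≤ b (≤-trans (e2in-≤ R S) (≤-reflexive (cong₂ _*_ e e)))) (≤-trans (≤-reflexive (*-zeroʳ b)) z≤n)
deletion a b N R R-sym hyp (suc s) S e with N ≤? suc s
... | no q = ≤-trans (*-monoʳ-≤ b (≤-trans (e2in-≤ R S) (≤-trans (≤-reflexive (cong₂ _*_ e e)) (*-mono-≤ (<⇒≤ (≰⇒> q)) (<⇒≤ (≰⇒> q)))))) (m≤n+m _ _)
... | yes le with hyp S (≤-trans le (≤-reflexive (sym e))) (≤-trans (s≤s z≤n) (≤-reflexive (sym e)))
... | v , Sv , deg = begin
    b * e2in R S                                        ≤⟨ *-monoʳ-≤ b (e2in-remove R R-sym S v) ⟩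
    b * (e2in R S′ + 2 * # (λ x → S x ∧ R v x))         ≡⟨ re₁ b (e2in R S′) _ ⟩
    b * e2in R S′ + 2 * (b * # (λ x → S x ∧ R v x))     ≤⟨ +-mono-≤ (deletion a b N R R-sym hyp s S′ (cong-pred (trans (#-remove S v Sv) e))) (*-monoʳ-≤ 2 (≤-trans deg (≤-reflexive (cong (a *_) e)))) ⟩
    a * (s * s + s) + b * (N * N) + 2 * (a * suc s)     ≡⟨ re₂ a s (b * (N * N)) ⟩
    a * (suc s * suc s + suc s) + b * (N * N) ∎
  where
  open ≤-Reasoning
  S′ = remove S v
  cong-pred : ∀ {x y} → suc x ≡ suc y → x ≡ y
  cong-pred refl = refl
  re₁ : ∀ b x d → b * (x + 2 * d) ≡ b * x + 2 * (b * d)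
  re₁ = solve-∀
  re₂ : ∀ a s c → a * (s * s + s) + c + 2 * (a * suc s) ≡ a * (suc s * suc s + suc s) + c
  re₂ = solve-∀

nonDeg : ∀ {n} (R : Rel n) (S : Fin n → Bool) v → # S ≡ # (λ x → S x ∧ R v x) + # (λ x → S x ∧ not (R v x))
nonDeg R S v = #-split S (R v)

clique : ∀ {n} (R : Rel n) → (∀ x y → R x y ≡ R y x) → ∀ r S j → j ≤ r → 1 ≤ # S → (∀ v → S v ≡ true → r * # (λ x → S x ∧ not (R v x)) < # S) → Multi R S (suc j) 1
clique R R-sym r S zero _ pos nn with #-pos S pos
... | v , Sv = multi (λ _ _ → v) (λ { _ zero zero _ → refl }) (λ _ _ → Sv) λ { zero zero _ _ ne → ⊥-elim (ne refl) }
clique {n} R R-sym r S (suc j) le pos nn with clique R R-sym r S j (<⇒≤ le) pos nn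
... | M with avoid S (λ i x → not (R (part M i zero) x)) few
  where
  V = # S
  few : ∑ (λ i → # (λ x → S x ∧ not (R (part M i zero) x))) < V
  few = *-cancelˡ-< r _ _ (begin-strict
      r * ∑ nn′                            ≡⟨ sym (∑-*ˡ r nn′) ⟩
      ∑ (λ i → r * nn′ i)                  <⟨ m<m+n _ (s≤s (z≤n {j})) ⟩
      ∑ (λ i → r * nn′ i) + suc j          ≡⟨ cong (∑ (λ i → r * nn′ i) +_) (sym (trans (∑-const {suc j} 1) (*-identityʳ (suc j)))) ⟩
      ∑ (λ i → r * nn′ i) + ∑ {suc j} (λ _ → 1) ≡⟨ sym (∑-distrib (λ i → r * nn′ i) (λ _ → 1)) ⟩
      ∑ (λ i → r * nn′ i + 1)              ≤⟨ ∑-bound {suc j} V (λ i → ≤-trans (≤-reflexive (+-comm _ 1)) (nn _ (part-in M i zero))) ⟩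
      suc j * V                            ≤⟨ *-monoˡ-≤ V le ⟩
      r * V ∎)
    where
    open ≤-Reasoning
    nn′ : Fin (suc j) → ℕ
    nn′ i = # (λ x → S x ∧ not (R (part M i zero) x))
... | u , Su , good = multi prt (λ { zero zero zero _ → refl ; (suc i) → part-inj M i }) (λ { zero _ → Su ; (suc i) → part-in M i }) crs
  where
  prt : Fin (suc (suc j)) → Fin 1 → Fin n
  prt zero _ = u
  prt (suc i) = part M i
  adjOf : ∀ i → R (part M i zero) u ≡ true
  adjOf i with bool-split (R (part M i zero) u)
  ... | inj₁ p = p
  ... | inj₂ p = ⊥-elim (t≢f (cong not p) (good i))
  crs : ∀ i i′ k k′ → i ≢ i′ → R (prt i k) (prt i′ k′) ≡ true
  crs zero zero _ _ ne = ⊥-elim (ne refl)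
  crs zero (suc i) zero zero ne = trans (R-sym _ _) (adjOf i)
  crs (suc i) zero zero zero ne = adjOf i
  crs (suc i) (suc i′) k k′ ne = cross M i i′ k k′ (ne ∘ cong suc)

-- Every vertex of S has fewer than (1/r - 1/(k+1))|S| non-neighbours in S.
FewMissing : ∀ {n} → ℕ → ℕ → Rel n → (Fin n → Bool) → Set
FewMissing k r R S = ∀ v → S v ≡ true → r * suc k * # (λ x → S x ∧ not (R v x)) + r * # S ≤ suc k * # S

enlarge : ∀ {n} k t r q → q ≡ suc t * (2 * suc k) → (R : Rel n) → (∀ x y → R x y ≡ R y x) → ∀ S → 2 * suc k * (2 ^ (suc r * q) * suc t) ≤ # S → FewMissing k (suc r) R S →
  Multi R S (suc r) q → Multi R S (suc (suc r)) (suc t)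
enlarge {n} k t r q q-eq R R-sym S big nn M = extend R-sym M good (λ v p → proj₁ (∧⁻ {S v} p)) (λ v p i → ⌊all⌋ v (proj₂ (∧⁻ {S v} p)) i)
    (*-cancelˡ-≤ (2 * K′) (≤-trans big goodMany))
  where
  K′ = suc k
  T = suc t
  ρ = suc r
  V = # S
  allGood? : ∀ v → Dec (∀ i → T ≤ # (λ j → R v (part M i j)))
  allGood? v = all? λ i → T ≤? # (λ j → R v (part M i j))
  ⌊all⌋ : ∀ v → ⌊ allGood? v ⌋ ≡ true → ∀ i → T ≤ # (λ j → R v (part M i j))
  ⌊all⌋ v p = dec⌊⌋ p
  good : Fin n → Bool
  good v = S v ∧ ⌊ allGood? v ⌋
  bad : Fin n → Bool
  bad v = S v ∧ not ⌊ allGood? v ⌋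
  miss : Fin n → ℕ
  miss v = ∑ (λ i → # (λ j → not (R v (part M i j))))
  bad-miss : ∀ v → ⌊ allGood? v ⌋ ≡ false → q ≤ miss v + T
  bad-miss v f = by (any? (λ i → # (λ j → R v (part M i j)) <? T))
    where
    by : Dec (∃ λ i → # (λ j → R v (part M i j)) < T) → q ≤ miss v + T
    by (no none) = ⊥-elim (⌊⌋false⁻ f (λ i → ≮⇒≥ (λ lt → none (i , lt))))
    by (yes (i , lt)) = ≤-trans (≤-reflexive (sym (trans (sym (#-split (λ _ → true) (λ j → R v (part M i j)))) (#-true (λ _ → refl)))))
        (≤-trans (≤-reflexive (+-comm (# (λ j → R v (part M i j))) _)) (+-mono-≤ (∑-term (λ i → # (λ j → not (R v (part M i j)))) i) (<⇒≤ lt)))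
  missSum : K′ * ∑ (λ v → ⟦ S v ⟧ * miss v) + q * ρ * V ≤ q * K′ * V
  missSum = *-cancelˡ-≤ ρ (begin
      ρ * (K′ * ∑ (λ v → ⟦ S v ⟧ * miss v) + q * ρ * V)        ≡⟨ re₁ ρ K′ (∑ (λ v → ⟦ S v ⟧ * miss v)) q V ⟩
      ρ * K′ * ∑ (λ v → ⟦ S v ⟧ * miss v) + ρ * (q * (ρ * V))  ≡⟨ cong (λ z → ρ * K′ * z + ρ * (q * (ρ * V))) exchange ⟩
      ρ * K′ * ∑∑ nn′ + ρ * (q * (ρ * V))                     ≡⟨ cong₂ _+_ (sym (trans (∑-cong (λ i → ∑-*ˡ (ρ * K′) (nn′ i))) (∑-*ˡ (ρ * K′) (λ i → ∑ (nn′ i))))) (sym (trans (∑-cong {ρ} (λ i → ∑-const {q} (ρ * V))) (∑-const {ρ} (q * (ρ * V))))) ⟩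
      ∑∑ (λ i j → ρ * K′ * nn′ i j) + ∑ {ρ} (λ i → ∑ {q} (λ j → ρ * V)) ≡⟨ sym (trans (∑-cong {ρ} (λ i → ∑-distrib {q} (λ j → ρ * K′ * nn′ i j) _)) (∑-distrib {ρ} (λ i → ∑ (λ j → ρ * K′ * nn′ i j)) _)) ⟩
      ∑∑ (λ i j → ρ * K′ * nn′ i j + ρ * V)                   ≤⟨ ∑-bound {ρ} _ (λ i → ∑-bound {q} _ (λ j → nn _ (part-in M i j))) ⟩
      ρ * (q * (K′ * V))                                      ≡⟨ cong (ρ *_) (sym (*-assoc q K′ V)) ⟩
      ρ * (q * K′ * V) ∎)
    where
    open ≤-Reasoning
    nn′ : Fin ρ → Fin q → ℕ
    nn′ i j = # (λ x → S x ∧ not (R (part M i j) x))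
    re₁ : ∀ r k x q v → r * (k * x + q * r * v) ≡ r * k * x + r * (q * (r * v))
    re₁ = solve-∀
    exchange : ∑ (λ v → ⟦ S v ⟧ * miss v) ≡ ∑∑ nn′
    exchange = trans (∑-cong (λ v → trans (sym (∑-*ˡ ⟦ S v ⟧ (λ i → # (λ j → not (R v (part M i j)))))) (∑-cong (λ i → trans (sym (∑-*ˡ ⟦ S v ⟧ (λ j → ⟦ not (R v (part M i j)) ⟧)))
        (∑-cong (λ j → trans (cong (λ b → ⟦ S v ⟧ * ⟦ not b ⟧) (R-sym v (part M i j))) (sym (⟦∧⟧ (S v) _))))))))
      (trans (∑-swap (λ v i → ∑ (λ j → ⟦ S v ∧ not (R (part M i j) v) ⟧))) (∑-cong (λ i → ∑-swap (λ v j → ⟦ S v ∧ not (R (part M i j) v) ⟧))))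
  badSum : # bad * q ≤ ∑ (λ v → ⟦ S v ⟧ * miss v) + # bad * T
  badSum = ≤-trans (≤-reflexive (sym (∑-*ʳ (λ v → ⟦ bad v ⟧) q))) (≤-trans (∑-mono cell) (≤-reflexive (trans (∑-distrib (λ v → ⟦ S v ⟧ * miss v) _) (cong (∑ (λ v → ⟦ S v ⟧ * miss v) +_) (∑-*ʳ (λ v → ⟦ bad v ⟧) T)))))
    where
    cell : ∀ v → ⟦ bad v ⟧ * q ≤ ⟦ S v ⟧ * miss v + ⟦ bad v ⟧ * T
    cell v = by (bool-split (bad v))
      where
      by : bad v ≡ true ⊎ bad v ≡ false → ⟦ bad v ⟧ * q ≤ ⟦ S v ⟧ * miss v + ⟦ bad v ⟧ * T
      by (inj₂ f) = ≤-trans (≤-reflexive (cong (_* q) (⟦⟧-false f))) z≤n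
      by (inj₁ b) = let (sv , nb) = ∧⁻ {S v} b in ≤-trans (≤-reflexive (trans (cong (_* q) (⟦⟧-true b)) (*-identityˡ q))) (≤-trans (bad-miss v (not⁻ nb))
            (≤-reflexive (sym (cong₂ _+_ (trans (cong (_* miss v) (⟦⟧-true sv)) (*-identityˡ _)) (trans (cong (_* T) (⟦⟧-true b)) (*-identityˡ T))))))
  goodMany : V ≤ 2 * K′ * # good
  goodMany = finish k (# bad) (# good) V (∑ (λ v → ⟦ S v ⟧ * miss v)) q r q-eq (trans (#-split S (λ v → ⌊ allGood? v ⌋)) (+-comm (# good) (# bad))) missSum badSum
    where
    finish : ∀ k b g V Σm q r → q ≡ T * (2 * suc k) → V ≡ b + g → suc k * Σm + q * suc r * V ≤ q * suc k * V → b * q ≤ Σm + b * T → V ≤ 2 * suc k * g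
    finish k b g V Σm q r refl refl ms bs = +-cancelˡ-≤ V _ _ (≤-trans two (+-monoˡ-≤ (2 * suc k * g) (m≤m+n b g)))
      where
      ms′ : Σm + 2 * T * suc r * V ≤ 2 * T * suc k * V
      ms′ = *-cancelˡ-≤ (suc k) (≤-trans (≤-reflexive (re₁ (suc k) Σm T (suc r) V)) (≤-trans ms (≤-reflexive (re₂ (suc k) T V))))
        where
        re₁ : ∀ k x t r v → k * (x + 2 * t * r * v) ≡ k * x + t * (2 * k) * r * v
        re₁ = solve-∀
        re₂ : ∀ k t v → t * (2 * k) * k * v ≡ k * (2 * t * k * v)
        re₂ = solve-∀
      both : 2 * suc k * b + 2 * suc r * V ≤ b + 2 * suc k * V
      both = *-cancelˡ-≤ T (+-cancelʳ-≤ Σm _ _ (≤-trans (≤-reflexive (re₁ T (suc k) b (suc r) V Σm)) (≤-trans (+-mono-≤ bs ms′) (≤-reflexive (re₂ Σm b T (suc k) V)))))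
        where
        re₁ : ∀ t k b r v x → t * (2 * k * b + 2 * r * v) + x ≡ b * (t * (2 * k)) + (x + 2 * t * r * v)
        re₁ = solve-∀
        re₂ : ∀ x b t k v → (x + b * t) + 2 * t * k * v ≡ t * (b + 2 * k * v) + x
        re₂ = solve-∀
      two : V + V ≤ b + 2 * suc k * g
      two = +-cancelˡ-≤ (2 * suc k * b) _ _ (≤-trans (+-monoʳ-≤ (2 * suc k * b) (≤-trans (≤-reflexive (re₁ V)) (*-monoˡ-≤ V (*-monoʳ-≤ 2 (s≤s (z≤n {r}))))))
          (≤-trans both (≤-reflexive (re₂ b (suc k) g))))
        where
        re₁ : ∀ v → v + v ≡ 2 * 1 * v
        re₁ = solve-∀
        re₂ : ∀ b k g → b + 2 * k * (b + g) ≡ 2 * k * b + (b + 2 * k * g)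
        re₂ = solve-∀

minDegree : ∀ k t r → ∃ λ N → ∀ {n} (R : Rel n) → (∀ x y → R x y ≡ R y x) → ∀ S → N ≤ # S → FewMissing k r R S → Multi R S (suc r) (suc t)
minDegree k t zero = suc t , λ R _ S le _ → multi (λ _ → proj₁ (pick S le)) (λ _ i j e → proj₁ (proj₂ (pick S le)) e) (λ _ → proj₂ (proj₂ (pick S le)))
  λ { zero zero _ _ ne → ⊥-elim (ne refl) }
minDegree k t (suc r) = from (minDegree k (suc t * (2 * suc k) ∸ 1) r)
  where
  q′ = suc t * (2 * suc k) ∸ 1
  from : (∃ λ N → ∀ {n} (R : Rel n) → (∀ x y → R x y ≡ R y x) → ∀ S → N ≤ # S → FewMissing k r R S → Multi R S (suc r) (suc q′)) →
    ∃ λ N → ∀ {n} (R : Rel n) → (∀ x y → R x y ≡ R y x) → ∀ S → N ≤ # S → FewMissing k (suc r) R S → Multi R S (suc (suc r)) (suc t)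
  from (N , ih) = N ⊔ big , λ R R-sym S le nn → enlarge k t r (suc q′) (m+[n∸m]≡n {1} {suc t * (2 * suc k)} (s≤s z≤n)) R R-sym S (≤-trans (m≤n⊔m N big) le) nn
      (ih R R-sym S (≤-trans (m≤m⊔n N big) le) (λ v Sv → ≤-trans (+-mono-≤ (*-monoˡ-≤ (# (λ x → S x ∧ not (R v x))) (*-monoˡ-≤ (suc k) (n≤1+n r))) (*-monoˡ-≤ (# S) (n≤1+n r))) (nn v Sv)))
    where
    big = 2 * suc k * (2 ^ (suc r * suc q′) * suc t)

edges-ES : ∀ k t r → 1 ≤ r → ∃ λ N → ∀ {n} (R : Rel n) → (∀ x y → R x y ≡ R y x) → ¬ Multi R (λ _ → true) (suc r) (suc t) →
  r * suc k * e2 R ≤ (r * suc k + r ∸ suc k) * (n * n + n) + r * suc k * (N * N)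
edges-ES k t (suc r) _ = proj₁ mdr , λ {n} R R-sym none → ≤-trans (*-monoʳ-≤ (suc r * suc k) (e2≤in R)) (deletion a b (proj₁ mdr) R R-sym (hyp R R-sym none) n (λ _ → true) (#-true (λ _ → refl)))
  where
  mdr = minDegree k t (suc r)
  b = suc r * suc k
  a = suc r * suc k + suc r ∸ suc k
  e2≤in : ∀ {n} (R : Rel n) → e2 R ≤ e2in R (λ _ → true)
  e2≤in R = ∑-mono (λ x → ∑-mono (λ y → ⟦⟧-mono (λ p → p)))
  hyp : ∀ {n} (R : Rel n) → (∀ x y → R x y ≡ R y x) → ¬ Multi R (λ _ → true) (suc (suc r)) (suc t) →
    ∀ S → proj₁ mdr ≤ # S → 1 ≤ # S → ∃ λ v → S v ≡ true × b * # (λ x → S x ∧ R v x) ≤ a * # S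
  hyp {n} R R-sym none S N≤ _ = by (any? (λ v → bool? (S v) ×-dec (b * # (λ x → S x ∧ R v x) ≤? a * # S)))
    where
    Low : Fin n → Set
    Low v = S v ≡ true × b * # (λ x → S x ∧ R v x) ≤ a * # S
    weaken : Multi R S (suc (suc r)) (suc t) → Multi R (λ _ → true) (suc (suc r)) (suc t)
    weaken (multi p i _ c) = multi p i (λ _ _ → refl) c
    cond : ¬ ∃ Low → FewMissing k (suc r) R S
    cond nov v Sv = +-cancelˡ-≤ (b * dg) _ _ (begin
        b * dg + (b * nd + suc r * # S)   ≡⟨ re b dg nd (suc r) (# S) ⟩
        b * (dg + nd) + suc r * # S       ≡⟨ cong (λ z → b * z + suc r * # S) (sym (nonDeg R S v)) ⟩
        b * # S + suc r * # S             ≡⟨ sym (*-distribʳ-+ (# S) b (suc r)) ⟩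
        (b + suc r) * # S                 ≡⟨ cong (_* # S) (sym (m∸n+n≡m {b + suc r} {suc k} (≤-trans (m≤m+n (suc k) (r * suc k)) (m≤m+n b (suc r))))) ⟩
        (a + suc k) * # S                 ≡⟨ *-distribʳ-+ (# S) a (suc k) ⟩
        a * # S + suc k * # S             ≤⟨ +-monoˡ-≤ (suc k * # S) (<⇒≤ (≰⇒> (λ le → nov (v , Sv , le)))) ⟩
        b * dg + suc k * # S ∎)
      where
      open ≤-Reasoning
      dg = # (λ x → S x ∧ R v x)
      nd = # (λ x → S x ∧ not (R v x))
      re : ∀ b d e r s → b * d + (b * e + r * s) ≡ b * (d + e) + r * s
      re = solve-∀
    by : Dec (∃ Low) → ∃ Low
    by (yes w) = w
    by (no nov) = ⊥-elim (none (weaken (proj₂ mdr R R-sym S N≤ (cond nov))))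

edges-clique : ∀ r {n} (R : Rel n) → (∀ x y → R x y ≡ R y x) → ¬ Multi R (λ _ → true) (suc (suc r)) 1 → suc r * e2 R ≤ r * (n * n + n) + suc r
edges-clique r {n} R R-sym none = ≤-trans (*-monoʳ-≤ (suc r) (∑-mono (λ x → ∑-mono (λ y → ⟦⟧-mono (λ p → p)))))
    (≤-trans (deletion r (suc r) 1 R R-sym hyp n (λ _ → true) (#-true (λ _ → refl))) (≤-reflexive (cong (r * (n * n + n) +_) (*-identityʳ (suc r)))))
  where
  hyp : ∀ S → 1 ≤ # S → 1 ≤ # S → ∃ λ v → S v ≡ true × suc r * # (λ x → S x ∧ R v x) ≤ r * # S
  hyp S pos _ = by (any? (λ v → bool? (S v) ×-dec (suc r * # (λ x → S x ∧ R v x) ≤? r * # S)))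
    where
    Low : Fin n → Set
    Low v = S v ≡ true × suc r * # (λ x → S x ∧ R v x) ≤ r * # S
    weaken : Multi R S (suc (suc r)) 1 → Multi R (λ _ → true) (suc (suc r)) 1
    weaken (multi p i _ c) = multi p i (λ _ _ → refl) c
    cond : ¬ ∃ Low → ∀ v → S v ≡ true → suc r * # (λ x → S x ∧ not (R v x)) < # S
    cond nov v Sv = +-cancelˡ-< (suc r * dg) _ _ (begin-strict
        suc r * dg + suc r * nd   ≡⟨ sym (*-distribˡ-+ (suc r) dg nd) ⟩
        suc r * (dg + nd)         ≡⟨ cong (suc r *_) (sym (nonDeg R S v)) ⟩
        # S + r * # S             ≡⟨ +-comm (# S) _ ⟩
        r * # S + # S             <⟨ +-monoˡ-< (# S) (≰⇒> (λ le → nov (v , Sv , le))) ⟩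
        suc r * dg + # S ∎)
      where
      open ≤-Reasoning
      dg = # (λ x → S x ∧ R v x)
      nd = # (λ x → S x ∧ not (R v x))
    by : Dec (∃ Low) → ∃ Low
    by (yes w) = w
    by (no nov) = ⊥-elim (none (weaken (clique R R-sym (suc r) S (suc r) ≤-refl pos (cond nov))))

-- Extending stars to edge-disjoint copies of H

#-∨ : ∀ {n} (T p q : Fin n → Bool) → # (λ t → T t ∧ (p t ∨ q t)) ≤ # (λ t → T t ∧ p t) + # (λ t → T t ∧ q t)
#-∨ T p q = ≤-trans (∑-mono (λ t → cell (T t) (p t) (q t))) (≤-reflexive (∑-distrib (λ t → ⟦ T t ∧ p t ⟧) _))
  where
  cell : ∀ a b c → ⟦ a ∧ (b ∨ c) ⟧ ≤ ⟦ a ∧ b ⟧ + ⟦ a ∧ c ⟧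
  cell true b c = ⟦∨⟧ b c
  cell false b c = ≤-trans (≤-reflexive (⟦⟧-false refl)) z≤n

#-δ≤1 : ∀ {n} (T : Fin n → Bool) x → # (λ t → T t ∧ (t == x)) ≤ 1
#-δ≤1 T x = ∑-atMost1 _ (λ t → ⟦⟧≤1 _) (λ t t′ p q → trans (==⇒≡ (proj₂ (∧⁻ {T t} (⟦⟧⇒ p)))) (sym (==⇒≡ (proj₂ (∧⁻ {T t′} (⟦⟧⇒ q))))))

module Star {h : ℕ} (H : Graph h) (v0 : Fin h) (indep : ∀ i j → adj H v0 i ≡ true → adj H v0 j ≡ true → adj H i j ≡ false) where

  isStar : Fin h → Bool
  isStar i = (i == v0) ∨ adj H v0 i

  leaf⇒star : ∀ {i} → adj H v0 i ≡ true → isStar i ≡ true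
  leaf⇒star {i} a = ∨⁺ʳ {i == v0} a

  star⇒ : ∀ {i} → isStar i ≡ true → i ≡ v0 ⊎ adj H v0 i ≡ true
  star⇒ {i} p with ∨⁻ {i == v0} p
  ... | inj₁ q = inj₁ (==⇒≡ q)
  ... | inj₂ q = inj₂ q

  module Embed {n : ℕ} (permit : Rel n) (permit-sym : ∀ x y → permit x y ≡ permit y x) (T Ov : Fin n → Bool) (σ : Fin h → Fin n)
               (σ-inj : ∀ i j → isStar i ≡ true → isStar j ≡ true → σ i ≡ σ j → i ≡ j) (B : ℕ)
               (leaf-few : ∀ i → adj H v0 i ≡ true → # (λ t → T t ∧ not (permit (σ i) t)) ≤ B)
               (ext-few : ∀ x → T x ≡ true → Ov x ≡ false → # (λ t → T t ∧ not (permit x t)) ≤ B)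
               (room : # (λ t → T t ∧ Ov t) + h * (1 + B) < # T) where

    InA : ℕ → Fin h → Set
    InA k i = isStar i ≡ true ⊎ toℕ i < k

    record State (k : ℕ) : Set where
      field
        map′ : Fin h → Fin n
        on-star : ∀ i → isStar i ≡ true → map′ i ≡ σ i
        inj-A : ∀ i j → InA k i → InA k j → map′ i ≡ map′ j → i ≡ j
        ext-A : ∀ i → InA k i → isStar i ≡ false → T (map′ i) ≡ true × Ov (map′ i) ≡ false
        edge-A : ∀ i j → InA k i → InA k j → adj H i j ≡ true → i ≢ v0 → j ≢ v0 → permit (map′ i) (map′ j) ≡ true
    open State

    start : State 0
    start = record
      { map′ = σ
      ; on-star = λ _ _ → refl
      ; inj-A = λ { i j (inj₁ p) (inj₁ q) → σ-inj i j p q }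
      ; ext-A = λ { i (inj₁ p) q → ⊥-elim (t≢f p q) }
      ; edge-A = λ { i j (inj₁ p) (inj₁ q) a ni nj → ⊥-elim (noedge i j (star⇒ p) (star⇒ q) a ni nj) } }
      where
      noedge : ∀ i j → i ≡ v0 ⊎ adj H v0 i ≡ true → j ≡ v0 ⊎ adj H v0 j ≡ true → adj H i j ≡ true → i ≢ v0 → j ≢ v0 → ⊥
      noedge i j (inj₁ e) _ _ ni _ = ni e
      noedge i j _ (inj₁ e) _ _ nj = nj e
      noedge i j (inj₂ p) (inj₂ q) a _ _ = t≢f a (indep i j p q)

    step : ∀ k → k < h → State k → State (suc k)
    step k k<h s with bool-split (isStar (fromℕ< k<h))
    ... | inj₁ st = record { map′ = map′ s ; on-star = on-star s ; inj-A = λ i j p q → inj-A s i j (dn p) (dn q) ; ext-A = λ i p → ext-A s i (dn p) ; edge-A = λ i j p q → edge-A s i j (dn p) (dn q) }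
      where
      dn : ∀ {i} → InA (suc k) i → InA k i
      dn (inj₁ p) = inj₁ p
      dn {i} (inj₂ p) with m≤n⇒m<n∨m≡n (≤-pred p)
      ... | inj₁ lt = inj₂ lt
      ... | inj₂ e = inj₁ (subst (λ z → isStar z ≡ true) (toℕ-injective (trans (toℕ-fromℕ< k<h) (sym e))) st)
    ... | inj₂ ns = result
      where
      kv = fromℕ< k<h
      f = map′ s
      inA? : ∀ i → Dec (InA k i)
      inA? i with bool? (isStar i) | toℕ i <? k
      ... | yes p | _ = yes (inj₁ p)
      ... | no _ | yes q = yes (inj₂ q)
      ... | no p | no q = no λ { (inj₁ a) → p a ; (inj₂ b) → q b }
      rel : Fin h → Bool
      rel j = ⌊ inA? j ⌋ ∧ adj H kv j
      bad : Fin (suc h) → Fin n → Bool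
      bad zero t = Ov t
      bad (suc j) t = (t == f j) ∨ (rel j ∧ not (permit (f j) t))
      relBound : ∀ j → # (λ t → T t ∧ (rel j ∧ not (permit (f j) t))) ≤ B
      relBound j with bool-split (rel j)
      ... | inj₂ r = ≤-trans (≤-reflexive (#-none (λ t p → t≢f (proj₁ (∧⁻ {rel j} (proj₂ (∧⁻ {T t} p)))) r))) z≤n
      ... | inj₁ r with ∧⁻ {⌊ inA? j ⌋} r
      ...   | ia , a = ≤-trans (#-mono (λ t p → ∧⁺ (proj₁ (∧⁻ {T t} p)) (proj₂ (∧⁻ {rel j} (proj₂ (∧⁻ {T t} p)))))) (by (bool-split (isStar j)))
        where
        by : isStar j ≡ true ⊎ isStar j ≡ false → # (λ t → T t ∧ not (permit (f j) t)) ≤ B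
        by (inj₂ nsj) with ext-A s j (dec⌊⌋ ia) nsj
        ... | Tj , Oj = ext-few _ Tj Oj
        by (inj₁ sj) with star⇒ sj
        ... | inj₁ refl = ⊥-elim (t≢f (∨⁺ʳ {kv == v0} (trans (adj-sym H v0 kv) a)) ns)
        ... | inj₂ lf = subst (λ z → # (λ t → T t ∧ not (permit z t)) ≤ B) (sym (on-star s j sj)) (leaf-few j lf)
      few : ∑ (λ j → # (λ t → T t ∧ bad j t)) < # T
      few = ≤-trans (s≤s (≤-trans (≤-reflexive (∑-suc (λ j → # (λ t → T t ∧ bad j t)))) (+-monoʳ-≤ (# (λ t → T t ∧ Ov t)) (∑-bound {h} (1 + B) (λ j →
          ≤-trans (#-∨ T (λ t → t == f j) (λ t → rel j ∧ not (permit (f j) t))) (+-mono-≤ (#-δ≤1 T (f j)) (relBound j))))))) room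
      found = avoid T bad few
      t = proj₁ found
      Tt = proj₁ (proj₂ found)
      ok = proj₂ (proj₂ found)
      fresh : ∀ j → t ≢ f j
      fresh j e = t≢f (∨⁺ˡ {t == f j} (⌊⌋dec e)) (ok (suc j))
      permitted : ∀ j → InA k j → adj H kv j ≡ true → permit (f j) t ≡ true
      permitted j ia a with bool-split (permit (f j) t)
      ... | inj₁ p = p
      ... | inj₂ p = ⊥-elim (t≢f (∨⁺ʳ {t == f j} (∧⁺ {rel j} (∧⁺ (⌊⌋dec ia) a) (not⁺ p))) (ok (suc j)))
      g : Fin h → Fin n
      g i = if i == kv then t else f i
      g-o : ∀ {i} → i ≢ kv → g i ≡ f i
      g-o {i} e = cong (λ b → if b then t else f i) (==-≢ e)
      dn : ∀ {i} → i ≢ kv → InA (suc k) i → InA k i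
      dn _ (inj₁ p) = inj₁ p
      dn {i} ne (inj₂ p) with m≤n⇒m<n∨m≡n (≤-pred p)
      ... | inj₁ lt = inj₂ lt
      ... | inj₂ e = ⊥-elim (ne (toℕ-injective (trans e (sym (toℕ-fromℕ< k<h)))))
      result : State (suc k)
      result = record
        { map′ = g
        ; on-star = λ i p → trans (g-o (λ e → t≢f (subst (λ z → isStar z ≡ true) e p) ns)) (on-star s i p)
        ; inj-A = injg
        ; ext-A = extg
        ; edge-A = edgeg }
        where
        injg : ∀ i j → InA (suc k) i → InA (suc k) j → g i ≡ g j → i ≡ j
        injg i j p q e with i ≟ kv | j ≟ kv
        ... | yes a | yes b = trans a (sym b)
        ... | yes a | no b = ⊥-elim (fresh j e)
        ... | no a | yes b = ⊥-elim (fresh i (sym e))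
        ... | no a | no b = inj-A s i j (dn a p) (dn b q) e
        extg : ∀ i → InA (suc k) i → isStar i ≡ false → T (g i) ≡ true × Ov (g i) ≡ false
        extg i p q with i ≟ kv
        ... | yes a = Tt , ok zero
        ... | no a = ext-A s i (dn a p) q
        edgeg : ∀ i j → InA (suc k) i → InA (suc k) j → adj H i j ≡ true → i ≢ v0 → j ≢ v0 → permit (g i) (g j) ≡ true
        edgeg i j p q a ni nj with i ≟ kv | j ≟ kv
        ... | yes refl | yes refl = ⊥-elim (t≢f a (adj-irrefl H kv))
        ... | yes refl | no y = trans (permit-sym _ _) (permitted j (dn y q) a)
        ... | no y | yes refl = permitted i (dn y p) (trans (adj-sym H kv i) a)
        ... | no y | no y′ = edge-A s i j (dn y p) (dn y′ q) a ni nj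

    run : ∀ k → k ≤ h → State k
    run zero _ = start
    run (suc k) le = step k le (run k (<⇒≤ le))

    embedding : ∃ λ φ → Inj φ × (∀ i → isStar i ≡ true → φ i ≡ σ i) × (∀ i → isStar i ≡ false → T (φ i) ≡ true × Ov (φ i) ≡ false) ×
      (∀ i j → adj H i j ≡ true → i ≢ v0 → j ≢ v0 → permit (φ i) (φ j) ≡ true)
    embedding = map′ s , (λ i j → inj-A s i j (inj₂ (toℕ<n i)) (inj₂ (toℕ<n j))) , on-star s , (λ i → ext-A s i (inj₂ (toℕ<n i))) , λ i j → edge-A s i j (inj₂ (toℕ<n i)) (inj₂ (toℕ<n j))
      where
      s = run h ≤-refl

  extLoad leafLoad : ∀ {n} → Fin n → (Fin h → Fin n) → ℕ
  extLoad x φ = ∑ (λ i → ⟦ not (isStar i) ⟧ * δ (φ i) x)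
  leafLoad x φ = ∑ (λ i → ⟦ adj H v0 i ⟧ * δ (φ i) x)

  StarDisj : ∀ {n} → (Fin h → Fin n) → (Fin h → Fin n) → Set
  StarDisj σ τ = ∀ i j → adj H v0 i ≡ true → adj H v0 j ≡ true → ¬ (σ v0 ≡ τ v0 × σ i ≡ τ j) × ¬ (σ v0 ≡ τ j × σ i ≡ τ v0)

  module Greedy {n : ℕ} (F : Rel n) (F-sym : ∀ x y → F x y ≡ F y x) (μ κ D O : ℕ) (1≤κ : 1 ≤ κ) where

    record Task : Set where
      field
        σ : Fin h → Fin n
        T : Fin n → Bool
        σ-inj : ∀ i j → isStar i ≡ true → isStar j ≡ true → σ i ≡ σ j → i ≡ j
        σ-F : ∀ i → adj H v0 i ≡ true → F (σ v0) (σ i) ≡ false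
        leaf-few : ∀ i → adj H v0 i ≡ true → # (λ t → T t ∧ not (F (σ i) t)) ≤ μ
        T-few : ∀ x → T x ≡ true → # (λ t → T t ∧ not (F x t)) ≤ μ
        room : O + h * (1 + (μ + h * (κ + D))) < # T
    open Task

    record Placed (Q : List (Fin h → Fin n)) : Set where
      field
        packs : Packs H Q
        starF : All (λ φ → ∀ i → adj H v0 i ≡ true → F (φ v0) (φ i) ≡ false) Q
        extF : All (λ φ → ∀ i j → adj H i j ≡ true → i ≢ v0 → j ≢ v0 → F (φ i) (φ j) ≡ true) Q
        load : ∀ x → listSum (extLoad x) Q ≤ κ
    open Placed

    extLoad≤1 : ∀ {φ : Fin h → Fin n} → Inj φ → ∀ x → extLoad x φ ≤ 1
    extLoad≤1 {φ} φ-inj x = ∑-atMost1 _ (λ i → *-mono-≤ (⟦⟧≤1 (not (isStar i))) (⟦⟧≤1 (φ i == x))) (λ i j p q → φ-inj i j (trans (at i p) (sym (at j q))))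
      where
      at : ∀ i → 1 ≤ ⟦ not (isStar i) ⟧ * δ (φ i) x → φ i ≡ x
      at i p with bool-split (φ i == x)
      ... | inj₁ q = ==⇒≡ q
      ... | inj₂ q = ⊥-elim (1+n≰n (≤-trans p (≤-reflexive (trans (cong (⟦ not (isStar i) ⟧ *_) (⟦⟧-false q)) (*-zeroʳ ⟦ not (isStar i) ⟧)))))

    extLoad-0 : ∀ {φ : Fin h → Fin n} x → (∀ i → isStar i ≡ false → φ i ≢ x) → extLoad x φ ≡ 0
    extLoad-0 {φ} x off = ∑-zero cell
      where
      cell : ∀ i → ⟦ not (isStar i) ⟧ * δ (φ i) x ≡ 0
      cell i with bool-split (isStar i)
      ... | inj₁ p = cong (_* δ (φ i) x) (⟦⟧-false (cong not p))
      ... | inj₂ p = trans (cong (⟦ not (isStar i) ⟧ *_) (δ-≢ (off i p))) (*-zeroʳ ⟦ not (isStar i) ⟧)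

    -- F-edges at x used by φ: x is then not the centre.
    usedF : ∀ φ → (∀ i → adj H v0 i ≡ true → F (φ v0) (φ i) ≡ false) → ∀ x → ∑ (λ t → ⟦ F x t ⟧ * cv H φ x t) ≤ h * (extLoad x φ + leafLoad x φ)
    usedF φ sF x = begin
        ∑ (λ t → ⟦ F x t ⟧ * cv H φ x t)                                             ≡⟨ ∑-cong (λ t → trans (sym (∑-*ˡ ⟦ F x t ⟧ _)) (∑-cong (λ i → sym (∑-*ˡ ⟦ F x t ⟧ _)))) ⟩
        ∑ (λ t → ∑ (λ i → ∑ (λ j → w i j t)))                                        ≡⟨ trans (∑-swap (λ t i → ∑ (λ j → w i j t))) (∑-cong (λ i → ∑-swap (λ t j → w i j t))) ⟩
        ∑ (λ i → ∑ (λ j → ∑ (w i j)))                                                ≤⟨ ∑-mono (λ i → ∑-bound (c i) (λ j → cell i j)) ⟩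
        ∑ (λ i → h * c i)                                                            ≡⟨ ∑-*ˡ h c ⟩
        h * ∑ c                                                                      ≡⟨ cong (h *_) (∑-distrib (λ i → ⟦ not (isStar i) ⟧ * δ (φ i) x) _) ⟩
        h * (extLoad x φ + leafLoad x φ) ∎
      where
      open ≤-Reasoning
      w : Fin h → Fin h → Fin n → ℕ
      w i j t = ⟦ F x t ⟧ * (⟦ adj H i j ⟧ * (δ (φ i) x * δ (φ j) t))
      c : Fin h → ℕ
      c i = ⟦ not (isStar i) ⟧ * δ (φ i) x + ⟦ adj H v0 i ⟧ * δ (φ i) x
      wδ : ∀ i j t → w i j t ≤ δ (φ i) x * δ (φ j) t
      wδ i j t = ≤-trans (*-mono-≤ (⟦⟧≤1 (F x t)) (*-monoˡ-≤ (δ (φ i) x * δ (φ j) t) (⟦⟧≤1 (adj H i j)))) (≤-reflexive (trans (*-identityˡ _) (*-identityˡ _)))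
      sumw : ∀ i j → ∑ (w i j) ≤ δ (φ i) x
      sumw i j = ≤-trans (∑-mono (wδ i j)) (≤-reflexive (trans (∑-*ˡ (δ (φ i) x) (δ (φ j))) (trans (cong (δ (φ i) x *_) (∑-δ1 (φ j))) (*-identityʳ _))))
      cell : ∀ i j → ∑ (w i j) ≤ c i
      cell i j with bool-split (isStar i)
      ... | inj₂ ns = ≤-trans (sumw i j) (≤-trans (≤-reflexive (sym (trans (cong (_* δ (φ i) x) (⟦⟧-true (not⁺ ns))) (*-identityˡ _)))) (m≤m+n _ _))
      ... | inj₁ st with star⇒ st
      ...   | inj₂ lf = ≤-trans (sumw i j) (≤-trans (≤-reflexive (sym (trans (cong (_* δ (φ i) x) (⟦⟧-true lf)) (*-identityˡ _)))) (m≤n+m _ _))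
      ...   | inj₁ refl = ≤-trans (≤-reflexive (∑-zero zerow)) z≤n
        where
        zerow : ∀ t → w v0 j t ≡ 0
        zerow t with 1 ≤? w v0 j t
        ... | no q = n≤0⇒n≡0 (≮⇒≥ q)
        ... | yes q with bool-split (F x t) | bool-split (adj H v0 j) | term-wit H {b = adj H v0 j} {φ v0} {x} {φ j} {t}
        ...   | inj₂ f | _ | _ = cong (_* (⟦ adj H v0 j ⟧ * (δ (φ v0) x * δ (φ j) t))) (⟦⟧-false f)
        ...   | inj₁ f | _ | tw with tw (≤-trans q (≤-trans (*-monoˡ-≤ _ (⟦⟧≤1 (F x t))) (≤-reflexive (*-identityˡ _))))
        ...     | a , refl , refl = ⊥-elim (t≢f f (sF j a))

    place : ∀ Q → Placed Q → (τ : Task) → All (StarDisj (σ τ)) Q →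
      (∀ x → listSum (leafLoad x) Q ≤ D) → length Q * h ≤ κ * O →
      ∃ λ ξ → (∀ i → isStar i ≡ true → ξ i ≡ σ τ i) × Placed (ξ ∷ Q)
    place Q pl τ sd leafs len = ξ , on , record
        { packs = (ξ-inj ∷ proj₁ (packs pl)) , (disj ∷ proj₂ (packs pl))
        ; starF = (λ i a → starξ i a) ∷ starF pl
        ; extF = (λ i j a ni nj → proj₁ (∧⁻ {F (ξ i) (ξ j)} (edg i j a ni nj))) ∷ extF pl
        ; load = load′ }
      where
      Ov : Fin n → Bool
      Ov x = ⌊ κ ≤? listSum (extLoad x) Q ⌋
      permit : Rel n
      permit x t = F x t ∧ free H Q x t
      Ov-few : # (λ t → T τ t ∧ Ov t) ≤ O
      Ov-few = *-cancelˡ-≤ κ {{>-nonZero 1≤κ}} (≤-trans (*-monoʳ-≤ κ (#-mono (λ t p → proj₂ (∧⁻ {T τ t} p)))) (≤-trans (≤-reflexive (sym (∑-*ˡ κ (λ x → ⟦ Ov x ⟧))))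
          (≤-trans (∑-mono cell) (≤-trans (≤-reflexive (listSum-∑ (λ ξ x → extLoad x ξ) Q)) (≤-trans (listSum-bound {xs = Q} (All.tabulate (λ {ψ} _ → tot ψ))) len)))))
        where
        cell : ∀ x → κ * ⟦ Ov x ⟧ ≤ listSum (extLoad x) Q
        cell x with κ ≤? listSum (extLoad x) Q
        ... | yes le = ≤-trans (≤-trans (*-monoʳ-≤ κ (⟦⟧≤1 true)) (≤-reflexive (*-identityʳ κ))) le
        ... | no _ = ≤-trans (≤-reflexive (trans (cong (κ *_) (⟦⟧-false refl)) (*-zeroʳ κ))) z≤n
        tot : ∀ (ψ : Fin h → Fin n) → ∑ (λ x → extLoad x ψ) ≤ h
        tot ψ = ≤-trans (≤-reflexive (∑-swap (λ x i → ⟦ not (isStar i) ⟧ * δ (ψ i) x))) (≤-trans (∑-bound {h} 1 (λ i → ≤-trans (≤-reflexive (trans (∑-*ˡ ⟦ not (isStar i) ⟧ (δ (ψ i)))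
            (trans (cong (⟦ not (isStar i) ⟧ *_) (∑-δ1 (ψ i))) (*-identityʳ _)))) (⟦⟧≤1 _))) (≤-reflexive (*-identityʳ h)))
      few : ∀ x → # (λ t → T τ t ∧ not (F x t)) ≤ μ → # (λ t → T τ t ∧ not (permit x t)) ≤ μ + h * (κ + D)
      few x le = ≤-trans (∑-mono cell) (≤-trans (≤-reflexive (∑-distrib (λ t → ⟦ T τ t ∧ not (F x t) ⟧) _)) (+-mono-≤ le used))
        where
        cell : ∀ t → ⟦ T τ t ∧ not (permit x t) ⟧ ≤ ⟦ T τ t ∧ not (F x t) ⟧ + ⟦ F x t ⟧ * cvP H Q x t
        cell t = go (T τ t) (F x t) (cvP H Q x t)
          where
          go : ∀ a f k → ⟦ a ∧ not (f ∧ isZero k) ⟧ ≤ ⟦ a ∧ not f ⟧ + ⟦ f ⟧ * k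
          go a false k = m≤m+n _ _
          go a true zero = m≤m+n _ _
          go a true (suc k) = ≤-trans (⟦⟧≤1 _) (≤-trans (≤-trans (s≤s z≤n) (≤-reflexive (sym (trans (cong (_* suc k) (⟦⟧-true refl)) (*-identityˡ (suc k)))))) (m≤n+m _ ⟦ a ∧ not true ⟧))
        usedAll : ∀ Q → All (λ ξ → ∀ i → adj H v0 i ≡ true → F (ξ v0) (ξ i) ≡ false) Q → ∑ (λ t → ⟦ F x t ⟧ * cvP H Q x t) ≤ h * (listSum (extLoad x) Q + listSum (leafLoad x) Q)
        usedAll [] [] = ≤-trans (≤-reflexive (∑-zero (λ t → *-zeroʳ ⟦ F x t ⟧))) z≤n
        usedAll (ψ ∷ Q) (s ∷ ss) = ≤-trans (≤-reflexive (trans (∑-cong (λ t → *-distribˡ-+ ⟦ F x t ⟧ (cv H ψ x t) _)) (∑-distrib (λ t → ⟦ F x t ⟧ * cv H ψ x t) _)))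
          (≤-trans (+-mono-≤ (usedF ψ s x) (usedAll Q ss)) (≤-reflexive (re h (extLoad x ψ) (leafLoad x ψ) (listSum (extLoad x) Q) (listSum (leafLoad x) Q))))
          where
          re : ∀ h a b c d → h * (a + b) + h * (c + d) ≡ h * ((a + c) + (b + d))
          re = solve-∀
        used : ∑ (λ t → ⟦ F x t ⟧ * cvP H Q x t) ≤ h * (κ + D)
        used = ≤-trans (usedAll Q (starF pl)) (*-monoʳ-≤ h (+-mono-≤ (load pl x) (leafs x)))
      emb = Embed.embedding permit (λ x y → cong₂ _∧_ (F-sym x y) (cong isZero (cvP-sym H Q x y))) (T τ) Ov (σ τ) (σ-inj τ) (μ + h * (κ + D))
        (λ i a → few (σ τ i) (leaf-few τ i a)) (λ x Tx _ → few x (T-few τ x Tx)) (≤-trans (s≤s (+-monoˡ-≤ _ Ov-few)) (room τ))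
      ξ = proj₁ emb
      ξ-inj = proj₁ (proj₂ emb)
      on = proj₁ (proj₂ (proj₂ emb))
      ext = proj₁ (proj₂ (proj₂ (proj₂ emb)))
      edg = proj₂ (proj₂ (proj₂ (proj₂ emb)))
      onc : ξ v0 ≡ σ τ v0
      onc = on v0 (∨⁺ˡ (==-refl v0))
      onl : ∀ i → adj H v0 i ≡ true → ξ i ≡ σ τ i
      onl i a = on i (leaf⇒star a)
      starξ : ∀ i → adj H v0 i ≡ true → F (ξ v0) (ξ i) ≡ false
      starξ i a = trans (cong₂ F onc (onl i a)) (σ-F τ i a)
      load′ : ∀ x → extLoad x ξ + listSum (extLoad x) Q ≤ κ
      load′ x = by (bool-split (Ov x))
        where
        by : Ov x ≡ true ⊎ Ov x ≡ false → extLoad x ξ + listSum (extLoad x) Q ≤ κ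
        by (inj₁ o) = ≤-trans (≤-reflexive (cong (_+ listSum (extLoad x) Q) (extLoad-0 x (λ i ns e → t≢f o (subst (λ z → Ov z ≡ false) e (proj₂ (ext i ns))))))) (load pl x)
        by (inj₂ o) = ≤-trans (+-monoˡ-≤ (listSum (extLoad x) Q) (extLoad≤1 ξ-inj x)) (≰⇒> (⌊⌋false⁻ {d = κ ≤? listSum (extLoad x) Q} o))
      disj : All (Disj H ξ) Q
      disj = go Q sd (starF pl) (extF pl) (λ i j a ni nj → proj₂ (∧⁻ {F (ξ i) (ξ j)} (edg i j a ni nj)))
        where
        go : ∀ Q → All (StarDisj (σ τ)) Q → All (λ ξ → ∀ i → adj H v0 i ≡ true → F (ξ v0) (ξ i) ≡ false) Q → All (λ ξ → ∀ i j → adj H i j ≡ true → i ≢ v0 → j ≢ v0 → F (ξ i) (ξ j) ≡ true) Q →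
          (∀ i j → adj H i j ≡ true → i ≢ v0 → j ≢ v0 → free H Q (ξ i) (ξ j) ≡ true) → All (Disj H ξ) Q
        go [] _ _ _ _ = []
        go (ψ ∷ Q) (s ∷ ss) (f ∷ fs) (x ∷ xs) fr = dis ∷ go Q ss fs xs (λ i j a ni nj → zer (cv H ψ (ξ i) (ξ j)) (fr i j a ni nj))
          where
          zer : ∀ a {b} → isZero (a + b) ≡ true → isZero b ≡ true
          zer zero p = p
          star-case : ∀ j → adj H v0 j ≡ true → ∀ i′ j′ → adj H i′ j′ ≡ true → ξ v0 ≡ ψ i′ → ξ j ≡ ψ j′ → ⊥
          star-case j a i′ j′ a′ e e′ = by (i′ ≟ v0) (j′ ≟ v0)
            where
            by : Dec (i′ ≡ v0) → Dec (j′ ≡ v0) → ⊥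
            by (yes i≡) _ = proj₁ (s j j′ a (trans (cong (λ z → adj H z j′) (sym i≡)) a′)) (trans (sym onc) (trans e (cong ψ i≡)) , trans (sym (onl j a)) e′)
            by (no _) (yes j≡) = proj₂ (s j i′ a (trans (cong (λ z → adj H z i′) (sym j≡)) (trans (adj-sym H j′ i′) a′))) (trans (sym onc) e , trans (sym (onl j a)) (trans e′ (cong ψ j≡)))
            by (no p) (no q) = t≢f (x i′ j′ a′ p q) (trans (sym (cong₂ F e e′)) (starξ j a))
          dis : Disj H ξ ψ
          dis i j i′ j′ a a′ e e′ = by (i ≟ v0) (j ≟ v0)
            where
            by : Dec (i ≡ v0) → Dec (j ≡ v0) → ⊥
            by (yes i≡) _ = star-case j (trans (cong (λ z → adj H z j) (sym i≡)) a) i′ j′ a′ (trans (cong ξ (sym i≡)) e) e′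
            by (no _) (yes j≡) = star-case i (trans (cong (λ z → adj H z i) (sym j≡)) (trans (adj-sym H j i) a)) j′ i′ (trans (adj-sym H j′ i′) a′) (trans (cong ξ (sym j≡)) e′) e
            by (no p) (no q) = 1+n≰n (≤-trans (cv-edge H ψ i′ j′ a′) (≤-trans (≤-reflexive (cong₂ (cv H ψ) (sym e) (sym e′))) (≤-trans (m≤m+n _ (cvP H Q (ξ i) (ξ j))) (≤-reflexive (isZero⇒ (fr i j a p q))))))

    leafLoad-cong : ∀ x {φ ψ : Fin h → Fin n} → (∀ i → isStar i ≡ true → φ i ≡ ψ i) → leafLoad x φ ≡ leafLoad x ψ
    leafLoad-cong x {φ} {ψ} e = ∑-cong cell
      where
      cell : ∀ i → ⟦ adj H v0 i ⟧ * δ (φ i) x ≡ ⟦ adj H v0 i ⟧ * δ (ψ i) x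
      cell i with bool-split (adj H v0 i)
      ... | inj₁ a = cong (λ z → ⟦ adj H v0 i ⟧ * δ z x) (e i (leaf⇒star a))
      ... | inj₂ a = trans (cong (_* δ (φ i) x) (⟦⟧-false a)) (sym (cong (_* δ (ψ i) x) (⟦⟧-false a)))

    StarDisj-cong : ∀ {σ φ ψ : Fin h → Fin n} → (∀ i → isStar i ≡ true → φ i ≡ ψ i) → StarDisj σ ψ → StarDisj σ φ
    StarDisj-cong e s i j a b = (λ (p , q) → proj₁ (s i j a b) (trans p (e v0 (∨⁺ˡ (==-refl v0))) , trans q (e j (leaf⇒star b)))) ,
      λ (p , q) → proj₂ (s i j a b) (trans p (e j (leaf⇒star b)) , trans q (e v0 (∨⁺ˡ (==-refl v0))))

    record Result (τs : List Task) : Set where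
      field
        copies : List (Fin h → Fin n)
        placed : Placed copies
        leaves : ∀ x → listSum (leafLoad x) copies ≡ listSum (λ τ → leafLoad x (σ τ)) τs
        count : length copies ≡ length τs
        covered : All (λ τ → Any (λ φ → ∀ i → isStar i ≡ true → φ i ≡ σ τ i) copies) τs
        from : All (λ φ → Any (λ τ → ∀ i → isStar i ≡ true → φ i ≡ σ τ i) τs) copies
        apart : ∀ ρ → All (λ τ → StarDisj ρ (σ τ)) τs → All (StarDisj ρ) copies
    open Result

    greedy : ∀ τs → AllPairs (λ τ τ′ → StarDisj (σ τ) (σ τ′)) τs → (∀ x → listSum (λ τ → leafLoad x (σ τ)) τs ≤ D) → length τs * h ≤ κ * O → Result τs
    greedy [] _ _ _ = record
      { copies = [] ; placed = record { packs = [] , [] ; starF = [] ; extF = [] ; load = λ _ → z≤n } ; leaves = λ _ → refl ; count = refl ; covered = [] ; from = [] ; apart = λ _ _ → [] }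
    greedy (τ ∷ τs) (d ∷ ds) lf len = record
      { copies = proj₁ added ∷ copies r
      ; placed = proj₂ (proj₂ added)
      ; leaves = λ x → cong₂ _+_ (leafLoad-cong x on) (leaves r x)
      ; count = cong suc (count r)
      ; covered = here on ∷ All.map there (covered r)
      ; from = here on ∷ All.map there (from r)
      ; apart = λ { ρ (s ∷ ss) → StarDisj-cong on s ∷ apart r ρ ss } }
      where
      len′ : length τs * h ≤ κ * O
      len′ = ≤-trans (*-monoˡ-≤ h (n≤1+n (length τs))) len
      lf′ : ∀ x → listSum (λ τ → leafLoad x (σ τ)) τs ≤ D
      lf′ x = ≤-trans (m≤n+m (listSum (λ τ → leafLoad x (σ τ)) τs) (leafLoad x (σ τ))) (lf x)
      r : Result τs
      r = greedy τs ds lf′ len′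
      added = place (copies r) (placed r) τ (apart r (σ τ) d) (λ x → ≤-trans (≤-reflexive (leaves r x)) (lf′ x)) (≤-trans (≤-reflexive (cong (_* h) (count r))) len′)
      on : ∀ i → isStar i ≡ true → proj₁ added i ≡ σ τ i
      on = proj₁ (proj₂ added)

-- Covering an oriented graph by stars, up to fewer than d edges at each centre

chop : ∀ {n} d (fuel : ℕ) (p : Fin n → Bool) → # p ≤ fuel → ∃ λ (Ts : List (Fin (suc d) → Fin n)) →
  All (λ t → Inj t × (∀ s → p (t s) ≡ true)) Ts × AllPairs (λ t t′ → ∀ s s′ → t s ≢ t′ s′) Ts ×
  Σ (Fin n → Bool) λ lo → (∀ x → lo x ≡ true → p x ≡ true) × # lo ≤ d × (∀ x → p x ≡ true → lo x ≡ true ⊎ Any (λ t → ∃ λ s → t s ≡ x) Ts)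
chop {n} d fuel p le with # p ≤? d
... | yes small = [] , [] , [] , p , (λ _ q → q) , small , λ _ q → inj₁ q
chop d zero p le | no big = ⊥-elim (big (≤-trans le z≤n))
chop {n} d (suc fuel) p le | no big with pick p (≰⇒> big)
... | t , t-inj , t-in with chop d fuel (λ x → p x ∧ not ⌊ any? (λ s → t s ≟ x) ⌋) (≤-pred (≤-trans shrink le))
  where
  shrink : # (λ x → p x ∧ not ⌊ any? (λ s → t s ≟ x) ⌋) < # p
  shrink = ≤-trans (+-monoˡ-≤ _ (≤-trans (≤-reflexive (sym (⟦⟧-true (∧⁺ (t-in zero) (⌊⌋dec {d = any? (λ s → t s ≟ t zero)} (zero , refl)))))) (∑-term (λ x → ⟦ p x ∧ ⌊ any? (λ s → t s ≟ x) ⌋ ⟧) (t zero))))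
    (≤-reflexive (sym (#-split p (λ x → ⌊ any? (λ s → t s ≟ x) ⌋))))
... | Ts , all , apart , lo , lo⊂ , few , cov = t ∷ Ts , ((λ i j e → t-inj e) , t-in) ∷ All.map (λ (i , q) → i , λ s → proj₁ (∧⁻ {p _} (q s))) all ,
      All.map (λ {t′} (i , q) s s′ e → ⌊⌋false⁻ {d = any? (λ s → t s ≟ t′ s′)} (not⁻ (proj₂ (∧⁻ {p (t′ s′)} (q s′)))) (s , e)) all ∷ apart ,
      lo , (λ x q → proj₁ (∧⁻ {p x} (lo⊂ x q))) , few , cov′
  where
  cov′ : ∀ x → p x ≡ true → lo x ≡ true ⊎ Any (λ t → ∃ λ s → t s ≡ x) (t ∷ Ts)
  cov′ x q with bool-split ⌊ any? (λ s → t s ≟ x) ⌋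
  ... | inj₁ y = inj₂ (here (dec⌊⌋ y))
  ... | inj₂ y with cov x (∧⁺ q (not⁺ y))
  ...   | inj₁ l = inj₁ l
  ...   | inj₂ a = inj₂ (there a)

module StarCover {h : ℕ} (H : Graph h) (v0 : Fin h) (indep : ∀ i j → adj H v0 i ≡ true → adj H v0 j ≡ true → adj H i j ≡ false) (d : ℕ) (deg : # (adj H v0) ≡ suc d) where
  open Star H v0 indep

  private
    nbrs : Σ (Fin (suc d) → Fin h) λ f → Inj f × (∀ s → adj H v0 (f s) ≡ true) × (∀ i → adj H v0 i ≡ true → ∃ λ s → f s ≡ i)
    nbrs = subst (λ m → Σ (Fin m → Fin h) λ f → Inj f × (∀ s → adj H v0 (f s) ≡ true) × (∀ i → adj H v0 i ≡ true → ∃ λ s → f s ≡ i)) deg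
      (proj₁ e , (λ i j → proj₁ (proj₂ e)) , proj₁ (proj₂ (proj₂ e)) , proj₂ (proj₂ (proj₂ e)))
      where
      e = enum (adj H v0)
  nb = proj₁ nbrs
  nb-inj = proj₁ (proj₂ nbrs)
  nb-adj = proj₁ (proj₂ (proj₂ nbrs))
  nb-sur = proj₂ (proj₂ (proj₂ nbrs))

  starMap : ∀ {n} → Fin n → (Fin (suc d) → Fin n) → Fin h → Fin n
  starMap c t i with any? (λ s → nb s ≟ i)
  ... | yes (s , _) = t s
  ... | no _ = c

  starMap-leaf : ∀ {n} (c : Fin n) t s → starMap c t (nb s) ≡ t s
  starMap-leaf c t s with any? (λ s′ → nb s′ ≟ nb s)
  ... | yes (s′ , e) = cong t (nb-inj s′ s e)
  ... | no q = ⊥-elim (q (s , refl))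

  starMap-v0 : ∀ {n} (c : Fin n) t → starMap c t v0 ≡ c
  starMap-v0 c t with any? (λ s → nb s ≟ v0)
  ... | yes (s , e) = ⊥-elim (t≢f (subst (λ z → adj H v0 z ≡ true) e (nb-adj s)) (adj-irrefl H v0))
  ... | no _ = refl

  starMap-adj : ∀ {n} (c : Fin n) t i → adj H v0 i ≡ true → ∃ λ s → starMap c t i ≡ t s
  starMap-adj c t i a with nb-sur i a
  ... | s , refl = s , starMap-leaf c t s

  module _ {n k : ℕ} (F : Rel n) (F-sym : ∀ x y → F x y ≡ F y x) (μ κ D O : ℕ) (1≤κ : 1 ≤ κ)
           (p : Fin n → Fin k → Fin n → Bool) (Tg : Fin k → Fin n → Bool) (R : Rel n)
           (pR : ∀ c a x → p c a x ≡ true → R c x ≡ true)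
           (pF : ∀ c a x → p c a x ≡ true → F c x ≡ false)
           (p-class : ∀ c a a′ x → p c a x ≡ true → p c a′ x ≡ true → a ≡ a′)
           (p-asym : ∀ c a a′ x → p c a x ≡ true → p x a′ c ≡ true → ⊥)
           (p-load : ∀ x → ∑ (λ c → ∑ (λ a → ⟦ p c a x ⟧)) ≤ D)
           (p-total : ∑ (λ c → ∑ (λ a → # (p c a))) * h ≤ κ * O)
           (p-few : ∀ c a x → p c a x ≡ true → # (λ t → Tg a t ∧ not (F x t)) ≤ μ)
           (T-few : ∀ a x → Tg a x ≡ true → # (λ t → Tg a t ∧ not (F x t)) ≤ μ)
           (room : ∀ a → O + h * (1 + (μ + h * (κ + D))) < # (Tg a)) where
    open Greedy F F-sym μ κ D O 1≤κ
    open Task using (σ; σ-inj)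

    irr : ∀ c a x → p c a x ≡ true → x ≢ c
    irr c a x q refl = p-asym c a a c q q

    mkTask : ∀ c a (t : Fin (suc d) → Fin n) → Inj t → (∀ s → p c a (t s) ≡ true) → Task
    mkTask c a t t-inj t-in = record
      { σ = starMap c t ; T = Tg a ; σ-inj = s-inj
      ; σ-F = λ i q → trans (cong (λ z → F z (starMap c t i)) (starMap-v0 c t)) (trans (cong (F c) (proj₂ (starMap-adj c t i q))) (pF c a _ (t-in _)))
      ; leaf-few = λ i q → subst (λ z → # (λ t′ → Tg a t′ ∧ not (F z t′)) ≤ μ) (sym (proj₂ (starMap-adj c t i q))) (p-few c a _ (t-in _))
      ; T-few = T-few a ; room = room a }
      where
      s-inj : ∀ i j → isStar i ≡ true → isStar j ≡ true → starMap c t i ≡ starMap c t j → i ≡ j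
      s-inj i j si sj e with star⇒ si | star⇒ sj
      ... | inj₁ refl | inj₁ refl = refl
      ... | inj₁ refl | inj₂ lj = ⊥-elim (irr c a _ (t-in (proj₁ (starMap-adj c t j lj))) (trans (sym (proj₂ (starMap-adj c t j lj))) (trans (sym e) (starMap-v0 c t))))
      ... | inj₂ li | inj₁ refl = ⊥-elim (irr c a _ (t-in (proj₁ (starMap-adj c t i li))) (trans (sym (proj₂ (starMap-adj c t i li))) (trans e (starMap-v0 c t))))
      ... | inj₂ li | inj₂ lj with nb-sur i li | nb-sur j lj
      ...   | s , refl | s′ , refl = cong nb (t-inj s s′ (trans (sym (starMap-leaf c t s)) (trans e (starMap-leaf c t s′))))

    record TaskSet (c : Fin n) (a : Fin k) : Set where
      field
        tasks : List Task
        centred : All (λ τ → σ τ v0 ≡ c × (∀ i → adj H v0 i ≡ true → p c a (σ τ i) ≡ true)) tasks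
        apartT : AllPairs (λ τ τ′ → ∀ i j → adj H v0 i ≡ true → adj H v0 j ≡ true → σ τ i ≢ σ τ′ j) tasks
        lo : Fin n → Bool
        lo⊂ : ∀ x → lo x ≡ true → p c a x ≡ true
        lo-few : # lo ≤ d
        cov : ∀ x → p c a x ≡ true → lo x ≡ true ⊎ Any (λ τ → ∃ λ i → adj H v0 i ≡ true × σ τ i ≡ x) tasks
    open TaskSet

    taskSet : ∀ c a → TaskSet c a
    taskSet c a with chop d (# (p c a)) (p c a) ≤-refl
    ... | Ts , all , apart , lo , lo⊂ , few , cv′ = record
      { tasks = mk Ts all ; centred = mk-c Ts all ; apartT = mk-a Ts all apart ; lo = lo ; lo⊂ = lo⊂ ; lo-few = few ; cov = λ x q → [ inj₁ , (λ y → inj₂ (mk-any Ts all y)) ]′ (cv′ x q) }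
      where
      OK : (Fin (suc d) → Fin n) → Set
      OK t = Inj t × (∀ s → p c a (t s) ≡ true)
      mk : ∀ Ts → All OK Ts → List Task
      mk [] [] = []
      mk (t ∷ Ts) ((i , q) ∷ os) = mkTask c a t i q ∷ mk Ts os
      mk-c : ∀ Ts os → All (λ τ → σ τ v0 ≡ c × (∀ i → adj H v0 i ≡ true → p c a (σ τ i) ≡ true)) (mk Ts os)
      mk-c [] [] = []
      mk-c (t ∷ Ts) ((i , q) ∷ os) = (starMap-v0 c t , λ j aj → subst (λ z → p c a z ≡ true) (sym (proj₂ (starMap-adj c t j aj))) (q _)) ∷ mk-c Ts os
      mk-a : ∀ Ts os → AllPairs (λ t t′ → ∀ s s′ → t s ≢ t′ s′) Ts → AllPairs (λ τ τ′ → ∀ i j → adj H v0 i ≡ true → adj H v0 j ≡ true → σ τ i ≢ σ τ′ j) (mk Ts os)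
      mk-a [] [] [] = []
      mk-a (t ∷ Ts) ((i , q) ∷ os) (x ∷ xs) = go Ts os x ∷ mk-a Ts os xs
        where
        go : ∀ Ts os → All (λ t′ → ∀ s s′ → t s ≢ t′ s′) Ts → All (λ τ′ → ∀ i j → adj H v0 i ≡ true → adj H v0 j ≡ true → starMap c t i ≢ σ τ′ j) (mk Ts os)
        go [] [] [] = []
        go (t′ ∷ Ts) ((i , q) ∷ os) (y ∷ ys) = (λ i j ai aj e → y _ _ (trans (sym (proj₂ (starMap-adj c t i ai))) (trans e (proj₂ (starMap-adj c t′ j aj))))) ∷ go Ts os ys
      mk-any : ∀ {x} Ts os → Any (λ t → ∃ λ s → t s ≡ x) Ts → Any (λ τ → ∃ λ i → adj H v0 i ≡ true × σ τ i ≡ x) (mk Ts os)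
      mk-any (t ∷ Ts) (o ∷ os) (here (s , e)) = here (nb s , nb-adj s , trans (starMap-leaf c t s) e)
      mk-any (t ∷ Ts) (o ∷ os) (there y) = there (mk-any Ts os y)

    leaf-wit : ∀ x (τ : Task) → 1 ≤ leafLoad x (σ τ) → ∃ λ i → adj H v0 i ≡ true × σ τ i ≡ x
    leaf-wit x τ q with ∑-pos _ q
    ... | i , r with bool-split (adj H v0 i) | bool-split (σ τ i == x)
    ...   | inj₁ a | inj₁ e = i , a , ==⇒≡ e
    ...   | inj₂ a | _ = ⊥-elim (1+n≰n (≤-trans r (≤-reflexive (cong (_* δ (σ τ i) x) (⟦⟧-false a)))))
    ...   | inj₁ a | inj₂ e = ⊥-elim (1+n≰n (≤-trans r (≤-reflexive (trans (cong (⟦ adj H v0 i ⟧ *_) (⟦⟧-false e)) (*-zeroʳ ⟦ adj H v0 i ⟧)))))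

    leafLoad≤1 : ∀ x (τ : Task) → leafLoad x (σ τ) ≤ 1
    leafLoad≤1 x τ = ∑-atMost1 _ (λ i → *-mono-≤ (⟦⟧≤1 (adj H v0 i)) (⟦⟧≤1 (σ τ i == x))) (λ i j q r → σ-inj τ i j (leaf⇒star (proj₁ (at i q))) (leaf⇒star (proj₁ (at j r))) (trans (proj₂ (at i q)) (sym (proj₂ (at j r)))))
      where
      at : ∀ i → 1 ≤ ⟦ adj H v0 i ⟧ * δ (σ τ i) x → adj H v0 i ≡ true × σ τ i ≡ x
      at i r with bool-split (adj H v0 i) | bool-split (σ τ i == x)
      ...   | inj₁ a | inj₁ e = a , ==⇒≡ e
      ...   | inj₂ a | _ = ⊥-elim (1+n≰n (≤-trans r (≤-reflexive (cong (_* δ (σ τ i) x) (⟦⟧-false a)))))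
      ...   | inj₁ a | inj₂ e = ⊥-elim (1+n≰n (≤-trans r (≤-reflexive (trans (cong (⟦ adj H v0 i ⟧ *_) (⟦⟧-false e)) (*-zeroʳ ⟦ adj H v0 i ⟧)))))

    set-load : ∀ c a x → listSum (λ τ → leafLoad x (σ τ)) (tasks (taskSet c a)) ≤ ⟦ p c a x ⟧
    set-load c a x with bool-split (p c a x)
    ... | inj₂ f = ≤-trans (≤-reflexive (zero-all (tasks (taskSet c a)) (All.map (λ {τ} (_ , q) r → bad {τ} q r) (centred (taskSet c a))))) z≤n
      where
      bad : ∀ {τ} → (∀ i → adj H v0 i ≡ true → p c a (σ τ i) ≡ true) → 1 ≤ leafLoad x (σ τ) → ⊥
      bad {τ} q r with leaf-wit x τ r
      ... | i , ai , refl = t≢f (q i ai) f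
      zero-all : ∀ τs → All (λ τ → ¬ (1 ≤ leafLoad x (σ τ))) τs → listSum (λ τ → leafLoad x (σ τ)) τs ≡ 0
      zero-all [] [] = refl
      zero-all (τ ∷ τs) (z ∷ zs) = cong₂ _+_ (n≤0⇒n≡0 (≮⇒≥ z)) (zero-all τs zs)
    ... | inj₁ t = ≤-trans (once (tasks (taskSet c a)) (apartT (taskSet c a))) (≤-reflexive (sym (⟦⟧-true t)))
      where
      zero-all : ∀ τs → All (λ τ → ¬ (1 ≤ leafLoad x (σ τ))) τs → listSum (λ τ → leafLoad x (σ τ)) τs ≡ 0
      zero-all [] [] = refl
      zero-all (τ ∷ τs) (z ∷ zs) = cong₂ _+_ (n≤0⇒n≡0 (≮⇒≥ z)) (zero-all τs zs)
      once : ∀ τs → AllPairs (λ τ τ′ → ∀ i j → adj H v0 i ≡ true → adj H v0 j ≡ true → σ τ i ≢ σ τ′ j) τs → listSum (λ τ → leafLoad x (σ τ)) τs ≤ 1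
      once [] [] = z≤n
      once (τ ∷ τs) (y ∷ ys) with 1 ≤? leafLoad x (σ τ)
      ... | no q = ≤-trans (≤-reflexive (cong (_+ listSum (λ τ → leafLoad x (σ τ)) τs) (n≤0⇒n≡0 (≮⇒≥ q)))) (once τs ys)
      ... | yes q = ≤-trans (≤-reflexive (trans (cong (leafLoad x (σ τ) +_) (zero-all τs (All.map (λ {τ′} z r → clash τ′ z r) y))) (+-identityʳ _))) (leafLoad≤1 x τ)
        where
        clash : ∀ τ′ → (∀ i j → adj H v0 i ≡ true → adj H v0 j ≡ true → σ τ i ≢ σ τ′ j) → 1 ≤ leafLoad x (σ τ′) → ⊥
        clash τ′ z r with leaf-wit x τ q | leaf-wit x τ′ r
        ... | i , ai , e | j , aj , e′ = z i j ai aj (trans e (sym e′))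

    row : Fin n → List Task
    row c = concat (tabulate (λ a → tasks (taskSet c a)))

    allTasks : List Task
    allTasks = concat (tabulate row)

    all-load : ∀ x → listSum (λ τ → leafLoad x (σ τ)) allTasks ≤ ∑ (λ c → ∑ (λ a → ⟦ p c a x ⟧))
    all-load x = ≤-trans (≤-reflexive (trans (listSum-concat-tab (λ τ → leafLoad x (σ τ)) row) (∑-cong (λ c → listSum-concat-tab (λ τ → leafLoad x (σ τ)) (λ a → tasks (taskSet c a))))))
      (∑-mono (λ c → ∑-mono (λ a → set-load c a x)))

    all-length : length allTasks * h ≤ κ * O
    all-length = ≤-trans (*-monoˡ-≤ h (begin
        length allTasks                                                   ≡⟨ sym (*-identityʳ _) ⟩
        length allTasks * 1                                               ≡⟨ sym (listSum-const 1 allTasks) ⟩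
        listSum (λ _ → 1) allTasks                                        ≤⟨ mono allTasks ⟩
        listSum (λ τ → ∑ (λ x → leafLoad x (σ τ))) allTasks               ≡⟨ sym (listSum-∑ (λ τ x → leafLoad x (σ τ)) allTasks) ⟩
        ∑ (λ x → listSum (λ τ → leafLoad x (σ τ)) allTasks)               ≤⟨ ∑-mono all-load ⟩
        ∑ (λ x → ∑ (λ c → ∑ (λ a → ⟦ p c a x ⟧)))                         ≡⟨ trans (∑-swap (λ x c → ∑ (λ a → ⟦ p c a x ⟧))) (∑-cong (λ c → ∑-swap (λ x a → ⟦ p c a x ⟧))) ⟩
        ∑ (λ c → ∑ (λ a → # (p c a))) ∎)) p-total
      where
      open ≤-Reasoning
      each : ∀ τ → 1 ≤ ∑ (λ x → leafLoad x (σ τ))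
      each τ = ≤-trans (s≤s (z≤n {d})) (≤-reflexive (trans (sym deg) (trans (∑-cong (λ i → sym (trans (∑-*ˡ ⟦ adj H v0 i ⟧ (δ (σ τ i))) (trans (cong (⟦ adj H v0 i ⟧ *_) (∑-δ1 (σ τ i))) (*-identityʳ _)))))
        (sym (∑-swap (λ x i → ⟦ adj H v0 i ⟧ * δ (σ τ i) x))))))
      mono : ∀ τs → listSum (λ _ → 1) τs ≤ listSum (λ τ → ∑ (λ x → leafLoad x (σ τ))) τs
      mono [] = z≤n
      mono (τ ∷ τs) = +-mono-≤ (each τ) (mono τs)

    all-apart : AllPairs (λ τ τ′ → StarDisj (σ τ) (σ τ′)) allTasks
    all-apart = APP.concat⁺ (AllP.tabulate⁺ {f = row} row-apart) (APP.tabulate⁺ {f = row} (λ {c} {c′} ne →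
        AllP.concat⁺ (AllP.tabulate⁺ {f = λ a → tasks (taskSet c a)} (λ a → All.map (λ {τ} (tc , tp) →
          AllP.concat⁺ (AllP.tabulate⁺ {f = λ a′ → tasks (taskSet c′ a′)} (λ a′ → All.map (λ {τ′} (tc′ , tp′) → sdisj c a c′ a′ τ τ′ tc tp tc′ tp′ (λ i j _ _ ec _ → ne (trans (sym tc) (trans ec tc′)))) (centred (taskSet c′ a′))))) (centred (taskSet c a))))))
      where
      sdisj : ∀ c a c′ a′ (τ τ′ : Task) → σ τ v0 ≡ c → (∀ i → adj H v0 i ≡ true → p c a (σ τ i) ≡ true) → σ τ′ v0 ≡ c′ → (∀ i → adj H v0 i ≡ true → p c′ a′ (σ τ′ i) ≡ true) →
        (∀ i j → adj H v0 i ≡ true → adj H v0 j ≡ true → σ τ v0 ≡ σ τ′ v0 → σ τ i ≡ σ τ′ j → ⊥) → StarDisj (σ τ) (σ τ′)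
      sdisj c a c′ a′ τ τ′ refl tp refl tp′ nope i j ai aj = (λ (e , e′) → nope i j ai aj e e′) , λ (e , e′) → p-asym (σ τ′ v0) a′ a (σ τ v0)
        (subst (λ z → p (σ τ′ v0) a′ z ≡ true) (sym e) (tp′ j aj)) (subst (λ z → p (σ τ v0) a z ≡ true) e′ (tp i ai))
      row-apart : ∀ c → AllPairs (λ τ τ′ → StarDisj (σ τ) (σ τ′)) (row c)
      row-apart c = APP.concat⁺ (AllP.tabulate⁺ {f = λ a → tasks (taskSet c a)} (λ a → inside a (tasks (taskSet c a)) (centred (taskSet c a)) (apartT (taskSet c a))))
        (APP.tabulate⁺ {f = λ a → tasks (taskSet c a)} (λ {a} {a′} ne → All.map (λ {τ} (tc , tp) → All.map (λ {τ′} (tc′ , tp′) → sdisj c a c a′ τ τ′ tc tp tc′ tp′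
          (λ i j ai aj _ e → ne (p-class c a a′ _ (tp i ai) (subst (λ z → p c a′ z ≡ true) (sym e) (tp′ j aj))))) (centred (taskSet c a′))) (centred (taskSet c a))))
        where
        inside : ∀ a τs → All (λ τ → σ τ v0 ≡ c × (∀ i → adj H v0 i ≡ true → p c a (σ τ i) ≡ true)) τs → AllPairs (λ τ τ′ → ∀ i j → adj H v0 i ≡ true → adj H v0 j ≡ true → σ τ i ≢ σ τ′ j) τs →
          AllPairs (λ τ τ′ → StarDisj (σ τ) (σ τ′)) τs
        inside a [] [] [] = []
        inside a (τ ∷ τs) ((tc , tp) ∷ cs) (y ∷ ys) = go τs cs y ∷ inside a τs cs ys
          where
          go : ∀ τs → All (λ τ → σ τ v0 ≡ c × (∀ i → adj H v0 i ≡ true → p c a (σ τ i) ≡ true)) τs → All (λ τ′ → ∀ i j → adj H v0 i ≡ true → adj H v0 j ≡ true → σ τ i ≢ σ τ′ j) τs → All (λ τ′ → StarDisj (σ τ) (σ τ′)) τs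
          go [] [] [] = []
          go (τ′ ∷ τs) ((tc′ , tp′) ∷ cs) (z ∷ zs) = sdisj c a c a τ τ′ tc tp tc′ tp′ (λ i j ai aj _ e → z i j ai aj e) ∷ go τs cs zs

    starCover : ∃ λ Q → Packs H Q × All (EdgesIn H (λ x y → (R x y ∨ R y x) ∨ F x y)) Q ×
      Σ (Fin n → Fin k → Fin n → Bool) λ lo → (∀ c a → # (lo c a) ≤ d) × (∀ c a x → lo c a x ≡ true → p c a x ≡ true) × (∀ c a x → p c a x ≡ true → lo c a x ≡ true ⊎ 1 ≤ cvP H Q c x)
    starCover = Q , Placed.packs (Result.placed r) , edgesIn Q (Result.from r) (Placed.extF (Result.placed r)) ,
        (λ c a → lo (taskSet c a)) , (λ c a → lo-few (taskSet c a)) , (λ c a → lo⊂ (taskSet c a)) , covers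
      where
      r = greedy allTasks all-apart (λ x → ≤-trans (all-load x) (p-load x)) all-length
      Q = Result.copies r
      task-R : All (λ τ → ∀ i → adj H v0 i ≡ true → R (σ τ v0) (σ τ i) ≡ true) allTasks
      task-R = AllP.concat⁺ (AllP.tabulate⁺ {f = row} (λ c → AllP.concat⁺ (AllP.tabulate⁺ {f = λ a → tasks (taskSet c a)} (λ a → All.map (λ { (refl , tp) i ai → pR _ a _ (tp i ai) }) (centred (taskSet c a))))))
      starR : ∀ (φ : Fin h → Fin n) τs → All (λ τ → ∀ i → adj H v0 i ≡ true → R (σ τ v0) (σ τ i) ≡ true) τs → Any (λ τ → ∀ i → isStar i ≡ true → φ i ≡ σ τ i) τs → ∀ i → adj H v0 i ≡ true → R (φ v0) (φ i) ≡ true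
      starR φ (τ ∷ τs) (t ∷ _) (here e) i ai = trans (cong₂ R (e v0 (∨⁺ˡ (==-refl v0))) (e i (leaf⇒star ai))) (t i ai)
      starR φ (τ ∷ τs) (_ ∷ ts) (there y) = starR φ τs ts y
      edgesIn : ∀ Q → All (λ φ → Any (λ τ → ∀ i → isStar i ≡ true → φ i ≡ σ τ i) allTasks) Q → All (λ φ → ∀ i j → adj H i j ≡ true → i ≢ v0 → j ≢ v0 → F (φ i) (φ j) ≡ true) Q → All (EdgesIn H (λ x y → (R x y ∨ R y x) ∨ F x y)) Q
      edgesIn [] [] [] = []
      edgesIn (φ ∷ Q) (y ∷ ys) (x ∷ xs) = e ∷ edgesIn Q ys xs
        where
        e : EdgesIn H (λ x y → (R x y ∨ R y x) ∨ F x y) φ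
        e i j a with i ≟ v0 | j ≟ v0
        ... | yes refl | _ = ∨⁺ˡ {R (φ i) (φ j) ∨ R (φ j) (φ i)} (∨⁺ˡ (starR φ allTasks task-R y j a))
        ... | no _ | yes refl = ∨⁺ˡ {R (φ i) (φ j) ∨ R (φ j) (φ i)} (∨⁺ʳ {R (φ i) (φ j)} (starR φ allTasks task-R y i (trans (adj-sym H v0 i) a)))
        ... | no ni | no nj = ∨⁺ʳ {R (φ i) (φ j) ∨ R (φ j) (φ i)} (x i j a ni nj)
      covers : ∀ c a x → p c a x ≡ true → lo (taskSet c a) x ≡ true ⊎ 1 ≤ cvP H Q c x
      covers c a x q = [ inj₁ , (λ y → inj₂ (found y)) ]′ (cov (taskSet c a) x q)
        where
        found : Any (λ τ → ∃ λ i → adj H v0 i ≡ true × σ τ i ≡ x) (tasks (taskSet c a)) → 1 ≤ cvP H Q c x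
        found y = (hit (tasks (taskSet c a)) y (centred (taskSet c a)) (AllP.tabulate⁻ {f = λ a → tasks (taskSet c a)} (AllP.concat⁻ {xss = tabulate (λ a → tasks (taskSet c a))} (AllP.tabulate⁻ {f = row} (AllP.concat⁻ {xss = tabulate row} (Result.covered r)) c)) a))
          where
          hit : ∀ τs → Any (λ τ → ∃ λ i → adj H v0 i ≡ true × σ τ i ≡ x) τs → All (λ τ → σ τ v0 ≡ c × (∀ i → adj H v0 i ≡ true → p c a (σ τ i) ≡ true)) τs → All (λ τ → Any (λ φ → ∀ i → isStar i ≡ true → φ i ≡ σ τ i) Q) τs → 1 ≤ cvP H Q c x
          hit (τ ∷ τs) (here (i , ai , refl)) ((refl , _) ∷ _) (z ∷ _) = cvP-any H (Any.map (λ {φ} e → ≤-trans (cv-edge H φ v0 i ai) (≤-reflexive (cong₂ (cv H φ) (e v0 (∨⁺ˡ (==-refl v0))) (e i (leaf⇒star ai))))) z)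
          hit (τ ∷ τs) (there y) (_ ∷ cs) (_ ∷ zs) = hit τs y cs zs

-- Dense graphs with bipartite H: constants, selection of subsets, and covering the edges to a smaller set

free-keep : ∀ {n h} (H : Graph h) (W : Rel n) (Q P : List (Fin h → Fin n)) x y → All (EdgesIn H W) Q → ¬ (W x y ≡ true) → free H P x y ≡ true → free H (Q ++ P) x y ≡ true
free-keep H W Q P x y eQ nW fr = trans (cong isZero (trans (cvP-++ H Q P x y) (trans (cong (_+ cvP H P x y) (cvP-all0 H (All.map (λ {φ} e p → bad φ e p) eQ))) refl))) fr
  where
  bad : ∀ φ → EdgesIn H W φ → 1 ≤ cv H φ x y → ⊥
  bad φ e p with cv-wit H φ x y p
  ... | i , j , a , refl , refl = nW (e i j a)

free-drop : ∀ {n h} (H : Graph h) (Q P : List (Fin h → Fin n)) x y → free H (Q ++ P) x y ≡ true → free H Q x y ≡ true × free H P x y ≡ true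
free-drop H Q P x y fr = cong isZero (m+n≡0⇒m≡0 (cvP H Q x y) z) , cong isZero (m+n≡0⇒n≡0 (cvP H Q x y) z)
  where
  z : cvP H Q x y + cvP H P x y ≡ 0
  z = trans (sym (cvP-++ H Q P x y)) (isZero⇒ fr)

packs-++ : ∀ {n h} (H : Graph h) (Q P : List (Fin h → Fin n)) → Packs H Q → Packs H P → All (EdgesIn H (free H P)) Q → Packs H (Q ++ P)
packs-++ H Q P (iQ , dQ) (iP , dP) fr = AllP.++⁺ iQ iP , APP.++⁺ dQ dP (All.map (λ {φ} e → free-disj H P φ e) fr)

edgesIn-mono : ∀ {n h} (H : Graph h) {W W′ : Rel n} → (∀ x y → W x y ≡ true → W′ x y ≡ true) → ∀ {Q} → All (EdgesIn H W) Q → All (EdgesIn H W′) Q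
edgesIn-mono H m = All.map (λ e i j a → m _ _ (e i j a))

class-sum : ∀ {n k} (cls : Fin n → Fin k) (Y : Fin n → Bool) → # Y ≡ ∑ (λ a → # (λ v → Y v ∧ (cls v == a)))
class-sum cls Y = trans (∑-cong (λ v → sym (trans (∑-cong (λ a → trans (⟦∧⟧ (Y v) _) refl)) (trans (∑-*ˡ ⟦ Y v ⟧ (λ a → δ (cls v) a)) (trans (cong (⟦ Y v ⟧ *_) (∑-δ1 (cls v))) (*-identityʳ _))))))
  (∑-swap (λ v a → ⟦ Y v ∧ (cls v == a) ⟧))

class-size : ∀ {n k} (cls : Fin n → Fin k) (Y : Fin n → Bool) y → (∀ a → # (λ v → Y v ∧ (cls v == a)) ≡ y) → # Y ≡ k * y
class-size {k = k} cls Y y e = trans (class-sum cls Y) (trans (∑-cong e) (∑-const {k} y))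

#-∪ : ∀ {n} (p q r : Fin n → Bool) → (∀ t → p t ≡ true → q t ≡ true ⊎ r t ≡ true) → # p ≤ # q + # r
#-∪ p q r c = ≤-trans (∑-mono cell) (≤-reflexive (∑-distrib (λ t → ⟦ q t ⟧) _))
  where
  cell : ∀ t → ⟦ p t ⟧ ≤ ⟦ q t ⟧ + ⟦ r t ⟧
  cell t with bool-split (p t)
  ... | inj₂ f = ≤-trans (≤-reflexive (⟦⟧-false f)) z≤n
  ... | inj₁ b with c t b
  ...   | inj₁ x = ≤-trans (⟦⟧≤1 _) (≤-trans (≤-reflexive (sym (⟦⟧-true x))) (m≤m+n _ _))
  ...   | inj₂ x = ≤-trans (⟦⟧≤1 _) (≤-trans (≤-reflexive (sym (⟦⟧-true x))) (m≤n+m _ _))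

#-eq≤1 : ∀ {n} (x : Fin n) → # (λ t → t == x) ≤ 1
#-eq≤1 x = ∑-atMost1 _ (λ t → ⟦⟧≤1 _) (λ t t′ p q → trans (==⇒≡ (⟦⟧⇒ p)) (sym (==⇒≡ (⟦⟧⇒ q))))

_∖_ : ∀ {n} → (Fin n → Bool) → (Fin n → Bool) → Fin n → Bool
(A ∖ B) x = A x ∧ not (B x)

∖⁺ : ∀ {n} (A B : Fin n → Bool) x → A x ≡ true → B x ≡ false → (A ∖ B) x ≡ true
∖⁺ A B x p q = ∧⁺ p (not⁺ q)

∖⁻ : ∀ {n} (A B : Fin n → Bool) x → (A ∖ B) x ≡ true → A x ≡ true × B x ≡ false
∖⁻ A B x p with ∧⁻ {A x} p
... | a , b = a , not⁻ b

module Constants (h : ℕ) where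
  opaque
    o3 k o2 q₁ Γ M Nk : ℕ
    o3 = suc (h * (4 + h * (20 * h + 2)))
    k = 10 * o3
    o2 = suc (h * (3 + h * (20 * k * h + 1)))
    q₁ = 10 * o2
    Γ = 2 * k * q₁
    M = 2 * Γ * h
    Nk = 2 * Γ * (2 ^ M * h)

  opaque
    unfolding o3

    o3-eq : o3 ≡ suc (h * (4 + h * (20 * h + 2)))
    o3-eq = refl

    k-eq : k ≡ 10 * o3
    k-eq = refl

    o2-eq : o2 ≡ suc (h * (3 + h * (20 * k * h + 1)))
    o2-eq = refl

    q₁-eq : q₁ ≡ 10 * o2
    q₁-eq = refl

    Γ-eq : Γ ≡ 2 * k * q₁
    Γ-eq = refl

    M-eq : M ≡ 2 * Γ * h
    M-eq = refl

    Nk-eq : Nk ≡ 2 * Γ * (2 ^ M * h)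
    Nk-eq = refl

  1≤o3 : 1 ≤ o3
  1≤o3 = ≤-trans (s≤s z≤n) (≤-reflexive (sym o3-eq))

  1≤k : 1 ≤ k
  1≤k = ≤-trans (*-mono-≤ (s≤s (z≤n {9})) 1≤o3) (≤-reflexive (sym k-eq))

  1≤o2 : 1 ≤ o2
  1≤o2 = ≤-trans (s≤s z≤n) (≤-reflexive (sym o2-eq))

  1≤q₁ : 1 ≤ q₁
  1≤q₁ = ≤-trans (*-mono-≤ (s≤s (z≤n {9})) 1≤o2) (≤-reflexive (sym q₁-eq))

  1≤Γ : 1 ≤ Γ
  1≤Γ = ≤-trans (*-mono-≤ (*-mono-≤ (s≤s (z≤n {1})) 1≤k) 1≤q₁) (≤-reflexive (sym Γ-eq))

  instance
    k≢0 : NonZero k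
    k≢0 = >-nonZero 1≤k
    q₁≢0 : NonZero q₁
    q₁≢0 = >-nonZero 1≤q₁

kst-bound : ∀ {h} (H : Graph h) (colour : Fin h → Fin 2) → (∀ i j → adj H i j ≡ true → colour i ≢ colour j) → ∀ Γ M Nk → 1 ≤ Γ → 1 ≤ h → M ≡ 2 * Γ * h → Nk ≡ 2 * Γ * (2 ^ M * h) →
  ∀ {n} (R : Rel n) → (∀ x y → R x y ≡ R y x) → (∀ x → R x x ≡ false) → (∀ φ → Inj φ → ¬ EdgesIn H R φ) → (U : Fin n → Bool) → Nk ≤ # U →
  # (λ v → ⌊ # U ≤? Γ * # (λ w → U w ∧ R v w) ⌋) ≤ M
kst-bound {h} H colour proper Γ M Nk 1≤Γ 1≤h refl refl R R-sym irr noH U big = ≮⇒≥ λ lt → noH′ (multi-embed H irr (found lt) colour proper)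
  where
  found : 2 * Γ * h < # (λ v → ⌊ # U ≤? Γ * # (λ w → U w ∧ R v w) ⌋) → Multi R (λ _ → true) 2 h
  found lt = kst-multi Γ h R R-sym U 1≤Γ 1≤h big (<⇒≤ lt)
  noH′ : ¬ ∃ λ φ → Inj φ × EdgesIn H R φ
  noH′ (φ , i , e) = noH φ i e

module Vortex {h : ℕ} (H : Graph h) (v0 : Fin h) (indep : ∀ i j → adj H v0 i ≡ true → adj H v0 j ≡ true → adj H i j ≡ false)
              (d : ℕ) (deg : # (adj H v0) ≡ suc d) (colour : Fin h → Fin 2) (proper : ∀ i j → adj H i j ≡ true → colour i ≢ colour j) where
  open Constants h

  1≤h : 1 ≤ h
  1≤h = ≤-trans (s≤s z≤n) (toℕ<n v0)

  pos : 1 ≤ e2H H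
  pos = ≤-trans (≤-trans (s≤s (z≤n {d})) (≤-reflexive (sym deg))) (∑-term (λ i → # (adj H i)) v0)

  kst : ∀ {n} (R : Rel n) → (∀ x y → R x y ≡ R y x) → (∀ x → R x x ≡ false) → (∀ φ → Inj φ → ¬ EdgesIn H R φ) → (U : Fin n → Bool) → Nk ≤ # U →
    # (λ v → ⌊ # U ≤? Γ * # (λ w → U w ∧ R v w) ⌋) ≤ M
  kst = kst-bound H colour proper Γ M Nk 1≤Γ 1≤h M-eq Nk-eq

  module Host {n : ℕ} (L : Graph n) (L-free : HFree H L) (cls : Fin n → Fin k) where

    nl : Rel n
    nl = nonL H L

    nl-sym : ∀ x y → nl x y ≡ nl y x
    nl-sym x y = cong₂ _∧_ (adj-sym (K n) x y) (cong not (adj-sym L x y))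

    nl-≢ : ∀ {x y} → nl x y ≡ true → x ≢ y
    nl-≢ {x} {y} p = K-adj⁻ (proj₁ (∧⁻ {adj (K n) x y} p))

    noL : ∀ φ → Inj φ → ¬ EdgesIn H (adj L) φ
    noL φ i e = L-free (record { φ = φ ; inj = λ {a} {b} → i a b ; edges = e })

    -- A subset with prescribed equal class sizes and small L-degrees: few vertices of a half have large L-degree.
    select : (U : Fin n → Bool) (s : ℕ) → (∀ a → s ≤ # (λ v → U v ∧ (cls v == a))) → Nk ≤ k * s → 2 * M ≤ s →
      Σ (Fin n → Bool) λ U′ → (∀ v → U′ v ≡ true → U v ≡ true) × (∀ a → # (λ v → U′ v ∧ (cls v == a)) ≡ s ∸ M) × (∀ v → U′ v ≡ true → q₁ * # (λ w → U′ w ∧ adj L v w) ≤ s ∸ M)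
    select U s le big 2M≤ = U′ , (λ v p → proj₁ (∧⁻ {U v} (W⊂ v (U′⊂W v p)))) , size′ , degs
      where
      part0 : ∀ a → Σ (Fin n → Bool) λ r → (∀ v → r v ≡ true → U v ∧ (cls v == a) ≡ true) × # r ≡ s
      part0 a = subset (λ v → U v ∧ (cls v == a)) s (le a)
      W : Fin n → Bool
      W v = proj₁ (part0 (cls v)) v
      W⊂ : ∀ v → W v ≡ true → U v ∧ (cls v == cls v) ≡ true
      W⊂ v p = proj₁ (proj₂ (part0 (cls v))) v p
      Wsize : ∀ a → # (λ v → W v ∧ (cls v == a)) ≡ s
      Wsize a = trans (∑-cong (λ v → cong ⟦_⟧ (bool-ext (to v) (fr v)))) (proj₂ (proj₂ (part0 a)))
        where
        to : ∀ v → W v ∧ (cls v == a) ≡ true → proj₁ (part0 a) v ≡ true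
        to v p = subst (λ z → proj₁ (part0 z) v ≡ true) (==⇒≡ (proj₂ (∧⁻ {W v} p))) (proj₁ (∧⁻ {W v} p))
        fr : ∀ v → proj₁ (part0 a) v ≡ true → W v ∧ (cls v == a) ≡ true
        fr v p = ∧⁺ (subst (λ z → proj₁ (part0 z) v ≡ true) (sym (==⇒≡ c)) p) c
          where
          c : (cls v == a) ≡ true
          c = proj₂ (∧⁻ {U v} (proj₁ (proj₂ (part0 a)) v p))
      W# : # W ≡ k * s
      W# = class-size cls W s Wsize
      high : Fin n → Bool
      high v = ⌊ # W ≤? Γ * # (λ w → W w ∧ adj L v w) ⌋
      high-few : # high ≤ M
      high-few = kst (adj L) (adj-sym L) (adj-irrefl L) noL W (≤-trans big (≤-reflexive (sym W#)))
      part1 : ∀ a → Σ (Fin n → Bool) λ r → (∀ v → r v ≡ true → (W v ∧ (cls v == a)) ∧ not (high v) ≡ true) × # r ≡ s ∸ M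
      part1 a = subset (λ v → (W v ∧ (cls v == a)) ∧ not (high v)) (s ∸ M) (m≤n+o⇒m∸n≤o s M (≤-trans (≤-reflexive (trans (sym (Wsize a)) (#-split (λ v → W v ∧ (cls v == a)) high)))
        (+-monoˡ-≤ _ (≤-trans (#-mono (λ v p → proj₂ (∧⁻ {W v ∧ (cls v == a)} p))) high-few))))
      U′ : Fin n → Bool
      U′ v = proj₁ (part1 (cls v)) v
      U′⊂ : ∀ v → U′ v ≡ true → (W v ∧ (cls v == cls v)) ∧ not (high v) ≡ true
      U′⊂ v p = proj₁ (proj₂ (part1 (cls v))) v p
      U′⊂W : ∀ v → U′ v ≡ true → W v ≡ true
      U′⊂W v p = proj₁ (∧⁻ {W v} (proj₁ (∧⁻ {W v ∧ (cls v == cls v)} (U′⊂ v p))))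
      size′ : ∀ a → # (λ v → U′ v ∧ (cls v == a)) ≡ s ∸ M
      size′ a = trans (∑-cong (λ v → cong ⟦_⟧ (bool-ext (to v) (fr v)))) (proj₂ (proj₂ (part1 a)))
        where
        to : ∀ v → U′ v ∧ (cls v == a) ≡ true → proj₁ (part1 a) v ≡ true
        to v p = subst (λ z → proj₁ (part1 z) v ≡ true) (==⇒≡ (proj₂ (∧⁻ {U′ v} p))) (proj₁ (∧⁻ {U′ v} p))
        fr : ∀ v → proj₁ (part1 a) v ≡ true → U′ v ∧ (cls v == a) ≡ true
        fr v p = ∧⁺ (subst (λ z → proj₁ (part1 z) v ≡ true) (sym (==⇒≡ c)) p) c
          where
          c : (cls v == a) ≡ true
          c = proj₂ (∧⁻ {W v} (proj₁ (∧⁻ {W v ∧ (cls v == a)} (proj₁ (proj₂ (part1 a)) v p))))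
      degs : ∀ v → U′ v ≡ true → q₁ * # (λ w → U′ w ∧ adj L v w) ≤ s ∸ M
      degs v p = ≤-trans (*-monoʳ-≤ q₁ (#-mono (λ w r → ∧⁺ (U′⊂W w (proj₁ (∧⁻ {U′ w} r))) (proj₂ (∧⁻ {U′ w} r))))) (half _ (⌊⌋false⁻ (not⁻ (proj₂ (∧⁻ {W v ∧ (cls v == cls v)} (U′⊂ v p))))))
        where
        half : ∀ x → ¬ (# W ≤ Γ * x) → q₁ * x ≤ s ∸ M
        half x nle = *-cancelˡ-≤ 2 (<⇒≤ small)
          where
          small : 2 * (q₁ * x) < (s ∸ M) + (s ∸ M + 0)
          small = ≤-trans (*-cancelˡ-< k _ _ (≤-trans (≤-reflexive (cong suc (trans (re k q₁ x) (cong (_* x) (sym Γ-eq))))) (≤-trans (≰⇒> nle) (≤-reflexive W#)))) s≤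
            where
            re : ∀ k q x → k * (2 * (q * x)) ≡ 2 * k * q * x
            re = solve-∀
            s≤ : s ≤ (s ∸ M) + (s ∸ M + 0)
            s≤ = ≤-trans (≤-reflexive (sym (m∸n+n≡m (≤-trans (m≤m+n M (M + 0)) 2M≤)))) (+-monoʳ-≤ (s ∸ M) (≤-trans (m+n≤o⇒m≤o∸n M (≤-trans (≤-reflexive (cong (M +_) (sym (+-identityʳ M)))) 2M≤)) (≤-reflexive (sym (+-identityʳ _)))))

    crossF : (U′ Y : Fin n → Bool) → Rel n
    crossF U′ Y x y = nl x y ∧ ((U′ x ∧ U′ y) ∧ ((Y x ∨ Y y) ∧ not (cls x == cls y)))

    -- Stars from X into U′ extended through Y by edges inside U′ joining different classes.
    module Phase3 (P : List (Fin h → Fin n)) (pk : Packs H P) (X U′ Y : Fin n → Bool) (s s′ y : ℕ)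
                  (X∩U′ : ∀ v → X v ≡ true → U′ v ≡ false) (Y⊂ : ∀ v → Y v ≡ true → U′ v ≡ true)
                  (Ysize : ∀ a → # (λ v → Y v ∧ (cls v == a)) ≡ y) (U′size : # U′ ≡ k * s′) (s′≤s : s′ ≤ s) (s≤5y : s ≤ 5 * y) (y≤s : y ≤ s) (1≤s : 1 ≤ s)
                  (I1 : ∀ u w → U′ u ≡ true → U′ w ≡ true → cls u ≢ cls w → free H P u w ≡ true) (Ldeg : ∀ w → U′ w ≡ true → # (λ t → U′ t ∧ adj L w t) ≤ s)
                  (S : Rel n) (S⊂ : ∀ c w → S c w ≡ true → X c ≡ true × U′ w ≡ true × nl c w ≡ true × free H P c w ≡ true)
                  (S-load : ∀ w → # (λ c → S c w) ≤ 2 * s) where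

      F : Rel n
      F = crossF U′ Y

      F⁻ : ∀ x y → F x y ≡ true → nl x y ≡ true × (U′ x ≡ true × U′ y ≡ true) × (Y x ∨ Y y ≡ true) × (cls x == cls y) ≡ false
      F⁻ x y p with ∧⁻ {nl x y} p
      ... | a , b with ∧⁻ {U′ x ∧ U′ y} b
      ...   | c , e with ∧⁻ {U′ x} c | ∧⁻ {Y x ∨ Y y} e
      ...     | u | v , w = a , u , v , not⁻ w

      F-sym : ∀ x y → F x y ≡ F y x
      F-sym x y = cong₂ _∧_ (nl-sym x y) (cong₂ _∧_ (∧-comm (U′ x) (U′ y)) (cong₂ _∧_ (∨-comm (Y x) (Y y)) (cong not (bool-ext (λ p → ⌊⌋dec (sym (==⇒≡ p))) (λ p → ⌊⌋dec (sym (==⇒≡ p)))))))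

      μ κ D O : ℕ
      μ = 1 + (s + s)
      κ = 20 * h * s
      D = 2 * s
      O = o3 * s

      few : ∀ x → U′ x ≡ true → # (λ t → Y t ∧ not (F x t)) ≤ μ
      few x Ux = ≤-trans (#-∪ _ (λ t → t == x) (λ t → (U′ t ∧ adj L x t) ∨ (Y t ∧ (cls t == cls x))) split) (+-mono-≤ (#-eq≤1 x)
          (≤-trans (#-∪ _ (λ t → U′ t ∧ adj L x t) (λ t → Y t ∧ (cls t == cls x)) (λ t p → ∨⁻ {U′ t ∧ adj L x t} p)) (+-mono-≤ (Ldeg x Ux) (≤-trans (≤-reflexive (Ysize (cls x))) y≤s))))
        where
        split : ∀ t → Y t ∧ not (F x t) ≡ true → (t == x) ≡ true ⊎ (U′ t ∧ adj L x t) ∨ (Y t ∧ (cls t == cls x)) ≡ true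
        split t p with ∧⁻ {Y t} p
        ... | Yt , nF with t ≟ x | bool-split (adj L x t) | bool-split (cls x == cls t)
        ...   | yes _ | _ | _ = inj₁ refl
        ...   | no _ | inj₁ l | _ = inj₂ (∨⁺ˡ (∧⁺ (Y⊂ t Yt) l))
        ...   | no _ | inj₂ _ | inj₁ c = inj₂ (∨⁺ʳ {U′ t ∧ adj L x t} (∧⁺ Yt (⌊⌋dec (sym (==⇒≡ c)))))
        ...   | no ne | inj₂ l | inj₂ c = ⊥-elim (t≢f (∧⁺ (∧⁺ (K-adj (ne ∘ sym)) (not⁺ l)) (∧⁺ (∧⁺ Ux (Y⊂ t Yt)) (∧⁺ (∨⁺ʳ {Y x} Yt) (not⁺ c)))) (not⁻ nF))

      total : ∑ (λ c → ∑ {1} (λ a → # (S c))) * h ≤ κ * O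
      total = ≤-trans (*-monoˡ-≤ h (begin
          ∑ (λ c → ∑ {1} (λ a → # (S c)))     ≡⟨ ∑-cong (λ c → trans (∑-const {1} (# (S c))) (+-identityʳ _)) ⟩
          ∑ (λ c → # (S c))                   ≡⟨ ∑-swap (λ c w → ⟦ S c w ⟧) ⟩
          ∑ (λ w → # (λ c → S c w))           ≤⟨ ∑-mono col ⟩
          ∑ (λ w → ⟦ U′ w ⟧ * (2 * s))        ≡⟨ ∑-*ʳ (λ w → ⟦ U′ w ⟧) (2 * s) ⟩
          # U′ * (2 * s)                      ≡⟨ cong (_* (2 * s)) U′size ⟩
          k * s′ * (2 * s)                    ≤⟨ *-monoˡ-≤ (2 * s) (*-monoʳ-≤ k s′≤s) ⟩
          k * s * (2 * s) ∎)) (≤-reflexive (trans (cong (λ z → z * s * (2 * s) * h) k-eq) (re o3 s h)))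
        where
        open ≤-Reasoning
        re : ∀ o s h → 10 * o * s * (2 * s) * h ≡ 20 * h * s * (o * s)
        re = solve-∀
        col : ∀ w → # (λ c → S c w) ≤ ⟦ U′ w ⟧ * (2 * s)
        col w with bool-split (U′ w)
        ... | inj₁ u = ≤-trans (S-load w) (≤-reflexive (sym (trans (cong (_* (2 * s)) (⟦⟧-true u)) (*-identityˡ (2 * s)))))
        ... | inj₂ u = ≤-trans (≤-reflexive (#-none (λ c p → t≢f (proj₁ (proj₂ (S⊂ c w p))) u))) z≤n

      room : O + h * (1 + (μ + h * (κ + D))) < # Y
      room = begin-strict
          o3 * s + h * (1 + (1 + (s + s) + h * (20 * h * s + 2 * s)))         ≤⟨ +-monoʳ-≤ (o3 * s) (*-monoʳ-≤ h (+-mono-≤ 1≤s (+-monoˡ-≤ (h * (20 * h * s + 2 * s)) (+-monoˡ-≤ (s + s) 1≤s)))) ⟩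
          o3 * s + h * (s + (s + (s + s) + h * (20 * h * s + 2 * s)))         ≡⟨ re h s (o3 * s) ⟩
          o3 * s + h * (4 + h * (20 * h + 2)) * s                             <⟨ +-monoʳ-< (o3 * s) (*-monoˡ-< s {{>-nonZero 1≤s}} (≤-reflexive (sym o3-eq))) ⟩
          o3 * s + o3 * s                                                     ≤⟨ +-mono-≤ (*-monoʳ-≤ o3 s≤5y) (*-monoʳ-≤ o3 s≤5y) ⟩
          o3 * (5 * y) + o3 * (5 * y)                                         ≡⟨ trans (re′ o3 y) (cong (_* y) (sym k-eq)) ⟩
          k * y                                                               ≡⟨ sym (class-size cls Y y Ysize) ⟩
          # Y ∎
        where
        open ≤-Reasoning
        re : ∀ h s o → o + h * (s + (s + (s + s) + h * (20 * h * s + 2 * s))) ≡ o + h * (4 + h * (20 * h + 2)) * s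
        re = solve-∀
        re′ : ∀ o y → o * (5 * y) + o * (5 * y) ≡ 10 * o * y
        re′ = solve-∀

      raw = StarCover.starCover H v0 indep d deg {n} {1} F F-sym μ κ D O (*-mono-≤ (*-mono-≤ (s≤s (z≤n {19})) 1≤h) 1≤s) (λ c _ w → S c w) (λ _ → Y) S
          (λ _ _ _ p → p) (λ c _ w p → ¬true⇒ (λ q → t≢f (proj₁ (proj₁ (proj₂ (F⁻ c w q)))) (X∩U′ c (proj₁ (S⊂ c w p)))))
          (λ { _ zero zero _ _ _ → refl }) (λ c _ _ w p q → t≢f (proj₁ (proj₂ (S⊂ c w p))) (X∩U′ w (proj₁ (S⊂ w c q))))
          (λ w → ≤-trans (≤-reflexive (∑-cong (λ c → trans (∑-const {1} ⟦ S c w ⟧) (+-identityʳ _)))) (S-load w)) total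
          (λ c _ w p → few w (proj₁ (proj₂ (S⊂ c w p)))) (λ _ x p → few x (Y⊂ x p)) (λ _ → room)

      cover : ∃ λ Q → Packs H (Q ++ P) × All (EdgesIn H (λ x y → (S x y ∨ S y x) ∨ F x y)) Q ×
        Σ (Fin n → Fin n → Bool) λ lo → (∀ c → # (lo c) ≤ d) × (∀ c w → lo c w ≡ true → S c w ≡ true) × (∀ c w → S c w ≡ true → lo c w ≡ true ⊎ 1 ≤ cvP H Q c w)
      cover = Q , packs-++ H Q P (proj₁ (proj₂ raw)) pk (edgesIn-mono H fr eQ) , eQ , (λ c → proj₁ r3 c zero) , (λ c → proj₁ (proj₂ r3) c zero) , (λ c → proj₁ (proj₂ (proj₂ r3)) c zero) , (λ c → proj₂ (proj₂ (proj₂ r3)) c zero)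
        where
        Q = proj₁ raw
        eQ = proj₁ (proj₂ (proj₂ raw))
        r3 = proj₂ (proj₂ (proj₂ raw))
        fr : ∀ x y → (S x y ∨ S y x) ∨ F x y ≡ true → free H P x y ≡ true
        fr x y p with ∨⁻ {S x y ∨ S y x} p
        ... | inj₂ f = I1 x y (proj₁ (proj₁ (proj₂ (F⁻ x y f)))) (proj₂ (proj₁ (proj₂ (F⁻ x y f)))) (⌊⌋false⁻ (proj₂ (proj₂ (proj₂ (F⁻ x y f)))))
        ... | inj₁ q with ∨⁻ {S x y} q
        ...   | inj₁ a = proj₂ (proj₂ (proj₂ (S⊂ x y a)))
        ...   | inj₂ a = trans (cong isZero (cvP-sym H P x y)) (proj₂ (proj₂ (proj₂ (S⊂ y x a))))

free-uncovered : ∀ {h n} (H : Graph h) (P : List (Fin h → Fin n)) x y → free H P x y ≡ true → ¬ (1 ≤ cvP H P x y)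
free-uncovered H P x y f p = 1+n≰n (≤-trans p (≤-reflexive (isZero⇒ {cvP H P x y} f)))

module VortexLevel {h : ℕ} (H : Graph h) (v0 : Fin h) (indep : ∀ i j → adj H v0 i ≡ true → adj H v0 j ≡ true → adj H i j ≡ false)
                   (d : ℕ) (deg : # (adj H v0) ≡ suc d) (colour : Fin h → Fin 2) (proper : ∀ i j → adj H i j ≡ true → colour i ≢ colour j)
                   {n : ℕ} (L : Graph n) (L-free : HFree H L) (cls : Fin n → Fin (Constants.k h)) where
  open Constants h
  open Vortex H v0 indep d deg colour proper
  open Host L L-free cls

  record LevelResult (U U′ U″ : Fin n → Bool) (s : ℕ) (P : List (Fin h → Fin n)) : Set where
    field
      P⁺ : List (Fin h → Fin n)
      packs⁺ : Packs H P⁺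
      edges⁺ : All (EdgesIn H nl) P → All (EdgesIn H nl) P⁺
      mono⁺ : ∀ x z → free H P⁺ x z ≡ true → free H P x z ≡ true
      I1⁺ : ∀ u w → U″ u ≡ true → U″ w ≡ true → free H P⁺ u w ≡ true
      I2⁺ : ∀ u w → (U′ ∖ U″) u ≡ true → U″ w ≡ true → cls u ≡ cls w → free H P⁺ u w ≡ true
      bound⁺ : ∑∑ (λ x z → ⟦ (U ∖ U′) x ∧ (U z ∧ (nl x z ∧ free H P⁺ x z)) ⟧) ≤ k * s * (d * k) + (k * s * (d * k) + k * s * (d * 1))

  module Level (U U′ U″ : Fin n → Bool) (s s′ s″ : ℕ) (U′⊂ : ∀ v → U′ v ≡ true → U v ≡ true) (U″⊂ : ∀ v → U″ v ≡ true → U′ v ≡ true)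
               (Usize : ∀ a → # (λ v → U v ∧ (cls v == a)) ≡ s) (U′size : ∀ a → # (λ v → U′ v ∧ (cls v == a)) ≡ s′) (U″size : ∀ a → # (λ v → U″ v ∧ (cls v == a)) ≡ s″)
               (s≤5y : s ≤ 5 * (s′ ∸ s″)) (s′≤s : s′ ≤ s) (M≤s : q₁ * M ≤ s) (Nk≤ : Nk ≤ k * s) (q₁≤s : q₁ ≤ s)
               (Ldeg : ∀ v → U v ≡ true → q₁ * # (λ w → U w ∧ adj L v w) ≤ s)
               (P : List (Fin h → Fin n)) (pk : Packs H P)
               (I1 : ∀ u w → U′ u ≡ true → U′ w ≡ true → free H P u w ≡ true)
               (I2 : ∀ u w → (U ∖ U′) u ≡ true → U′ w ≡ true → cls u ≡ cls w → free H P u w ≡ true) where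

    X Y : Fin n → Bool
    X = U ∖ U′
    Y = U′ ∖ U″

    y : ℕ
    y = s′ ∸ s″

    X⇒U : ∀ v → X v ≡ true → U v ≡ true
    X⇒U v p = proj₁ (∖⁻ U U′ v p)

    X⇒¬U′ : ∀ v → X v ≡ true → U′ v ≡ false
    X⇒¬U′ v p = proj₂ (∖⁻ U U′ v p)

    Y⇒U′ : ∀ v → Y v ≡ true → U′ v ≡ true
    Y⇒U′ v p = proj₁ (∖⁻ U′ U″ v p)

    Ysize : ∀ a → # (λ v → Y v ∧ (cls v == a)) ≡ y
    Ysize a = trans (sym (m+n∸m≡n (# (λ v → U″ v ∧ (cls v == a))) _)) (cong₂ _∸_ tot (U″size a))
      where
      tot : # (λ v → U″ v ∧ (cls v == a)) + # (λ v → Y v ∧ (cls v == a)) ≡ s′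
      tot = trans (sym (trans (#-split (λ v → U′ v ∧ (cls v == a)) U″) (cong₂ _+_ (∑-cong (λ v → cong ⟦_⟧ (bool-ext (e₁ v) (e₂ v)))) (∑-cong (λ v → cong ⟦_⟧ (sw (U′ v) (cls v == a) (U″ v))))))) (U′size a)
        where
        e₁ : ∀ v → (U′ v ∧ (cls v == a)) ∧ U″ v ≡ true → U″ v ∧ (cls v == a) ≡ true
        e₁ v p with ∧⁻ {U′ v ∧ (cls v == a)} p
        ... | q , r = ∧⁺ r (proj₂ (∧⁻ {U′ v} q))
        e₂ : ∀ v → U″ v ∧ (cls v == a) ≡ true → (U′ v ∧ (cls v == a)) ∧ U″ v ≡ true
        e₂ v p with ∧⁻ {U″ v} p
        ... | q , r = ∧⁺ (∧⁺ (U″⊂ v q) r) q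
        sw : ∀ a b c → (a ∧ b) ∧ not c ≡ (a ∧ not c) ∧ b
        sw false b c = refl
        sw true b c = ∧-comm b (not c)

    -- First phase: a maximal packing among the edges meeting X, keeping aside the same-class edges from X to U′.
    InA : Fin n → Fin n → Set
    InA x z = nl x z ≡ true × (U x ≡ true × U z ≡ true) × ¬ (U′ x ≡ true × U′ z ≡ true) × ¬ (cls x ≡ cls z × (U′ x ≡ true ⊎ U′ z ≡ true))

    inA? : ∀ x z → Dec (InA x z)
    inA? x z = bool? (nl x z) ×-dec ((bool? (U x) ×-dec bool? (U z)) ×-dec (¬? (bool? (U′ x) ×-dec bool? (U′ z)) ×-dec ¬? ((cls x ≟ cls z) ×-dec (bool? (U′ x) ⊎-dec bool? (U′ z)))))

    A : Rel n
    A x z = ⌊ inA? x z ⌋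

    InA-sym : ∀ x z → InA x z → InA z x
    InA-sym x z (a , (b , c) , e , f) = trans (nl-sym z x) a , (c , b) , (λ (p , q) → e (q , p)) , λ { (p , inj₁ q) → f (sym p , inj₂ q) ; (p , inj₂ q) → f (sym p , inj₁ q) }

    A-sym : ∀ x z → A x z ≡ A z x
    A-sym x z = bool-ext (λ p → ⌊⌋dec (InA-sym x z (dec⌊⌋ p))) (λ p → ⌊⌋dec (InA-sym z x (dec⌊⌋ p)))

    U# : # U ≡ k * s
    U# = class-size cls U s Usize

    module AfterFirst (Q1 : List (Fin h → Fin n)) (pk1 : Packs H (Q1 ++ P)) (Q1-A : All (EdgesIn H A) Q1) (noR : Saturated H A (Q1 ++ P)) where

      P1 : List (Fin h → Fin n)
      P1 = Q1 ++ P

      R : Rel n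
      R x z = A x z ∧ free H P1 x z

      R⇒A : ∀ x z → R x z ≡ true → InA x z
      R⇒A x z p = dec⌊⌋ (proj₁ (∧⁻ {A x z} p))

      R⇒free : ∀ x z → R x z ≡ true → free H P1 x z ≡ true
      R⇒free x z p = proj₂ (∧⁻ {A x z} p)

      R-sym : ∀ x z → R x z ≡ R z x
      R-sym x z = cong₂ _∧_ (A-sym x z) (cong isZero (cvP-sym H P1 x z))

      R-irr : ∀ x → R x x ≡ false
      R-irr x = ¬true⇒ (λ p → nl-≢ (proj₁ (R⇒A x x p)) refl)

      highR : Fin n → Bool
      highR v = ⌊ # U ≤? Γ * # (λ w → U w ∧ R v w) ⌋

      highR-few : # highR ≤ M
      highR-few = kst R R-sym R-irr noR U (≤-trans Nk≤ (≤-reflexive (sym U#)))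

      lowR : ∀ v → highR v ≡ false → q₁ * # (R v) ≤ s
      lowR v z = *-cancelˡ-≤ k (≤-trans (≤-trans (≤-reflexive (sym (*-assoc k q₁ (# (R v))))) (*-monoˡ-≤ (# (R v)) (*-monoˡ-≤ q₁ (m≤m+n k (k + 0)))))
        (≤-trans (≤-trans (≤-reflexive (cong (_* # (R v)) (sym Γ-eq))) (*-monoʳ-≤ Γ (#-mono (λ w p → ∧⁺ (proj₂ (proj₁ (proj₂ (R⇒A v w p)))) p)))) (≤-trans (<⇒≤ (≰⇒> (⌊⌋false⁻ z))) (≤-reflexive U#))))

    module Second (Q1 : List (Fin h → Fin n)) (pk1 : Packs H (Q1 ++ P)) (Q1-A : All (EdgesIn H A) Q1)
                  (R : Rel n) (R⇒A : ∀ x z → R x z ≡ true → InA x z) (R⇒free : ∀ x z → R x z ≡ true → free H (Q1 ++ P) x z ≡ true)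
                  (⇒R : ∀ x z → InA x z → free H (Q1 ++ P) x z ≡ true → R x z ≡ true) (R-sym : ∀ x z → R x z ≡ R z x)
                  (Z : Fin n → Bool) (Z-few : # Z ≤ M) (nonZ : ∀ v → Z v ≡ false → q₁ * # (R v) ≤ s) where

      P1 : List (Fin h → Fin n)
      P1 = Q1 ++ P

      -- Second phase: orient the remaining edges inside X and from Z to X away from Z, and cover them through Y.
      rk : Fin n → ℕ
      rk c = if Z c then toℕ c else n + toℕ c

      rk-Z : ∀ {c} → Z c ≡ true → rk c ≡ toℕ c
      rk-Z {c} p = cong (λ b → if b then toℕ c else n + toℕ c) p

      rk-nZ : ∀ {c} → Z c ≡ false → rk c ≡ n + toℕ c
      rk-nZ {c} p = cong (λ b → if b then toℕ c else n + toℕ c) p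

      rk-inj : ∀ c x → rk c ≡ rk x → c ≡ x
      rk-inj c x e with bool-split (Z c) | bool-split (Z x)
      ... | inj₁ p | inj₁ q = toℕ-injective (trans (sym (rk-Z p)) (trans e (rk-Z q)))
      ... | inj₂ p | inj₂ q = toℕ-injective (+-cancelˡ-≡ n _ _ (trans (sym (rk-nZ p)) (trans e (rk-nZ q))))
      ... | inj₁ p | inj₂ q = ⊥-elim (<⇒≱ (toℕ<n c) (≤-trans (m≤m+n n (toℕ x)) (≤-reflexive (trans (sym (rk-nZ q)) (trans (sym e) (rk-Z p))))))
      ... | inj₂ p | inj₁ q = ⊥-elim (<⇒≱ (toℕ<n x) (≤-trans (m≤m+n n (toℕ c)) (≤-reflexive (trans (sym (rk-nZ p)) (trans e (rk-Z q))))))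

      Or : Fin n → Fin n → Set
      Or c x = R c x ≡ true × X x ≡ true × ((X c ≡ false × Z c ≡ true) ⊎ (X c ≡ true × rk c < rk x))

      or? : ∀ c x → Dec (Or c x)
      or? c x = bool? (R c x) ×-dec (bool? (X x) ×-dec (((bool-f (X c)) ×-dec bool? (Z c)) ⊎-dec (bool? (X c) ×-dec (rk c <? rk x))))
        where
        bool-f : ∀ b → Dec (b ≡ false)
        bool-f false = yes refl
        bool-f true = no λ ()

      Or-asym : ∀ c x → Or c x → Or x c → ⊥
      Or-asym c x (_ , Xx , o) (_ , Xc , o′) with o | o′
      ... | inj₁ (f , _) | _ = t≢f Xc f
      ... | inj₂ _ | inj₁ (f , _) = t≢f Xx f
      ... | inj₂ (_ , lt) | inj₂ (_ , lt′) = <-asym lt lt′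

      e : ℕ
      e = s / q₁

      Or-load : ∀ x → # (λ c → ⌊ or? c x ⌋) ≤ e
      Or-load x = ≤-trans (≤-reflexive (sym (m*n/n≡m _ q₁))) (/-monoˡ-≤ q₁ (≤-trans (≤-reflexive (*-comm _ q₁)) bound))
        where
        bound : q₁ * # (λ c → ⌊ or? c x ⌋) ≤ s
        bound with bool-split (Z x)
        ... | inj₂ nz = ≤-trans (*-monoʳ-≤ q₁ (#-mono (λ c p → trans (R-sym x c) (proj₁ (dec⌊⌋ {d = or? c x} p))))) (nonZ x nz)
        ... | inj₁ z = ≤-trans (*-monoʳ-≤ q₁ (≤-trans (#-mono (λ c p → inZ c (dec⌊⌋ p))) Z-few)) M≤s
          where
          inZ : ∀ c → Or c x → Z c ≡ true
          inZ c (_ , _ , inj₁ (_ , q)) = q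
          inZ c (_ , _ , inj₂ (_ , lt)) with bool-split (Z c)
          ... | inj₁ q = q
          ... | inj₂ q = ⊥-elim (<⇒≱ lt (≤-trans (≤-trans (≤-reflexive (rk-Z z)) (<⇒≤ (toℕ<n x))) (≤-trans (m≤m+n n (toℕ c)) (≤-reflexive (sym (rk-nZ q))))))

      InF : Fin n → Fin n → Set
      InF x z = nl x z ≡ true × cls x ≡ cls z × ((X x ≡ true × Y z ≡ true) ⊎ (Y x ≡ true × X z ≡ true) ⊎ (Y x ≡ true × Y z ≡ true))

      inF? : ∀ x z → Dec (InF x z)
      inF? x z = bool? (nl x z) ×-dec ((cls x ≟ cls z) ×-dec ((bool? (X x) ×-dec bool? (Y z)) ⊎-dec ((bool? (Y x) ×-dec bool? (X z)) ⊎-dec (bool? (Y x) ×-dec bool? (Y z)))))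

      InF-sym : ∀ x z → InF x z → InF z x
      InF-sym x z (a , b , inj₁ (p , q)) = trans (nl-sym z x) a , sym b , inj₂ (inj₁ (q , p))
      InF-sym x z (a , b , inj₂ (inj₁ (p , q))) = trans (nl-sym z x) a , sym b , inj₁ (q , p)
      InF-sym x z (a , b , inj₂ (inj₂ (p , q))) = trans (nl-sym z x) a , sym b , inj₂ (inj₂ (q , p))

      F : Rel n
      F x z = ⌊ inF? x z ⌋

      F-sym : ∀ x z → F x z ≡ F z x
      F-sym x z = bool-ext (λ p → ⌊⌋dec (InF-sym x z (dec⌊⌋ p))) (λ p → ⌊⌋dec (InF-sym z x (dec⌊⌋ p)))

      InF-notA : ∀ x z → InF x z → ¬ InA x z
      InF-notA x z (_ , c , inj₁ (p , q)) (_ , _ , _ , f) = f (c , inj₂ (Y⇒U′ z q))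
      InF-notA x z (_ , c , inj₂ (inj₁ (p , q))) (_ , _ , _ , f) = f (c , inj₁ (Y⇒U′ x p))
      InF-notA x z (_ , c , inj₂ (inj₂ (p , q))) (_ , _ , _ , f) = f (c , inj₁ (Y⇒U′ x p))

      F-free : ∀ x z → InF x z → free H P1 x z ≡ true
      F-free x z f = free-keep H A Q1 P x z Q1-A (λ a → InF-notA x z f (dec⌊⌋ a)) (fr f)
        where
        fr : InF x z → free H P x z ≡ true
        fr (_ , c , inj₁ (p , q)) = I2 x z p (Y⇒U′ z q) c
        fr (_ , c , inj₂ (inj₁ (p , q))) = trans (cong isZero (cvP-sym H P x z)) (I2 z x q (Y⇒U′ x p) (sym c))
        fr (_ , c , inj₂ (inj₂ (p , q))) = I1 x z (Y⇒U′ x p) (Y⇒U′ z q)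

      p : Fin n → Fin k → Fin n → Bool
      p c a x = ⌊ or? c x ⌋ ∧ (cls x == a)

      p⇒ : ∀ c a x → p c a x ≡ true → Or c x × cls x ≡ a
      p⇒ c a x q with ∧⁻ {⌊ or? c x ⌋} q
      ... | o , c′ = dec⌊⌋ o , ==⇒≡ c′

      Tg : Fin k → Fin n → Bool
      Tg a t = Y t ∧ (cls t == a)

      1≤e : 1 ≤ e
      1≤e = ≤-trans (≤-reflexive (sym (m*n/n≡m 1 q₁))) (/-monoˡ-≤ q₁ (≤-trans (≤-reflexive (*-identityˡ q₁)) q₁≤s))

      s≤2q₁e : s ≤ 2 * q₁ * e
      s≤2q₁e = ≤-trans (≤-reflexive (m≡m%n+[m/n]*n s q₁)) (≤-trans (+-monoˡ-≤ (e * q₁) (≤-trans (<⇒≤ (m%n<n s q₁)) (≤-trans (≤-reflexive (sym (*-identityˡ q₁))) (*-monoˡ-≤ q₁ 1≤e)))) (≤-reflexive (re e q₁)))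
        where
        re : ∀ e q → e * q + e * q ≡ 2 * q * e
        re = solve-∀

      few2 : ∀ a x → U x ≡ true → (∀ t → Y t ≡ true → cls t ≡ a → nl x t ≡ true → InF x t) → # (λ t → Tg a t ∧ not (F x t)) ≤ 1 + e
      few2 a x Ux ok = ≤-trans (#-∪ _ (λ t → t == x) (λ t → U t ∧ adj L x t) split) (+-mono-≤ (#-eq≤1 x)
          (≤-trans (≤-reflexive (sym (m*n/n≡m _ q₁))) (/-monoˡ-≤ q₁ (≤-trans (≤-reflexive (*-comm _ q₁)) (Ldeg x Ux)))))
        where
        split : ∀ t → Tg a t ∧ not (F x t) ≡ true → (t == x) ≡ true ⊎ U t ∧ adj L x t ≡ true
        split t q with ∧⁻ {Tg a t} q
        ... | ta , nF with ∧⁻ {Y t} ta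
        ...   | Yt , ca with t ≟ x | bool-split (adj L x t)
        ...     | yes _ | _ = inj₁ refl
        ...     | no _ | inj₁ l = inj₂ (∧⁺ (U′⊂ t (Y⇒U′ t Yt)) l)
        ...     | no ne | inj₂ l = ⊥-elim (t≢f (⌊⌋dec {d = inF? x t} (ok t Yt (==⇒≡ ca) (∧⁺ (K-adj (ne ∘ sym)) (not⁺ l)))) (not⁻ nF))

      few2-leaf : ∀ c a x → p c a x ≡ true → # (λ t → Tg a t ∧ not (F x t)) ≤ 1 + e
      few2-leaf c a x q with p⇒ c a x q
      ... | (_ , Xx , _) , ca = few2 a x (X⇒U x Xx) (λ t Yt ct nn → nn , trans ca (sym ct) , inj₁ (Xx , Yt))

      few2-T : ∀ a x → Tg a x ≡ true → # (λ t → Tg a t ∧ not (F x t)) ≤ 1 + e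
      few2-T a x q with ∧⁻ {Y x} q
      ... | Yx , ca = few2 a x (U′⊂ x (Y⇒U′ x Yx)) (λ t Yt ct nn → nn , trans (==⇒≡ ca) (sym ct) , inj₂ (inj₂ (Yx , Yt)))

      load2 : ∀ x → ∑ (λ c → ∑ (λ a → ⟦ p c a x ⟧)) ≤ e
      load2 x = ≤-trans (≤-reflexive (∑-cong (λ c → trans (∑-cong (λ a → ⟦∧⟧ ⌊ or? c x ⌋ _)) (trans (∑-*ˡ ⟦ ⌊ or? c x ⌋ ⟧ (λ a → δ (cls x) a)) (trans (cong (⟦ ⌊ or? c x ⌋ ⟧ *_) (∑-δ1 (cls x))) (*-identityʳ _)))))) (Or-load x)

      κ O : ℕ
      κ = 20 * k * h * e
      O = o2 * e

      total2 : ∑ (λ c → ∑ (λ a → # (p c a))) * h ≤ κ * O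
      total2 = ≤-trans (*-monoˡ-≤ h (begin
          ∑ (λ c → ∑ (λ a → # (p c a)))                ≡⟨ trans (∑-cong (λ c → ∑-swap (λ a x → ⟦ p c a x ⟧))) (∑-swap (λ c x → ∑ (λ a → ⟦ p c a x ⟧))) ⟩
          ∑ (λ x → ∑ (λ c → ∑ (λ a → ⟦ p c a x ⟧)))    ≤⟨ ∑-mono col ⟩
          ∑ (λ x → ⟦ U x ⟧ * e)                        ≡⟨ ∑-*ʳ (λ x → ⟦ U x ⟧) e ⟩
          # U * e                                      ≡⟨ cong (_* e) U# ⟩
          k * s * e                                    ≤⟨ *-monoˡ-≤ e (*-monoʳ-≤ k s≤2q₁e) ⟩
          k * (2 * q₁ * e) * e ∎)) (≤-reflexive (trans (cong (λ z → k * (2 * z * e) * e * h) q₁-eq) (re k o2 e h)))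
        where
        open ≤-Reasoning
        re : ∀ k o e h → k * (2 * (10 * o) * e) * e * h ≡ 20 * k * h * e * (o * e)
        re = solve-∀
        col : ∀ x → ∑ (λ c → ∑ (λ a → ⟦ p c a x ⟧)) ≤ ⟦ U x ⟧ * e
        col x with bool-split (U x)
        ... | inj₁ u = ≤-trans (load2 x) (≤-reflexive (sym (trans (cong (_* e) (⟦⟧-true u)) (*-identityˡ e))))
        ... | inj₂ u = ≤-trans (≤-reflexive (∑-zero (λ c → ∑-zero (λ a → ⟦⟧-false (¬true⇒ (λ q → t≢f (X⇒U x (proj₁ (proj₂ (proj₁ (p⇒ c a x q))))) u)))))) z≤n

      room2 : ∀ a → O + h * (1 + ((1 + e) + h * (κ + e))) < # (Tg a)
      room2 a = begin-strict
          o2 * e + h * (1 + ((1 + e) + h * (κ + e)))           ≤⟨ +-monoʳ-≤ (o2 * e) (*-monoʳ-≤ h (+-mono-≤ 1≤e (+-monoˡ-≤ (h * (κ + e)) (+-monoˡ-≤ e 1≤e)))) ⟩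
          o2 * e + h * (e + ((e + e) + h * (κ + e)))           ≡⟨ re (20 * k) h e (o2 * e) ⟩
          o2 * e + h * (3 + h * (20 * k * h + 1)) * e          <⟨ +-monoʳ-< (o2 * e) (*-monoˡ-< e {{>-nonZero 1≤e}} (≤-reflexive (sym o2-eq))) ⟩
          o2 * e + o2 * e                                      ≤⟨ *-cancelˡ-≤ 5 five ⟩
          y                                                    ≡⟨ sym (Ysize a) ⟩
          # (Tg a) ∎
        where
        open ≤-Reasoning
        re : ∀ c h e o → o + h * (e + ((e + e) + h * (c * h * e + e))) ≡ o + h * (3 + h * (c * h + 1)) * e
        re = solve-∀
        five : 5 * (o2 * e + o2 * e) ≤ 5 * y
        five = ≤-trans (≤-reflexive (trans (re₁ o2 e) (trans (cong (_* e) (sym q₁-eq)) (*-comm q₁ e)))) (≤-trans (m/n*n≤m s q₁) s≤5y)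
          where
          re₁ : ∀ o e → 5 * (o * e + o * e) ≡ 10 * o * e
          re₁ = solve-∀

      cover2 = StarCover.starCover H v0 indep d deg {n} {k} F F-sym (1 + e) κ e O (*-mono-≤ (*-mono-≤ (*-mono-≤ (s≤s (z≤n {19})) 1≤k) 1≤h) 1≤e) p Tg R
        (λ c a x q → proj₁ (proj₁ (p⇒ c a x q))) (λ c a x q → ¬true⇒ (λ f → InF-notA c x (dec⌊⌋ f) (R⇒A c x (proj₁ (proj₁ (p⇒ c a x q))))))
        (λ c a a′ x q q′ → trans (sym (proj₂ (p⇒ c a x q))) (proj₂ (p⇒ c a′ x q′))) (λ c a a′ x q q′ → Or-asym c x (proj₁ (p⇒ c a x q)) (proj₁ (p⇒ x a′ c q′)))
        load2 total2 few2-leaf few2-T room2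


      module Third (Q2 : List (Fin h → Fin n)) (Q2-packs : Packs H Q2) (Q2-edges : All (EdgesIn H (λ x z → (R x z ∨ R z x) ∨ F x z)) Q2)
                   (lo2 : Fin n → Fin k → Fin n → Bool) (lo2-few : ∀ c a → # (lo2 c a) ≤ d) (lo2⊂ : ∀ c a x → lo2 c a x ≡ true → p c a x ≡ true)
                   (lo2-cov : ∀ c a x → p c a x ≡ true → lo2 c a x ≡ true ⊎ 1 ≤ cvP H Q2 c x) where

        P2 : List (Fin h → Fin n)
        P2 = Q2 ++ P1

        Q2-W : ∀ x z → (R x z ∨ R z x) ∨ F x z ≡ true → (InA x z × free H P1 x z ≡ true) ⊎ InF x z
        Q2-W x z q with ∨⁻ {R x z ∨ R z x} q
        ... | inj₂ f = inj₂ (dec⌊⌋ f)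
        ... | inj₁ r with ∨⁻ {R x z} r
        ...   | inj₁ a = inj₁ (R⇒A x z a , R⇒free x z a)
        ...   | inj₂ a = inj₁ (R⇒A x z (trans (R-sym x z) a) , R⇒free x z (trans (R-sym x z) a))

        pk2 : Packs H P2
        pk2 = packs-++ H Q2 P1 Q2-packs pk1 (edgesIn-mono H (λ x z q → [ proj₂ , F-free x z ]′ (Q2-W x z q)) Q2-edges)

        -- Third phase: the remaining edges from X to U′.
        In3 : Fin n → Fin n → Set
        In3 c w = X c ≡ true × U′ w ≡ true × nl c w ≡ true × free H P2 c w ≡ true × (cls c ≡ cls w ⊎ Z w ≡ false)

        in3? : ∀ c w → Dec (In3 c w)
        in3? c w = bool? (X c) ×-dec (bool? (U′ w) ×-dec (bool? (nl c w) ×-dec (bool? (free H P2 c w) ×-dec ((cls c ≟ cls w) ⊎-dec bool-f (Z w)))))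
          where
          bool-f : ∀ b → Dec (b ≡ false)
          bool-f false = yes refl
          bool-f true = no λ ()

        S : Rel n
        S c w = ⌊ in3? c w ⌋

        XU′-A : ∀ c w → X c ≡ true → U′ w ≡ true → nl c w ≡ true → cls c ≢ cls w → InA c w
        XU′-A c w Xc Uw nn ne = nn , (X⇒U c Xc , U′⊂ w Uw) , (λ (a , _) → t≢f a (X⇒¬U′ c Xc)) , λ (a , _) → ne a

        1≤s : 1 ≤ s
        1≤s = ≤-trans 1≤q₁ q₁≤s

        S-load : ∀ w → # (λ c → S c w) ≤ 2 * s
        S-load w = ≤-trans (#-∪ _ (λ c → U c ∧ (cls c == cls w)) (λ c → not (Z w) ∧ R w c) split) (≤-trans (+-mono-≤ (≤-reflexive (Usize (cls w))) rest) (≤-reflexive (cong (s +_) (sym (+-identityʳ s)))))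
          where
          split : ∀ c → S c w ≡ true → U c ∧ (cls c == cls w) ≡ true ⊎ not (Z w) ∧ R w c ≡ true
          split c q with dec⌊⌋ {d = in3? c w} q
          ... | Xc , Uw , nn , fr , o with cls c ≟ cls w | o
          ...   | yes _ | _ = inj₁ (∧⁺ (X⇒U c Xc) refl)
          ...   | no ne | inj₁ eq = ⊥-elim (ne eq)
          ...   | no ne | inj₂ z = inj₂ (∧⁺ (not⁺ z) (trans (R-sym w c) (⇒R c w (XU′-A c w Xc Uw nn ne) (proj₂ (free-drop H Q2 P1 c w fr)))))
          rest : # (λ c → not (Z w) ∧ R w c) ≤ s
          rest with bool-split (Z w)
          ... | inj₁ z = ≤-trans (≤-reflexive (#-none (λ c q → t≢f z (not⁻ (proj₁ (∧⁻ {not (Z w)} q)))))) z≤n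
          ... | inj₂ z = ≤-trans (#-mono (λ c q → proj₂ (∧⁻ {not (Z w)} q))) (≤-trans (≤-trans (≤-reflexive (sym (*-identityˡ _))) (*-monoˡ-≤ (# (R w)) 1≤q₁)) (nonZ w z))

        I1-2 : ∀ u w → U′ u ≡ true → U′ w ≡ true → ¬ InF u w → free H P2 u w ≡ true
        I1-2 u w a b nf = free-keep H _ Q2 P1 u w Q2-edges (λ q → [ (λ (ia , _) → proj₁ (proj₂ (proj₂ ia)) (a , b)) , nf ]′ (Q2-W u w q))
          (free-keep H A Q1 P u w Q1-A (λ q → proj₁ (proj₂ (proj₂ (dec⌊⌋ {d = inA? u w} q))) (a , b)) (I1 u w a b))

        Ldeg′ : ∀ w → U′ w ≡ true → # (λ t → U′ t ∧ adj L w t) ≤ s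
        Ldeg′ w u = ≤-trans (≤-trans (#-mono (λ t q → ∧⁺ (U′⊂ t (proj₁ (∧⁻ {U′ t} q))) (proj₂ (∧⁻ {U′ t} q)))) (≤-trans (≤-reflexive (sym (*-identityˡ _))) (*-monoˡ-≤ (# (λ t → U t ∧ adj L w t)) 1≤q₁))) (Ldeg w (U′⊂ w u))

        S⊂ : ∀ c w → S c w ≡ true → X c ≡ true × U′ w ≡ true × nl c w ≡ true × free H P2 c w ≡ true
        S⊂ c w q = let (a , b , e′ , f , _) = dec⌊⌋ {d = in3? c w} q in a , b , e′ , f

        cover3 = Phase3.cover P2 pk2 X U′ Y s s′ y X⇒¬U′ Y⇒U′ Ysize (class-size cls U′ s′ U′size) s′≤s s≤5y (≤-trans (m∸n≤m s′ s″) s′≤s) 1≤s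
          (λ u w a b ne → I1-2 u w a b (λ f → ne (proj₁ (proj₂ f)))) Ldeg′ S S⊂ S-load

        module Fourth (Q3 : List (Fin h → Fin n)) (pk3 : Packs H (Q3 ++ P2)) (Q3-edges : All (EdgesIn H (λ x z → (S x z ∨ S z x) ∨ crossF U′ Y x z)) Q3)
                      (lo3 : Rel n) (lo3-few : ∀ c → # (lo3 c) ≤ d) (lo3⊂ : ∀ c w → lo3 c w ≡ true → S c w ≡ true)
                      (lo3-cov : ∀ c w → S c w ≡ true → lo3 c w ≡ true ⊎ 1 ≤ cvP H Q3 c w) where

          P3 : List (Fin h → Fin n)
          P3 = Q3 ++ P2

          Q3-W : ∀ x z → (S x z ∨ S z x) ∨ crossF U′ Y x z ≡ true → (S x z ≡ true ⊎ S z x ≡ true) ⊎ crossF U′ Y x z ≡ true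
          Q3-W x z q with ∨⁻ {S x z ∨ S z x} q
          ... | inj₂ f = inj₂ f
          ... | inj₁ f = inj₁ (∨⁻ {S x z} f)

          crossF⁻ : ∀ x z → crossF U′ Y x z ≡ true → nl x z ≡ true × (Y x ≡ true ⊎ Y z ≡ true) × cls x ≢ cls z
          crossF⁻ x z q with ∧⁻ {nl x z} q
          ... | a , b with ∧⁻ {U′ x ∧ U′ z} b
          ...   | _ , f with ∧⁻ {Y x ∨ Y z} f
          ...     | g , g′ = a , ∨⁻ {Y x} g , ⌊⌋false⁻ (not⁻ g′)

          edges3 : All (EdgesIn H nl) P → All (EdgesIn H nl) P3
          edges3 eP = AllP.++⁺ (edgesIn-mono H (λ x z q → w3 x z (Q3-W x z q)) Q3-edges)
            (AllP.++⁺ (edgesIn-mono H (λ x z q → [ (λ (ia , _) → proj₁ ia) , proj₁ ]′ (Q2-W x z q)) Q2-edges)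
              (AllP.++⁺ (edgesIn-mono H (λ x z q → proj₁ (dec⌊⌋ {d = inA? x z} q)) Q1-A) eP))
            where
            w3 : ∀ x z → (S x z ≡ true ⊎ S z x ≡ true) ⊎ crossF U′ Y x z ≡ true → nl x z ≡ true
            w3 x z (inj₁ (inj₁ q)) = proj₁ (proj₂ (proj₂ (S⊂ x z q)))
            w3 x z (inj₁ (inj₂ q)) = trans (nl-sym x z) (proj₁ (proj₂ (proj₂ (S⊂ z x q))))
            w3 x z (inj₂ q) = proj₁ (crossF⁻ x z q)

          mono3 : ∀ x z → free H P3 x z ≡ true → free H P x z ≡ true
          mono3 x z q = proj₂ (free-drop H Q1 P x z (proj₂ (free-drop H Q2 P1 x z (proj₂ (free-drop H Q3 P2 x z q)))))

          keep3 : ∀ u w → U′ u ≡ true → U′ w ≡ true → ¬ InF u w → ¬ (crossF U′ Y u w ≡ true) → free H P3 u w ≡ true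
          keep3 u w a b nf nc = free-keep H _ Q3 P2 u w Q3-edges (λ q → none (Q3-W u w q)) (I1-2 u w a b nf)
            where
            none : (S u w ≡ true ⊎ S w u ≡ true) ⊎ crossF U′ Y u w ≡ true → ⊥
            none (inj₁ (inj₁ q)) = t≢f a (X⇒¬U′ u (proj₁ (S⊂ u w q)))
            none (inj₁ (inj₂ q)) = t≢f b (X⇒¬U′ w (proj₁ (S⊂ w u q)))
            none (inj₂ q) = nc q

          ¬Y : ∀ w → U″ w ≡ true → ¬ (Y w ≡ true)
          ¬Y w a b = t≢f a (proj₂ (∖⁻ U′ U″ w b))

          ¬X : ∀ w → U′ w ≡ true → ¬ (X w ≡ true)
          ¬X w a b = t≢f a (X⇒¬U′ w b)

          I1-3 : ∀ u w → U″ u ≡ true → U″ w ≡ true → free H P3 u w ≡ true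
          I1-3 u w a b = keep3 u w (U″⊂ u a) (U″⊂ w b)
            (λ { (_ , _ , inj₁ (q , _)) → ¬X u (U″⊂ u a) q ; (_ , _ , inj₂ (inj₁ (q , _))) → ¬Y u a q ; (_ , _ , inj₂ (inj₂ (q , _))) → ¬Y u a q })
            (λ q → [ ¬Y u a , ¬Y w b ]′ (proj₁ (proj₂ (crossF⁻ u w q))))

          I2-3 : ∀ u w → Y u ≡ true → U″ w ≡ true → cls u ≡ cls w → free H P3 u w ≡ true
          I2-3 u w a b c = keep3 u w (Y⇒U′ u a) (U″⊂ w b)
            (λ { (_ , _ , inj₁ (q , _)) → ¬X u (Y⇒U′ u a) q ; (_ , _ , inj₂ (inj₁ (_ , q))) → ¬X w (U″⊂ w b) q ; (_ , _ , inj₂ (inj₂ (_ , q))) → ¬Y w b q })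
            (λ q → proj₂ (proj₂ (crossF⁻ u w q)) c)

          Bad : Fin n → Fin n → Bool
          Bad x z = X x ∧ (U z ∧ (nl x z ∧ free H P3 x z))

          LO : ∀ x z → Set
          LO x z = lo2 x (cls z) z ≡ true ⊎ lo2 z (cls x) x ≡ true ⊎ lo3 x z ≡ true

          bad-LO : ∀ x z → Bad x z ≡ true → LO x z
          bad-LO x z q with ∧⁻ {X x} q
          ... | Xx , q₂ with ∧⁻ {U z} q₂
          ...   | Uz , q₃ with ∧⁻ {nl x z} q₃
          ...     | nn , fr = by (bool-split (U′ z))
            where
            fr3 : free H Q3 x z ≡ true × free H P2 x z ≡ true
            fr3 = free-drop H Q3 P2 x z fr
            fr2 : free H Q2 x z ≡ true × free H P1 x z ≡ true
            fr2 = free-drop H Q2 P1 x z (proj₂ fr3)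
            fr2′ : free H Q2 z x ≡ true
            fr2′ = trans (cong isZero (cvP-sym H Q2 z x)) (proj₁ fr2)
            orient : Or x z → LO x z
            orient o with lo2-cov x (cls z) z (∧⁺ (⌊⌋dec {d = or? x z} o) (==-refl (cls z)))
            ... | inj₁ l = inj₁ l
            ... | inj₂ g = ⊥-elim (free-uncovered H Q2 x z (proj₁ fr2) g)
            orient′ : Or z x → LO x z
            orient′ o with lo2-cov z (cls x) x (∧⁺ (⌊⌋dec {d = or? z x} o) (==-refl (cls x)))
            ... | inj₁ l = inj₂ (inj₁ l)
            ... | inj₂ g = ⊥-elim (free-uncovered H Q2 z x fr2′ g)
            third : In3 x z → LO x z
            third i with lo3-cov x z (⌊⌋dec {d = in3? x z} i)
            ... | inj₁ l = inj₂ (inj₂ l)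
            ... | inj₂ g = ⊥-elim (free-uncovered H Q3 x z (proj₁ fr3) g)
            by : U′ z ≡ true ⊎ U′ z ≡ false → LO x z
            by (inj₂ nU) = cmp (<-cmp (rk x) (rk z))
              where
              Xz : X z ≡ true
              Xz = ∖⁺ U U′ z Uz nU
              Rxz : R x z ≡ true
              Rxz = ⇒R x z (nn , (X⇒U x Xx , Uz) , (λ (a , _) → t≢f a (X⇒¬U′ x Xx)) , λ { (_ , inj₁ a) → t≢f a (X⇒¬U′ x Xx) ; (_ , inj₂ a) → t≢f a nU }) (proj₂ fr2)
              cmp : Tri (rk x < rk z) (rk x ≡ rk z) (rk x > rk z) → LO x z
              cmp (tri< lt _ _) = orient (Rxz , Xz , inj₂ (Xx , lt))
              cmp (tri≈ _ eq _) = ⊥-elim (nl-≢ nn (rk-inj x z eq))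
              cmp (tri> _ _ gt) = orient′ (trans (R-sym z x) Rxz , Xx , inj₂ (Xz , gt))
            by (inj₁ Uz′) with cls x ≟ cls z | bool-split (Z z)
            ... | yes c | _ = third (Xx , Uz′ , nn , proj₂ fr3 , inj₁ c)
            ... | no _ | inj₂ nz = third (Xx , Uz′ , nn , proj₂ fr3 , inj₂ nz)
            ... | no c | inj₁ zz = orient′ (trans (R-sym z x) (⇒R x z (XU′-A x z Xx Uz′ nn c) (proj₂ fr2)) , Xx , inj₁ (¬true⇒ (¬X z Uz′) , zz))

          lo2-U : ∀ c a → # (lo2 c a) ≤ ⟦ U c ⟧ * d
          lo2-U c a with bool-split (U c)
          ... | inj₁ u = ≤-trans (lo2-few c a) (≤-reflexive (sym (trans (cong (_* d) (⟦⟧-true u)) (*-identityˡ d))))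
          ... | inj₂ u = ≤-trans (≤-reflexive (#-none (λ x q → t≢f (proj₁ (proj₁ (proj₂ (R⇒A c x (proj₁ (proj₁ (p⇒ c a x (lo2⊂ c a x q)))))))) u))) z≤n

          lo3-U : ∀ c → # (lo3 c) ≤ ⟦ U c ⟧ * d
          lo3-U c with bool-split (U c)
          ... | inj₁ u = ≤-trans (lo3-few c) (≤-reflexive (sym (trans (cong (_* d) (⟦⟧-true u)) (*-identityˡ d))))
          ... | inj₂ u = ≤-trans (≤-reflexive (#-none (λ x q → t≢f (X⇒U c (proj₁ (S⊂ c x (lo3⊂ c x q)))) u))) z≤n

          one2 : Fin n → Fin n → ℕ
          one2 c x = ∑ (λ a → ⟦ lo2 c a x ⟧)

          one2-sum : ∀ c → ∑ (one2 c) ≤ ⟦ U c ⟧ * d * k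
          one2-sum c = ≤-trans (≤-reflexive (∑-swap (λ x a → ⟦ lo2 c a x ⟧))) (≤-trans (∑-bound {k} (⟦ U c ⟧ * d) (lo2-U c)) (≤-reflexive (*-comm k _)))

          sumU : ∀ m → ∑ (λ c → ⟦ U c ⟧ * d * m) ≡ k * s * (d * m)
          sumU m = trans (∑-cong (λ c → *-assoc ⟦ U c ⟧ d m)) (trans (∑-*ʳ (λ c → ⟦ U c ⟧) (d * m)) (cong (_* (d * m)) U#))

          bound3 : ∑∑ (λ x z → ⟦ Bad x z ⟧) ≤ k * s * (d * k) + (k * s * (d * k) + k * s * (d * 1))
          bound3 = ≤-trans (∑-mono (λ x → ∑-mono (λ z → cell x z)))
            (≤-trans (≤-reflexive (trans (∑-cong (λ x → trans (∑-distrib (one2 x) _) (cong (∑ (one2 x) +_) (∑-distrib (λ z → one2 z x) (λ z → ⟦ lo3 x z ⟧))))) (trans (∑-distrib (λ x → ∑ (one2 x)) _) (cong (∑∑ one2 +_) (∑-distrib (λ x → ∑ (λ z → one2 z x)) (λ x → # (lo3 x)))))))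
              (+-mono-≤ sum2 (+-mono-≤ (≤-trans (≤-reflexive (∑-swap (λ x z → one2 z x))) sum2) (≤-trans (∑-mono (λ c → ≤-trans (lo3-U c) (≤-reflexive (sym (*-identityʳ _))))) (≤-reflexive (sumU 1))))))
            where
            sum2 : ∑∑ one2 ≤ k * s * (d * k)
            sum2 = ≤-trans (∑-mono one2-sum) (≤-reflexive (sumU k))
            hit : ∀ c a x → lo2 c a x ≡ true → 1 ≤ one2 c x
            hit c a x q = ≤-trans (≤-reflexive (sym (⟦⟧-true q))) (∑-term (λ a → ⟦ lo2 c a x ⟧) a)
            cell : ∀ x z → ⟦ Bad x z ⟧ ≤ one2 x z + (one2 z x + ⟦ lo3 x z ⟧)
            cell x z with bool-split (Bad x z)
            ... | inj₂ f = ≤-trans (≤-reflexive (⟦⟧-false f)) z≤n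
            ... | inj₁ b with bad-LO x z b
            ...   | inj₁ l = ≤-trans (⟦⟧≤1 _) (≤-trans (hit x (cls z) z l) (m≤m+n _ _))
            ...   | inj₂ (inj₁ l) = ≤-trans (⟦⟧≤1 _) (≤-trans (hit z (cls x) x l) (≤-trans (m≤m+n (one2 z x) ⟦ lo3 x z ⟧) (m≤n+m _ (one2 x z))))
            ...   | inj₂ (inj₂ l) = ≤-trans (⟦⟧≤1 _) (≤-trans (≤-reflexive (sym (⟦⟧-true l))) (≤-trans (m≤n+m ⟦ lo3 x z ⟧ (one2 z x)) (m≤n+m _ (one2 x z))))

          levelResult : LevelResult U U′ U″ s P
          levelResult = record { P⁺ = P3 ; packs⁺ = pk3 ; edges⁺ = edges3 ; mono⁺ = mono3 ; I1⁺ = I1-3 ; I2⁺ = I2-3 ; bound⁺ = bound3 }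

        levelResult : LevelResult U U′ U″ s P
        levelResult = go cover3
          where
          go : (∃ λ Q → Packs H (Q ++ P2) × All (EdgesIn H (λ x y → (S x y ∨ S y x) ∨ crossF U′ Y x y)) Q × Σ (Fin n → Fin n → Bool) λ lo → (∀ c → # (lo c) ≤ d) × (∀ c w → lo c w ≡ true → S c w ≡ true) × (∀ c w → S c w ≡ true → lo c w ≡ true ⊎ 1 ≤ cvP H Q c w)) →
            LevelResult U U′ U″ s P
          go (Q3 , pk3 , e3 , lo3 , few3 , sub3 , cov3) = Fourth.levelResult Q3 pk3 e3 lo3 few3 sub3 cov3

      levelResult : LevelResult U U′ U″ s P
      levelResult = go cover2
        where
        go : (∃ λ Q → Packs H Q × All (EdgesIn H (λ x z → (R x z ∨ R z x) ∨ F x z)) Q × Σ (Fin n → Fin k → Fin n → Bool) λ lo → (∀ c a → # (lo c a) ≤ d) × (∀ c a x → lo c a x ≡ true → p c a x ≡ true) × (∀ c a x → p c a x ≡ true → lo c a x ≡ true ⊎ 1 ≤ cvP H Q c x)) →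
          LevelResult U U′ U″ s P
        go (Q2 , pkQ2 , e2′ , lo , few , sub , cov) = Third.levelResult Q2 pkQ2 e2′ lo few sub cov

    levelResult : LevelResult U U′ U″ s P
    levelResult = go (saturate H A P pos pk)
      where
      go : (∃ λ Q → Packs H (Q ++ P) × All (EdgesIn H A) Q × Saturated H A (Q ++ P)) → LevelResult U U′ U″ s P
      go (Q1 , pk1 , e1 , noR) = Second.levelResult Q1 pk1 e1 (AfterFirst.R Q1 pk1 e1 noR) (AfterFirst.R⇒A Q1 pk1 e1 noR) (AfterFirst.R⇒free Q1 pk1 e1 noR)
        (λ x z a f → ∧⁺ (⌊⌋dec {d = inA? x z} a) f) (AfterFirst.R-sym Q1 pk1 e1 noR) (AfterFirst.highR Q1 pk1 e1 noR) (AfterFirst.highR-few Q1 pk1 e1 noR) (AfterFirst.lowR Q1 pk1 e1 noR)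

class-diff : ∀ {n k} (cls : Fin n → Fin k) (U V : Fin n → Bool) s t → (∀ v → V v ≡ true → U v ≡ true) →
  (∀ a → # (λ v → U v ∧ (cls v == a)) ≡ s) → (∀ a → # (λ v → V v ∧ (cls v == a)) ≡ t) → ∀ a → # (λ v → (U ∖ V) v ∧ (cls v == a)) ≡ s ∸ t
class-diff cls U V s t V⊂ Us Vs a = trans (sym (m+n∸m≡n (# (λ v → V v ∧ (cls v == a))) _)) (cong₂ _∸_ tot (Vs a))
  where
  tot : # (λ v → V v ∧ (cls v == a)) + # (λ v → (U ∖ V) v ∧ (cls v == a)) ≡ s
  tot = trans (sym (trans (#-split (λ v → U v ∧ (cls v == a)) V) (cong₂ _+_ (∑-cong (λ v → cong ⟦_⟧ (bool-ext (e₁ v) (e₂ v)))) (∑-cong (λ v → cong ⟦_⟧ (sw (U v) (cls v == a) (V v))))))) (Us a)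
    where
    e₁ : ∀ v → (U v ∧ (cls v == a)) ∧ V v ≡ true → V v ∧ (cls v == a) ≡ true
    e₁ v p with ∧⁻ {U v ∧ (cls v == a)} p
    ... | q , r = ∧⁺ r (proj₂ (∧⁻ {U v} q))
    e₂ : ∀ v → V v ∧ (cls v == a) ≡ true → (U v ∧ (cls v == a)) ∧ V v ≡ true
    e₂ v p with ∧⁻ {V v} p
    ... | q , r = ∧⁺ (∧⁺ (V⊂ v q) r) q
    sw : ∀ a b c → (a ∧ b) ∧ not c ≡ (a ∧ not c) ∧ b
    sw false b c = refl
    sw true b c = ∧-comm b (not c)

halving : ∀ M T s → 2 * M + 1 ≤ T → 4 * T + 2 * M + 1 ≤ s →
  T ≤ (s / 2 ∸ M) / 2 × s ≤ 5 * ((s / 2 ∸ M) ∸ ((s / 2 ∸ M) / 2 ∸ M)) × 2 * (s / 2 ∸ M) ≤ s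
halving M T s MT big = T≤ , s≤5y , 2s′≤s
  where
  s₁ = s / 2
  s′ = s₁ ∸ M
  s₀ = s′ / 2
  y = s′ ∸ (s₀ ∸ M)
  s≤ : s ≤ 1 + s₁ * 2
  s≤ = ≤-trans (≤-reflexive (m≡m%n+[m/n]*n s 2)) (+-monoˡ-≤ (s₁ * 2) (≤-pred (m%n<n s 2)))
  s₁≥ : 2 * T + M ≤ s₁
  s₁≥ = *-cancelʳ-≤ _ _ 2 (+-cancelˡ-≤ 1 _ _ (≤-trans (≤-reflexive (re T M)) (≤-trans big s≤)))
    where
    re : ∀ t m → 1 + (2 * t + m) * 2 ≡ 4 * t + 2 * m + 1
    re = solve-∀
  M≤s₁ : M ≤ s₁
  M≤s₁ = ≤-trans (m≤n+m M (2 * T)) s₁≥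
  s′≥ : 2 * T ≤ s′
  s′≥ = m+n≤o⇒m≤o∸n (2 * T) s₁≥
  T≤ : T ≤ s₀
  T≤ = ≤-trans (≤-reflexive (sym (m*n/n≡m T 2))) (/-monoˡ-≤ 2 (≤-trans (≤-reflexive (*-comm T 2)) s′≥))
  2s₀≤ : s₀ + s₀ ≤ s′
  2s₀≤ = ≤-trans (≤-reflexive (re s₀)) (m/n*n≤m s′ 2)
    where
    re : ∀ x → x + x ≡ x * 2
    re = solve-∀
  y≥ : s₀ ≤ y
  y≥ = ≤-trans (m+n≤o⇒m≤o∸n s₀ 2s₀≤) (∸-monoʳ-≤ s′ (m∸n≤m s₀ M))
  s′≤2y : s′ ≤ 2 * y
  s′≤2y = ≤-trans (≤-reflexive (sym (m∸n+n≡m (≤-trans (m∸n≤m s₀ M) (≤-trans (m≤m+n s₀ s₀) 2s₀≤))))) (≤-trans (+-monoʳ-≤ y (≤-trans (m∸n≤m s₀ M) y≥)) (≤-reflexive (cong (y +_) (sym (+-identityʳ y)))))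
  s≤5y : s ≤ 5 * y
  s≤5y = ≤-trans s≤ (≤-trans (≤-reflexive (cong (λ z → 1 + z * 2) (sym (m∸n+n≡m M≤s₁)))) (≤-trans (≤-reflexive (re s′ M))
    (≤-trans (+-mono-≤ (*-monoʳ-≤ 2 s′≤2y) (≤-trans MT (≤-trans T≤ y≥))) (≤-reflexive (re′ y)))))
    where
    re : ∀ a m → 1 + (a + m) * 2 ≡ 2 * a + (2 * m + 1)
    re = solve-∀
    re′ : ∀ y → 2 * (2 * y) + y ≡ 5 * y
    re′ = solve-∀
  2s′≤s : 2 * s′ ≤ s
  2s′≤s = ≤-trans (*-monoʳ-≤ 2 (m∸n≤m s₁ M)) (≤-trans (≤-reflexive (*-comm 2 s₁)) (m/n*n≤m s 2))

module VortexRun {h : ℕ} (H : Graph h) (v0 : Fin h) (indep : ∀ i j → adj H v0 i ≡ true → adj H v0 j ≡ true → adj H i j ≡ false)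
                 (d : ℕ) (deg : # (adj H v0) ≡ suc d) (colour : Fin h → Fin 2) (proper : ∀ i j → adj H i j ≡ true → colour i ≢ colour j) where
  open Constants h
  open Vortex H v0 indep d deg colour proper

  T N₁ W : ℕ
  T = Nk + 2 * M + 1
  N₁ = 4 * T + 2 * M + 1 + (q₁ * M + q₁)
  W = k * k + k * k + k

  module Run {n : ℕ} (L : Graph n) (L-free : HFree H L) (cls : Fin n → Fin k) where
    open Host L L-free cls

    left : (Fin n → Bool) → List (Fin h → Fin n) → ℕ
    left U P = ∑∑ (λ x z → ⟦ (U x ∧ U z) ∧ (nl x z ∧ free H P x z) ⟧)

    touching : (X U : Fin n → Bool) → List (Fin h → Fin n) → ℕ
    touching X U P = ∑∑ (λ x z → ⟦ X x ∧ (U z ∧ (nl x z ∧ free H P x z)) ⟧)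

    touching-mono : ∀ X U P P′ → (∀ x z → free H P′ x z ≡ true → free H P x z ≡ true) → touching X U P′ ≤ touching X U P
    touching-mono X U P P′ m = ∑-mono (λ x → ∑-mono (λ z → ⟦⟧-mono (λ q → let (a , b) = ∧⁻ {X x} q ; (c , e) = ∧⁻ {U z} b ; (f , g) = ∧⁻ {nl x z} e in ∧⁺ a (∧⁺ c (∧⁺ f (m x z g))))))

    left-split : ∀ U U′ P → left U P ≤ left U′ P + (touching (U ∖ U′) U P + touching (U ∖ U′) U P)
    left-split U U′ P = ≤-trans (∑-mono (λ x → ∑-mono (cell x))) (≤-reflexive (trans (∑-cong (λ x → trans (∑-distrib (λ z → ⟦ (U′ x ∧ U′ z) ∧ g x z ⟧) _) (cong (∑ (λ z → ⟦ (U′ x ∧ U′ z) ∧ g x z ⟧) +_) (∑-distrib (λ z → tt x z) (λ z → tt z x)))))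
        (trans (∑-distrib (λ x → ∑ (λ z → ⟦ (U′ x ∧ U′ z) ∧ g x z ⟧)) _) (cong (left U′ P +_) (trans (∑-distrib (λ x → ∑ (λ z → tt x z)) _) (cong (touching (U ∖ U′) U P +_) (∑-swap (λ x z → tt z x))))))))
      where
      g : Fin n → Fin n → Bool
      g x z = nl x z ∧ free H P x z
      g-sym : ∀ x z → g x z ≡ g z x
      g-sym x z = cong₂ _∧_ (nl-sym x z) (cong isZero (cvP-sym H P x z))
      tt : Fin n → Fin n → ℕ
      tt x z = ⟦ (U ∖ U′) x ∧ (U z ∧ g x z) ⟧
      cell : ∀ x z → ⟦ (U x ∧ U z) ∧ g x z ⟧ ≤ ⟦ (U′ x ∧ U′ z) ∧ g x z ⟧ + (tt x z + tt z x)
      cell x z with bool-split ((U x ∧ U z) ∧ g x z)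
      ... | inj₂ f = ≤-trans (≤-reflexive (⟦⟧-false f)) z≤n
      ... | inj₁ t with ∧⁻ {U x ∧ U z} t
      ...   | u , gg with ∧⁻ {U x} u | bool-split (U′ x) | bool-split (U′ z)
      ...     | ux , uz | inj₁ a | inj₁ b = ≤-trans (⟦⟧≤1 _) (≤-trans (≤-reflexive (sym (⟦⟧-true (∧⁺ (∧⁺ a b) gg)))) (m≤m+n _ _))
      ...     | ux , uz | inj₂ a | _ = ≤-trans (⟦⟧≤1 _) (≤-trans (≤-reflexive (sym (⟦⟧-true (∧⁺ (∖⁺ U U′ x ux a) (∧⁺ uz gg))))) (≤-trans (m≤m+n (tt x z) (tt z x)) (m≤n+m _ ⟦ (U′ x ∧ U′ z) ∧ g x z ⟧)))
      ...     | ux , uz | _ | inj₂ b = ≤-trans (⟦⟧≤1 _) (≤-trans (≤-reflexive (sym (⟦⟧-true (∧⁺ (∖⁺ U U′ z uz b) (∧⁺ ux (trans (g-sym z x) gg)))))) (≤-trans (m≤n+m (tt z x) (tt x z)) (m≤n+m _ ⟦ (U′ x ∧ U′ z) ∧ g x z ⟧)))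

    left-trivial : ∀ U P → left U P ≤ # U * # U
    left-trivial U P = ≤-trans (∑-mono (λ x → ≤-trans (∑-mono (λ z → ≤-trans (⟦⟧-mono (λ q → proj₁ (∧⁻ {U x ∧ U z} q))) (≤-reflexive (⟦∧⟧ (U x) (U z))))) (≤-reflexive (∑-*ˡ ⟦ U x ⟧ (λ z → ⟦ U z ⟧))))) (≤-reflexive (∑-*ʳ (λ x → ⟦ U x ⟧) (# U)))

    Sized : (Fin n → Bool) → ℕ → Set
    Sized U s = (∀ a → # (λ v → U v ∧ (cls v == a)) ≡ s) × (∀ v → U v ≡ true → q₁ * # (λ w → U w ∧ adj L v w) ≤ s)

    record State (U U′ : Fin n → Bool) (s : ℕ) (P : List (Fin h → Fin n)) : Set where
      field
        sub : ∀ v → U′ v ≡ true → U v ≡ true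
        sized : Sized U s
        sized′ : Sized U′ (s / 2 ∸ M)
        packs : Packs H P
        edges′ : All (EdgesIn H nl) P
        I1 : ∀ u w → U′ u ≡ true → U′ w ≡ true → free H P u w ≡ true
        I2 : ∀ u w → (U ∖ U′) u ≡ true → U′ w ≡ true → cls u ≡ cls w → free H P u w ≡ true
    open State

    Goal : (Fin n → Bool) → ℕ → List (Fin h → Fin n) → Set
    Goal U s P = ∃ λ P⁺ → Packs H P⁺ × All (EdgesIn H nl) P⁺ × (∀ x z → free H P⁺ x z ≡ true → free H P x z ≡ true) × left U P⁺ ≤ 4 * W * d * s + k * N₁ * (k * N₁)

    descend : ∀ s U U′ P → State U U′ s P → Goal U s P
    descend = <-rec _ λ s rec U U′ P st → go s rec U U′ P st (N₁ ≤? s)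
      where
      go : ∀ s → (∀ {r} → r < s → ∀ U U′ P → State U U′ r P → Goal U r P) → ∀ U U′ P → State U U′ s P → Dec (N₁ ≤ s) → Goal U s P
      go s rec U U′ P st (no small) = P , packs st , edges′ st , (λ _ _ q → q) , ≤-trans (left-trivial U P) (≤-trans (*-mono-≤ U≤ U≤) (m≤n+m _ _))
        where
        U≤ : # U ≤ k * N₁
        U≤ = ≤-trans (≤-reflexive (class-size cls U s (proj₁ (sized st)))) (*-monoʳ-≤ k (<⇒≤ (≰⇒> small)))
      go s rec U U′ P st (yes large) = next (select U′ s₀ (λ a → ≤-trans (m/n≤m s′ 2) (≤-reflexive (sym (proj₁ (sized′ st) a)))) Nk≤s₀ 2M≤s₀)
        where
        s′ = s / 2 ∸ M
        s₀ = s′ / 2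
        s″ = s₀ ∸ M
        hv = halving M T s (+-monoˡ-≤ 1 (m≤n+m (2 * M) Nk)) (≤-trans (m≤m+n _ _) large)
        T≤s₀ = proj₁ hv
        Nk≤s₀ : Nk ≤ k * s₀
        Nk≤s₀ = ≤-trans (≤-trans (≤-trans (m≤m+n Nk (2 * M)) (m≤m+n _ 1)) T≤s₀) (≤-trans (≤-reflexive (sym (*-identityˡ s₀))) (*-monoˡ-≤ s₀ 1≤k))
        2M≤s₀ : 2 * M ≤ s₀
        2M≤s₀ = ≤-trans (≤-trans (m≤n+m (2 * M) Nk) (m≤m+n _ 1)) T≤s₀
        s′≤s : s′ ≤ s
        s′≤s = ≤-trans (m≤m+n s′ (s′ + 0)) (proj₂ (proj₂ hv))
        s₀≤s : s₀ ≤ s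
        s₀≤s = ≤-trans (m/n≤m s′ 2) s′≤s
        qs : q₁ * M + q₁ ≤ s
        qs = ≤-trans (m≤n+m (q₁ * M + q₁) (4 * T + 2 * M + 1)) large
        s′<s : s′ < s
        s′<s = ≤-trans (≤-trans (s≤s (≤-reflexive (sym (+-identityʳ s′)))) (+-monoˡ-≤ (s′ + 0) 1≤s′)) (proj₂ (proj₂ hv))
          where
          1≤s′ : 1 ≤ s′
          1≤s′ = ≤-trans (≤-trans (m≤n+m 1 (Nk + 2 * M)) T≤s₀) (m/n≤m s′ 2)
        next : (Σ (Fin n → Bool) λ U″ → (∀ v → U″ v ≡ true → U′ v ≡ true) × (∀ a → # (λ v → U″ v ∧ (cls v == a)) ≡ s″) × (∀ v → U″ v ≡ true → q₁ * # (λ w → U″ w ∧ adj L v w) ≤ s″)) → Goal U s P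
        next (U″ , sub″ , size″ , deg″) = final (rec s′<s U′ U″ (VortexLevel.LevelResult.P⁺ level) (record
            { sub = sub″ ; sized = sized′ st ; sized′ = size″ , deg″ ; packs = VortexLevel.LevelResult.packs⁺ level ; edges′ = VortexLevel.LevelResult.edges⁺ level (edges′ st) ; I1 = VortexLevel.LevelResult.I1⁺ level ; I2 = VortexLevel.LevelResult.I2⁺ level }))
          where
          level = VortexLevel.Level.levelResult H v0 indep d deg colour proper L L-free cls U U′ U″ s s′ s″ (sub st) sub″ (proj₁ (sized st)) (proj₁ (sized′ st)) size″
            (proj₁ (proj₂ hv)) s′≤s (≤-trans (m≤m+n _ q₁) qs) (≤-trans Nk≤s₀ (*-monoʳ-≤ k s₀≤s)) (≤-trans (m≤n+m q₁ (q₁ * M)) qs) (proj₂ (sized st)) P (packs st) (I1 st) (I2 st)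
          final : Goal U′ s′ (VortexLevel.LevelResult.P⁺ level) → Goal U s P
          final (P⁺ , pk , eg , mono , bd) = P⁺ , pk , eg , (λ x z q → VortexLevel.LevelResult.mono⁺ level x z (mono x z q)) , (begin
              left U P⁺                                                       ≤⟨ left-split U U′ P⁺ ⟩
              left U′ P⁺ + (touching (U ∖ U′) U P⁺ + touching (U ∖ U′) U P⁺)   ≤⟨ +-mono-≤ bd (+-mono-≤ tb tb) ⟩
              (4 * W * d * s′ + C₂) + (B + B)                                 ≡⟨ re₁ W d s′ C₂ B ⟩
              2 * W * d * (2 * s′) + 2 * B + C₂                               ≤⟨ +-monoˡ-≤ C₂ (+-monoˡ-≤ (2 * B) (*-monoʳ-≤ (2 * W * d) (proj₂ (proj₂ hv)))) ⟩
              2 * W * d * s + 2 * B + C₂                                      ≡⟨ cong (_+ C₂) (re₂ k d s) ⟩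
              4 * W * d * s + C₂ ∎)
            where
            open ≤-Reasoning
            B C₂ : ℕ
            B = k * s * (d * k) + (k * s * (d * k) + k * s * (d * 1))
            C₂ = k * N₁ * (k * N₁)
            tb : touching (U ∖ U′) U P⁺ ≤ B
            tb = ≤-trans (touching-mono (U ∖ U′) U (VortexLevel.LevelResult.P⁺ level) P⁺ mono) (VortexLevel.LevelResult.bound⁺ level)
            re₁ : ∀ W d s′ C B → (4 * W * d * s′ + C) + (B + B) ≡ 2 * W * d * (2 * s′) + 2 * B + C
            re₁ = solve-∀
            re₂ : ∀ k d s → 2 * (k * k + k * k + k) * d * s + 2 * (k * s * (d * k) + (k * s * (d * k) + k * s * (d * 1))) ≡ 4 * (k * k + k * k + k) * d * s
            re₂ = solve-∀

module VortexStart {h : ℕ} (H : Graph h) (v0 : Fin h) (indep : ∀ i j → adj H v0 i ≡ true → adj H v0 j ≡ true → adj H i j ≡ false)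
                   (d : ℕ) (deg : # (adj H v0) ≡ suc d) (colour : Fin h → Fin 2) (proper : ∀ i j → adj H i j ≡ true → colour i ≢ colour j) where
  open Constants h
  open Vortex H v0 indep d deg colour proper
  open VortexRun H v0 indep d deg colour proper

  b S₀ N₀ A₀ B₀ : ℕ
  b = k + k * M
  S₀ = 2 * (Nk + 2 * M) + b + 1
  N₀ = k * (S₀ + M)
  A₀ = 4 * W
  B₀ = k * N₁ * (k * N₁) + 2 * (b * (b + d))

  residue : ∀ {n} → Fin n → Fin k
  residue v = fromℕ< (m%n<n (toℕ v) k)

  residue-size : ∀ n (a : Fin k) → n / k ≤ # (λ (v : Fin n) → true ∧ (residue v == a))
  residue-size n a = #-inj _ f f-inj λ j → ⌊⌋dec (toℕ-injective (trans (toℕ-fromℕ< _) (trans (cong (_% k) (toℕ-fromℕ< (lt j))) (trans ([m+kn]%n≡m%n (toℕ a) (toℕ j) k) (m<n⇒m%n≡m (toℕ<n a))))))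
    where
    lt : ∀ (j : Fin (n / k)) → toℕ a + toℕ j * k < n
    lt j = ≤-trans (+-monoˡ-≤ (toℕ j * k) (toℕ<n a)) (≤-trans (*-monoˡ-≤ k (toℕ<n j)) (m/n*n≤m n k))
    f : Fin (n / k) → Fin n
    f j = fromℕ< (lt j)
    f-inj : Injective _≡_ _≡_ f
    f-inj {i} {j} e = toℕ-injective (*-cancelʳ-≡ _ _ k (+-cancelˡ-≡ (toℕ a) _ _ (trans (sym (toℕ-fromℕ< (lt i))) (trans (cong toℕ e) (toℕ-fromℕ< (lt j))))))

  Packed : ∀ {n} → Graph n → Set
  Packed {n} L = ∃ λ (P : List (Fin h → Fin n)) → Packs H P × All (EdgesIn H (nonL H L)) P × unc H L P ≤ A₀ * d * n + B₀

  module Begin {n : ℕ} (big : N₀ ≤ n) (L : Graph n) (L-free : HFree H L) where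
    open Host L L-free residue
    open Run L L-free residue

    t s₀ h₀ s₁ : ℕ
    t = n / k
    s₀ = t ∸ M
    h₀ = s₀ / 2
    s₁ = h₀ ∸ M

    t≥ : S₀ + M ≤ t
    t≥ = ≤-trans (≤-reflexive (sym (m*n/n≡m (S₀ + M) k))) (/-monoˡ-≤ k (≤-trans (≤-reflexive (*-comm (S₀ + M) k)) big))

    s₀≥ : S₀ ≤ s₀
    s₀≥ = m+n≤o⇒m≤o∸n S₀ t≥

    h₀≥ : Nk + 2 * M ≤ h₀
    h₀≥ = ≤-trans (≤-reflexive (sym (m*n/n≡m (Nk + 2 * M) 2))) (/-monoˡ-≤ 2 (≤-trans (≤-reflexive (*-comm (Nk + 2 * M) 2)) (≤-trans (≤-trans (m≤m+n (2 * (Nk + 2 * M)) b) (m≤m+n (2 * (Nk + 2 * M) + b) 1)) s₀≥)))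

    h₀≤t : h₀ ≤ t
    h₀≤t = ≤-trans (m/n≤m s₀ 2) (m∸n≤m t M)

    Nk≤ : ∀ x → h₀ ≤ x → Nk ≤ k * x
    Nk≤ x le = ≤-trans (≤-trans (m≤m+n Nk (2 * M)) (≤-trans h₀≥ le)) (≤-trans (≤-reflexive (sym (*-identityˡ x))) (*-monoˡ-≤ x 1≤k))

    2M≤ : ∀ x → h₀ ≤ x → 2 * M ≤ x
    2M≤ x le = ≤-trans (m≤n+m (2 * M) Nk) (≤-trans h₀≥ le)

    module Go (U₀ U₁ : Fin n → Bool) (size₀ : ∀ a → # (λ v → U₀ v ∧ (residue v == a)) ≡ s₀) (deg₀ : ∀ v → U₀ v ≡ true → q₁ * # (λ w → U₀ w ∧ adj L v w) ≤ s₀)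
              (sub₁ : ∀ v → U₁ v ≡ true → U₀ v ≡ true) (size₁ : ∀ a → # (λ v → U₁ v ∧ (residue v == a)) ≡ s₁) (deg₁ : ∀ v → U₁ v ≡ true → q₁ * # (λ w → U₁ w ∧ adj L v w) ≤ s₁) where

      X Y : Fin n → Bool
      X v = not (U₀ v)
      Y = U₀ ∖ U₁

      U₀# : # U₀ ≡ k * s₀
      U₀# = class-size residue U₀ s₀ size₀

      X≤b : # X ≤ b
      X≤b = +-cancelˡ-≤ (# U₀) _ _ (≤-trans (≤-reflexive (trans (sym (#-split (λ _ → true) U₀)) (#-true (λ _ → refl)))) (≤-trans n≤ (≤-reflexive (cong (_+ b) (sym U₀#)))))
        where
        n≤ : n ≤ k * s₀ + (k + k * M)
        n≤ = ≤-trans (≤-reflexive (m≡m%n+[m/n]*n n k)) (≤-trans (+-mono-≤ (<⇒≤ (m%n<n n k)) (≤-reflexive (trans (*-comm t k) (cong (k *_) (sym (m∸n+n≡m (≤-trans (m≤n+m M S₀) t≥))))))) (≤-reflexive (re k s₀ M)))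
          where
          re : ∀ k s m → k + k * (s + m) ≡ k * s + (k + k * m)
          re = solve-∀

      S : Rel n
      S c w = X c ∧ (U₀ w ∧ nl c w)

      y≥ : s₀ ≤ 2 * (s₀ ∸ s₁)
      y≥ = ≤-trans (≤-reflexive (sym (m∸n+n≡m (≤-trans (m∸n≤m h₀ M) (m/n≤m s₀ 2))))) (≤-trans (+-monoʳ-≤ (s₀ ∸ s₁) (≤-trans (m∸n≤m h₀ M) (≤-trans h≤ (∸-monoʳ-≤ s₀ (m∸n≤m h₀ M))))) (≤-reflexive (cong (s₀ ∸ s₁ +_) (sym (+-identityʳ _)))))
        where
        h≤ : h₀ ≤ s₀ ∸ h₀
        h≤ = m+n≤o⇒m≤o∸n h₀ (≤-trans (≤-reflexive (re h₀)) (m/n*n≤m s₀ 2))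
          where
          re : ∀ x → x + x ≡ x * 2
          re = solve-∀

      s₀≤2s₀ : s₀ ≤ 2 * s₀
      s₀≤2s₀ = m≤m+n s₀ (s₀ + 0)

      cover = Phase3.cover [] ([] , []) X U₀ Y (2 * s₀) s₀ (s₀ ∸ s₁) (λ v q → not⁻ q) (λ v q → proj₁ (∖⁻ U₀ U₁ v q)) (class-diff residue U₀ U₁ s₀ s₁ sub₁ size₀ size₁) U₀# s₀≤2s₀
        (≤-trans (*-monoʳ-≤ 2 y≥) (≤-trans (≤-reflexive (re (s₀ ∸ s₁))) (*-monoˡ-≤ (s₀ ∸ s₁) (n≤1+n 4)))) (≤-trans (m∸n≤m s₀ s₁) s₀≤2s₀) (≤-trans (≤-trans (m≤n+m 1 (2 * (Nk + 2 * M) + b)) s₀≥) s₀≤2s₀)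
        (λ _ _ _ _ _ → refl) (λ w u → ≤-trans (≤-trans (≤-trans (≤-reflexive (sym (*-identityˡ _))) (*-monoˡ-≤ (# (λ t → U₀ t ∧ adj L w t)) 1≤q₁)) (deg₀ w u)) s₀≤2s₀) S
        (λ c w q → let (a , r) = ∧⁻ {X c} q ; (e , f) = ∧⁻ {U₀ w} r in a , e , f , refl)
        (λ w → ≤-trans (#-mono (λ c q → proj₁ (∧⁻ {X c} q))) (≤-trans X≤b (≤-trans (≤-trans (≤-trans (m≤n+m b (2 * (Nk + 2 * M))) (m≤m+n (2 * (Nk + 2 * M) + b) 1)) s₀≥) (≤-trans s₀≤2s₀ (m≤m+n (2 * s₀) (2 * s₀ + 0))))))
        where
        re : ∀ y → 2 * (2 * y) ≡ 4 * y
        re = solve-∀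

      module Cov (Q : List (Fin h → Fin n)) (pkQ : Packs H (Q ++ [])) (eQ : All (EdgesIn H (λ x y → (S x y ∨ S y x) ∨ crossF U₀ Y x y)) Q)
                 (lo : Rel n) (lo-few : ∀ c → # (lo c) ≤ d) (lo-cov : ∀ c w → S c w ≡ true → lo c w ≡ true ⊎ 1 ≤ cvP H Q c w) where
        P₀ : List (Fin h → Fin n)
        P₀ = Q ++ []

        S⁻ : ∀ x z → S x z ≡ true → X x ≡ true × nl x z ≡ true
        S⁻ x z q = let (a , r) = ∧⁻ {X x} q ; (_ , f) = ∧⁻ {U₀ z} r in a , f

        cross⁻ : ∀ x z → crossF U₀ Y x z ≡ true → nl x z ≡ true × (Y x ≡ true ⊎ Y z ≡ true) × residue x ≢ residue z
        cross⁻ x z q = let (a , r) = ∧⁻ {nl x z} q ; (_ , f) = ∧⁻ {U₀ x ∧ U₀ z} r ; (g , g′) = ∧⁻ {Y x ∨ Y z} f in a , ∨⁻ {Y x} g , ⌊⌋false⁻ (not⁻ g′)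

        W⁻ : ∀ x z → (S x z ∨ S z x) ∨ crossF U₀ Y x z ≡ true → (S x z ≡ true ⊎ S z x ≡ true) ⊎ crossF U₀ Y x z ≡ true
        W⁻ x z q with ∨⁻ {S x z ∨ S z x} q
        ... | inj₂ f = inj₂ f
        ... | inj₁ f = inj₁ (∨⁻ {S x z} f)

        nlQ : All (EdgesIn H nl) P₀
        nlQ = AllP.++⁺ (edgesIn-mono H (λ x z q → w x z (W⁻ x z q)) eQ) []
          where
          w : ∀ x z → (S x z ≡ true ⊎ S z x ≡ true) ⊎ crossF U₀ Y x z ≡ true → nl x z ≡ true
          w x z (inj₁ (inj₁ q)) = proj₂ (S⁻ x z q)
          w x z (inj₁ (inj₂ q)) = trans (nl-sym x z) (proj₂ (S⁻ z x q))
          w x z (inj₂ q) = proj₁ (cross⁻ x z q)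

        keep : ∀ u w → U₀ u ≡ true → U₀ w ≡ true → ¬ (crossF U₀ Y u w ≡ true) → free H P₀ u w ≡ true
        keep u w a e nc = free-keep H _ Q [] u w eQ (λ q → none (W⁻ u w q)) refl
          where
          none : (S u w ≡ true ⊎ S w u ≡ true) ⊎ crossF U₀ Y u w ≡ true → ⊥
          none (inj₁ (inj₁ q)) = t≢f a (not⁻ (proj₁ (S⁻ u w q)))
          none (inj₁ (inj₂ q)) = t≢f e (not⁻ (proj₁ (S⁻ w u q)))
          none (inj₂ q) = nc q

        ¬Y : ∀ w → U₁ w ≡ true → ¬ (Y w ≡ true)
        ¬Y w a q = t≢f a (proj₂ (∖⁻ U₀ U₁ w q))

        st : State U₀ U₁ s₀ P₀
        st = record
          { sub = sub₁ ; sized = size₀ , deg₀ ; sized′ = size₁ , deg₁ ; packs = pkQ ; edges′ = nlQ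
          ; I1 = λ u w a e → keep u w (sub₁ u a) (sub₁ w e) (λ q → [ ¬Y u a , ¬Y w e ]′ (proj₁ (proj₂ (cross⁻ u w q))))
          ; I2 = λ u w a e c → keep u w (proj₁ (∖⁻ U₀ U₁ u a)) (sub₁ w e) (λ q → proj₂ (proj₂ (cross⁻ u w q)) c) }

        done : Goal U₀ s₀ P₀ → Packed L
        done (P , pk , eg , mono , bd) = P , pk , eg , (begin
            unc H L P                                          ≤⟨ ∑-mono (λ x → ∑-mono (λ z → ⟦⟧-mono (λ q → q))) ⟩
            left (λ _ → true) P                                ≤⟨ left-split (λ _ → true) U₀ P ⟩
            left U₀ P + (touching X (λ _ → true) P + touching X (λ _ → true) P) ≤⟨ +-mono-≤ bd (+-mono-≤ tb tb) ⟩
            4 * W * d * s₀ + k * N₁ * (k * N₁) + (b * (b + d) + b * (b + d)) ≤⟨ +-monoˡ-≤ _ (+-monoˡ-≤ (k * N₁ * (k * N₁)) (*-monoʳ-≤ (4 * W * d) s₀≤n)) ⟩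
            4 * W * d * n + k * N₁ * (k * N₁) + (b * (b + d) + b * (b + d)) ≡⟨ re (4 * W * d * n) (k * N₁ * (k * N₁)) (b * (b + d)) ⟩
            A₀ * d * n + B₀ ∎)
          where
          open ≤-Reasoning
          re : ∀ a c e → a + c + (e + e) ≡ a + (c + 2 * e)
          re = solve-∀
          s₀≤n : s₀ ≤ n
          s₀≤n = ≤-trans (m∸n≤m t M) (m/n≤m n k)
          row : ∀ x → ∑ (λ z → ⟦ X x ∧ (nl x z ∧ free H P x z) ⟧) ≤ ⟦ X x ⟧ * (b + d)
          row x with bool-split (X x)
          ... | inj₂ f = ≤-trans (≤-reflexive (#-none (λ z q → t≢f (proj₁ (∧⁻ {X x} q)) f))) z≤n
          ... | inj₁ Xx = ≤-trans (#-∪ _ X (lo x) split) (≤-trans (+-mono-≤ X≤b (lo-few x)) (≤-reflexive (sym (trans (cong (_* (b + d)) (⟦⟧-true Xx)) (*-identityˡ _)))))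
            where
            split : ∀ z → X x ∧ (nl x z ∧ free H P x z) ≡ true → X z ≡ true ⊎ lo x z ≡ true
            split z q with bool-split (U₀ z)
            ... | inj₂ u = inj₁ (not⁺ u)
            ... | inj₁ u with ∧⁻ {X x} q
            ...   | _ , q′ with ∧⁻ {nl x z} q′
            ...     | nn , fr with lo-cov x z (∧⁺ Xx (∧⁺ u nn))
            ...       | inj₁ l = inj₂ l
            ...       | inj₂ g = ⊥-elim (1+n≰n (≤-trans g (≤-reflexive (isZero⇒ (proj₁ (free-drop H Q [] x z (mono x z fr)))))))
          tb : touching X (λ _ → true) P ≤ b * (b + d)
          tb = ≤-trans (∑-mono row) (≤-trans (≤-reflexive (∑-*ʳ (λ x → ⟦ X x ⟧) (b + d))) (*-monoˡ-≤ (b + d) X≤b))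

        packed : Packed L
        packed = done (descend s₀ U₀ U₁ P₀ st)

      packed : Packed L
      packed = go cover
        where
        go : (∃ λ Q → Packs H (Q ++ []) × All (EdgesIn H (λ x y → (S x y ∨ S y x) ∨ crossF U₀ Y x y)) Q ×
          Σ (Fin n → Fin n → Bool) λ lo → (∀ c → # (lo c) ≤ d) × (∀ c w → lo c w ≡ true → S c w ≡ true) × (∀ c w → S c w ≡ true → lo c w ≡ true ⊎ 1 ≤ cvP H Q c w)) → Packed L
        go (Q , pk , e , lo , few , _ , cov) = Cov.packed Q pk e lo few cov

    packed : Packed L
    packed = first (select (λ _ → true) t (residue-size n) (Nk≤ t h₀≤t) (2M≤ t h₀≤t))
      where
      second : (U₀ : Fin n → Bool) → (∀ a → # (λ v → U₀ v ∧ (residue v == a)) ≡ s₀) → (∀ v → U₀ v ≡ true → q₁ * # (λ w → U₀ w ∧ adj L v w) ≤ s₀) →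
        (Σ (Fin n → Bool) λ U₁ → (∀ v → U₁ v ≡ true → U₀ v ≡ true) × (∀ a → # (λ v → U₁ v ∧ (residue v == a)) ≡ s₁) × (∀ v → U₁ v ≡ true → q₁ * # (λ w → U₁ w ∧ adj L v w) ≤ s₁)) → Packed L
      second U₀ z₀ g₀ (U₁ , sb , z₁ , g₁) = Go.packed U₀ U₁ z₀ g₀ sb z₁ g₁
      first : (Σ (Fin n → Bool) λ U₀ → (∀ v → U₀ v ≡ true → true ≡ true) × (∀ a → # (λ v → U₀ v ∧ (residue v == a)) ≡ s₀) × (∀ v → U₀ v ≡ true → q₁ * # (λ w → U₀ w ∧ adj L v w) ≤ s₀)) → Packed L
      first (U₀ , _ , z₀ , g₀) = second U₀ z₀ g₀ (select U₀ h₀ (λ a → ≤-trans (m/n≤m s₀ 2) (≤-reflexive (sym (z₀ a)))) (Nk≤ h₀ ≤-refl) (2M≤ h₀ ≤-refl))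

sparse-packing : ∀ {h} (H : Graph h) (v0 : Fin h) (d : ℕ) → # (adj H v0) ≡ suc d → (colour : Fin h → Fin 2) → (∀ i j → adj H i j ≡ true → colour i ≢ colour j) →
  ∃ λ A → ∃ λ B → ∃ λ N → ∀ {n} → N ≤ n → (L : Graph n) → HFree H L → ∃ λ (P : List (Fin h → Fin n)) → Packs H P × All (EdgesIn H (nonL H L)) P × unc H L P ≤ A * d * n + B
sparse-packing H v0 d deg colour proper = A₀ , B₀ , N₀ , λ big L L-free → Begin.packed big L L-free
  where
  third : ∀ {a b c : Fin 2} → a ≢ b → a ≢ c → b ≡ c
  third {zero} {zero} p _ = ⊥-elim (p refl)
  third {zero} {suc zero} {zero} _ q = ⊥-elim (q refl)
  third {zero} {suc zero} {suc zero} _ _ = refl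
  third {suc zero} {suc zero} p _ = ⊥-elim (p refl)
  third {suc zero} {zero} {suc zero} _ q = ⊥-elim (q refl)
  third {suc zero} {zero} {zero} _ _ = refl
  open VortexStart H v0 (λ i j a b → ¬true⇒ (λ e → proper i j e (third (proper v0 i a) (proper v0 j b)))) d deg colour proper

-- Forests

#-two : ∀ {n} (p : Fin n → Bool) x → 2 ≤ # p → ∃ λ w → p w ≡ true × w ≢ x
#-two p x two = let (w , q) = #-pos (λ w → p w ∧ not (w == x)) rest ; (a , b) = ∧⁻ {p w} q in w , a , λ e → t≢f (⌊⌋dec e) (not⁻ b)
  where
  rest : 1 ≤ # (λ w → p w ∧ not (w == x))
  rest = +-cancelˡ-≤ 1 _ _ (≤-trans two (≤-trans (≤-reflexive (#-split p (λ w → w == x))) (+-monoˡ-≤ _ (#-δ≤1 p x))))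

module _ {h : ℕ} (H : Graph h) where

  record Path (k : ℕ) : Set where
    field
      vertex : Fin (suc (suc k)) → Fin h
      vertex-inj : ∀ i j → vertex i ≡ vertex j → i ≡ j
      consecutive : ∀ i → adj H (vertex (inject₁ i)) (vertex (suc i)) ≡ true
  open Path

  close : ∀ {k} (p : Path k) (m : Fin k) → adj H (vertex p zero) (vertex p (suc (suc m))) ≡ true → HasCycle H
  close {k} p m a = toℕ m , v , (λ {i} {j} e → inject≤-inj le (vertex-inj p _ _ e)) , ed , trans (cong (λ z → adj H z (v zero)) last) (trans (adj-sym H _ _) a)
    where
    le : suc (suc (suc (toℕ m))) ≤ suc (suc k)
    le = s≤s (s≤s (toℕ<n m))
    v : Fin (suc (suc (suc (toℕ m)))) → Fin h
    v i = vertex p (inject≤ i le)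
    ed : ∀ i → adj H (v (inject₁ i)) (v (suc i)) ≡ true
    ed i = subst₂ (λ x y → adj H (vertex p x) (vertex p y) ≡ true) (toℕ-injective (trans (toℕ-inject₁ _) (trans (toℕ-inject≤ i (≤-pred le)) (sym (trans (toℕ-inject≤ (inject₁ i) le) (toℕ-inject₁ i))))))
      (toℕ-injective (trans (cong suc (toℕ-inject≤ i (≤-pred le))) (sym (toℕ-inject≤ (suc i) le)))) (consecutive p (inject≤ i (≤-pred le)))
    last : v (fromℕ (suc (suc (toℕ m)))) ≡ vertex p (suc (suc m))
    last = cong (vertex p) (toℕ-injective (trans (toℕ-inject≤ (fromℕ (suc (suc (toℕ m)))) le) (toℕ-fromℕ (suc (suc (toℕ m))))))

  grow : (∀ v w → adj H v w ≡ true → 2 ≤ # (adj H v)) → ∀ fuel k → h < k + fuel → Path k → HasCycle H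
  grow two zero k lt p = ⊥-elim (<⇒≱ lt (≤-trans (≤-reflexive (+-identityʳ k)) (≤-trans (≤-trans (n≤1+n k) (n≤1+n _)) (injective⇒≤ {f = vertex p} (λ {i} {j} → vertex-inj p i j)))))
  grow two (suc fuel) k lt p = next (#-two (adj H (vertex p zero)) (vertex p (suc zero)) (two _ _ (consecutive p zero)))
    where
    next : (∃ λ w → adj H (vertex p zero) w ≡ true × w ≢ vertex p (suc zero)) → HasCycle H
    next (w , a , ne) = by (any? (λ i → vertex p i ≟ w))
      where
      by : Dec (∃ λ i → vertex p i ≡ w) → HasCycle H
      by (yes (zero , e)) = ⊥-elim (adj-≢ H a e)
      by (yes (suc zero , e)) = ⊥-elim (ne (sym e))
      by (yes (suc (suc m) , e)) = close p m (subst (λ z → adj H (vertex p zero) z ≡ true) (sym e) a)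
      by (no fresh) = grow two fuel (suc k) (≤-trans lt (≤-reflexive (+-suc k fuel))) (record { vertex = w ◂ vertex p ; vertex-inj = vi ; consecutive = λ { zero → trans (adj-sym H _ _) a ; (suc i) → consecutive p i } })
        where
        vi : ∀ i j → (w ◂ vertex p) i ≡ (w ◂ vertex p) j → i ≡ j
        vi zero zero _ = refl
        vi zero (suc j) e = ⊥-elim (fresh (j , sym e))
        vi (suc i) zero e = ⊥-elim (fresh (i , e))
        vi (suc i) (suc j) e = cong suc (vertex-inj p i j e)

  min-degree-2⇒cycle : 1 ≤ e2H H → (∀ v w → adj H v w ≡ true → 2 ≤ # (adj H v)) → HasCycle H
  min-degree-2⇒cycle pos two = let (i , j , a) = edge-of H pos in grow two (suc h) 0 ≤-refl
    (record { vertex = i ◂ (λ _ → j) ; vertex-inj = λ { zero zero _ → refl ; zero (suc zero) e → ⊥-elim (adj-≢ H a e) ; (suc zero) zero e → ⊥-elim (adj-≢ H a (sym e)) ; (suc zero) (suc zero) _ → refl } ; consecutive = λ { zero → a } })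

  leaf-or-cycle : 1 ≤ e2H H → (∃ λ v → # (adj H v) ≡ 1) ⊎ HasCycle H
  leaf-or-cycle pos = by (any? (λ v → # (adj H v) ≟ℕ 1))
    where
    by : Dec (∃ λ v → # (adj H v) ≡ 1) → (∃ λ v → # (adj H v) ≡ 1) ⊎ HasCycle H
    by (yes l) = inj₁ l
    by (no none) = inj₂ (min-degree-2⇒cycle pos (λ v w a → ≤∧≢⇒< (≤-trans (≤-reflexive (sym (⟦⟧-true a))) (∑-term (λ w → ⟦ adj H v w ⟧) w)) (λ e → none (v , sym e))))

isolate : ∀ {h} → Graph h → Fin h → Graph h
isolate H v = record
  { adj = λ i j → adj H i j ∧ (not (i == v) ∧ not (j == v))
  ; adj-sym = λ i j → cong₂ _∧_ (adj-sym H i j) (∧-comm (not (i == v)) (not (j == v)))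
  ; adj-irrefl = λ i → cong (_∧ (not (i == v) ∧ not (i == v))) (adj-irrefl H i) }

isolate-cycle : ∀ {h} (H : Graph h) v → HasCycle (isolate H v) → HasCycle H
isolate-cycle H v (m , c , ci , ed , la) = m , c , ci , (λ i → proj₁ (∧⁻ {adj H _ _} (ed i))) , proj₁ (∧⁻ {adj H _ _} la)

isolate-e2 : ∀ {h} (H : Graph h) v w → adj H v w ≡ true → e2 (adj (isolate H v)) < e2 (adj H)
isolate-e2 H v w a = ∑-strict (λ x → ∑-mono (λ y → ⟦⟧-mono (λ p → proj₁ (∧⁻ {adj H x y} p)))) v
  (≤-trans (s≤s (≤-reflexive (#-none (λ y p → t≢f (==-refl v) (not⁻ (proj₁ (∧⁻ {not (v == v)} (proj₂ (∧⁻ {adj H v y} p))))))))) (≤-trans (≤-reflexive (sym (⟦⟧-true a))) (∑-term (λ w → ⟦ adj H v w ⟧) w)))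

-- Colour H after isolating a leaf, then give the leaf the colour its neighbour does not have.
forest-bipartite : ∀ {h} fuel (H : Graph h) → e2 (adj H) ≤ fuel → (HasCycle H → ⊥) → IsBipartite H
forest-bipartite {h} fuel H le acyclic = by (1 ≤? e2 (adj H)) fuel le
  where
  by : Dec (1 ≤ e2 (adj H)) → ∀ fuel → e2 (adj H) ≤ fuel → IsBipartite H
  by (no none) _ _ = (λ _ → true) , λ i j a → ⊥-elim (none (≤-trans (≤-reflexive (sym (⟦⟧-true a))) (≤-trans (∑-term (λ j → ⟦ adj H i j ⟧) j) (∑-term (λ i → # (adj H i)) i))))
  by (yes pos) zero le′ = ⊥-elim (1+n≰n (≤-trans pos le′))
  by (yes pos) (suc f) le′ = [ leaf , (λ c → ⊥-elim (acyclic c)) ]′ (leaf-or-cycle H pos)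
    where
    leaf : (∃ λ v → # (adj H v) ≡ 1) → IsBipartite H
    leaf (v , one) = colour , proper
      where
      nbr = #-pos (adj H v) (≤-reflexive (sym one))
      w = proj₁ nbr
      rest = forest-bipartite f (isolate H v) (≤-pred (≤-trans (isolate-e2 H v w (proj₂ nbr)) le′)) (λ c → acyclic (isolate-cycle H v c))
      g = proj₁ rest
      colour : Fin h → Bool
      colour i = if i == v then not (g w) else g i
      only : ∀ j → adj H v j ≡ true → j ≡ w
      only j a = by-dec (j ≟ w)
        where
        by-dec : Dec (j ≡ w) → j ≡ w
        by-dec (yes e) = e
        by-dec (no ne) = ⊥-elim (1+n≰n (≤-trans (#-inj (adj H v) (j ◂ (λ _ → w)) (λ { {zero} {zero} _ → refl ; {zero} {suc zero} e → ⊥-elim (ne e) ; {suc zero} {zero} e → ⊥-elim (ne (sym e)) ; {suc zero} {suc zero} _ → refl })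
          (λ { zero → a ; (suc zero) → proj₂ nbr })) (≤-reflexive one)))
      not-fix : ∀ b → not b ≢ b
      not-fix true ()
      not-fix false ()
      proper : ∀ i j → adj H i j ≡ true → colour i ≢ colour j
      proper i j a e with i ≟ v | j ≟ v
      ... | yes refl | yes refl = adj-≢ H a refl
      ... | yes refl | no nj = not-fix (g w) (trans e (cong g (only j a)))
      ... | no ni | yes refl = not-fix (g w) (trans (sym e) (cong g (only i (trans (adj-sym H j i) a))))
      ... | no ni | no nj = proj₂ rest i j (∧⁺ a (∧⁺ (cong not (==-≢ ni)) (cong not (==-≢ nj)))) e

-- Graphs of large girth and bounded degree, and lower bounds for ex

data Walk {n : ℕ} (R : Rel n) : ℕ → Fin n → Fin n → Set where
  here : ∀ {k x} → Walk R k x x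
  step : ∀ {k x y z} → R x y ≡ true → Walk R k y z → Walk R (suc k) x z

walk? : ∀ {n} (R : Rel n) k x y → Dec (Walk R k x y)
walk? R zero x y with x ≟ y
... | yes refl = yes here
... | no ne = no λ { here → ne refl }
walk? R (suc k) x y with x ≟ y | any? (λ z → bool? (R x z) ×-dec walk? R k z y)
... | yes refl | _ = yes here
... | no _ | yes (z , r , w) = yes (step r w)
... | no ne | no none = no λ { here → ne refl ; (step r w) → none (_ , r , w) }

walk-mono : ∀ {n} {R R′ : Rel n} {k l x y} → (∀ u v → R u v ≡ true → R′ u v ≡ true) → k ≤ l → Walk R k x y → Walk R′ l x y
walk-mono m le here = here
walk-mono m (s≤s le) (step r w) = step (m _ _ r) (walk-mono m le w)

walk-++ : ∀ {n} {R : Rel n} {k l x y z} → Walk R k x y → Walk R l y z → Walk R (k + l) x z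
walk-++ {k = k} {l} here w = walk-mono (λ _ _ p → p) (m≤n+m l k) w
walk-++ (step r v) w = step r (walk-++ v w)

walk-rev : ∀ {n} {R : Rel n} → (∀ x y → R x y ≡ R y x) → ∀ {k x y} → Walk R k x y → Walk R k y x
walk-rev R-sym here = here
walk-rev R-sym {suc k} (step r w) = walk-mono (λ _ _ p → p) (≤-reflexive (+-comm k 1)) (walk-++ (walk-rev R-sym w) (step {k = 0} (trans (R-sym _ _) r) here))

walk-along : ∀ {n} {R : Rel n} k (u : Fin (suc k) → Fin n) → (∀ i → R (u (inject₁ i)) (u (suc i)) ≡ true) → Walk R k (u zero) (u (fromℕ k))
walk-along zero u e = here
walk-along (suc k) u e = step (e zero) (walk-along k (u ∘ suc) (e ∘ suc))

ballBound : ℕ → ℕ → ℕ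
ballBound Δ zero = 1
ballBound Δ (suc k) = 1 + Δ * ballBound Δ k

ball≤ : ∀ {n} (R : Rel n) Δ → (∀ x → # (R x) ≤ Δ) → ∀ k x → # (λ y → ⌊ walk? R k x y ⌋) ≤ ballBound Δ k
ball≤ R Δ dg zero x = ≤-trans (#-mono (λ y p → at y (dec⌊⌋ p))) (∑-atMost1 _ (λ y → ⟦⟧≤1 (x == y)) (λ y y′ p q → trans (sym (==⇒≡ (⟦⟧⇒ p))) (==⇒≡ (⟦⟧⇒ q))))
  where
  at : ∀ y → Walk R 0 x y → (x == y) ≡ true
  at .x here = ==-refl x
ball≤ {n} R Δ dg (suc k) x = ≤-trans (∑-mono cell) (≤-trans (≤-reflexive (trans (∑-distrib (δ x) _) (cong₂ _+_ (∑-δ1 x) (∑-swap (λ y z → ⟦ R x z ⟧ * ⟦ ⌊ walk? R k z y ⌋ ⟧)))))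
    (+-monoʳ-≤ 1 (≤-trans (∑-mono (λ z → ≤-trans (≤-reflexive (∑-*ˡ ⟦ R x z ⟧ (λ y → ⟦ ⌊ walk? R k z y ⌋ ⟧))) (*-monoʳ-≤ ⟦ R x z ⟧ (ball≤ R Δ dg k z)))) (≤-trans (≤-reflexive (∑-*ʳ (λ z → ⟦ R x z ⟧) (ballBound Δ k))) (*-monoˡ-≤ (ballBound Δ k) (dg x))))))
  where
  at : ∀ y → Walk R (suc k) x y → 1 ≤ δ x y + ∑ (λ z → ⟦ R x z ⟧ * ⟦ ⌊ walk? R k z y ⌋ ⟧)
  at .x here = ≤-trans (≤-reflexive (sym (δ-refl x))) (m≤m+n _ _)
  at y (step {y = z} r w) = ≤-trans (≤-trans (≤-reflexive (sym (cong₂ _*_ (⟦⟧-true r) (⟦⟧-true (⌊⌋dec {d = walk? R k z y} w))))) (∑-term (λ z → ⟦ R x z ⟧ * ⟦ ⌊ walk? R k z y ⌋ ⟧) z)) (m≤n+m _ (δ x y))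
  cell : ∀ y → ⟦ ⌊ walk? R (suc k) x y ⌋ ⟧ ≤ δ x y + ∑ (λ z → ⟦ R x z ⟧ * ⟦ ⌊ walk? R k z y ⌋ ⟧)
  cell y = by (bool-split ⌊ walk? R (suc k) x y ⌋)
    where
    by : ⌊ walk? R (suc k) x y ⌋ ≡ true ⊎ ⌊ walk? R (suc k) x y ⌋ ≡ false → ⟦ ⌊ walk? R (suc k) x y ⌋ ⟧ ≤ δ x y + ∑ (λ z → ⟦ R x z ⟧ * ⟦ ⌊ walk? R k z y ⌋ ⟧)
    by (inj₁ p) = ≤-trans (⟦⟧≤1 _) (at y (dec⌊⌋ p))
    by (inj₂ p) = ≤-trans (≤-reflexive (⟦⟧-false p)) z≤n

SamePair : ∀ {n} → Fin n → Fin n → Fin n → Fin n → Set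
SamePair a b x y = (x ≡ a × y ≡ b) ⊎ (x ≡ b × y ≡ a)

samePair? : ∀ {n} (a b x y : Fin n) → Dec (SamePair a b x y)
samePair? a b x y = ((x ≟ a) ×-dec (y ≟ b)) ⊎-dec ((x ≟ b) ×-dec (y ≟ a))

deleteEdge addEdge : ∀ {n} → Rel n → Fin n → Fin n → Rel n
deleteEdge R a b x y = R x y ∧ not ⌊ samePair? a b x y ⌋
addEdge R a b x y = R x y ∨ ⌊ samePair? a b x y ⌋

-- No edge lies on a cycle of length at most k + 1.
NoShort : ∀ {n} → ℕ → Rel n → Set
NoShort k R = ∀ x y → R x y ≡ true → ¬ Walk (deleteEdge R x y) k x y

module AddEdge {n : ℕ} (R : Rel n) (R-sym : ∀ x y → R x y ≡ R y x) (l : ℕ) (short : NoShort l R) (a b : Fin n) (far : ¬ Walk R l a b) where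

  R⁺ : Rel n
  R⁺ = addEdge R a b

  del⇒R : ∀ x y u v → deleteEdge R x y u v ≡ true → R u v ≡ true
  del⇒R x y u v p = proj₁ (∧⁻ {R u v} p)

  Split : Fin n → Fin n → ℕ → Fin n → Fin n → Set
  Split x y k s t = Walk (deleteEdge R x y) k s t ⊎ (∃ λ p → ∃ λ q → ∃ λ i → ∃ λ j → SamePair a b p q × Walk (deleteEdge R x y) i s p × Walk (deleteEdge R x y) j q t × suc (i + j) ≤ k)

  split : ∀ x y {k s t} → Walk (deleteEdge R⁺ x y) k s t → Split x y k s t
  split x y here = inj₁ here
  split x y {suc k} {s} {t} (step {y = s′} r w) = by (∨⁻ {R s s′} (proj₁ (∧⁻ {R⁺ s s′} r))) (split x y w)
    where
    nd : not ⌊ samePair? x y s s′ ⌋ ≡ true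
    nd = proj₂ (∧⁻ {R⁺ s s′} r)
    new : SamePair a b s s′ → Split x y k s′ t → Split x y (suc k) s t
    new sp (inj₁ v) = inj₂ (s , s′ , 0 , k , sp , here , v , ≤-refl)
    new sp (inj₂ (p , q , i , j , sp′ , v , v′ , le)) = same sp sp′
      where
      j≤ : suc j ≤ suc k
      j≤ = s≤s (≤-trans (≤-trans (m≤n+m j i) (n≤1+n _)) le)
      same : SamePair a b s s′ → SamePair a b p q → Split x y (suc k) s t
      same (inj₁ (refl , refl)) (inj₁ (refl , refl)) = inj₂ (s , s′ , 0 , j , inj₁ (refl , refl) , here , v′ , j≤)
      same (inj₁ (refl , refl)) (inj₂ (refl , refl)) = inj₁ (walk-mono (λ _ _ p → p) (≤-trans (n≤1+n j) j≤) v′)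
      same (inj₂ (refl , refl)) (inj₁ (refl , refl)) = inj₁ (walk-mono (λ _ _ p → p) (≤-trans (n≤1+n j) j≤) v′)
      same (inj₂ (refl , refl)) (inj₂ (refl , refl)) = inj₂ (s , s′ , 0 , j , inj₂ (refl , refl) , here , v′ , j≤)
    old : R s s′ ≡ true → Split x y k s′ t → Split x y (suc k) s t
    old e (inj₁ v) = inj₁ (step (∧⁺ e nd) v)
    old e (inj₂ (p , q , i , j , sp , v , v′ , le)) = inj₂ (p , q , suc i , j , sp , step (∧⁺ e nd) v , v′ , s≤s le)
    by : R s s′ ≡ true ⊎ ⌊ samePair? a b s s′ ⌋ ≡ true → Split x y k s′ t → Split x y (suc k) s t
    by (inj₁ e) = old e
    by (inj₂ e) = new (dec⌊⌋ e)

  short⁺ : NoShort l R⁺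
  short⁺ x y r w = by (samePair? a b x y)
    where
    by : Dec (SamePair a b x y) → ⊥
    by (yes sp) = ab sp
      where
      toR : ∀ u v → deleteEdge R⁺ x y u v ≡ true → R u v ≡ true
      toR u v p = [ id , (λ e → ⊥-elim (t≢f (⌊⌋dec {d = samePair? x y u v} (swp sp (dec⌊⌋ e))) (not⁻ (proj₂ (∧⁻ {R⁺ u v} p))))) ]′ (∨⁻ {R u v} (proj₁ (∧⁻ {R⁺ u v} p)))
        where
        swp : SamePair a b x y → SamePair a b u v → SamePair x y u v
        swp (inj₁ (refl , refl)) s = s
        swp (inj₂ (refl , refl)) (inj₁ s) = inj₂ s
        swp (inj₂ (refl , refl)) (inj₂ s) = inj₁ s
      wR : Walk R l x y
      wR = walk-mono toR ≤-refl w
      ab : SamePair a b x y → ⊥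
      ab (inj₁ (refl , refl)) = far wR
      ab (inj₂ (refl , refl)) = far (walk-rev R-sym wR)
    by (no nsp) = go (∨⁻ {R x y} r) (split x y w)
      where
      go : R x y ≡ true ⊎ ⌊ samePair? a b x y ⌋ ≡ true → Split x y l x y → ⊥
      go (inj₂ e) _ = nsp (dec⌊⌋ e)
      go (inj₁ e) (inj₁ v) = short x y e v
      go (inj₁ e) (inj₂ (p , q , i , j , sp , v , v′ , le)) = route sp
        where
        vR : Walk R i x p
        vR = walk-mono (del⇒R x y) ≤-refl v
        vR′ : Walk R j q y
        vR′ = walk-mono (del⇒R x y) ≤-refl v′
        there-and-back : Walk R (i + suc j) p q
        there-and-back = walk-++ (walk-rev R-sym vR) (step e (walk-rev R-sym vR′))
        route : SamePair a b p q → ⊥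
        route (inj₁ (refl , refl)) = far (walk-mono (λ _ _ p → p) (≤-trans (≤-reflexive (+-suc i j)) le) there-and-back)
        route (inj₂ (refl , refl)) = far (walk-mono (λ _ _ p → p) (≤-trans (≤-reflexive (+-suc i j)) le) (walk-rev R-sym there-and-back))

record LargeGirth (n l Δ : ℕ) : Set where
  field
    rel : Rel n
    rel-sym : ∀ x y → rel x y ≡ rel y x
    rel-irr : ∀ x → rel x x ≡ false
    degree≤ : ∀ x → # (rel x) ≤ Δ
    no-short : NoShort l rel
open LargeGirth

-- Join two distant vertices of degree < Δ as long as possible: in the end they all lie in one small ball.
largeGirth : ∀ n l Δ → 1 ≤ l → ∃ λ (G : LargeGirth n l Δ) → Δ * n ≤ e2 (rel G) + Δ * ballBound Δ l
largeGirth n l Δ 1≤l = go (suc (n * n)) start (m≤n+m (suc (n * n)) (e2 (rel start)))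
  where
  start : LargeGirth n l Δ
  start = record { rel = λ _ _ → false ; rel-sym = λ _ _ → refl ; rel-irr = λ _ → refl ; degree≤ = λ x → ≤-trans (≤-reflexive (#-none {p = λ _ → false} (λ _ ()))) z≤n ; no-short = λ _ _ () }
  go : ∀ fuel (G : LargeGirth n l Δ) → n * n < e2 (rel G) + fuel → ∃ λ (G : LargeGirth n l Δ) → Δ * n ≤ e2 (rel G) + Δ * ballBound Δ l
  go zero G lt = ⊥-elim (<⇒≱ lt (≤-trans (≤-reflexive (+-identityʳ _)) (≤-trans (∑-bound (n * 1) (λ x → ∑-bound 1 (λ y → ⟦⟧≤1 _))) (≤-reflexive (cong (n *_) (*-identityʳ n))))))
  go (suc fuel) G lt = by (any? (λ a → any? (λ b → (# (rel G a) <? Δ) ×-dec ((# (rel G b) <? Δ) ×-dec ¬? (walk? (rel G) l a b)))))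
    where
    R = rel G
    Pick : Fin n → Fin n → Set
    Pick a b = # (R a) < Δ × # (R b) < Δ × ¬ Walk R l a b
    low : Fin n → Bool
    low x = ⌊ # (R x) <? Δ ⌋
    degrees : Δ * n ≤ e2 R + Δ * # low
    degrees = begin
        Δ * n                          ≡⟨ trans (*-comm Δ n) (sym (∑-const {n} Δ)) ⟩
        ∑ {n} (λ x → Δ)                ≤⟨ ∑-mono (λ x → cell x (# (R x) <? Δ)) ⟩
        ∑ (λ x → # (R x) + Δ * ⟦ low x ⟧) ≡⟨ ∑-distrib (λ x → # (R x)) _ ⟩
        e2 R + ∑ (λ x → Δ * ⟦ low x ⟧) ≡⟨ cong (e2 R +_) (∑-*ˡ Δ (λ x → ⟦ low x ⟧)) ⟩
        e2 R + Δ * # low ∎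
      where
      open ≤-Reasoning
      cell : ∀ x (q : Dec (# (R x) < Δ)) → Δ ≤ # (R x) + Δ * ⟦ ⌊ q ⌋ ⟧
      cell x (yes _) = ≤-trans (≤-reflexive (sym (trans (cong (Δ *_) (⟦⟧-true refl)) (*-identityʳ Δ)))) (m≤n+m _ _)
      cell x (no q) = ≤-trans (≮⇒≥ q) (m≤m+n _ _)
    by : Dec (∃ λ a → ∃ λ b → Pick a b) → ∃ λ (G : LargeGirth n l Δ) → Δ * n ≤ e2 (rel G) + Δ * ballBound Δ l
    by (no none) = G , ≤-trans degrees (+-monoʳ-≤ (e2 R) (*-monoʳ-≤ Δ few))
      where
      few : # low ≤ ballBound Δ l
      few with 1 ≤? # low
      ... | no q = ≤-trans (≤-reflexive (n≤0⇒n≡0 (≮⇒≥ q))) z≤n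
      ... | yes q = let (a , la) = #-pos low q in ≤-trans (#-mono (λ b lb → near a b (dec⌊⌋ la) (dec⌊⌋ lb) (walk? R l a b))) (ball≤ R Δ (degree≤ G) l a)
        where
        near : ∀ a b → # (R a) < Δ → # (R b) < Δ → (w : Dec (Walk R l a b)) → ⌊ w ⌋ ≡ true
        near a b x y (yes _) = refl
        near a b x y (no w) = ⊥-elim (none (a , b , x , y , w))
    by (yes (a , b , da , db , far)) = go fuel G⁺ (≤-trans lt (≤-trans (≤-reflexive (+-suc (e2 R) fuel)) (+-monoˡ-≤ fuel more)))
      where
      a≢b : a ≢ b
      a≢b refl = far here
      open AddEdge R (rel-sym G) l (no-short G) a b far
      sp-sym : ∀ x y → SamePair a b x y → SamePair a b y x
      sp-sym x y (inj₁ (p , q)) = inj₂ (q , p)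
      sp-sym x y (inj₂ (p , q)) = inj₁ (q , p)
      dg : ∀ x → # (R⁺ x) ≤ Δ
      dg x = by-end (x ≟ a) (x ≟ b)
        where
        one-more : ∀ y → # (R x) < Δ → (∀ z → SamePair a b x z → z ≡ y) → # (R⁺ x) ≤ Δ
        one-more y lt′ only = ≤-trans (#-∪ _ (R x) (λ z → z == y) (λ z p → [ inj₁ , (λ e → inj₂ (⌊⌋dec (only z (dec⌊⌋ e)))) ]′ (∨⁻ {R x z} p))) (≤-trans (+-monoʳ-≤ (# (R x)) (#-eq≤1 y)) (≤-trans (≤-reflexive (+-comm _ 1)) lt′))
        by-end : Dec (x ≡ a) → Dec (x ≡ b) → # (R⁺ x) ≤ Δ
        by-end (yes refl) _ = one-more b da (λ { z (inj₁ (_ , e)) → e ; z (inj₂ (e , _)) → ⊥-elim (a≢b e) })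
        by-end (no _) (yes refl) = one-more a db (λ { z (inj₁ (e , _)) → ⊥-elim (a≢b (sym e)) ; z (inj₂ (_ , e)) → e })
        by-end (no p) (no q) = ≤-trans (#-mono (λ z r → [ id , (λ e → ⊥-elim ([ (λ (e′ , _) → p e′) , (λ (e′ , _) → q e′) ]′ (dec⌊⌋ {d = samePair? a b x z} e))) ]′ (∨⁻ {R x z} r))) (degree≤ G x)
      G⁺ : LargeGirth n l Δ
      G⁺ = record
        { rel = R⁺
        ; rel-sym = λ x y → cong₂ _∨_ (rel-sym G x y) (bool-ext (λ e → ⌊⌋dec {d = samePair? a b y x} (sp-sym x y (dec⌊⌋ e))) (λ e → ⌊⌋dec {d = samePair? a b x y} (sp-sym y x (dec⌊⌋ e))))
        ; rel-irr = λ x → ¬true⇒ (λ r → [ (λ e → t≢f e (rel-irr G x)) , (λ e → [ (λ (p , q) → a≢b (trans (sym p) q)) , (λ (p , q) → a≢b (trans (sym q) p)) ]′ (dec⌊⌋ {d = samePair? a b x x} e)) ]′ (∨⁻ {R x x} r))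
        ; degree≤ = dg ; no-short = short⁺ }
      more : e2 R < e2 R⁺
      more = ∑-strict (λ x → ∑-mono (λ y → ⟦⟧-mono (λ p → ∨⁺ˡ p))) a (∑-strict (λ y → ⟦⟧-mono (λ p → ∨⁺ˡ p)) b
        (≤-trans (s≤s (≤-reflexive (⟦⟧-false (¬true⇒ (λ r → far (walk-mono (λ _ _ p → p) 1≤l (step {k = 0} r here))))))) (≤-reflexive (sym (⟦⟧-true (∨⁺ʳ {R a b} (⌊⌋dec {d = samePair? a b a b} (inj₁ (refl , refl)))))))))

girthGraph : ∀ {n l Δ} → LargeGirth n l Δ → Graph n
girthGraph G = record { adj = rel G ; adj-sym = rel-sym G ; adj-irrefl = rel-irr G }

cycle-short : ∀ {h n Δ} (H : Graph h) (G : LargeGirth n h Δ) → HasCycle H → HFree H (girthGraph G)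
cycle-short {h} H G (m , v , v-inj , ed , la) c = no-short G (u zero) (u (fromℕ (suc (suc m)))) (trans (rel-sym G _ _) (edges c _ _ la))
    (walk-mono (λ _ _ p → p) (≤-trans (n≤1+n _) (injective⇒≤ {f = v} v-inj)) (walk-along (suc (suc m)) u (λ i → ∧⁺ (edges c _ _ (ed i)) (not⁺ (⌊⌋false (other i))))))
  where
  u : Fin (suc (suc (suc m))) → Fin _
  u i = φ c (v i)
  u-inj : ∀ {i j} → u i ≡ u j → i ≡ j
  u-inj e = v-inj (inj c e)
  other : ∀ i → ¬ SamePair (u zero) (u (fromℕ (suc (suc m)))) (u (inject₁ i)) (u (suc i))
  other zero (inj₁ (_ , e)) with u-inj e
  ... | ()
  other (suc i) (inj₁ (e , _)) with u-inj e
  ... | ()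
  other i (inj₂ (_ , e)) with u-inj e
  ... | ()

ex-cycle : ∀ {h} (H : Graph h) → HasCycle H → 1 ≤ h → ∀ K → ∃ λ N → ∀ {n e} → N ≤ n → IsEx n H e → K * n ≤ e
ex-cycle {h} H cyc 1≤h K = 2 * Bd , λ {n} {e} big (_ , ex) → *-cancelˡ-≤ 2 (+-cancelʳ-≤ (2 * K * n) _ _ (bound n e big (largeGirth n h (4 * K) 1≤h) ex))
  where
  Bd = ballBound (4 * K) h
  bound : ∀ n e → 2 * Bd ≤ n → (∃ λ (G : LargeGirth n h (4 * K)) → 4 * K * n ≤ e2 (rel G) + 4 * K * Bd) → (∀ (G : Graph n) → HFree H G → ‖ G ‖ ≤ e) → 2 * (K * n) + 2 * K * n ≤ 2 * e + 2 * K * n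
  bound n e big (G , dense) ex = begin
      2 * (K * n) + 2 * K * n    ≡⟨ re K n ⟩
      4 * K * n                  ≤⟨ dense ⟩
      e2 (rel G) + 4 * K * Bd    ≤⟨ +-mono-≤ (≤-trans (≤-reflexive (e2-‖‖ (girthGraph G))) (*-monoʳ-≤ 2 (ex (girthGraph G) (cycle-short H G cyc)))) (≤-trans (≤-reflexive (re′ K Bd)) (*-monoʳ-≤ (2 * K) big)) ⟩
      2 * e + 2 * K * n ∎
    where
    open ≤-Reasoning
    re : ∀ k n → 2 * (k * n) + 2 * k * n ≡ 4 * k * n
    re = solve-∀
    re′ : ∀ k b → 4 * k * b ≡ 2 * k * (2 * b)
    re′ = solve-∀

ex-branch : ∀ {h} (H : Graph h) v → 2 ≤ # (adj H v) → ∀ {n e} → IsEx n H e → n ≤ 2 * e + ballBound 1 1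
ex-branch H v two {n} {e} (_ , ex) = from (largeGirth n 1 1 ≤-refl)
  where
  from : (∃ λ (G : LargeGirth n 1 1) → 1 * n ≤ e2 (rel G) + 1 * ballBound 1 1) → n ≤ 2 * e + ballBound 1 1
  from (G , dense) = ≤-trans (≤-reflexive (sym (*-identityˡ n))) (≤-trans dense (+-mono-≤ (≤-trans (≤-reflexive (e2-‖‖ (girthGraph G))) (*-monoʳ-≤ 2 (ex (girthGraph G) hfree))) (≤-reflexive (*-identityˡ _))))
    where
    hfree : HFree H (girthGraph G)
    hfree c = 1+n≰n (≤-trans two (≤-trans (≤-trans (∑-mono (λ w → ⟦⟧-mono (λ a → edges c v w a))) (∑-inj (φ c) (inj c) (λ y → ⟦ rel G (φ c v) y ⟧))) (degree≤ G (φ c v))))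

star : ∀ n → Graph (suc n)
star n = record { adj = ad ; adj-sym = sy ; adj-irrefl = λ { zero → refl ; (suc i) → refl } }
  where
  ad : Fin (suc n) → Fin (suc n) → Bool
  ad zero (suc _) = true
  ad (suc _) zero = true
  ad _ _ = false
  sy : ∀ i j → ad i j ≡ ad j i
  sy zero zero = refl
  sy zero (suc j) = refl
  sy (suc i) zero = refl
  sy (suc i) (suc j) = refl

ex-disjoint : ∀ {h} (H : Graph h) i j k l → adj H i j ≡ true → adj H k l ≡ true → i ≢ k → i ≢ l → j ≢ k → j ≢ l → ∀ {n e} → IsEx (suc n) H e → n ≤ 2 * e
ex-disjoint H i j k l a a′ ik il jk jl {n} {e} (_ , ex) = ≤-trans big (≤-trans (≤-reflexive (e2-‖‖ (star n))) (*-monoʳ-≤ 2 (ex (star n) hfree)))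
  where
  big : n ≤ e2 (adj (star n))
  big = ≤-trans (#-inj (adj (star n) zero) suc suc-injective (λ _ → refl)) (∑-term (λ x → # (adj (star n) x)) zero)
  centre : ∀ x y → adj (star n) x y ≡ true → x ≡ zero ⊎ y ≡ zero
  centre zero _ _ = inj₁ refl
  centre (suc x) zero _ = inj₂ refl
  hfree : HFree H (star n)
  hfree c with centre _ _ (edges c i j a) | centre _ _ (edges c k l a′)
  ... | inj₁ p | inj₁ q = ik (inj c (trans p (sym q)))
  ... | inj₁ p | inj₂ q = il (inj c (trans p (sym q)))
  ... | inj₂ p | inj₁ q = jk (inj c (trans p (sym q)))
  ... | inj₂ p | inj₂ q = jl (inj c (trans p (sym q)))

-- A graph with at least two edges has a vertex of degree two or two disjoint edges.
ex-unbounded : ∀ {h} (H : Graph h) → 3 ≤ e2 (adj H) → ∀ K → ∃ λ N → ∀ {n e} → N ≤ n → IsEx n H e → K ≤ e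
ex-unbounded {h} H three K = by (any? (λ v → 2 ≤? # (adj H v)))
  where
  by : Dec (∃ λ v → 2 ≤ # (adj H v)) → ∃ λ N → ∀ {n e} → N ≤ n → IsEx n H e → K ≤ e
  by (yes (v , two)) = 2 * K + ballBound 1 1 , λ big isEx → *-cancelˡ-≤ 2 (+-cancelʳ-≤ (ballBound 1 1) _ _ (≤-trans big (ex-branch H v two isEx)))
  by (no none) = disjoint (edge-of H (≤-trans (s≤s z≤n) three))
    where
    one : ∀ v → # (adj H v) ≤ 1
    one v = ≤-pred (≰⇒> (λ two → none (v , two)))
    same : ∀ v x y → adj H v x ≡ true → adj H v y ≡ true → x ≡ y
    same v x y a b = by-dec (x ≟ y)
      where
      by-dec : Dec (x ≡ y) → x ≡ y
      by-dec (yes e) = e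
      by-dec (no ne) = ⊥-elim (1+n≰n (≤-trans (#-inj (adj H v) (x ◂ (λ _ → y)) (λ { {zero} {zero} _ → refl ; {zero} {suc zero} e → ⊥-elim (ne e) ; {suc zero} {zero} e → ⊥-elim (ne (sym e)) ; {suc zero} {suc zero} _ → refl })
        (λ { zero → a ; (suc zero) → b })) (one v)))
    disjoint : (∃ λ i → ∃ λ j → adj H i j ≡ true) → ∃ λ N → ∀ {n e} → N ≤ n → IsEx n H e → K ≤ e
    disjoint (i , j , a) = second (∑-< (λ v → δ i v + δ j v) (λ v → # (adj H v)) (≤-trans (s≤s (≤-reflexive (trans (∑-distrib (δ i) (δ j)) (cong₂ _+_ (∑-δ1 i) (∑-δ1 j))))) three))
      where
      second : (∃ λ k → δ i k + δ j k < # (adj H k)) → ∃ λ N → ∀ {n e} → N ≤ n → IsEx n H e → K ≤ e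
      second (k , lt) = suc (2 * K) , λ { {suc n} (s≤s big) isEx → *-cancelˡ-≤ 2 (≤-trans big (ex-disjoint H i j k l a al ik il jk jl isEx)) }
        where
        nbr = #-pos (adj H k) (≤-trans (s≤s z≤n) lt)
        l = proj₁ nbr
        al = proj₂ nbr
        off : ∀ x → 1 ≤ δ x k → δ x k ≤ δ i k + δ j k → ⊥
        off x p q = 1+n≰n (≤-trans (s≤s (≤-trans p q)) (≤-trans lt (one k)))
        ik : i ≢ k
        ik refl = off i (≤-reflexive (sym (δ-refl i))) (m≤m+n _ _)
        jk : j ≢ k
        jk refl = off j (≤-reflexive (sym (δ-refl j))) (m≤n+m _ _)
        il : i ≢ l
        il e = jk (same i j k a (trans (cong (λ z → adj H z k) e) (trans (adj-sym H l k) al)))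
        jl : j ≢ l
        jl e = ik (same j i k (trans (adj-sym H j i) a) (trans (cong (λ z → adj H z k) e) (trans (adj-sym H l k) al)))

-- A single edge: every nonempty graph on at least h vertices contains H.
ex-edge : ∀ {h} (H : Graph h) → e2 (adj H) ≤ 2 → 1 ≤ e2 (adj H) → ∀ {n e} → h ≤ n → IsEx n H e → e ≡ 0
ex-edge {h} H le pos {n} {e} h≤n ((G , G-free , refl) , _) = n≤0⇒n≡0 (≮⇒≥ (λ p → contra (∑-pos _ (≤-trans p (≤-trans (m≤m+n ‖ G ‖ (‖ G ‖ + 0)) (≤-reflexive (sym (e2-‖‖ G))))))))
  where
  contra : (∃ λ x → 1 ≤ # (adj G x)) → ⊥
  contra (x , p) = embed (#-pos (adj G x) p) (edge-of H pos)
    where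
    embed : (∃ λ y → adj G x y ≡ true) → (∃ λ i → ∃ λ j → adj H i j ≡ true) → ⊥
    embed (y , xy) (i , j , a) = G-free (record { φ = f ; inj = f-inj ; edges = ed })
      where
      g : Fin h → Fin n
      g v = swap (inject≤ i h≤n) x (inject≤ v h≤n)
      f : Fin h → Fin n
      f v = swap (g j) y (g v)
      g-inj : ∀ {u v} → g u ≡ g v → u ≡ v
      g-inj q = inject≤-inj h≤n (swap-inj (inject≤ i h≤n) x q)
      f-inj : ∀ {u v} → f u ≡ f v → u ≡ v
      f-inj q = g-inj (swap-inj (g j) y q)
      gi : g i ≡ x
      gi = swap-x (inject≤ i h≤n) x
      fi : f i ≡ x
      fi = trans (swap-o (g j) y (g i) (λ q → adj-≢ H a (g-inj q)) (λ q → x≢y (trans (sym gi) q))) gi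
        where
        x≢y : x ≢ y
        x≢y refl = t≢f xy (adj-irrefl G x)
      fj : f j ≡ y
      fj = swap-x (g j) y
      ed : ∀ u v → adj H u v ≡ true → adj G (f u) (f v) ≡ true
      ed u v b = by (samePair? i j u v)
        where
        by : Dec (SamePair i j u v) → adj G (f u) (f v) ≡ true
        by (yes (inj₁ (refl , refl))) = trans (cong₂ (adj G) fi fj) xy
        by (yes (inj₂ (refl , refl))) = trans (cong₂ (adj G) fj fi) (trans (adj-sym G y x) xy)
        by (no ne) = ⊥-elim (1+n≰n (≤-trans extra le))
          where
          pair : Fin h → Fin h → ℕ
          pair s t = δ i s * δ j t + δ j s * δ i t
          total : ∑∑ pair ≡ 2
          total = trans (∑-cong (λ s → trans (∑-distrib (λ t → δ i s * δ j t) (λ t → δ j s * δ i t)) (cong₂ _+_ (trans (∑-*ˡ (δ i s) (δ j)) (trans (cong (δ i s *_) (∑-δ1 j)) (*-identityʳ (δ i s)))) (trans (∑-*ˡ (δ j s) (δ i)) (trans (cong (δ j s *_) (∑-δ1 i)) (*-identityʳ (δ j s)))))))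
            (trans (∑-distrib (δ i) (δ j)) (cong₂ _+_ (∑-δ1 i) (∑-δ1 j)))
          δ0 : ∀ {s t : Fin h} {p q : Fin h} → ¬ (p ≡ s × q ≡ t) → δ p s * δ q t ≡ 0
          δ0 {s} {t} {p} {q} np with p ≟ s | q ≟ t
          ... | yes e | yes e′ = ⊥-elim (np (e , e′))
          ... | no _ | d′ = cong (_* ⟦ ⌊ d′ ⌋ ⟧) (⟦⟧-false refl)
          ... | yes _ | no _ = trans (cong (⟦ true ⟧ *_) (⟦⟧-false refl)) (*-zeroʳ ⟦ true ⟧)
          cell : ∀ s t → pair s t ≤ ⟦ adj H s t ⟧
          cell s t = by-pair (samePair? i j s t)
            where
            by-pair : Dec (SamePair i j s t) → pair s t ≤ ⟦ adj H s t ⟧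
            by-pair (no q) = ≤-trans (≤-reflexive (cong₂ _+_ (δ0 (λ (x , y) → q (inj₁ (sym x , sym y)))) (δ0 (λ (x , y) → q (inj₂ (sym x , sym y)))))) z≤n
            by-pair (yes (inj₁ (refl , refl))) = ≤-trans (+-mono-≤ (*-mono-≤ (⟦⟧≤1 (i == i)) (⟦⟧≤1 (j == j))) (≤-reflexive (δ0 (λ (x , _) → adj-≢ H a (sym x))))) (≤-reflexive (sym (⟦⟧-true a)))
            by-pair (yes (inj₂ (refl , refl))) = ≤-trans (+-mono-≤ (≤-reflexive (δ0 (λ (x , _) → adj-≢ H a x))) (*-mono-≤ (⟦⟧≤1 (j == j)) (⟦⟧≤1 (i == i)))) (≤-reflexive (sym (⟦⟧-true (trans (adj-sym H j i) a))))
          pair0 : pair u v ≡ 0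
          pair0 = cong₂ _+_ (δ0 (λ (x , y) → ne (inj₁ (sym x , sym y)))) (δ0 (λ (x , y) → ne (inj₂ (sym x , sym y))))
          extra : 3 ≤ e2 (adj H)
          extra = ≤-trans (≤-reflexive (cong suc (sym total))) (∑-strict (λ s → ∑-mono (cell s)) u (∑-strict (cell u) v (≤-trans (≤-reflexive (cong suc pair0)) (≤-reflexive (sym (⟦⟧-true b))))))

-- Complete r-partite graphs and packings of their complements

partite : ∀ r .{{_ : NonZero r}} n → Graph n
partite r n = record
  { adj = λ x y → not ⌊ toℕ x % r ≟ℕ toℕ y % r ⌋
  ; adj-sym = λ x y → cong not (bool-ext {⌊ toℕ x % r ≟ℕ toℕ y % r ⌋} {⌊ toℕ y % r ≟ℕ toℕ x % r ⌋} (λ p → ⌊⌋dec (sym (dec⌊⌋ p))) (λ p → ⌊⌋dec (sym (dec⌊⌋ p))))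
  ; adj-irrefl = λ x → cong not (⌊⌋dec {d = toℕ x % r ≟ℕ toℕ x % r} refl) }

Colorable : ∀ {h} → Graph h → ℕ → Set
Colorable {h} H r = ∃ λ (f : Fin h → Fin r) → ∀ i j → adj H i j ≡ true → f i ≢ f j

partite-free : ∀ {h} (H : Graph h) r .{{_ : NonZero r}} n → ¬ Colorable H r → HFree H (partite r n)
partite-free H r n nc c = nc ((λ i → fromℕ< (m%n<n (toℕ (φ c i)) r)) , λ i j a e → ⌊⌋false⁻ (not⁻ (edges c i j a)) (trans (sym (toℕ-fromℕ< _)) (trans (cong toℕ e) (toℕ-fromℕ< _))))

module Partite (r : ℕ) (1≤r : 1 ≤ r) (n : ℕ) where
  instance
    r≢0 : NonZero r
    r≢0 = >-nonZero 1≤r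

  m : ℕ
  m = n / r

  L : Graph n
  L = partite r n

  same : Fin n → Fin n → Bool
  same x y = ⌊ toℕ x % r ≟ℕ toℕ y % r ⌋

  rm≤n : r * m ≤ n
  rm≤n = ≤-trans (≤-reflexive (*-comm r m)) (m/n*n≤m n r)

  n≤rm+r : n ≤ r * m + r
  n≤rm+r = ≤-trans (≤-reflexive (trans (m≡m%n+[m/n]*n n r) (+-comm (n % r) _))) (+-mono-≤ (≤-reflexive (*-comm m r)) (<⇒≤ (m%n<n n r)))

  same-row : ∀ x → # (same x) ≤ suc m
  same-row x = #-≤-inj (same x) (λ y → fromℕ< (s≤s (/-monoˡ-≤ r (<⇒≤ (toℕ<n y))))) (λ y z p q e → toℕ-injective (trans (m≡m%n+[m/n]*n (toℕ y) r)
      (trans (cong₂ (λ u v → u + v * r) (trans (sym (dec⌊⌋ p)) (dec⌊⌋ q)) (trans (sym (toℕ-fromℕ< _)) (trans (cong toℕ e) (toℕ-fromℕ< _)))) (sym (m≡m%n+[m/n]*n (toℕ z) r)))))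

  sameSum : ∑∑ (λ x y → ⟦ same x y ⟧) ≤ n * suc m
  sameSum = ∑-bound (suc m) same-row

  e2L+same : e2 (adj L) + ∑∑ (λ x y → ⟦ same x y ⟧) ≡ n * n
  e2L+same = trans (sym (trans (∑-cong (λ x → ∑-distrib (λ y → ⟦ adj L x y ⟧) _)) (∑-distrib (λ x → # (adj L x)) _)))
    (trans (∑-cong {n} (λ x → trans (∑-cong {n} (λ y → cell (same x y))) (trans (∑-const {n} 1) (*-identityʳ n)))) (∑-const {n} n))
    where
    cell : ∀ b → ⟦ not b ⟧ + ⟦ b ⟧ ≡ 1
    cell true = cong₂ _+_ (⟦⟧-false refl) (⟦⟧-true refl)
    cell false = cong₂ _+_ (⟦⟧-true refl) (⟦⟧-false refl)

  e2L-lower : r * (n * n) ≤ r * e2 (adj L) + (n * n + r * n)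
  e2L-lower = ≤-trans (≤-reflexive (trans (cong (r *_) (sym e2L+same)) (*-distribˡ-+ r (e2 (adj L)) _))) (+-monoʳ-≤ (r * e2 (adj L)) (≤-trans (*-monoʳ-≤ r sameSum)
    (≤-trans (≤-reflexive (re r n m)) (+-monoˡ-≤ (r * n) (*-monoˡ-≤ n rm≤n)))))
    where
    re : ∀ r n m → r * (n * suc m) ≡ r * m * n + r * n
    re = solve-∀

  module _ {h : ℕ} (H : Graph h) (Pm : List (Fin h → Fin m)) (pkm : Packs H Pm) where

    place : Fin r → Fin m → Fin n
    place a j = fromℕ< {toℕ a + toℕ j * r} (≤-trans (+-monoˡ-≤ (toℕ j * r) (toℕ<n a)) (≤-trans (*-monoˡ-≤ r (toℕ<n j)) (m/n*n≤m n r)))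

    place-ℕ : ∀ a j → toℕ (place a j) ≡ toℕ a + toℕ j * r
    place-ℕ a j = toℕ-fromℕ< _

    place-mod : ∀ a j → toℕ (place a j) % r ≡ toℕ a
    place-mod a j = trans (cong (_% r) (place-ℕ a j)) (trans ([m+kn]%n≡m%n (toℕ a) (toℕ j) r) (m<n⇒m%n≡m (toℕ<n a)))

    place-inj : ∀ {a j j′} → place a j ≡ place a j′ → j ≡ j′
    place-inj {a} {j} {j′} e = toℕ-injective (*-cancelʳ-≡ _ _ r (+-cancelˡ-≡ (toℕ a) _ _ (trans (sym (place-ℕ a j)) (trans (cong toℕ e) (place-ℕ a j′)))))

    place-part : ∀ {a a′ j j′} → place a j ≡ place a′ j′ → a ≡ a′
    place-part {a} {a′} {j} {j′} e = toℕ-injective (trans (sym (place-mod a j)) (trans (cong (λ z → toℕ z % r) e) (place-mod a′ j′)))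

    part-copies : Fin r → List (Fin h → Fin n)
    part-copies a = map (place a ∘_) Pm

    P : List (Fin h → Fin n)
    P = concat (tabulate part-copies)

    packs : Packs H P
    packs = AllP.concat⁺ {xss = tabulate part-copies} (AllP.tabulate⁺ {f = part-copies} (λ a → AllP.map⁺ (All.map (λ i x y e → i x y (place-inj e)) (proj₁ pkm)))) ,
      APP.concat⁺ (AllP.tabulate⁺ {f = part-copies} (λ a → APP.map⁺ (AP.map (λ d i j i′ j′ p q e e′ → d i j i′ j′ p q (place-inj e) (place-inj e′)) (proj₂ pkm))))
        (APP.tabulate⁺ {f = part-copies} (λ {a} {a′} ne → AllP.map⁺ (All.tabulate (λ {f} _ → AllP.map⁺ (All.tabulate (λ {g} _ i j i′ j′ p q e e′ → ne (place-part {a} {a′} {f i} {g i′} e)))))))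

    nonL-edges : All (EdgesIn H (nonL H L)) P
    nonL-edges = AllP.concat⁺ {xss = tabulate part-copies} (AllP.tabulate⁺ {f = part-copies} (λ a → AllP.map⁺ (All.map (λ {f} i x y e → ∧⁺ (K-adj (λ q → adj-≢ H e (i x y (place-inj q))))
      (not⁺ (cong not (⌊⌋dec {d = toℕ (place a (f x)) % r ≟ℕ toℕ (place a (f y)) % r} (trans (place-mod a (f x)) (sym (place-mod a (f y)))))))) (proj₁ pkm))))

    length-P : length P ≡ r * length Pm
    length-P = trans (length-concat-tab part-copies) (trans (∑-cong (λ a → length-map (place a ∘_) Pm)) (∑-const {r} (length Pm)))

    unc-eq : unc H L P + length P * e2H H + n ≤ ∑∑ (λ x y → ⟦ same x y ⟧)
    unc-eq = ≤-trans (≤-reflexive (cong₂ (λ u v → unc H L P + u + v) (sym (cvP-total H P)) (sym (trans (∑-cong {n} (λ x → ∑-δ1 x)) (trans (∑-const {n} 1) (*-identityʳ n))))))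
      (≤-trans (≤-reflexive (trans (cong (_+ ∑∑ (δ {n})) (sym (∑-distrib (λ x → ∑ (λ y → ⟦ nonL H L x y ∧ free H P x y ⟧)) _))) (sym (∑-distrib _ (λ x → ∑ (δ x))))))
        (∑-mono (λ x → ≤-trans (≤-reflexive (trans (cong (_+ ∑ (δ x)) (sym (∑-distrib (λ y → ⟦ nonL H L x y ∧ free H P x y ⟧) _))) (sym (∑-distrib _ (δ x))))) (∑-mono (cell x)))))
      where
      inside : ∀ x y → 1 ≤ cvP H P x y → nonL H L x y ≡ true
      inside x y p = go P nonL-edges (cvP-wit H P x y p)
        where
        go : ∀ P → All (EdgesIn H (nonL H L)) P → Any (λ f → 1 ≤ cv H f x y) P → nonL H L x y ≡ true
        go (f ∷ P) (e ∷ _) (here q) = let (i , j , a , ex , ey) = cv-wit H f x y q in subst₂ (λ u v → nonL H L u v ≡ true) ex ey (e i j a)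
        go (f ∷ P) (_ ∷ es) (there q) = go P es q
      not-false : ∀ {b} → not b ≡ false → b ≡ true
      not-false {true} _ = refl
      cell : ∀ x y → ⟦ nonL H L x y ∧ free H P x y ⟧ + cvP H P x y + δ x y ≤ ⟦ same x y ⟧
      cell x y = by (x ≟ y) (cvP H P x y) refl
        where
        by : Dec (x ≡ y) → ∀ k → cvP H P x y ≡ k → ⟦ nonL H L x y ∧ free H P x y ⟧ + cvP H P x y + δ x y ≤ ⟦ same x y ⟧
        by (yes refl) k _ = ≤-trans (≤-reflexive (trans (cong₂ (λ u v → u + v + δ x x) (⟦⟧-false (¬true⇒ (λ q → K-adj⁻ (proj₁ (∧⁻ {adj (K n) x x} (proj₁ (∧⁻ {nonL H L x x} q)))) refl))) (cvP-diag H (proj₁ packs) x)) (δ-refl x)))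
          (≤-reflexive (sym (⟦⟧-true (⌊⌋dec {d = toℕ x % r ≟ℕ toℕ x % r} refl))))
        by (no ne) zero z = ≤-trans (≤-reflexive (trans (cong₂ (λ u v → ⟦ nonL H L x y ∧ free H P x y ⟧ + u + v) z (δ-≢ ne)) (trans (+-identityʳ _) (+-identityʳ _))))
          (⟦⟧-mono (λ q → not-false (not⁻ (proj₂ (∧⁻ {adj (K n) x y} (proj₁ (∧⁻ {nonL H L x y} q)))))))
        by (no ne) (suc k) z = ≤-trans (≤-reflexive (trans (cong₂ (λ u v → u + cvP H P x y + v) (⟦⟧-false (¬true⇒ (λ q → t≢f (proj₂ (∧⁻ {nonL H L x y} q)) (cong isZero z)))) (δ-≢ ne)) (+-identityʳ _)))
          (≤-trans (cvP≤1 H packs x y) (≤-reflexive (sym (⟦⟧-true (not-false (not⁻ (proj₂ (∧⁻ {adj (K n) x y} (inside x y (≤-trans (s≤s z≤n) (≤-reflexive (sym z))))))))))))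

    unc-bound : ∀ C → m * m ≤ m + length Pm * e2H H + C * m → unc H L P ≤ (C + 3) * n + r
    unc-bound C full = +-cancelʳ-≤ (r * (length Pm * e2H H) + n) _ _ (begin
        unc H L P + (r * (length Pm * e2H H) + n)      ≡⟨ trans (sym (+-assoc (unc H L P) _ n)) (cong (λ z → unc H L P + z + n) (trans (sym (*-assoc r (length Pm) (e2H H))) (cong (_* e2H H) (sym length-P)))) ⟩
        unc H L P + length P * e2H H + n               ≤⟨ ≤-trans unc-eq sameSum ⟩
        n * suc m                                      ≡⟨ re₁ n m ⟩
        m * n + n                                      ≤⟨ +-monoˡ-≤ n (*-monoʳ-≤ m n≤rm+r) ⟩
        m * (r * m + r) + n                            ≡⟨ re₂ m r n ⟩
        r * (m * m) + r * m + n                        ≤⟨ +-monoˡ-≤ n (+-monoˡ-≤ (r * m) (*-monoʳ-≤ r full)) ⟩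
        r * (m + length Pm * e2H H + C * m) + r * m + n ≡⟨ re₃ r m (length Pm * e2H H) C n ⟩
        (C + 2) * (r * m) + (r * (length Pm * e2H H) + n) ≤⟨ +-monoˡ-≤ _ (≤-trans (*-mono-≤ (+-monoʳ-≤ C (n≤1+n 2)) rm≤n) (m≤m+n _ r)) ⟩
        (C + 3) * n + r + (r * (length Pm * e2H H) + n) ∎)
      where
      open ≤-Reasoning
      re₁ : ∀ n m → n * suc m ≡ m * n + n
      re₁ = solve-∀
      re₂ : ∀ m r n → m * (r * m + r) + n ≡ r * (m * m) + r * m + n
      re₂ = solve-∀
      re₃ : ∀ r m e C n → r * (m + e + C * m) + r * m + n ≡ (C + 2) * (r * m) + (r * e + n)
      re₃ = solve-∀

partite-packing : ∀ {h} (H : Graph h) → 1 ≤ e2H H → ∀ r (1≤r : 1 ≤ r) → ∃ λ C → ∀ n → ∃ λ (P : List (Fin h → Fin n)) →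
  Packs H P × All (EdgesIn H (nonL H (Partite.L r 1≤r n))) P × unc H (Partite.L r 1≤r n) P ≤ C * n + r
partite-packing H pos r 1≤r = from (pack-complete H pos)
  where
  from : (∃ λ C → ∀ m → ∃ λ (P : List (Fin _ → Fin m)) → Packs H P × m * m ≤ m + length P * e2H H + C * m) → ∃ λ C → ∀ n → ∃ λ (P : List (Fin _ → Fin n)) →
    Packs H P × All (EdgesIn H (nonL H (Partite.L r 1≤r n))) P × unc H (Partite.L r 1≤r n) P ≤ C * n + r
  from (C , pc) = C + 3 , λ n → let (Pm , pk , full) = pc (Partite.m r 1≤r n) in
    Partite.P r 1≤r n H Pm pk , Partite.packs r 1≤r n H Pm pk , Partite.nonL-edges r 1≤r n H Pm pk , Partite.unc-bound r 1≤r n H Pm pk C full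

-- Assembling the estimates

e2H≡2‖‖ : ∀ {h} (H : Graph h) → e2H H ≡ 2 * ‖ H ‖
e2H≡2‖‖ H = e2-‖‖ H

1≤e2H : ∀ {h} (H : Graph h) → 1 ≤ ‖ H ‖ → 1 ≤ e2H H
1≤e2H H 1≤m = ≤-trans 1≤m (≤-trans (m≤m+n ‖ H ‖ (‖ H ‖ + 0)) (≤-reflexive (sym (e2H≡2‖‖ H))))

err-upper : ∀ {h n c e} (H : Graph h) → 1 ≤ ‖ H ‖ → IsCl (K n) H c → IsEx n H e → (L : Graph n) → HFree H L → (P : List (Fin h → Fin n)) →
  Packs H P → All (EdgesIn H (nonL H L)) P → ∀ Y X → 2 * e ≤ e2 (adj L) + Y → unc H L P ≤ X → err ‖ H ‖ n c e ≤ ‖ H ‖ * X + Y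
err-upper {n = n} {c} {e} H 1≤m cl ex L L-free P packs inside Y X e≤ unc≤ = err-bound m n c e (m * X + Y) lower upper
  where
  open ≤-Reasoning
  m = ‖ H ‖
  pos : 1 ≤ e2H H
  pos = 1≤e2H H 1≤m
  re₁ : ∀ n c m e → n + c * (2 * m) + 2 * e ≡ n + 2 * (m * c + e)
  re₁ = solve-∀
  lower : n choose 2 ≤ m * c + e
  lower = *-cancelˡ-≤ 2 (+-cancelˡ-≤ n _ _ (begin
    n + 2 * (n choose 2)     ≡⟨ 2*C2 n ⟩
    n * n                    ≤⟨ cl-lower H cl ex ⟩
    n + c * e2H H + 2 * e    ≡⟨ cong (λ z → n + c * z + 2 * e) (e2H≡2‖‖ H) ⟩
    n + c * (2 * m) + 2 * e  ≡⟨ re₁ n c m e ⟩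
    n + 2 * (m * c + e)      ∎))
  re₂ : ∀ n c m l y → n + 2 * (m * c) + (l + y) ≡ n + c * (2 * m) + l + y
  re₂ = solve-∀
  re₃ : ∀ n b m x y → n + 2 * b + 2 * m * x + (y + y) ≡ n + 2 * (b + (m * x + y))
  re₃ = solve-∀
  upper : m * c + e ≤ n choose 2 + (m * X + Y)
  upper = *-cancelˡ-≤ 2 (+-cancelˡ-≤ n _ _ (begin
    n + 2 * (m * c + e)                        ≡⟨ cong (n +_) (*-distribˡ-+ 2 (m * c) e) ⟩
    n + (2 * (m * c) + 2 * e)                  ≡⟨ sym (+-assoc n (2 * (m * c)) (2 * e)) ⟩
    n + 2 * (m * c) + 2 * e                    ≤⟨ +-monoʳ-≤ (n + 2 * (m * c)) e≤ ⟩
    n + 2 * (m * c) + (e2 (adj L) + Y)         ≡⟨ re₂ n c m (e2 (adj L)) Y ⟩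
    n + c * (2 * m) + e2 (adj L) + Y           ≡⟨ cong (λ z → n + c * z + e2 (adj L) + Y) (sym (e2H≡2‖‖ H)) ⟩
    n + c * e2H H + e2 (adj L) + Y             ≤⟨ +-monoˡ-≤ Y (cl-upper H L L-free P packs inside pos cl) ⟩
    n * n + e2H H * unc H L P + Y              ≤⟨ +-mono-≤ (+-mono-≤ (≤-reflexive (sym (2*C2 n))) (*-mono-≤ (≤-reflexive (e2H≡2‖‖ H)) unc≤)) (m≤m+n Y Y) ⟩
    n + 2 * (n choose 2) + 2 * m * X + (Y + Y) ≡⟨ re₃ n (n choose 2) m X Y ⟩
    n + 2 * (n choose 2 + (m * X + Y))         ∎))

err≤ex : ∀ {h n c e} (H : Graph h) → 1 ≤ ‖ H ‖ → IsCl (K n) H c → IsEx n H e → err ‖ H ‖ n c e ≤ e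
err≤ex {n = n} {c} {e} H 1≤m cl ex = err-bound m n c e e lower (+-monoˡ-≤ e upper)
  where
  open ≤-Reasoning
  m = ‖ H ‖
  re₁ : ∀ n c m e → n + c * (2 * m) + 2 * e ≡ n + 2 * (m * c + e)
  re₁ = solve-∀
  lower : n choose 2 ≤ m * c + e
  lower = *-cancelˡ-≤ 2 (+-cancelˡ-≤ n _ _ (begin
    n + 2 * (n choose 2)     ≡⟨ 2*C2 n ⟩
    n * n                    ≤⟨ cl-lower H cl ex ⟩
    n + c * e2H H + 2 * e    ≡⟨ cong (λ z → n + c * z + 2 * e) (e2H≡2‖‖ H) ⟩
    n + c * (2 * m) + 2 * e  ≡⟨ re₁ n c m e ⟩
    n + 2 * (m * c + e)      ∎))
  re₂ : ∀ n c m → n + 2 * (m * c) ≡ n + c * (2 * m)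
  re₂ = solve-∀
  upper : m * c ≤ n choose 2
  upper = *-cancelˡ-≤ 2 (+-cancelˡ-≤ n _ _ (begin
    n + 2 * (m * c)       ≡⟨ re₂ n c m ⟩
    n + c * (2 * m)       ≡⟨ cong (λ z → n + c * z) (sym (e2H≡2‖‖ H)) ⟩
    n + c * e2H H         ≤⟨ cl-trivial H cl ⟩
    n * n                 ≡⟨ sym (2*C2 n) ⟩
    n + 2 * (n choose 2)  ∎))

-- Bipartite H: the extremal graph itself plays the role of L.

err-bipartite : ∀ {h} (H : Graph h) → 1 ≤ ‖ H ‖ → Colorable H 2 → (v0 : Fin h) (d : ℕ) → # (adj H v0) ≡ suc d →
  ∃ λ A → ∃ λ B → ∃ λ N → ∀ n c e → n ≥ N → IsCl (K n) H c → IsEx n H e → err ‖ H ‖ n c e ≤ ‖ H ‖ * (A * d * n + B)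
err-bipartite {h} H 1≤m (f , proper) v0 d deg = from (sparse-packing H v0 d deg f proper)
  where
  from : (∃ λ A → ∃ λ B → ∃ λ N → ∀ {n} → N ≤ n → (L : Graph n) → HFree H L → ∃ λ (P : List (Fin h → Fin n)) → Packs H P × All (EdgesIn H (nonL H L)) P × unc H L P ≤ A * d * n + B) →
    ∃ λ A → ∃ λ B → ∃ λ N → ∀ n c e → n ≥ N → IsCl (K n) H c → IsEx n H e → err ‖ H ‖ n c e ≤ ‖ H ‖ * (A * d * n + B)
  from (A , B , N , pack) = A , B , N , λ n c e big cl ex → bound n c e cl ex (pack big (proj₁ (proj₁ ex)) (proj₁ (proj₂ (proj₁ ex))))
    where
    bound : ∀ n c e → IsCl (K n) H c → (ex : IsEx n H e) →
      (∃ λ (P : List (Fin h → Fin n)) → Packs H P × All (EdgesIn H (nonL H (proj₁ (proj₁ ex)))) P × unc H (proj₁ (proj₁ ex)) P ≤ A * d * n + B) → err ‖ H ‖ n c e ≤ ‖ H ‖ * (A * d * n + B)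
    bound n c e cl ex (P , packs , inside , unc≤) = ≤-trans (err-upper {c = c} {e = e} H 1≤m cl ex G (proj₁ (proj₂ (proj₁ ex))) P packs inside 0 (A * d * n + B)
        (≤-reflexive (trans (cong (2 *_) (sym (proj₂ (proj₂ (proj₁ ex))))) (trans (sym (e2-‖‖ G)) (sym (+-identityʳ (e2 (adj G))))))) unc≤) (≤-reflexive (+-identityʳ _))
      where
      G : Graph n
      G = proj₁ (proj₁ ex)

bipartite-linear : ∀ {h} (H : Graph h) → 1 ≤ ‖ H ‖ → Colorable H 2 →
  ∃ λ D → ∃ λ N → ∀ n c e → n ≥ N → IsCl (K n) H c → IsEx n H e → err ‖ H ‖ n c e ≤ D * n
bipartite-linear {h} H 1≤m col = from (edge-of H pos)
  where
  pos : 1 ≤ e2H H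
  pos = 1≤e2H H 1≤m
  Goal : Set
  Goal = ∃ λ D → ∃ λ N → ∀ n c e → n ≥ N → IsCl (K n) H c → IsEx n H e → err ‖ H ‖ n c e ≤ D * n
  done : ∀ d → (∃ λ A → ∃ λ B → ∃ λ N → ∀ n c e → n ≥ N → IsCl (K n) H c → IsEx n H e → err ‖ H ‖ n c e ≤ ‖ H ‖ * (A * d * n + B)) → Goal
  done d (A , B , N , bound) = ‖ H ‖ * (A * d + B) , suc N , λ n c e big cl ex → ≤-trans (bound n c e (≤-trans (n≤1+n N) big) cl ex)
    (≤-trans (*-monoʳ-≤ ‖ H ‖ (≤-trans (+-monoʳ-≤ (A * d * n) (m≤m*n B n {{>-nonZero (≤-trans (s≤s z≤n) big)}})) (≤-reflexive (sym (*-distribʳ-+ n (A * d) B))))) (≤-reflexive (sym (*-assoc ‖ H ‖ (A * d + B) n))))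
  degree : ∀ i k → 1 ≤ k → # (adj H i) ≡ k → Goal
  degree i (suc d) _ deg = done d (err-bipartite H 1≤m col i d deg)
  from : (∃ λ i → ∃ λ j → adj H i j ≡ true) → Goal
  from (i , j , a) = degree i (# (adj H i)) (≤-trans (≤-reflexive (sym (⟦⟧-true a))) (∑-term (λ j → ⟦ adj H i j ⟧) j)) refl

leaf-constant : ∀ {h} (H : Graph h) → 1 ≤ ‖ H ‖ → Colorable H 2 → (∃ λ v → # (adj H v) ≡ 1) →
  ∃ λ D → ∃ λ N → ∀ n c e → n ≥ N → IsCl (K n) H c → IsEx n H e → err ‖ H ‖ n c e ≤ D
leaf-constant H 1≤m col (v , deg) = from (err-bipartite H 1≤m col v 0 deg)
  where
  from : (∃ λ A → ∃ λ B → ∃ λ N → ∀ n c e → n ≥ N → IsCl (K n) H c → IsEx n H e → err ‖ H ‖ n c e ≤ ‖ H ‖ * (A * 0 * n + B)) →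
    ∃ λ D → ∃ λ N → ∀ n c e → n ≥ N → IsCl (K n) H c → IsEx n H e → err ‖ H ‖ n c e ≤ D
  from (A , B , N , bound) = ‖ H ‖ * B , N , λ n c e big cl ex → ≤-trans (bound n c e big cl ex) (≤-reflexive (cong (λ z → ‖ H ‖ * (z * n + B)) (*-zeroʳ A)))

-- Non-r-colourable H: the complete r-partite graph plays the role of L.

err-partite : ∀ {h} (H : Graph h) → 1 ≤ ‖ H ‖ → ∀ r (1≤r : 1 ≤ r) → ¬ Colorable H r →
  ∃ λ C → ∀ n c e → IsCl (K n) H c → IsEx n H e → ∀ Y → 2 * e ≤ e2 (adj (Partite.L r 1≤r n)) + Y → err ‖ H ‖ n c e ≤ ‖ H ‖ * (C * n + r) + Y
err-partite {h} H 1≤m r 1≤r nc = from (partite-packing H pos r 1≤r)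
  where
  pos : 1 ≤ e2H H
  pos = 1≤e2H H 1≤m
  from : (∃ λ C → ∀ n → ∃ λ (P : List (Fin h → Fin n)) → Packs H P × All (EdgesIn H (nonL H (Partite.L r 1≤r n))) P × unc H (Partite.L r 1≤r n) P ≤ C * n + r) →
    ∃ λ C → ∀ n c e → IsCl (K n) H c → IsEx n H e → ∀ Y → 2 * e ≤ e2 (adj (Partite.L r 1≤r n)) + Y → err ‖ H ‖ n c e ≤ ‖ H ‖ * (C * n + r) + Y
  from (C , pack) = C , λ n c e cl ex Y e≤ → let (P , packs , inside , unc≤) = pack n in
    err-upper {c = c} {e = e} H 1≤m cl ex (Partite.L r 1≤r n) (partite-free H r {{>-nonZero 1≤r}} n nc) P packs inside Y (C * n + r) e≤ unc≤

ex-e2 : ∀ {h n e} (H : Graph h) → IsEx n H e → ∃ λ (G : Graph n) → HFree H G × 2 * e ≡ e2 (adj G)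
ex-e2 H ((G , free , eq) , _) = G , free , trans (cong (2 *_) (sym eq)) (sym (e2-‖‖ G))

complete-linear : ∀ {h} (H : Graph h) → 1 ≤ ‖ H ‖ → IsComplete H →
  ∃ λ D → ∃ λ N → ∀ n c e → n ≥ N → IsCl (K n) H c → IsEx n H e → err ‖ H ‖ n c e ≤ D * n
complete-linear {zero} H () _
complete-linear {suc zero} H 1≤m _ = ⊥-elim (one (edge-of H (1≤e2H H 1≤m)))
  where
  one : (∃ λ i → ∃ λ j → adj H i j ≡ true) → ⊥
  one (zero , zero , a) = t≢f a (adj-irrefl H zero)
complete-linear {suc (suc r′)} H 1≤m complete = from (err-partite H 1≤m r (s≤s z≤n) not-colorable)
  where
  r = suc r′
  not-colorable : ¬ Colorable H r
  not-colorable (f , proper) = 1+n≰n (injective⇒≤ {f = f} (λ {i} {j} → inj′ i j))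
    where
    inj′ : ∀ i j → f i ≡ f j → i ≡ j
    inj′ i j q with i ≟ j
    ... | yes e = e
    ... | no ne = ⊥-elim (proper i j (complete i j ne) q)
  clique-free : ∀ {n} (G : Graph n) → HFree H G → ¬ Multi (adj G) (λ _ → true) (suc r) 1
  clique-free G free M = free (record { φ = λ v → part M v zero ; inj = λ {i} {j} → inj′ i j ; edges = λ i j a → cross M i j zero zero (adj-≢ H a) })
    where
    inj′ : ∀ i j → part M i zero ≡ part M j zero → i ≡ j
    inj′ i j q with i ≟ j
    ... | yes e = e
    ... | no ne = ⊥-elim (t≢f (cross M i j zero zero ne) (trans (cong (λ z → adj G z (part M j zero)) q) (adj-irrefl G (part M j zero))))
  ex≤ : ∀ {n e} → IsEx n H e → 2 * e ≤ e2 (adj (Partite.L r (s≤s z≤n) n)) + (2 * n + 1)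
  ex≤ {n} {e} ex = by (ex-e2 H ex)
    where
    open ≤-Reasoning
    l : ℕ
    l = e2 (adj (Partite.L r (s≤s z≤n) n))
    re₁ : ∀ n r → r * (n * n + n) + suc r + n * n ≡ suc r * (n * n) + r * n + suc r
    re₁ = solve-∀
    re₂ : ∀ n r l → suc r * l + (n * n + suc r * n) + r * n + suc r + n ≡ suc r * (l + (2 * n + 1)) + n * n
    re₂ = solve-∀
    by : (∃ λ (G : Graph n) → HFree H G × 2 * e ≡ e2 (adj G)) → 2 * e ≤ l + (2 * n + 1)
    by (G , free , eq) = *-cancelˡ-≤ r (+-cancelʳ-≤ (n * n) _ _ (begin
      r * (2 * e) + n * n                               ≡⟨ cong (λ z → r * z + n * n) eq ⟩
      r * e2 (adj G) + n * n                            ≤⟨ +-monoˡ-≤ (n * n) (edges-clique r′ (adj G) (adj-sym G) (clique-free G free)) ⟩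
      r′ * (n * n + n) + r + n * n                      ≡⟨ re₁ n r′ ⟩
      r * (n * n) + r′ * n + r                          ≤⟨ +-monoˡ-≤ r (+-monoˡ-≤ (r′ * n) (Partite.e2L-lower r (s≤s z≤n) n)) ⟩
      r * l + (n * n + r * n) + r′ * n + r              ≤⟨ m≤m+n _ n ⟩
      r * l + (n * n + r * n) + r′ * n + r + n          ≡⟨ re₂ n r′ l ⟩
      r * (l + (2 * n + 1)) + n * n                     ∎))
  from : (∃ λ C → ∀ n c e → IsCl (K n) H c → IsEx n H e → ∀ Y → 2 * e ≤ e2 (adj (Partite.L r (s≤s z≤n) n)) + Y → err ‖ H ‖ n c e ≤ ‖ H ‖ * (C * n + r) + Y) →
    ∃ λ D → ∃ λ N → ∀ n c e → n ≥ N → IsCl (K n) H c → IsEx n H e → err ‖ H ‖ n c e ≤ D * n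
  from (C , bound) = ‖ H ‖ * (C + r) + 3 , 1 , λ n c e big cl ex → ≤-trans (bound n c e cl ex (2 * n + 1) (ex≤ ex))
    (≤-trans (+-mono-≤ (*-monoʳ-≤ ‖ H ‖ (+-monoʳ-≤ (C * n) (m≤m*n r n {{>-nonZero big}}))) (+-monoʳ-≤ (2 * n) big)) (≤-reflexive (re ‖ H ‖ C n r)))
    where
    re : ∀ m C n r → m * (C * n + r * n) + (2 * n + n) ≡ (m * (C + r) + 3) * n
    re = solve-∀

colorable? : ∀ {h} (H : Graph h) r → Dec (Colorable H r)
colorable? H r = search (λ f → ∀ i j → adj H i j ≡ true → f i ≢ f j) (λ f → all? λ i → all? λ j → by (bool? (adj H i j)) (f i ≟ f j))
    (λ eq p i j a q → p i j a (trans (eq i) (trans q (sym (eq j)))))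
  where
  by : ∀ {A B : Set} → Dec A → Dec B → Dec (A → ¬ B)
  by (no na) _ = yes λ a → ⊥-elim (na a)
  by _ (no nb) = yes λ _ → nb
  by (yes a) (yes b) = no λ f → f a b

chromatic : ∀ {h} (H : Graph h) fuel r → ¬ Colorable H r → Colorable H (r + fuel) → ∃ λ q → r ≤ q × ¬ Colorable H q × Colorable H (suc q)
chromatic H zero r nc c = ⊥-elim (nc (subst (Colorable H) (+-identityʳ r) c))
chromatic H (suc fuel) r nc c = by (colorable? H (suc r))
  where
  by : Dec (Colorable H (suc r)) → ∃ λ q → r ≤ q × ¬ Colorable H q × Colorable H (suc q)
  by (yes c′) = r , ≤-refl , nc , c′
  by (no nc′) = let (q , le , rest) = chromatic H fuel (suc r) nc′ (subst (Colorable H) (+-suc r fuel) c) in q , ≤-trans (n≤1+n r) le , rest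

colorable-own : ∀ {h} (H : Graph h) r → Colorable H (r + h)
colorable-own H r = (r ↑ʳ_) , λ i j a q → adj-≢ H a (↑ʳ-injective r i j q)

-- For H of chromatic number r + 1 ≥ 3, ex(n, H) exceeds e(L) by at most n²/(16k) + O(n) by Erdős–Stone, whereas ex(n, H) ≥ n²/4 - O(n).
chromatic-little-o : ∀ {t} (H : Graph (suc t)) → 1 ≤ ‖ H ‖ → ∀ r → 2 ≤ r → ¬ Colorable H r → Colorable H (suc r) → ∀ k s → suc s ≡ 8 * k →
  ∃ λ N → ∀ n c e → n ≥ N → IsCl (K n) H c → IsEx n H e → k * err ‖ H ‖ n c e ≤ ‖ H ‖ * e
chromatic-little-o {t} H 1≤m r 2≤r nc (f , proper) k s s≡ = from (edges-ES s t r 1≤r) (err-partite H 1≤m r 1≤r nc)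
  where
  1≤r : 1 ≤ r
  1≤r = ≤-trans (n≤1+n 1) 2≤r
  m = ‖ H ‖
  Lp : ∀ n → Graph n
  Lp n = Partite.L r 1≤r n
  multi-free : ∀ {n} (G : Graph n) → HFree H G → ¬ Multi (adj G) (λ _ → true) (suc r) (suc t)
  multi-free G free M = let (g , g-inj , ed) = multi-embed H (adj-irrefl G) M f proper in free (record { φ = g ; inj = λ {i} {j} → g-inj i j ; edges = ed })
  lower : ∀ {n e} → IsEx n H e → n * n ≤ 4 * e + 2 * n
  lower {n} {e} (_ , ex) = ≤-trans half (+-monoˡ-≤ (2 * n) (≤-trans (*-monoʳ-≤ 2 (≤-trans (≤-reflexive (e2-‖‖ (Lp n))) (*-monoʳ-≤ 2 (ex (Lp n) (partite-free H r {{>-nonZero 1≤r}} n nc))))) (≤-reflexive (sym (*-assoc 2 2 e)))))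
    where
    open ≤-Reasoning
    l : ℕ
    l = e2 (adj (Lp n))
    re₁ : ∀ r q → r * q + r * q ≡ 2 * (r * q)
    re₁ = solve-∀
    re₂ : ∀ r l q n → 2 * (r * l + (q + r * n)) ≡ r * (2 * l + 2 * n) + 2 * q
    re₂ = solve-∀
    half : n * n ≤ 2 * l + 2 * n
    half = *-cancelˡ-≤ r {{>-nonZero 1≤r}} (+-cancelʳ-≤ (r * (n * n)) _ _ (begin
      r * (n * n) + r * (n * n)                ≡⟨ re₁ r (n * n) ⟩
      2 * (r * (n * n))                        ≤⟨ *-monoʳ-≤ 2 (Partite.e2L-lower r 1≤r n) ⟩
      2 * (r * l + (n * n + r * n))            ≡⟨ re₂ r l (n * n) n ⟩
      r * (2 * l + 2 * n) + 2 * (n * n)        ≤⟨ +-monoʳ-≤ (r * (2 * l + 2 * n)) (*-monoˡ-≤ (n * n) 2≤r) ⟩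
      r * (2 * l + 2 * n) + r * (n * n)        ∎))
  from : (∃ λ N → ∀ {n} (R : Rel n) → (∀ x y → R x y ≡ R y x) → ¬ Multi R (λ _ → true) (suc r) (suc t) → r * suc s * e2 R ≤ (r * suc s + r ∸ suc s) * (n * n + n) + r * suc s * (N * N)) →
    (∃ λ C → ∀ n c e → IsCl (K n) H c → IsEx n H e → ∀ Y → 2 * e ≤ e2 (adj (Lp n)) + Y → err ‖ H ‖ n c e ≤ ‖ H ‖ * (C * n + r) + Y) →
    ∃ λ N → ∀ n c e → n ≥ N → IsCl (K n) H c → IsEx n H e → k * err ‖ H ‖ n c e ≤ ‖ H ‖ * e
  from (N , es) (C , bound) = suc S , λ n c e big cl ex → *-cancelˡ-≤ 8 (+-cancelʳ-≤ (4 * n) _ _ (final n e ex c big cl))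
    where
    S : ℕ
    S = 8 * k * m * (C + r) + (2 * suc s + 1) + suc s * (N * N) + 4
    module _ (n e : ℕ) (ex : IsEx n H e) where
      open ≤-Reasoning
      l : ℕ
      l = e2 (adj (Lp n))
      Y : ℕ
      Y = 2 * e ∸ l
      re₁ : ∀ r u q n N → r * u + r * (q + n) + r * u * N ≡ r * (u + (q + n) + u * N)
      re₁ = solve-∀
      excess : suc s * (2 * e) ≤ suc s * l + (n * n + (2 * suc s + 1) * n + suc s * (N * N))
      excess = by (ex-e2 H ex)
        where
        re₂ : ∀ r u g → r * (u * g) ≡ r * u * g
        re₂ = solve-∀
        re₃ : ∀ r u q n w → (r * u + r) * (q + n) + r * u * w ≡ u * (r * q) + (r * u * n + r * (q + n) + r * u * w)
        re₃ = solve-∀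
        re₄ : ∀ r u q n w l → u * (r * l + (q + r * n)) + (r * u * n + r * (q + n) + r * u * w) ≡ r * (u * l + (q + (2 * u + 1) * n + u * w)) + u * q
        re₄ = solve-∀
        by : (∃ λ (G : Graph n) → HFree H G × 2 * e ≡ e2 (adj G)) → suc s * (2 * e) ≤ suc s * l + (n * n + (2 * suc s + 1) * n + suc s * (N * N))
        by (G , free , eq) = *-cancelˡ-≤ r {{>-nonZero 1≤r}} (+-cancelʳ-≤ (suc s * (n * n)) _ _ (begin
          r * (suc s * (2 * e)) + suc s * (n * n)
            ≡⟨ cong (λ z → r * (suc s * z) + suc s * (n * n)) eq ⟩
          r * (suc s * e2 (adj G)) + suc s * (n * n)
            ≡⟨ cong (_+ suc s * (n * n)) (re₂ r (suc s) (e2 (adj G))) ⟩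
          r * suc s * e2 (adj G) + suc s * (n * n)
            ≤⟨ +-mono-≤ (es (adj G) (adj-sym G) (multi-free G free)) (*-monoʳ-≤ (suc s) (m≤m+n (n * n) n)) ⟩
          (r * suc s + r ∸ suc s) * (n * n + n) + r * suc s * (N * N) + suc s * (n * n + n)
            ≡⟨ trans (swap+ ((r * suc s + r ∸ suc s) * (n * n + n)) (r * suc s * (N * N)) (suc s * (n * n + n))) (cong (_+ r * suc s * (N * N)) (trans (sym (*-distribʳ-+ (n * n + n) (r * suc s + r ∸ suc s) (suc s)))
                 (cong (_* (n * n + n)) (m∸n+n≡m (≤-trans (m≤n*m (suc s) r {{>-nonZero 1≤r}}) (m≤m+n (r * suc s) r)))))) ⟩
          (r * suc s + r) * (n * n + n) + r * suc s * (N * N)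
            ≡⟨ re₃ r (suc s) (n * n) n (N * N) ⟩
          suc s * (r * (n * n)) + (r * suc s * n + r * (n * n + n) + r * suc s * (N * N))
            ≤⟨ +-monoˡ-≤ _ (*-monoʳ-≤ (suc s) (Partite.e2L-lower r 1≤r n)) ⟩
          suc s * (r * l + (n * n + r * n)) + (r * suc s * n + r * (n * n + n) + r * suc s * (N * N))
            ≡⟨ re₄ r (suc s) (n * n) n (N * N) l ⟩
          r * (suc s * l + (n * n + (2 * suc s + 1) * n + suc s * (N * N))) + suc s * (n * n) ∎))
          where
          swap+ : ∀ a b c → a + b + c ≡ a + c + b
          swap+ = solve-∀
      KY : suc s * Y ≤ n * n + (2 * suc s + 1) * n + suc s * (N * N)
      KY = ≤-trans (≤-reflexive (*-distribˡ-∸ (suc s) (2 * e) l)) (≤-trans (∸-monoˡ-≤ (suc s * l) excess) (≤-reflexive (m+n∸m≡n (suc s * l) _)))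
      8kY : 8 * k * Y ≤ n * n + (2 * suc s + 1) * n + suc s * (N * N)
      8kY = subst (λ z → z * Y ≤ n * n + (2 * suc s + 1) * n + suc s * (N * N)) s≡ KY
      final : ∀ c → suc S ≤ n → IsCl (K n) H c → 8 * (k * err m n c e) + 4 * n ≤ 8 * (m * e) + 4 * n
      final c big cl = begin
          8 * (k * err m n c e) + 4 * n
            ≤⟨ +-monoˡ-≤ (4 * n) (*-monoʳ-≤ 8 (*-monoʳ-≤ k (bound n c e cl ex Y (m≤n+m∸n (2 * e) l)))) ⟩
          8 * (k * (m * (C * n + r) + Y)) + 4 * n
            ≡⟨ re₅ k (m * (C * n + r)) Y n ⟩
          8 * k * (m * (C * n + r)) + 8 * k * Y + 4 * n
            ≤⟨ +-monoˡ-≤ (4 * n) (+-mono-≤ (*-monoʳ-≤ (8 * k) (*-monoʳ-≤ m (+-monoʳ-≤ (C * n) (m≤m*n r n {{n≢0}})))) (≤-trans 8kY (+-monoʳ-≤ (n * n + (2 * suc s + 1) * n) (m≤m*n (suc s * (N * N)) n {{n≢0}})))) ⟩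
          8 * k * (m * (C * n + r * n)) + (n * n + (2 * suc s + 1) * n + suc s * (N * N) * n) + 4 * n
            ≡⟨ re₆ k m C n r (2 * suc s + 1) (suc s * (N * N)) ⟩
          n * n + S * n
            ≤⟨ +-monoʳ-≤ (n * n) (*-monoˡ-≤ n (≤-trans (n≤1+n S) big)) ⟩
          n * n + n * n
            ≤⟨ +-mono-≤ (lower ex) (lower ex) ⟩
          4 * e + 2 * n + (4 * e + 2 * n)
            ≡⟨ re₇ e n ⟩
          8 * (1 * e) + 4 * n
            ≤⟨ +-monoˡ-≤ (4 * n) (*-monoʳ-≤ 8 (*-monoˡ-≤ e 1≤m)) ⟩
          8 * (m * e) + 4 * n ∎
        where
        n≢0 : NonZero n
        n≢0 = >-nonZero (≤-trans (s≤s z≤n) big)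
        re₅ : ∀ k a y n → 8 * (k * (a + y)) + 4 * n ≡ 8 * k * a + 8 * k * y + 4 * n
        re₅ = solve-∀
        re₆ : ∀ k m C n r a b → 8 * k * (m * (C * n + r * n)) + (n * n + a * n + b * n) + 4 * n ≡ n * n + (8 * k * m * (C + r) + a + b + 4) * n
        re₆ = solve-∀
        re₇ : ∀ e n → 4 * e + 2 * n + (4 * e + 2 * n) ≡ 8 * (1 * e) + 4 * n
        re₇ = solve-∀

bipartite-little-o : ∀ {h} (H : Graph h) → 1 ≤ ‖ H ‖ → Colorable H 2 → ∀ k →
  ∃ λ N → ∀ n c e → n ≥ N → IsCl (K n) H c → IsEx n H e → k * err ‖ H ‖ n c e ≤ ‖ H ‖ * e
bipartite-little-o {h} H 1≤m col k = by (leaf-or-cycle H pos)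
  where
  Goal : Set
  Goal = ∃ λ N → ∀ n c e → n ≥ N → IsCl (K n) H c → IsEx n H e → k * err ‖ H ‖ n c e ≤ ‖ H ‖ * e
  pos : 1 ≤ e2H H
  pos = 1≤e2H H 1≤m
  e≤me : ∀ e → e ≤ ‖ H ‖ * e
  e≤me e = m≤n*m e ‖ H ‖ {{>-nonZero 1≤m}}
  inhabited : Fin h → 1 ≤ h
  inhabited v = ≤-trans (s≤s z≤n) (toℕ<n v)
  cyclic-case : HasCycle H → (∃ λ D → ∃ λ N → ∀ n c e → n ≥ N → IsCl (K n) H c → IsEx n H e → err ‖ H ‖ n c e ≤ D * n) → Goal
  cyclic-case cyc (D , N , bound) = let (N′ , large) = ex-cycle H cyc (inhabited (proj₁ (edge-of H pos))) (k * D) in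
    N ⊔ N′ , λ n c e big cl ex → ≤-trans (*-monoʳ-≤ k (bound n c e (≤-trans (m≤m⊔n N N′) big) cl ex))
      (≤-trans (≤-reflexive (sym (*-assoc k D n))) (≤-trans (large (≤-trans (m≤n⊔m N N′) big) ex) (e≤me e)))
  leaf-case : Dec (3 ≤ e2 (adj H)) → (∃ λ D → ∃ λ N → ∀ n c e → n ≥ N → IsCl (K n) H c → IsEx n H e → err ‖ H ‖ n c e ≤ D) → Goal
  leaf-case (yes three) (D , N , bound) = let (N′ , large) = ex-unbounded H three (k * D) in
    N ⊔ N′ , λ n c e big cl ex → ≤-trans (*-monoʳ-≤ k (bound n c e (≤-trans (m≤m⊔n N N′) big) cl ex)) (≤-trans (large (≤-trans (m≤n⊔m N N′) big) ex) (e≤me e))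
  leaf-case (no two) _ = h , λ n c e big cl ex → ≤-trans (≤-reflexive (trans (cong (k *_) (n≤0⇒n≡0 (≤-trans (err≤ex {c = c} {e = e} H 1≤m cl ex) (≤-reflexive (ex-edge H (≮⇒≥ two) pos big ex))))) (*-zeroʳ k))) z≤n
  by : (∃ λ v → # (adj H v) ≡ 1) ⊎ HasCycle H → Goal
  by (inj₁ leaf) = leaf-case (3 ≤? e2 (adj H)) (leaf-constant H 1≤m col leaf)
  by (inj₂ cyc) = cyclic-case cyc (bipartite-linear H 1≤m col)

little-o : ∀ {h} (H : Graph h) → 1 ≤ ‖ H ‖ → ∀ k → 1 ≤ k →
  ∃ λ N → ∀ n c e → n ≥ N → IsCl (K n) H c → IsEx n H e → k * err ‖ H ‖ n c e ≤ ‖ H ‖ * e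
little-o {zero} H () _ _
little-o {suc t} H 1≤m (suc k) _ = by (colorable? H 2)
  where
  8suc : ∀ k → suc (8 * k + 7) ≡ 8 * suc k
  8suc = solve-∀
  by : Dec (Colorable H 2) → ∃ λ N → ∀ n c e → n ≥ N → IsCl (K n) H c → IsEx n H e → suc k * err ‖ H ‖ n c e ≤ ‖ H ‖ * e
  by (yes col) = bipartite-little-o H 1≤m col (suc k)
  by (no nc) = let (r , 2≤r , nc′ , c′) = chromatic H (suc t) 2 nc (colorable-own H 2) in
    chromatic-little-o H 1≤m r 2≤r nc′ c′ (suc k) (8 * k + 7) (8suc k)

colorable-bipartite : ∀ {h} (H : Graph h) → IsBipartite H → Colorable H 2
colorable-bipartite H (f , proper) = side ∘ f , λ i j a e → proper i j a (side-inj _ _ e)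
  where
  side : Bool → Fin 2
  side true = zero
  side false = suc zero
  side-inj : ∀ a b → side a ≡ side b → a ≡ b
  side-inj true true _ = refl
  side-inj false false _ = refl

theorem1 : ∀ {h : ℕ} (H : Graph h) → 1 ≤ ‖ H ‖ →
    (∀ (k : ℕ) → 1 ≤ k → ∃ λ N → ∀ (n c e : ℕ) → n ≥ N →
        IsCl (K n) H c → IsEx n H e → k * err ‖ H ‖ n c e ≤ ‖ H ‖ * e)
    × ((IsComplete H ⊎ IsBipartite H) → ∃ λ D → ∃ λ N → ∀ (n c e : ℕ) → n ≥ N →
        IsCl (K n) H c → IsEx n H e → err ‖ H ‖ n c e ≤ D * n)
    × (IsForest H → ∃ λ D → ∃ λ N → ∀ (n c e : ℕ) → n ≥ N →
        IsCl (K n) H c → IsEx n H e → err ‖ H ‖ n c e ≤ D)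
theorem1 H 1≤m = little-o H 1≤m , linear , constant
  where
  linear : (IsComplete H ⊎ IsBipartite H) → ∃ λ D → ∃ λ N → ∀ (n c e : ℕ) → n ≥ N → IsCl (K n) H c → IsEx n H e → err ‖ H ‖ n c e ≤ D * n
  linear (inj₁ complete) = complete-linear H 1≤m complete
  linear (inj₂ bipartite) = bipartite-linear H 1≤m (colorable-bipartite H bipartite)
  constant : IsForest H → ∃ λ D → ∃ λ N → ∀ (n c e : ℕ) → n ≥ N → IsCl (K n) H c → IsEx n H e → err ‖ H ‖ n c e ≤ D
  constant acyclic = leaf-constant H 1≤m (colorable-bipartite H (forest-bipartite (e2 (adj H)) H ≤-refl acyclic)) (by (leaf-or-cycle H pos))
    where
    pos : 1 ≤ e2H H
    pos = 1≤e2H H 1≤m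
    by : (∃ λ v → # (adj H v) ≡ 1) ⊎ HasCycle H → ∃ λ v → # (adj H v) ≡ 1
    by (inj₁ leaf) = leaf
    by (inj₂ cyc) = ⊥-elim (acyclic cyc)
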